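{- There exist absolute constants $K_0>0$ and $c>0$ and a randomized polynomial time algorithm with the following property. Given any integer $n>K_0$, any fractional solution $y\in[0,1]^n$, any $m\le 2^n$ linear constraints given by vectors $a_1,\ldots,a_m\in\mathbb{R}^n$, and any $\lambda_1,\ldots,\lambda_m\ge 0$ with $$\sum_{j=1}^m e^{ -\lambda_j^2/K_0}<\frac{n}{16},$$ the algorithm finds a solution $y'\in[0,1]^n$ such that $$|\langle y'-y,a_j\rangle|\le \lambda_j\cdot\sqrt{W_j(y)}+\frac{1}{n^2}\cdot\|a_j\|\qquad\text{for all } j=1,\ldots,m,$$ and $$y'_i\in\{0,1\}\quad\text{for at least } c\,n \text{ indices } i\in\{1,\ldots,n\}.$$ Here $W_j(y):=\sum_{i=1}^n a_{ji}^2\cdot\min\{y_i,1-y_i\}^2$ for each $j=1,\ldots,m$.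
   Context: $a_{ji}$ denotes the $i$-th coordinate of $a_j$, $\langle\cdot,\cdot\rangle$ is the standard inner product and $\|\cdot\|$ is the Euclidean norm. Running time is polynomial in $n$, $m$ and the bit size of the (rational) input numbers. -}

module Defs where

open import Data.Bool.Base using (Bool; true; false; if_then_else_)
open import Data.Digit using (Bit; 0b; 1b; toDigits)
open import Data.Fin.Base using (Fin)
import Data.Fin.Properties as Fin
open import Data.Fin.Subset using (Subset; _∈_)
  renaming (∣_∣ to card)
open import Data.Integer.Base as ℤ using (ℤ; +_; -[1+_])
import Data.Integer.Properties as ℤ
open import Data.List.Base as List using (List; []; _∷_; _++_; length)
open import Data.List.Relation.Unary.All using (All)
open import Data.List.Relation.Unary.Unique.Propositional using (Unique)
open import Data.Nat.Base as ℕ using (ℕ; zero; suc)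
import Data.Nat.Properties as ℕ
open import Data.Product.Base using (Σ-syntax; ∃-syntax; _×_; _,_; proj₁; proj₂)
open import Data.Rational.Base
open import Data.Rational.Properties
import Data.Rational.Unnormalised.Base as ℚᵘ
import Data.Rational.Unnormalised.Properties as ℚᵘ
open import Data.Sum.Base using (_⊎_)
open import Data.Vec.Base as Vec using (Vec; []; _∷_)
open import Data.Vec.Functional as Vector using (Vector)
open import Function.Base using (_$_)
open import Relation.Binary.PropositionalEquality
  using (_≡_; refl; sym; trans; cong; subst; subst₂)
open import Relation.Nullary.Decidable using (does; yes; no)
open import Data.Rational.Solver using (module +-*-Solver)

------------------------------------------------------------------------
-- Rational preliminaries

fromℕ : ℕ → ℚ
fromℕ n = + n / 1

infixl 8 _²
_² : ℚ → ℚ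
p ² = p * p

∑ : ∀ {n} → Vector ℚ n → ℚ
∑ = Vector.foldr _+_ 0ℚ

⟨_,_⟩ : ∀ {n} → Vector ℚ n → Vector ℚ n → ℚ
⟨ u , v ⟩ = ∑ (λ i → u i * v i)

infixl 6 _⊖_
_⊖_ : ∀ {n} → Vector ℚ n → Vector ℚ n → Vector ℚ n
(u ⊖ v) i = u i - v i

InUnitCube : ∀ {n} → Vector ℚ n → Set
InUnitCube y = ∀ i → 0ℚ ≤ y i × y i ≤ 1ℚ

½^_ : ℕ → ℚ
½^ zero  = 1ℚ
½^ suc n = (½^ n) * ½

module _ where
  fromℕ-suc : ∀ n → fromℕ (suc n) ≡ 1ℚ + fromℕ n
  fromℕ-suc n = toℚᵘ-injective $ begin
    toℚᵘ (fromℕ (suc n))              ≈⟨ toℚᵘ-fromℚᵘ (ℚᵘ.mkℚᵘ (+ suc n) 0) ⟩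
    ℚᵘ.mkℚᵘ (+ suc n) 0               ≈⟨ ℚᵘ.*≡* (cong (ℤ._* + 1) (cong (λ i → ℤ.1ℤ ℤ.+ i) (sym (ℤ.*-identityʳ (+ n))))) ⟩
    ℚᵘ.1ℚᵘ ℚᵘ.+ ℚᵘ.mkℚᵘ (+ n) 0       ≈⟨ ℚᵘ.+-congʳ ℚᵘ.1ℚᵘ (ℚᵘ.≃-sym (toℚᵘ-fromℚᵘ (ℚᵘ.mkℚᵘ (+ n) 0))) ⟩
    toℚᵘ 1ℚ ℚᵘ.+ toℚᵘ (fromℕ n)       ≈⟨ ℚᵘ.≃-sym (toℚᵘ-homo-+ 1ℚ (fromℕ n)) ⟩
    toℚᵘ (1ℚ + fromℕ n)               ∎
    where open ℚᵘ.≃-Reasoning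

  fromℕ-*-1/ : ∀ n → fromℕ (suc n) * (+ 1 / suc n) ≡ 1ℚ
  fromℕ-*-1/ n = toℚᵘ-injective $ begin
    toℚᵘ (fromℕ (suc n) * (+ 1 / suc n))
      ≈⟨ toℚᵘ-homo-* (fromℕ (suc n)) (+ 1 / suc n) ⟩
    toℚᵘ (fromℕ (suc n)) ℚᵘ.* toℚᵘ (+ 1 / suc n)
      ≈⟨ ℚᵘ.*-cong (toℚᵘ-fromℚᵘ (ℚᵘ.mkℚᵘ (+ suc n) 0)) (toℚᵘ-fromℚᵘ (ℚᵘ.mkℚᵘ (+ 1) n)) ⟩
    ℚᵘ.mkℚᵘ (+ suc n) 0 ℚᵘ.* ℚᵘ.mkℚᵘ (+ 1) n
      ≈⟨ ℚᵘ.*≡* (trans (ℤ.*-identityʳ _) (trans (ℤ.*-identityʳ _)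
           (sym (trans (ℤ.*-identityˡ _) (cong (λ k → + suc k) (ℕ.+-identityʳ n)))))) ⟩
    toℚᵘ 1ℚ ∎
    where open ℚᵘ.≃-Reasoning

  fromℕ-mono : ∀ {m n} → m ℕ.≤ n → fromℕ m ≤ fromℕ n
  fromℕ-mono {m} {n} m≤n = toℚᵘ-cancel-≤ $
    ℚᵘ.≤-trans (ℚᵘ.≤-reflexive (toℚᵘ-fromℚᵘ (ℚᵘ.mkℚᵘ (+ m) 0)))
    (ℚᵘ.≤-trans (ℚᵘ.*≤* (ℤ.*-monoʳ-≤-nonNeg (+ 1) (ℤ.+≤+ m≤n)))
    (ℚᵘ.≤-reflexive (ℚᵘ.≃-sym (toℚᵘ-fromℚᵘ (ℚᵘ.mkℚᵘ (+ n) 0)))))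

  bound : ℚ → ℕ
  bound p = ℤ.∣ ↥ p ∣

  ≤-bound : ∀ p → p ≤ fromℕ (bound p)
  ≤-bound p = toℚᵘ-cancel-≤ $
    ℚᵘ.≤-trans (h p)
    (ℚᵘ.≤-reflexive (ℚᵘ.≃-sym (toℚᵘ-fromℚᵘ (ℚᵘ.mkℚᵘ (+ bound p) 0))))
    where
    h : ∀ p → toℚᵘ p ℚᵘ.≤ ℚᵘ.mkℚᵘ (+ bound p) 0
    h (mkℚ (+ a) d _) = ℚᵘ.*≤* $
      subst₂ ℤ._≤_ (ℤ.pos-* a 1) (ℤ.pos-* a (suc d))
        (ℤ.+≤+ (ℕ.*-monoʳ-≤ a (ℕ.s≤s ℕ.z≤n)))
    h (mkℚ -[1+ a ] d _) = ℚᵘ.*≤* ℤ.-≤+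

  ½^-nonNeg : ∀ n → NonNegative (½^ n)
  ½^-nonNeg zero    = _
  ½^-nonNeg (suc n) = nonNeg*nonNeg⇒nonNeg (½^ n) {{½^-nonNeg n}} ½

  2^_ : ℕ → ℚ
  2^ zero  = 1ℚ
  2^ suc n = (2^ n) + (2^ n)

  1≤2^ : ∀ n → 1ℚ ≤ 2^ n
  1≤2^ zero    = ≤-refl
  1≤2^ (suc n) = ≤-trans (1≤2^ n)
    (≤-trans (≤-reflexive (sym (+-identityʳ (2^ n))))
             (+-monoʳ-≤ (2^ n) (≤-trans (<⇒≤ (positive⁻¹ 1ℚ)) (1≤2^ n))))

  fromℕ≤2^ : ∀ n → fromℕ n ≤ 2^ n
  fromℕ≤2^ zero    = <⇒≤ (positive⁻¹ 1ℚ)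
  fromℕ≤2^ (suc n) = ≤-trans (≤-reflexive (fromℕ-suc n)) (+-mono-≤ (1≤2^ n) (fromℕ≤2^ n))

  2^*½^ : ∀ n → (2^ n) * (½^ n) ≡ 1ℚ
  2^*½^ zero    = refl
  2^*½^ (suc n) = trans (lemma (2^ n) (½^ n)) (2^*½^ n)
    where
    open +-*-Solver
    lemma : ∀ a b → (a + a) * (b * ½) ≡ a * b
    lemma = solve 2 (λ a b → (a :+ a) :* (b :* con ½) := a :* b) refl

  ½^-small : ∀ x ε → 0ℚ < ε → ∃[ j ] x * (½^ j) ≤ ε
  ½^-small x ε ε>0 = j , (begin
    x * (½^ j)                  ≤⟨ *-monoʳ-≤-nonNeg (½^ j) {{½^-nonNeg j}} x≤ ⟩
    (ε * (2^ j)) * (½^ j)       ≡⟨ trans (*-assoc ε (2^ j) (½^ j)) (trans (cong (ε *_) (2^*½^ j)) (*-identityʳ ε)) ⟩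
    ε                           ∎)
    where
    open ≤-Reasoning
    instance
      ε-pos : Positive ε
      ε-pos = positive ε>0
      ε-nonZero : NonZero ε
      ε-nonZero = pos⇒nonZero ε
      ε-nonNeg : NonNegative ε
      ε-nonNeg = pos⇒nonNeg ε
    j = bound (x * (1/ ε))
    x≤ : x ≤ ε * (2^ j)
    x≤ = begin
      x                         ≡⟨ sym (trans (*-assoc x (1/ ε) ε) (trans (cong (x *_) (*-inverseˡ ε)) (*-identityʳ x))) ⟩
      (x * (1/ ε)) * ε          ≤⟨ *-monoʳ-≤-nonNeg ε (≤-trans (≤-bound (x * (1/ ε))) (fromℕ≤2^ j)) ⟩
      (2^ j) * ε                ≡⟨ *-comm (2^ j) ε ⟩
      ε * (2^ j)                ∎

  half-pos : ∀ {ε} → 0ℚ < ε → 0ℚ < ε * ½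
  half-pos {ε} ε>0 = positive⁻¹ (ε * ½) {{pos*pos⇒pos ε {{positive ε>0}} ½}}

  halves : ∀ ε → ε * ½ + ε * ½ ≡ ε
  halves = solve 1 (λ e → e :* con ½ :+ e :* con ½ := e) refl
    where open +-*-Solver

  ∣-∣-sym : ∀ p q → ∣ p - q ∣ ≡ ∣ q - p ∣
  ∣-∣-sym p q = trans (cong ∣_∣ (lemma p q)) (∣-p∣≡∣p∣ (q - p))
    where
    open +-*-Solver
    lemma : ∀ p q → p - q ≡ - (q - p)
    lemma = solve 2 (λ p q → p :- q := :- (q :- p)) refl

  ∣-∣-triangle : ∀ p q r → ∣ p - r ∣ ≤ ∣ p - q ∣ + ∣ q - r ∣
  ∣-∣-triangle p q r =
    subst (λ z → ∣ z ∣ ≤ ∣ p - q ∣ + ∣ q - r ∣) (lemma p q r) (∣p+q∣≤∣p∣+∣q∣ (p - q) (q - r))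
    where
    open +-*-Solver
    lemma : ∀ p q r → (p - q) + (q - r) ≡ p - r
    lemma = solve 3 (λ p q r → (p :- q) :+ (q :- r) := p :- r) refl

------------------------------------------------------------------------
-- Real numbers, as Cauchy sequences of rationals

IsCauchy : (ℕ → ℚ) → Set
IsCauchy s = ∀ ε → 0ℚ < ε →
  ∃[ N ] ∀ k l → N ℕ.≤ k → N ℕ.≤ l → ∣ s k - s l ∣ ≤ ε

record ℝ : Set where
  constructor mkℝ
  field
    seq    : ℕ → ℚ
    cauchy : IsCauchy seq

open ℝ public

infix 4 _≤ᴿ_ _<ᴿ_

_≤ᴿ_ : ℝ → ℝ → Set
x ≤ᴿ y = ∀ ε → 0ℚ < ε → ∃[ N ] ∀ k → N ℕ.≤ k → seq x k ≤ seq y k + ε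

_<ᴿ_ : ℝ → ℝ → Set
x <ᴿ y = ∃[ ε ] (0ℚ < ε × ∃[ N ] ∀ k → N ℕ.≤ k → seq x k + ε ≤ seq y k)

fromℚ : ℚ → ℝ
fromℚ q = mkℝ (λ _ → q) λ ε ε>0 → 0 , λ _ _ _ _ →
  ≤-trans (≤-reflexive (cong ∣_∣ (+-inverseʳ q))) (<⇒≤ ε>0)

infixl 6 _+ᴿ_
_+ᴿ_ : ℝ → ℝ → ℝ
x +ᴿ y = mkℝ (λ k → seq x k + seq y k) λ ε ε>0 →
  let (M , hx) = cauchy x (ε * ½) (half-pos ε>0)
      (N , hy) = cauchy y (ε * ½) (half-pos ε>0)
  in M ℕ.⊔ N , λ k l k≥ l≥ → begin
    ∣ (seq x k + seq y k) - (seq x l + seq y l) ∣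
      ≡⟨ cong ∣_∣ (lemma (seq x k) (seq y k) (seq x l) (seq y l)) ⟩
    ∣ (seq x k - seq x l) + (seq y k - seq y l) ∣
      ≤⟨ ∣p+q∣≤∣p∣+∣q∣ (seq x k - seq x l) (seq y k - seq y l) ⟩
    ∣ seq x k - seq x l ∣ + ∣ seq y k - seq y l ∣
      ≤⟨ +-mono-≤ (hx k l (ℕ.m⊔n≤o⇒m≤o M N k≥) (ℕ.m⊔n≤o⇒m≤o M N l≥))
                  (hy k l (ℕ.m⊔n≤o⇒n≤o M N k≥) (ℕ.m⊔n≤o⇒n≤o M N l≥)) ⟩
    ε * ½ + ε * ½
      ≡⟨ halves ε ⟩
    ε ∎
  where
  open ≤-Reasoning
  open +-*-Solver
  lemma : ∀ a b c d → (a + b) - (c + d) ≡ (a - c) + (b - d)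
  lemma = solve 4 (λ a b c d → (a :+ b) :- (c :+ d) := (a :- c) :+ (b :- d)) refl

infixr 7 _·_
_·_ : ℚ → ℝ → ℝ
q · x = mkℝ (λ k → q * seq x k) λ ε ε>0 →
  let (N , h) = cauchy x (ε * (1/ r)) (positive⁻¹ _ {{pos*pos⇒pos ε {{positive ε>0}} (1/ r) {{1/pos⇒pos r}}}})
  in N , λ k l k≥ l≥ → begin
    ∣ q * seq x k - q * seq x l ∣  ≡⟨ cong ∣_∣ (lemma q (seq x k) (seq x l)) ⟩
    ∣ q * (seq x k - seq x l) ∣    ≡⟨ ∣p*q∣≡∣p∣*∣q∣ q (seq x k - seq x l) ⟩
    ∣ q ∣ * ∣ seq x k - seq x l ∣  ≤⟨ *-monoʳ-≤-nonNeg (∣ seq x k - seq x l ∣) {{∣-∣-nonNeg (seq x k - seq x l)}} ∣q∣≤r ⟩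
    r * ∣ seq x k - seq x l ∣      ≤⟨ *-monoˡ-≤-nonNeg r {{pos⇒nonNeg r}} (h k l k≥ l≥) ⟩
    r * (ε * (1/ r))               ≡⟨ lemma′ r ε (1/ r) ⟩
    ε * (r * (1/ r))               ≡⟨ cong (ε *_) (*-inverseʳ r) ⟩
    ε * 1ℚ                         ≡⟨ *-identityʳ ε ⟩
    ε                              ∎
  where
  open ≤-Reasoning
  open +-*-Solver
  r : ℚ
  r = 1ℚ + ∣ q ∣
  instance
    r-pos : Positive r
    r-pos = pos+nonNeg⇒pos 1ℚ ∣ q ∣ {{∣-∣-nonNeg q}}
    r-nonZero : NonZero r
    r-nonZero = pos⇒nonZero r
  ∣q∣≤r : ∣ q ∣ ≤ r
  ∣q∣≤r = ≤-trans (≤-reflexive (sym (+-identityˡ ∣ q ∣)))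
                  (+-monoˡ-≤ ∣ q ∣ (<⇒≤ (positive⁻¹ 1ℚ)))
  lemma : ∀ a b c → a * b - a * c ≡ a * (b - c)
  lemma = solve 3 (λ a b c → a :* b :- a :* c := a :* (b :- c)) refl
  lemma′ : ∀ a b c → a * (b * c) ≡ b * (a * c)
  lemma′ = solve 3 (λ a b c → a :* (b :* c) := b :* (a :* c)) refl

∑ᴿ : ∀ {n} → Vector ℝ n → ℝ
∑ᴿ = Vector.foldr _+ᴿ_ (fromℚ 0ℚ)

module _ where
  geometric⇒cauchy : ∀ (s : ℕ → ℚ) D N →
    (∀ j → ∣ s (suc j ℕ.+ N) - s (j ℕ.+ N) ∣ ≤ D * (½^ suc j)) → IsCauchy s
  geometric⇒cauchy s D N step ε ε>0 = j₀ ℕ.+ N , λ k l k≥ l≥ → begin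
    ∣ s k - s l ∣                                    ≤⟨ ∣-∣-triangle (s k) (s (j₀ ℕ.+ N)) (s l) ⟩
    ∣ s k - s (j₀ ℕ.+ N) ∣ + ∣ s (j₀ ℕ.+ N) - s l ∣  ≤⟨ +-mono-≤ (near k k≥) (≤-trans (≤-reflexive (∣-∣-sym (s (j₀ ℕ.+ N)) (s l))) (near l l≥)) ⟩
    ε * ½ + ε * ½                                    ≡⟨ halves ε ⟩
    ε                                                ∎
    where
    open ≤-Reasoning
    open +-*-Solver
    small = ½^-small D (ε * ½) (half-pos ε>0)
    j₀ = proj₁ small
    D≥0 : ∀ j → 0ℚ ≤ D * (½^ suc j)
    D≥0 j = ≤-trans (0≤∣p∣ _) (step j)
    lemma : ∀ d h → d * (h * ½) + d * (h * ½) ≡ d * h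
    lemma = solve 2 (λ d h → d :* (h :* con ½) :+ d :* (h :* con ½) := d :* h) refl
    tail : ∀ i j → ∣ s ((i ℕ.+ j) ℕ.+ N) - s (j ℕ.+ N) ∣ ≤ D * (½^ j)
    tail zero j = begin
      ∣ s (j ℕ.+ N) - s (j ℕ.+ N) ∣        ≡⟨ cong ∣_∣ (+-inverseʳ (s (j ℕ.+ N))) ⟩
      0ℚ                                   ≤⟨ +-mono-≤ (D≥0 j) (D≥0 j) ⟩
      D * (½^ suc j) + D * (½^ suc j)      ≡⟨ lemma D (½^ j) ⟩
      D * (½^ j)                           ∎
    tail (suc i) j = begin
      ∣ s ((suc i ℕ.+ j) ℕ.+ N) - s (j ℕ.+ N) ∣
        ≡⟨ cong (λ z → ∣ s (z ℕ.+ N) - s (j ℕ.+ N) ∣) (sym (ℕ.+-suc i j)) ⟩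
      ∣ s ((i ℕ.+ suc j) ℕ.+ N) - s (j ℕ.+ N) ∣
        ≤⟨ ∣-∣-triangle (s ((i ℕ.+ suc j) ℕ.+ N)) (s (suc j ℕ.+ N)) (s (j ℕ.+ N)) ⟩
      ∣ s ((i ℕ.+ suc j) ℕ.+ N) - s (suc j ℕ.+ N) ∣ + ∣ s (suc j ℕ.+ N) - s (j ℕ.+ N) ∣
        ≤⟨ +-mono-≤ (tail i (suc j)) (step j) ⟩
      D * (½^ suc j) + D * (½^ suc j)
        ≡⟨ lemma D (½^ j) ⟩
      D * (½^ j) ∎
    near : ∀ k → j₀ ℕ.+ N ℕ.≤ k → ∣ s k - s (j₀ ℕ.+ N) ∣ ≤ ε * ½
    near k k≥ = begin
      ∣ s k - s (j₀ ℕ.+ N) ∣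
        ≡⟨ cong (λ z → ∣ s z - s (j₀ ℕ.+ N) ∣)
             (sym (trans (ℕ.+-assoc (k ℕ.∸ (j₀ ℕ.+ N)) j₀ N) (ℕ.m∸n+n≡m k≥))) ⟩
      ∣ s (((k ℕ.∸ (j₀ ℕ.+ N)) ℕ.+ j₀) ℕ.+ N) - s (j₀ ℕ.+ N) ∣
        ≤⟨ tail (k ℕ.∸ (j₀ ℕ.+ N)) j₀ ⟩
      D * (½^ j₀)
        ≤⟨ proj₂ small ⟩
      ε * ½ ∎

  add-sub : ∀ a b → (a + b) - a ≡ b
  add-sub = solve 2 (λ a b → (a :+ b) :- a := b) refl
    where open +-*-Solver

------------------------------------------------------------------------
-- Exponential and square root of a rational

expTerm : ℚ → ℕ → ℚ
expTerm q zero    = 1ℚ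
expTerm q (suc k) = expTerm q k * (q * (+ 1 / suc k))

expSeq : ℚ → ℕ → ℚ
expSeq q zero    = 0ℚ
expSeq q (suc k) = expSeq q k + expTerm q k

module _ where
  expSeq-cauchy : ∀ q → IsCauchy (expSeq q)
  expSeq-cauchy q = geometric⇒cauchy (expSeq q) D N step
    where
    open ≤-Reasoning
    open +-*-Solver
    N = bound (∣ q ∣ + ∣ q ∣)
    D = ∣ expTerm q N ∣ + ∣ expTerm q N ∣
    dbl : ∀ t → t ≡ (t + t) * (1ℚ * ½)
    dbl = solve 1 (λ t → t := (t :+ t) :* (con 1ℚ :* con ½)) refl
    half : ∀ x → x ≡ (x + x) * ½
    half = solve 1 (λ t → t := (t :+ t) :* con ½) refl
    swap : ∀ a b → (a * ½) * b ≡ ½ * (a * b)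
    swap = solve 2 (λ a b → (a :* con ½) :* b := con ½ :* (a :* b)) refl
    ratio : ∀ k → N ℕ.≤ suc k → ∣ q * (+ 1 / suc k) ∣ ≤ ½
    ratio k N≤ = begin
      ∣ q * (+ 1 / suc k) ∣             ≡⟨ ∣p*q∣≡∣p∣*∣q∣ q (+ 1 / suc k) ⟩
      ∣ q ∣ * ∣ + 1 / suc k ∣           ≡⟨ cong (∣ q ∣ *_) (0≤p⇒∣p∣≡p (nonNegative⁻¹ _ {{nn}})) ⟩
      ∣ q ∣ * (+ 1 / suc k)             ≡⟨ cong (_* (+ 1 / suc k)) (half ∣ q ∣) ⟩
      ((∣ q ∣ + ∣ q ∣) * ½) * (+ 1 / suc k)
        ≤⟨ *-monoʳ-≤-nonNeg (+ 1 / suc k) {{nn}} (*-monoʳ-≤-nonNeg ½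
             (≤-trans (≤-bound (∣ q ∣ + ∣ q ∣)) (fromℕ-mono N≤))) ⟩
      (fromℕ (suc k) * ½) * (+ 1 / suc k)  ≡⟨ swap (fromℕ (suc k)) (+ 1 / suc k) ⟩
      ½ * (fromℕ (suc k) * (+ 1 / suc k))  ≡⟨ cong (½ *_) (fromℕ-*-1/ k) ⟩
      ½ ∎
      where
      nn : NonNegative (+ 1 / suc k)
      nn = normalize-nonNeg 1 (suc k)
    decay : ∀ j → ∣ expTerm q (j ℕ.+ N) ∣ ≤ D * (½^ suc j)
    decay zero    = ≤-reflexive (dbl ∣ expTerm q N ∣)
    decay (suc j) = begin
      ∣ expTerm q (j ℕ.+ N) * (q * (+ 1 / suc (j ℕ.+ N))) ∣
        ≡⟨ ∣p*q∣≡∣p∣*∣q∣ (expTerm q (j ℕ.+ N)) (q * (+ 1 / suc (j ℕ.+ N))) ⟩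
      ∣ expTerm q (j ℕ.+ N) ∣ * ∣ q * (+ 1 / suc (j ℕ.+ N)) ∣
        ≤⟨ *-monoˡ-≤-nonNeg ∣ expTerm q (j ℕ.+ N) ∣ {{∣-∣-nonNeg (expTerm q (j ℕ.+ N))}}
             (ratio (j ℕ.+ N) (ℕ.m≤n+m N (suc j))) ⟩
      ∣ expTerm q (j ℕ.+ N) ∣ * ½
        ≤⟨ *-monoʳ-≤-nonNeg ½ (decay j) ⟩
      (D * (½^ suc j)) * ½
        ≡⟨ *-assoc D (½^ suc j) ½ ⟩
      D * (½^ suc (suc j)) ∎
    step : ∀ j → ∣ expSeq q (suc j ℕ.+ N) - expSeq q (j ℕ.+ N) ∣ ≤ D * (½^ suc j)
    step j = ≤-trans
      (≤-reflexive (cong ∣_∣ (add-sub (expSeq q (j ℕ.+ N)) (expTerm q (j ℕ.+ N)))))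
      (decay j)

exp : ℚ → ℝ
exp q = mkℝ (expSeq q) (expSeq-cauchy q)

-- Binary search from below: for q ≥ 0, the k-th term s satisfies
-- s² ≤ q < (s + (1 + q) / 2ᵏ)².  For q < 0 the sequence is constantly 0.

sqrtSeq : ℚ → ℕ → ℚ
sqrtSeq q zero    = 0ℚ
sqrtSeq q (suc k) =
  let s = sqrtSeq q k
      d = (1ℚ + ∣ q ∣) * (½^ suc k)
  in if does ((s + d) ² ≤? q) then s + d else s

module _ where
  sqrtSeq-cauchy : ∀ q → IsCauchy (sqrtSeq q)
  sqrtSeq-cauchy q = geometric⇒cauchy (sqrtSeq q) (1ℚ + ∣ q ∣) 0 λ j →
    subst (λ z → ∣ sqrtSeq q (suc z) - sqrtSeq q z ∣ ≤ (1ℚ + ∣ q ∣) * (½^ suc j))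
          (sym (ℕ.+-identityʳ j)) (step j)
    where
    nn : ∀ k → NonNegative ((1ℚ + ∣ q ∣) * (½^ k))
    nn k = nonNeg*nonNeg⇒nonNeg (1ℚ + ∣ q ∣)
      {{nonNeg+nonNeg⇒nonNeg 1ℚ ∣ q ∣ {{∣-∣-nonNeg q}}}} (½^ k) {{½^-nonNeg k}}
    step : ∀ j → ∣ sqrtSeq q (suc j) - sqrtSeq q j ∣ ≤ (1ℚ + ∣ q ∣) * (½^ suc j)
    step j with does ((sqrtSeq q j + (1ℚ + ∣ q ∣) * (½^ suc j)) ² ≤? q)
    ... | true  = ≤-reflexive (trans
          (cong ∣_∣ (add-sub (sqrtSeq q j) ((1ℚ + ∣ q ∣) * (½^ suc j))))
          (0≤p⇒∣p∣≡p (nonNegative⁻¹ _ {{nn (suc j)}})))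
    ... | false = ≤-trans (≤-reflexive (cong ∣_∣ (+-inverseʳ (sqrtSeq q j))))
          (nonNegative⁻¹ _ {{nn (suc j)}})

√_ : ℚ → ℝ
√ q = mkℝ (sqrtSeq q) (sqrtSeq-cauchy q)

∥_∥ : ∀ {n} → Vector ℚ n → ℝ
∥ v ∥ = √ ⟨ v , v ⟩

------------------------------------------------------------------------
-- Probabilistic multitape Turing machines

data Letter : Set where
  bit : Bit → Letter
  sep : Letter

data Symbol (w : ℕ) : Set where
  blank  : Symbol w
  letter : Letter → Symbol w
  work   : Fin w → Symbol w

data Move : Set where
  left stay right : Move

-- A two-way infinite tape.  The list before the head is stored nearest
-- cell first, and both lists are implicitly followed by blanks.

record Tape (w : ℕ) : Set where
  constructor tape
  field
    before : List (Symbol w)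
    head   : Symbol w
    after  : List (Symbol w)

module _ {w : ℕ} where

  pop : List (Symbol w) → Symbol w × List (Symbol w)
  pop []       = blank , []
  pop (x ∷ xs) = x , xs

  load : List (Symbol w) → Tape w
  load xs = let (x , xs′) = pop xs in tape [] x xs′

  write : Symbol w × Move → Tape w → Tape w
  write (x , left)  (tape ls _ rs) = let (l , ls′) = pop ls in tape ls′ l (x ∷ rs)
  write (x , stay)  (tape ls _ rs) = tape ls x rs
  write (x , right) (tape ls _ rs) = let (r , rs′) = pop rs in tape (x ∷ ls) r rs′

  letters : List (Symbol w) → List Letter
  letters (letter a ∷ xs) = a ∷ letters xs
  letters _               = []

  contents : Tape w → List Letter
  contents (tape _ x rs) = letters (x ∷ rs)

-- One fair coin is flipped per step.  The first tape holds the input and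
-- finally the output, which is read from the head rightwards; the other
-- #tapes tapes start blank.

record Machine : Set where
  field
    #states #tapes #work : ℕ
    start stop           : Fin #states
    δ                    : Fin #states → Vec (Symbol #work) (suc #tapes) → Bool →
                           Fin #states × Vec (Symbol #work × Move) (suc #tapes)

module _ (M : Machine) where
  open Machine M

  record Config : Set where
    constructor config
    field
      state : Fin #states
      tapes : Vec (Tape #work) (suc #tapes)

  open Config

  initial : List Letter → Config
  initial x = config start (load (List.map letter x) ∷ Vec.replicate #tapes (load []))

  Halted : Config → Set
  Halted C = state C ≡ stop

  step : Bool → Config → Config
  step b (config q ts) with q Fin.≟ stop
  ... | yes _ = config q ts
  ... | no  _ = let (q′ , acts) = δ q (Vec.map Tape.head ts) b
                in config q′ (Vec.zipWith write acts ts)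

  run : ∀ {t} → Vec Bool t → Config → Config
  run []       C = C
  run (b ∷ bs) C = run bs (step b C)

  output : ∀ {t} → List Letter → Vec Bool t → List Letter
  output x coins = contents (Vec.head (tapes (run coins (initial x))))

  HaltsWithin : (ℕ → ℕ) → Set
  HaltsWithin T = ∀ (x : List Letter) (coins : Vec Bool (T (length x))) →
    Halted (run coins (initial x))

PolynomiallyBounded : (ℕ → ℕ) → Set
PolynomiallyBounded T = ∃[ C ] ∃[ d ] ∀ s → T s ℕ.≤ C ℕ.* s ℕ.^ d ℕ.+ C

-- Pr[ E ]≥ p is a lower bound for uniformly random coins.  Distinct elements
-- of E are listed, rather than counted, so that E need not be decidable.

Pr[_]≥_ : ∀ {t} → (Vec Bool t → Set) → ℚ → Set
Pr[_]≥_ {t} E p = ∃[ cs ] (Unique cs × All E cs × p * fromℕ (2 ℕ.^ t) ≤ fromℕ (length cs))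

------------------------------------------------------------------------
-- Encodings

encodeℕ : ℕ → List Letter
encodeℕ n = List.map bit (proj₁ (toDigits 2 n)) ++ sep ∷ []

encodeℤ : ℤ → List Letter
encodeℤ (+ n)    = bit 0b ∷ encodeℕ n
encodeℤ -[1+ n ] = bit 1b ∷ encodeℕ (suc n)

encodeℚ : ℚ → List Letter
encodeℚ q = encodeℤ (↥ q) ++ encodeℕ (↧ₙ q)

encodeVector : ∀ {A : Set} {n} → (A → List Letter) → Vector A n → List Letter
encodeVector enc v = List.concatMap enc (Vector.toList v)

-- Every number contributes at least one letter, so being polynomial in the
-- length of this word is being polynomial in n, m and the total bit size.

encodeInput : ∀ n m → Vector ℚ n → Vector (Vector ℚ n) m → Vector ℚ m → List Letter
encodeInput n m y a Λ =
  encodeℕ n ++ encodeℕ m ++ encodeVector encodeℚ y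
    ++ encodeVector (encodeVector encodeℚ) a ++ encodeVector encodeℚ Λ

encodeOutput : ∀ {n} → Vector ℚ n → List Letter
encodeOutput = encodeVector encodeℚ

------------------------------------------------------------------------
-- The rounding problem

W : ∀ {n} → Vector ℚ n → Vector ℚ n → ℚ
W a y = ∑ (λ i → a i ² * (y i ⊓ (1ℚ - y i)) ²)

AtLeast_IntegralIn_ : ∀ {n} → ℚ → Vector ℚ n → Set
AtLeast_IntegralIn_ {n} r y = Σ[ S ∈ Subset n ]
  (r ≤ fromℕ (card S) × (∀ {i} → i ∈ S → y i ≡ 0ℚ ⊎ y i ≡ 1ℚ))

{-# OPTIONS --safe #-}
module Submission where

-- The algorithm is deterministic. It walks x in the box [-X, X]ⁿ, in integers throughout, from the origin, and
-- freezes the coordinates that come close to the boundary. A step u is a unit vector to which the heat flow of the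
-- currently heavy rows is applied for a long time, so that u is small on every heavy row. Averaged over all unit
-- vectors and both signs, the total weight of the rows, in which the row j counts as a multiplicative exponential
-- of A j · x, does not grow while x · x does, so some step improves the potential as long as many coordinates are
-- active. The final weights bound all A j · x. At least half of the frozen coordinates of x or of -x point
-- towards the integer nearest to y, and those become integral.

open import Data.Bool.Base using (Bool; true; false; if_then_else_; not)
open import Data.Empty using (⊥; ⊥-elim)
open import Data.Fin.Base as Fin using (Fin)
open import Data.Integer.Base as Z using (ℤ; 0ℤ; 1ℤ; -1ℤ)
import Data.Integer.Properties as Z
open import Data.List.Base as List using (List; []; _∷_; _++_; length)
import Data.List.Properties as List
open import Data.Maybe.Base using (Maybe; just; nothing)
open import Data.Nat.Base as N using (ℕ; zero; suc)
import Data.Nat.Properties as N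
open import Data.Product.Base using (Σ-syntax; ∃-syntax; _×_; _,_; proj₁; proj₂)
open import Data.Rational.Base as Q using (ℚ; 0ℚ; 1ℚ; ↥_; ↧_; ↧ₙ_)
import Data.Rational.Properties as Q
open import Data.Sum.Base using (_⊎_; inj₁; inj₂)
open import Data.Unit.Base using (⊤; tt)
open import Data.Vec.Base as Vec using (Vec; []; _∷_)
import Data.Vec.Properties as Vec
open import Data.Vec.Functional as Vector using (Vector)
open import Function.Base using (_∘_)
open import Relation.Binary.Definitions using (tri<; tri≈; tri>)
open import Relation.Binary.PropositionalEquality hiding (J)
open import Relation.Nullary using (Dec; yes; no; contradiction)
open import Relation.Nullary.Decidable using (toWitness)

infixr 7 _==_

_==_ : ∀ {a} {A : Set a} {x y z : A} → x ≡ y → y ≡ z → x ≡ z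
p == q = trans p q

module Order {A : Set} (_≤_ : A → A → Set) (≤-trans : ∀ {x y z} → x ≤ y → y ≤ z → x ≤ z) where

 infixr 6 _<<_ _=<_ _<=_

 -- In a chain, < stands for an inequality and = for an equation, on the respective side.
 _<<_ : ∀ {x y z} → x ≤ y → y ≤ z → x ≤ z
 p << q = ≤-trans p q

 _=<_ : ∀ {x y z} → x ≡ y → y ≤ z → x ≤ z
 refl =< q = q

 _<=_ : ∀ {x y z} → x ≤ y → y ≡ z → x ≤ z
 p <= refl = p

module Chainℕ = Order N._≤_ N.≤-trans
module Chainℤ = Order Z._≤_ Z.≤-trans
module Chainℚ = Order Q._≤_ Q.≤-trans

module Machines where

 open import Data.Fin.Base using (zero; suc; _↑ˡ_; _↑ʳ_; splitAt)
 import Data.Fin.Properties as Fin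
 open import Data.Maybe.Base as Maybe using (Maybe; just; nothing) renaming (maybe′ to maybe)
 open import Data.Nat.Base using (_+_; _≤_; z≤n; s≤s)
 open import Data.Nat.Properties using (≤-refl; ≤-trans; +-assoc; +-mono-≤)
 open import Data.Sum.Base as Sum using ()
 open import Data.Vec.Base using (lookup; _[_]≔_)
 open import Defs hiding (1≤2^; bound)

 Stack : Set
 Stack = List Letter

 Mem : Set
 Mem = Vec Stack 5

 top : Stack -> Maybe Letter
 top [] = nothing
 top(a ∷ _) = just a

 rest : Stack -> Stack
 rest [] = []
 rest(_ ∷ xs) = xs

 Test : Set
 Test = Maybe Letter -> Bool

 infixr 5 _⨾_

 data Prog : Set where
  push : Fin 5 -> Letter -> Prog
  pull : Fin 5 -> Prog
  _⨾_ : Prog -> Prog -> Prog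
  ifp : Fin 5 -> Test -> Prog -> Prog -> Prog
  loop : Fin 5 -> Test -> Prog -> Prog

 -- Runs p m k m' bounds the number of machine steps from above by k.
 data Runs : Prog -> Mem -> ℕ -> Mem -> Set where
  r-push : ∀ {i a m} -> Runs(push i a)m 2(m [ i ]≔ (a ∷ lookup m i))
  r-pull : ∀ {i m} -> Runs(pull i)m 1(m [ i ]≔ rest(lookup m i))
  r-seq : ∀ {p q m m' m'' k l} -> Runs p m k m' -> Runs q m' l m'' -> Runs(p ⨾ q)m(k + l)m''
  r-then : ∀ {i f p q m m' k} -> f(top(lookup m i))≡ true -> Runs p m k m' -> Runs(ifp i f p q)m(suc k)m'
  r-else : ∀ {i f p q m m' k} -> f(top(lookup m i))≡ false -> Runs q m k m' -> Runs(ifp i f p q)m(suc k)m'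
  r-stop : ∀ {i f p m} -> f(top(lookup m i))≡ false -> Runs(loop i f p)m 1 m
  r-step : ∀ {i f p m m' m'' k l} -> f(top(lookup m i))≡ true -> Runs p m k m' -> Runs(loop i f p)m' l m'' ->
   Runs(loop i f p)m(suc(k + l))m''
  r-weak : ∀ {p m m' k l} -> k ≤ l -> Runs p m k m' -> Runs p m l m'

 Sym : Set
 Sym = Symbol 0

 toLetter : Sym -> Maybe Letter
 toLetter blank = nothing
 toLetter(letter a) = just a

 St : Prog -> Set
 St(push _ _) = ⊤
 St(pull _) = ⊤
 St(p ⨾ q) = St p ⊎ St q
 St(ifp _ _ p q) = ⊤ ⊎ (St p ⊎ St q)
 St(loop _ _ p) = ⊤ ⊎ St p

 entry : ∀ p -> St p
 entry(push _ _) = tt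
 entry(pull _) = tt
 entry(p ⨾ _) = inj₁(entry p)
 entry(ifp _ _ _ _) = inj₁ tt
 entry(loop _ _ _) = inj₁ tt

 #St : Prog -> ℕ
 #St(push _ _) = 1
 #St(pull _) = 1
 #St(p ⨾ q) = #St p + #St q
 #St(ifp _ _ p q) = 1 +(#St p + #St q)
 #St(loop _ _ p) = 1 + #St p

 toFin : ∀ p -> St p -> Fin(#St p)
 toFin(push _ _)_ = zero
 toFin(pull _)_ = zero
 toFin(p ⨾ q)(inj₁ s) = toFin p s ↑ˡ #St q
 toFin(p ⨾ q)(inj₂ s) = #St p ↑ʳ toFin q s
 toFin(ifp _ _ p q)(inj₁ _) = zero
 toFin(ifp _ _ p q)(inj₂(inj₁ s)) = suc(toFin p s ↑ˡ #St q)
 toFin(ifp _ _ p q)(inj₂(inj₂ s)) = suc(#St p ↑ʳ toFin q s)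
 toFin(loop _ _ p)(inj₁ _) = zero
 toFin(loop _ _ p)(inj₂ s) = suc(toFin p s)

 fromFin : ∀ p -> Fin(#St p) -> St p
 fromFin(push _ _)_ = tt
 fromFin(pull _)_ = tt
 fromFin(p ⨾ q)i = Sum.map(fromFin p)(fromFin q)(splitAt(#St p)i)
 fromFin(ifp _ _ p q)zero = inj₁ tt
 fromFin(ifp _ _ p q)(suc i) = inj₂(Sum.map(fromFin p)(fromFin q)(splitAt(#St p)i))
 fromFin(loop _ _ p)zero = inj₁ tt
 fromFin(loop _ _ p)(suc i) = inj₂(fromFin p i)

 from-to : ∀ p s -> fromFin p(toFin p s)≡ s
 from-to(push _ _)_ = refl
 from-to(pull _)_ = refl
 from-to(p ⨾ q)(inj₁ s) rewrite Fin.splitAt-↑ˡ(#St p)(toFin p s)(#St q) = cong inj₁(from-to p s)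
 from-to(p ⨾ q)(inj₂ s) rewrite Fin.splitAt-↑ʳ(#St p)(#St q)(toFin q s) = cong inj₂(from-to q s)
 from-to(ifp _ _ p q)(inj₁ _) = refl
 from-to(ifp _ _ p q)(inj₂(inj₁ s)) rewrite Fin.splitAt-↑ˡ(#St p)(toFin p s)(#St q) =
  cong (λ s -> inj₂(inj₁ s))(from-to p s)
 from-to(ifp _ _ p q)(inj₂(inj₂ s)) rewrite Fin.splitAt-↑ʳ(#St p)(#St q)(toFin q s) =
  cong (λ s -> inj₂(inj₂ s))(from-to q s)
 from-to(loop _ _ p)(inj₁ _) = refl
 from-to(loop _ _ p)(inj₂ s) = cong inj₂(from-to p s)

 Heads : Set
 Heads = Vec Sym 5

 Actions : Set
 Actions = Vec(Sym × Move)5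

 idle : Heads -> Actions
 idle = Vec.map(_, stay)

 -- A push on a nonempty stack first moves the head to the free cell on the left.
 pushAct : Fin 5 -> Letter -> Heads -> Bool × Actions
 pushAct i a h with lookup h i
 ... | blank = true , idle h [ i ]≔ (letter a , stay)
 ... | letter b = false , idle h [ i ]≔ (letter b , left)

 δp : ∀ p -> St p -> Heads -> Maybe(St p)× Actions
 δp(push i a)s h = let (d , acts) = pushAct i a h in (if d then nothing else just tt), acts
 δp(pull i)s h = nothing , idle h [ i ]≔ (blank , right)
 δp(p ⨾ q)(inj₁ s)h = let (t , acts) = δp p s h in just(maybe inj₁(inj₂(entry q))t), acts
 δp(p ⨾ q)(inj₂ s)h = let (t , acts) = δp q s h in Maybe.map inj₂ t , acts
 δp(ifp i f p q)(inj₁ _)h =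
  just(inj₂(if f(toLetter(lookup h i)) then inj₁(entry p) else inj₂(entry q))), idle h
 δp(ifp i f p q)(inj₂(inj₁ s))h = let (t , acts) = δp p s h in Maybe.map (λ s -> inj₂(inj₁ s))t , acts
 δp(ifp i f p q)(inj₂(inj₂ s))h = let (t , acts) = δp q s h in Maybe.map (λ s -> inj₂(inj₂ s))t , acts
 δp(loop i f p)(inj₁ _)h =(if f(toLetter(lookup h i)) then just(inj₂(entry p)) else nothing), idle h
 δp(loop i f p)(inj₂ s)h = let (t , acts) = δp p s h in just(maybe inj₂(inj₁ tt)t), acts

 stateToFin : ∀ P -> Maybe(St P) -> Fin(suc(#St P))
 stateToFin P nothing = zero
 stateToFin P(just s) = suc(toFin P s)

 machineδ : ∀ P -> Fin(suc(#St P)) -> Heads -> Fin(suc(#St P))× Actions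
 machineδ P zero h = zero , idle h
 machineδ P(suc s)h = let (t , acts) = δp P(fromFin P s)h in stateToFin P t , acts

 machine : Prog -> Machine
 machine P = record
  { #states = suc(#St P) ; #tapes = 4 ; #work = 0
  ; start = suc(toFin P(entry P)) ; stop = zero
  ; δ = λ s h _ -> machineδ P s h }

 stk : ℕ -> Stack -> Tape 0
 stk k [] = tape(List.replicate k blank)blank []
 stk k(x ∷ xs) = tape(List.replicate k blank)(letter x)(List.map letter xs)

 Rep : Vec(Tape 0)5 -> Mem -> Set
 Rep ts m = Σ[ ks ∈ Vec ℕ 5 ] ts ≡ Vec.zipWith stk ks m

 rep-lookup : ∀ {n}(ks : Vec ℕ n)(m : Vec Stack n)i ->
  lookup(Vec.map Tape.head(Vec.zipWith stk ks m))i ≡ maybe letter blank(top(lookup m i))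
 rep-lookup(k ∷ ks)([] ∷ m)zero = refl
 rep-lookup(k ∷ ks)((x ∷ xs)∷ m)zero = refl
 rep-lookup(k ∷ ks)(_ ∷ m)(suc i) = rep-lookup ks m i

 toLetter-top : ∀ x -> toLetter(maybe letter blank x)≡ x
 toLetter-top nothing = refl
 toLetter-top(just _) = refl

 idle-write : ∀ {n}(ts : Vec(Tape 0)n) -> Vec.zipWith write(Vec.map(_, stay)(Vec.map Tape.head ts))ts ≡ ts
 idle-write [] = refl
 idle-write(t ∷ ts) = cong(t ∷_)(idle-write ts)

 write-at : ∀ {n}(ts : Vec(Tape 0)n)i a ->
  Vec.zipWith write(Vec.map(_, stay)(Vec.map Tape.head ts) [ i ]≔ a)ts ≡ ts [ i ]≔ write a(lookup ts i)
 write-at(t ∷ ts)zero a = cong(_ ∷_)(idle-write ts)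
 write-at(t ∷ ts)(suc i)a = cong(t ∷_)(write-at ts i a)

 zip-update : ∀ {n}(ks : Vec ℕ n)(m : Vec Stack n)i k xs ->
  Vec.zipWith stk ks m [ i ]≔ stk k xs ≡ Vec.zipWith stk(ks [ i ]≔ k)(m [ i ]≔ xs)
 zip-update(_ ∷ ks)(_ ∷ m)zero k xs = refl
 zip-update(_ ∷ ks)(_ ∷ m)(suc i)k xs = cong(_ ∷_)(zip-update ks m i k xs)

 lookup-zip : ∀ {n}(ks : Vec ℕ n)(m : Vec Stack n)i -> lookup(Vec.zipWith stk ks m)i ≡ stk(lookup ks i)(lookup m i)
 lookup-zip ks m i = Vec.lookup-zipWith stk i ks m

 pull-tape : ∀ k xs -> write(blank , right)(stk k xs)≡ stk(suc k)(rest xs)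
 pull-tape k [] = refl
 pull-tape k(x ∷ []) = refl
 pull-tape k(x ∷ y ∷ xs) = refl

 module Sim (P : Prog) where
  M : Machine
  M = machine P

  conf : Maybe(St P) -> Vec(Tape 0)5 -> Config M
  conf s ts = config(stateToFin P s)ts

  step-conf : ∀ b s ts -> let (t , acts) = δp P s(Vec.map Tape.head ts) in
   step M b(conf(just s)ts)≡ conf t(Vec.zipWith write acts ts)
  step-conf b s ts rewrite from-to P s = refl

  record Reach (k : ℕ)(C D : Config M) : Set where
   constructor reach
   field
    len : ℕ
    len≤ : len ≤ k
    steps : ∀ (bs : Vec Bool len) -> run M bs C ≡ D

  run-++ : ∀ {j l}(bs : Vec Bool j)(cs : Vec Bool l)C -> run M(bs Vec.++ cs)C ≡ run M cs(run M bs C)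
  run-++ [] cs C = refl
  run-++(b ∷ bs)cs C = run-++ bs cs(step M b C)

  reach-refl : ∀ {C} -> Reach 0 C C
  reach-refl = reach 0 z≤n λ { [] -> refl }

  reach-trans : ∀ {k l C D E} -> Reach k C D -> Reach l D E -> Reach(k + l)C E
  reach-trans {C = C}{E = E}(reach j j≤ f)(reach i i≤ g) = reach(j + i)(+-mono-≤ j≤ i≤)h where
   h : ∀ bs -> run M bs C ≡ E
   h bs with Vec.splitAt j bs
   ... | bs1 , bs2 , refl = run-++ bs1 bs2 C == cong(run M bs2)(f bs1)== g bs2

  reach-weak : ∀ {k l C D} -> k ≤ l -> Reach k C D -> Reach l C D
  reach-weak k≤l(reach j j≤ f) = reach j(≤-trans j≤ k≤l)f

  reach-step : ∀ {s ts t acts} -> δp P s(Vec.map Tape.head ts)≡(t , acts) ->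
   Reach 1(conf(just s)ts)(conf t(Vec.zipWith write acts ts))
  reach-step {s}{ts}eq = reach 1 ≤-refl λ { (b ∷ []) ->
   step-conf b s ts == cong(λ (t , acts) -> conf t(Vec.zipWith write acts ts))eq }

  -- ι places the states of p among those of P, and control leaves p for ex.
  Embeds : ∀ p ->(St p -> St P) -> Maybe(St P) -> Set
  Embeds p ι ex = ∀ s h -> δp P(ι s)h ≡(maybe (λ s -> just(ι s))ex(proj₁(δp p s h)), proj₂(δp p s h))

  Target : ℕ -> Config M -> Maybe(St P) -> Mem -> Set
  Target k C ex m = Σ[ ts ∈ Vec(Tape 0)5 ] Rep ts m × Reach k C(conf ex ts)

  map-maybe : ∀ {A B C : Set}(f : A -> B)(g : B -> C)(c : C)(x : Maybe A) ->
   maybe g c(Maybe.map f x)≡ maybe (λ a -> g(f a))c x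
  map-maybe f g c nothing = refl
  map-maybe f g c(just _) = refl

  top-of : ∀ {ts m} -> Rep ts m -> ∀ i -> toLetter(lookup(Vec.map Tape.head ts)i)≡ top(lookup m i)
  top-of {m = m}(ks , refl)i = cong toLetter(rep-lookup ks m i)== toLetter-top(top(lookup m i))

  write-rep : ∀ ks m i {a k xs} -> write a(stk(lookup ks i)(lookup m i))≡ stk k xs ->
   Rep(Vec.zipWith write(idle(Vec.map Tape.head(Vec.zipWith stk ks m)) [ i ]≔ a)(Vec.zipWith stk ks m))(m [ i ]≔ xs)
  write-rep ks m i {a}{k}{xs}eq = ks [ i ]≔ k ,
   write-at(Vec.zipWith stk ks m)i a ==
   cong(Vec.zipWith stk ks m [ i ]≔_)(cong(write a)(lookup-zip ks m i)== eq)==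
    zip-update ks m i k xs

  idle-rep : ∀ {ts m} -> Rep ts m -> Rep(Vec.zipWith write(idle(Vec.map Tape.head ts))ts)m
  idle-rep {ts}(ks , eq) = ks , idle-write ts == eq

  push-tape : ∀ k x xs a -> Σ[ t ∈ Tape 0 ] write(letter x , left)(stk k(x ∷ xs))≡ t × Tape.head t ≡ blank ×
   Σ[ k' ∈ ℕ ] write(letter a , stay)t ≡ stk k'(a ∷ x ∷ xs)
  push-tape zero x xs a = _ , refl , refl , 0 , refl
  push-tape(suc k)x xs a = _ , refl , refl , k , refl

  module _ {ι ex i a}(emb : Embeds (push i a) ι ex) where

   push-blank : ∀ ts -> Tape.head(lookup ts i)≡ blank ->
    Reach 1(conf(just(ι tt))ts)(conf ex(ts [ i ]≔ write(letter a , stay)(lookup ts i)))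
   push-blank ts eq = subst (λ us -> Reach 1 _ (conf ex us))(write-at ts i(letter a , stay))(reach-step eq') where
    h = Vec.map Tape.head ts
    eq' : δp P(ι tt)h ≡(ex , idle h [ i ]≔ (letter a , stay))
    eq' with emb tt h
    ... | e rewrite Vec.lookup-map i Tape.head ts == eq = e

   push-letter : ∀ ts {b} -> Tape.head(lookup ts i)≡ letter b ->
    Reach 1(conf(just(ι tt))ts)(conf(just(ι tt))(ts [ i ]≔ write(letter b , left)(lookup ts i)))
   push-letter ts {b}eq = subst (λ us -> Reach 1 _ (conf(just(ι tt))us))(write-at ts i(letter b , left))(reach-step eq') where
    h = Vec.map Tape.head ts
    eq' : δp P(ι tt)h ≡(just(ι tt), idle h [ i ]≔ (letter b , left))
    eq' with emb tt h
    ... | e rewrite Vec.lookup-map i Tape.head ts == eq = e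

  sim-push : ∀ {ι ex i a} -> Embeds(push i a)ι ex -> ∀ {ts}{m : Mem} -> Rep ts m ->
   Target 2(conf(just(ι tt))ts)ex(m [ i ]≔ (a ∷ lookup m i))
  sim-push {ι}{ex}{i}{a}emb {ts}{m}(ks , refl) with lookup m i in eq
  ... | [] = _ ,(ks [ i ]≔ lookup ks i , cong (λ t -> ts [ i ]≔ write(letter a , stay)t)tape≡ ==
   zip-update ks m i(lookup ks i)(a ∷ []))
   , reach-weak(s≤s z≤n)(push-blank emb ts(cong Tape.head tape≡)) where
   tape≡ = lookup-zip ks m i == cong(stk(lookup ks i))eq
  ... | x ∷ xs with push-tape(lookup ks i)x xs a
  ... | t , wr , hd , k' , wr' = _ ,(ks [ i ]≔ k' ,
   cong (λ us -> us [ i ]≔ write(letter a , stay)(lookup us i))refl ==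
   Vec.[]≔-idempotent ts i ==
   cong(ts [ i ]≔_)(cong(write(letter a , stay))ts1-i == wr')== zip-update ks m i k' _)
   , reach-trans(push-letter emb ts(cong Tape.head tape≡))(push-blank emb ts1(cong Tape.head ts1-i == hd)) where
   tape≡ = lookup-zip ks m i == cong(stk(lookup ks i))eq
   ts1 = ts [ i ]≔ write(letter x , left)(lookup ts i)
   ts1-i = Vec.lookup∘updateAt i ts == cong(write(letter x , left))tape≡ == wr

  sim : ∀ {p m k m'} -> Runs p m k m' -> ∀ ι ex -> Embeds p ι ex -> ∀ {ts} -> Rep ts m ->
   Target k(conf(just(ι(entry p)))ts)ex m'
  sim-loop : ∀ {i f p m k m'} -> Runs(loop i f p)m k m' -> ∀ ι ex -> Embeds(loop i f p)ι ex -> ∀ {C} ->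
   ∀ {j} -> Target j C(just(ι(inj₁ tt)))m -> Target(j + k)C ex m'

  sim r-push ι ex emb rep = sim-push emb rep
  sim {pull i}(r-pull {m = m})ι ex emb {ts}(ks , refl) =
   _ , write-rep ks m i(pull-tape(lookup ks i)(lookup m i)), reach-step(emb tt(Vec.map Tape.head ts))
  sim {p ⨾ q}(r-seq r1 r2)ι ex emb rep
   with sim r1 (λ s -> ι(inj₁ s))(just(ι(inj₂(entry q))))
    (λ s h -> emb(inj₁ s)h == cong(_, _)(split(proj₁(δp p s h))))rep where
   split : ∀ x -> just(ι(maybe inj₁(inj₂(entry q))x))≡ maybe (λ s -> just(ι(inj₁ s)))(just(ι(inj₂(entry q))))x
   split nothing = refl
   split(just _) = refl
  ... | ts' , rep' , r with sim r2 (λ s -> ι(inj₂ s))ex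
   (λ s h -> emb(inj₂ s)h == cong(_, _)(map-maybe inj₂ _ ex(proj₁(δp q s h))))rep'
  ... | ts'' , rep'' , r' = ts'' , rep'' , reach-trans r r'
  sim {ifp i f p q}(r-then t r)ι ex emb {ts}rep
   with sim r (λ s -> ι(inj₂(inj₁ s)))ex
    (λ s h -> emb(inj₂(inj₁ s))h == cong(_, _)(map-maybe (λ s -> inj₂(inj₁ s))_ ex(proj₁(δp p s h))))(idle-rep rep)
  ... | ts' , rep' , r' = ts' , rep' , reach-trans(reach-step eq)r' where
   h = Vec.map Tape.head ts
   eq : δp P(ι(inj₁ tt))h ≡(just(ι(inj₂(inj₁(entry p)))), idle h)
   eq with emb(inj₁ tt)h
   ... | e rewrite cong f(top-of rep i)== t = e
  sim {ifp i f p q}(r-else t r)ι ex emb {ts}rep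
   with sim r (λ s -> ι(inj₂(inj₂ s)))ex
    (λ s h -> emb(inj₂(inj₂ s))h == cong(_, _)(map-maybe (λ s -> inj₂(inj₂ s))_ ex(proj₁(δp q s h))))(idle-rep rep)
  ... | ts' , rep' , r' = ts' , rep' , reach-trans(reach-step eq)r' where
   h = Vec.map Tape.head ts
   eq : δp P(ι(inj₁ tt))h ≡(just(ι(inj₂(inj₂(entry q)))), idle h)
   eq with emb(inj₁ tt)h
   ... | e rewrite cong f(top-of rep i)== t = e
  sim {loop i f p}r@(r-stop _)ι ex emb rep = sim-loop r ι ex emb(_ , rep , reach-refl)
  sim {loop i f p}r@(r-step _ _ _)ι ex emb rep = sim-loop r ι ex emb(_ , rep , reach-refl)
  sim(r-weak le r)ι ex emb rep with sim r ι ex emb rep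
  ... | ts , rep' , r' = ts , rep' , reach-weak le r'

  sim-loop {i}{f}(r-stop t)ι ex emb(ts , rep , r0) = _ , idle-rep rep , reach-trans r0(reach-step eq) where
   h = Vec.map Tape.head ts
   eq : δp P(ι(inj₁ tt))h ≡(ex , idle h)
   eq with emb(inj₁ tt)h
   ... | e rewrite cong f(top-of rep i)== t = e
  sim-loop {i}{f}{p}{m' = m'}(r-step {k = k}{l}t r1 r2)ι ex emb {C}{j}(ts , rep , r0)
   with sim r1 (λ s -> ι(inj₂ s))(just(ι(inj₁ tt)))
    (λ s h -> emb(inj₂ s)h == cong(_, _)(back(proj₁(δp p s h))))(idle-rep rep) where
   back : ∀ x -> just(ι(maybe inj₂(inj₁ tt)x))≡ maybe (λ s -> just(ι(inj₂ s)))(just(ι(inj₁ tt)))x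
   back nothing = refl
   back(just _) = refl
  ... | ts' , rep' , r' = subst (λ z -> Target z C ex m')(+-assoc j(suc k)l)(sim-loop r2 ι ex emb(ts' , rep' , reach-trans r0(reach-trans(reach-step eq)r'))) where
   h = Vec.map Tape.head ts
   eq : δp P(ι(inj₁ tt))h ≡(just(ι(inj₂(entry p))), idle h)
   eq with emb(inj₁ tt)h
   ... | e rewrite cong f(top-of rep i)== t = e
  sim-loop(r-weak {k = k}le r)ι ex emb {j = j}tg with sim-loop r ι ex emb tg
  ... | ts , rep , r' = ts , rep , reach-weak(+-mono-≤(≤-refl {j})le)r'

  run-program : ∀ {m k m'} -> Runs P m k m' -> ∀ {ts} -> Rep ts m ->
   Σ[ ts' ∈ Vec(Tape 0)5 ] Rep ts' m' × Reach k(conf(just(entry P))ts)(conf nothing ts')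
  run-program r = sim r (λ s -> s)nothing λ s h -> cong(_, proj₂(δp P s h))(η(proj₁(δp P s h))) where
   η : ∀ (x : Maybe(St P)) -> x ≡ maybe just nothing x
   η nothing = refl
   η(just _) = refl

 open import Data.Nat.Base
 open import Data.Nat.Properties
 open import Data.Nat.Tactic.RingSolver using () renaming (solve-∀ to ring)
 open Chainℕ

 ≤-by : ∀ {x y}d -> x + d ≡ y -> x ≤ y
 ≤-by {x}d eq = m≤m+n x d <= eq

 data Tree : Set where
  leaf : Tree
  node : Tree -> Tree -> Tree

 size : Tree -> ℕ
 size leaf = 1
 size(node l r) = suc(size l + size r)

 1≤size : ∀ t -> 1 ≤ size t
 1≤size leaf = s≤s z≤n
 1≤size(node _ _) = s≤s z≤n

 weight : List Tree -> ℕ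
 weight [] = 0
 weight(t ∷ ts) = size t + weight ts

 pattern iIO = zero
 pattern iS = suc zero
 pattern iA = suc(suc zero)
 pattern iR = suc(suc(suc zero))
 pattern iC = suc(suc(suc(suc zero)))

 pattern lf' = bit zero
 pattern nd' = bit(suc zero)

 isNode : Test
 isNode(just nd') = true
 isNode _ = false

 nonEmpty : Test
 nonEmpty(just _) = true
 nonEmpty nothing = false

 ser : Tree -> Stack -> Stack
 ser leaf s = lf' ∷ s
 ser(node l r)s = nd' ∷ ser l(ser r s)

 out :(Letter -> Stack -> Stack) -> Tree -> Stack -> Stack
 out f leaf a = f lf' a
 out f(node l r)a = out f r(out f l(f nd' a))

 rser : Tree -> Stack -> Stack
 rser = out _∷_

 out-const : ∀ t a -> out (λ _ a -> a)t a ≡ a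
 out-const leaf a = refl
 out-const(node l r)a = cong(out _ r)(out-const l a)== out-const r a

 data Mode : Set where
  toA toR toAR drop : Mode

 onA onR : Mode -> Letter -> Stack -> Stack
 onA toA x a = x ∷ a
 onA toAR x a = x ∷ a
 onA toR x a = a
 onA drop x a = a
 onR toR x a = x ∷ a
 onR toAR x a = x ∷ a
 onR toA x a = a
 onR drop x a = a

 emit : Mode -> Letter -> Prog -> Prog
 emit toA x p = push iA x ⨾ p
 emit toR x p = push iR x ⨾ p
 emit toAR x p = push iA x ⨾ push iR x ⨾ p
 emit drop x p = p

 emit-runs : ∀ md x {p io s a r c k m} -> Runs p(io ∷ s ∷ onA md x a ∷ onR md x r ∷ c ∷ [])k m ->
  Runs(emit md x p)(io ∷ s ∷ a ∷ r ∷ c ∷ [])(4 + k)m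
 emit-runs toA x h = r-weak(≤-by 2(+-comm _ 2))(r-seq r-push h)
 emit-runs toR x h = r-weak(≤-by 2(+-comm _ 2))(r-seq r-push h)
 emit-runs toAR x h = r-seq r-push(r-seq r-push h)
 emit-runs drop x h = r-weak(≤-by 4(+-comm _ 4))h

 scanLoop : Mode -> Prog
 scanLoop md = loop iC nonEmpty
  (ifp iS isNode(emit md nd'(pull iS ⨾ push iC sep))(emit md lf'(pull iS ⨾ pull iC)))

 scan : Mode -> Prog
 scan md = push iC sep ⨾ scanLoop md

 scanLoop-runs : ∀ md t {io s a r x c k m} ->
  Runs(scanLoop md)(io ∷ s ∷ out(onA md)t a ∷ out(onR md)t r ∷ c ∷ [])k m ->
  Runs(scanLoop md)(io ∷ ser t s ∷ a ∷ r ∷(x ∷ c)∷ [])(9 * size t + k)m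
 scanLoop-runs md leaf {k = k}h = r-weak(≤-by 1(eq k))(r-step refl(r-else refl(emit-runs md lf'(r-seq r-pull r-pull)))h) where
  eq : ∀ k -> suc(7 + k)+ 1 ≡ 9 + k
  eq = ring
 scanLoop-runs md(node l r){k = k}h =
  r-weak(≤-reflexive(eq(size l)(size r)k))
   (r-step refl(r-then refl(emit-runs md nd'(r-seq r-pull r-push)))(scanLoop-runs md l {x = sep}(scanLoop-runs md r h))) where
  eq : ∀ l r k -> suc(8 +(9 * l +(9 * r + k)))≡ 9 * suc(l + r)+ k
  eq = ring

 scan-runs : ∀ md t {io s a r} -> Runs(scan md)(io ∷ ser t s ∷ a ∷ r ∷ [] ∷ [])(12 * size t)
  (io ∷ s ∷ out(onA md)t a ∷ out(onR md)t r ∷ [] ∷ [])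
 scan-runs md t = r-weak(eq(size t)=< +-monoʳ-≤(9 * size t)(*-monoʳ-≤ 3(1≤size t))<= eq'(size t))
  (r-seq r-push(scanLoop-runs md t(r-stop refl))) where
  eq : ∀ n -> 2 +(9 * n + 1)≡ 9 * n + 3 * 1
  eq = ring
  eq' : ∀ n -> 9 * n + 3 * n ≡ 12 * n
  eq' = ring

 unload : Fin 5 -> Prog
 unload i = loop i nonEmpty(ifp i isNode(pull i ⨾ push iS nd')(pull i ⨾ push iS lf'))

 private
  unload-eq : ∀ l r k -> 5 * r +(5 * l +(5 + k))≡ 5 * suc(l + r)+ k
  unload-eq = ring

 unloadA-tree : ∀ t {io s a r c k m} -> Runs(unload iA)(io ∷ ser t s ∷ a ∷ r ∷ c ∷ [])k m ->
  Runs(unload iA)(io ∷ s ∷ rser t a ∷ r ∷ c ∷ [])(5 * size t + k)m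
 unloadA-tree leaf h = r-step refl(r-else refl(r-seq r-pull r-push))h
 unloadA-tree(node l r){k = k}h = r-weak(≤-reflexive(unload-eq(size l)(size r)k))
  (unloadA-tree r(unloadA-tree l(r-step refl(r-then refl(r-seq r-pull r-push))h)))

 unloadR-tree : ∀ t {io s a r c k m} -> Runs(unload iR)(io ∷ ser t s ∷ a ∷ r ∷ c ∷ [])k m ->
  Runs(unload iR)(io ∷ s ∷ a ∷ rser t r ∷ c ∷ [])(5 * size t + k)m
 unloadR-tree leaf h = r-step refl(r-else refl(r-seq r-pull r-push))h
 unloadR-tree(node l r){k = k}h = r-weak(≤-reflexive(unload-eq(size l)(size r)k))
  (unloadR-tree r(unloadR-tree l(r-step refl(r-then refl(r-seq r-pull r-push))h)))

 sers : List Tree -> Stack -> Stack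
 sers [] s = s
 sers(t ∷ ts)s = ser t(sers ts s)

 rsers : List Tree -> Stack -> Stack
 rsers [] a = a
 rsers(t ∷ ts)a = rsers ts(rser t a)

 sers-++ : ∀ ts us s -> sers(ts ++ us)s ≡ sers ts(sers us s)
 sers-++ [] us s = refl
 sers-++(t ∷ ts)us s = cong(ser t)(sers-++ ts us s)

 rsers-++ : ∀ ts us a -> rsers(ts ++ us)a ≡ rsers us(rsers ts a)
 rsers-++ [] us a = refl
 rsers-++(t ∷ ts)us a = rsers-++ ts us(rser t a)

 weight-++ : ∀ ts us -> weight(ts ++ us)≡ weight ts + weight us
 weight-++ [] us = refl
 weight-++(t ∷ ts)us = cong(size t +_)(weight-++ ts us)== sym(+-assoc(size t)_ _)

 unloadA-trees : ∀ ts {io s a r c k m} -> Runs(unload iA)(io ∷ sers ts s ∷ a ∷ r ∷ c ∷ [])k m ->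
  Runs(unload iA)(io ∷ s ∷ rsers ts a ∷ r ∷ c ∷ [])(5 * weight ts + k)m
 unloadA-trees [] h = h
 unloadA-trees(t ∷ ts){k = k}h = r-weak(≤-reflexive(eq(size t)(weight ts)k))(unloadA-trees ts(unloadA-tree t h)) where
  eq : ∀ t ts k -> 5 * ts +(5 * t + k)≡ 5 *(t + ts)+ k
  eq = ring

 unloadA-runs : ∀ ts {io s r c} -> Runs(unload iA)(io ∷ s ∷ rsers ts [] ∷ r ∷ c ∷ [])(5 * weight ts + 1)(io ∷ sers ts s ∷ [] ∷ r ∷ c ∷ [])
 unloadA-runs ts = unloadA-trees ts(r-stop refl)

 unloadR-runs : ∀ t {io s a c} -> Runs(unload iR)(io ∷ s ∷ a ∷ rser t [] ∷ c ∷ [])(5 * size t + 1)(io ∷ ser t s ∷ a ∷ [] ∷ c ∷ [])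
 unloadR-runs t = unloadR-tree t(r-stop refl)

 retarget : ∀ {p m k m1 m2} -> m1 ≡ m2 -> Runs p m k m1 -> Runs p m k m2
 retarget refl r = r

 repeat : ℕ -> Prog -> Prog -> Prog
 repeat zero p q = q
 repeat(suc n)p q = p ⨾ repeat n p q

 scansA-runs : ∀ ts {q io s a k m} -> Runs q(io ∷ s ∷ rsers ts a ∷ [] ∷ [] ∷ [])k m ->
  Runs(repeat(length ts)(scan toA)q)(io ∷ sers ts s ∷ a ∷ [] ∷ [] ∷ [])(12 * weight ts + k)m
 scansA-runs [] h = h
 scansA-runs(t ∷ ts){io = io}{s}{a}{k}h = r-weak(≤-reflexive(eq(size t)(weight ts)k))
  (r-seq(retarget(cong (λ r -> io ∷ sers ts s ∷ rser t a ∷ r ∷ [] ∷ [])(out-const t []))(scan-runs toA t))(scansA-runs ts h)) where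
  eq : ∀ t ts k -> 12 * t +(12 * ts + k)≡ 12 *(t + ts)+ k
  eq = ring

 drops-runs : ∀ ts {q io s a k m} -> Runs q(io ∷ s ∷ a ∷ [] ∷ [] ∷ [])k m ->
  Runs(repeat(length ts)(scan drop)q)(io ∷ sers ts s ∷ a ∷ [] ∷ [] ∷ [])(12 * weight ts + k)m
 drops-runs [] h = h
 drops-runs(t ∷ ts){io = io}{s}{a}{k}h = r-weak(≤-reflexive(eq(size t)(weight ts)k))
  (r-seq(retarget(cong₂ (λ a r -> io ∷ sers ts s ∷ a ∷ r ∷ [] ∷ [])(out-const t a)(out-const t []))(scan-runs drop t))(drops-runs ts h)) where
  eq : ∀ t ts k -> 12 * t +(12 * ts + k)≡ 12 *(t + ts)+ k
  eq = ring

 mem : Stack -> List Tree -> Mem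
 mem io σ = io ∷ sers σ [] ∷ [] ∷ [] ∷ [] ∷ []

 data At : ℕ -> List Tree -> Tree -> Set where
  here : ∀ {t σ} -> At 0(t ∷ σ)t
  there : ∀ {j u σ t} -> At j σ t -> At(suc j)(u ∷ σ)t

 at-size : ∀ {j σ t} -> At j σ t -> size t ≤ weight σ
 at-size here = m≤m+n _ _
 at-size(there p) = at-size p << m≤n+m _ _

 pick : ℕ -> Prog
 pick j = repeat j(scan toA)(scan toAR ⨾ unload iA ⨾ unload iR)

 record Split (j : ℕ)(σ : List Tree)(t : Tree) : Set where
  constructor split
  field
   front back : List Tree
   len : length front ≡ j
   eq : σ ≡ front ++ t ∷ back

 at-split : ∀ {j σ t} -> At j σ t -> Split j σ t
 at-split here = split [] _ refl refl
 at-split(there {u = u}p) with at-split p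
 ... | split ts us refl refl = split(u ∷ ts)us refl refl

 pick-runs : ∀ {j σ t io} -> At j σ t -> Runs(pick j)(mem io σ)(24 * weight σ)(mem io(t ∷ σ))
 pick-runs {io = io}p with at-split p
 pick-runs {t = t}{io}p | split ts us refl refl =
  r-weak cost(subst₂ (λ s s' -> Runs(pick(length ts))(io ∷ s ∷ [] ∷ [] ∷ [] ∷ [])_ (io ∷ ser t s' ∷ [] ∷ [] ∷ [] ∷ []))
   (sym(sers-++ ts(t ∷ us)[]))
   (sym(sers-++(ts ++ t ∷ [])us [])== cong (λ v -> sers v [])(List.++-assoc ts(t ∷ [])us))
   (scansA-runs ts(r-seq(scan-runs toAR t)
    (r-seq(subst (λ a -> Runs(unload iA)(io ∷ sers us [] ∷ a ∷ rser t [] ∷ [] ∷ [])(5 * weight(ts ++ t ∷ [])+ 1)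
     (io ∷ sers(ts ++ t ∷ [])(sers us [])∷ [] ∷ rser t [] ∷ [] ∷ []))
     (rsers-++ ts(t ∷ [])[])(unloadA-runs(ts ++ t ∷ [])))
     (unloadR-runs t))))) where
  eq : ∀ a b c -> 12 * a +(12 * b +((5 *(a +(b + 0))+ 1)+(5 * b + 1)))+(7 * a + 24 * c)+ 2 * b ≡ 24 *(a +(b + c))+ 2 * 1
  eq = ring
  cost = +-cancelʳ-≤(2 * 1)_ _ ( +-mono-≤(m≤m+n(12 * weight ts +(12 * size t +((5 * weight(ts ++ t ∷ [])+ 1)+(5 * size t + 1))))(7 * weight ts + 24 * weight us))(*-monoʳ-≤ 2(1≤size t))<=
   cong (λ w -> 12 * weight ts +(12 * size t +((5 * w + 1)+(5 * size t + 1)))+(7 * weight ts + 24 * weight us)+ 2 * size t)(weight-++ ts(t ∷ []))==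
   eq(weight ts)(size t)(weight us)==
   cong (λ w -> 24 * w + 2 * 1)(sym(weight-++ ts(t ∷ us))))

 nip : ℕ -> ℕ -> Prog
 nip k j = repeat k(scan toA)(repeat j(scan drop)(unload iA))

 nip-runs : ∀ ts us {σ io} -> Runs(nip(length ts)(length us))(mem io(ts ++ us ++ σ))(17 * weight(ts ++ us)+ 1)(mem io(ts ++ σ))
 nip-runs ts us {σ}{io} = r-weak cost(subst₂ (λ s s' -> Runs(nip(length ts)(length us))(io ∷ s ∷ [] ∷ [] ∷ [] ∷ [])_ (io ∷ s' ∷ [] ∷ [] ∷ [] ∷ []))
  (sym(sers-++ ts(us ++ σ)[] == cong(sers ts)(sers-++ us σ [])))
  (sym(sers-++ ts σ []))
  (scansA-runs ts(drops-runs us(unloadA-runs ts)))) where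
  eq : ∀ a b -> 12 * a +(12 * b +(5 * a + 1))+ 5 * b ≡ 17 *(a + b)+ 1
  eq = ring
  cost = ≤-by(5 * weight us)(eq(weight ts)(weight us))<= cong (λ w -> 17 * w + 1)(sym(weight-++ ts us))

 infixl 6 _⊕_
 infixl 7 _⊗_
 infixl 8 _⊚_

 data Poly : Set where
  con : ℕ -> Poly
  X : Poly
  _⊕_ _⊗_ _⊚_ : Poly -> Poly -> Poly

 ⟦_⟧ : Poly -> ℕ -> ℕ
 ⟦ con c ⟧ s = c
 ⟦ X ⟧ s = s
 ⟦ p ⊕ q ⟧ s = ⟦ p ⟧ s + ⟦ q ⟧ s
 ⟦ p ⊗ q ⟧ s = ⟦ p ⟧ s * ⟦ q ⟧ s
 ⟦ p ⊚ q ⟧ s = ⟦ p ⟧ (⟦ q ⟧ s)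

 ⟦⟧-mono : ∀ p {s t} -> s ≤ t -> ⟦ p ⟧ s ≤ ⟦ p ⟧ t
 ⟦⟧-mono(con c)s≤t = ≤-refl
 ⟦⟧-mono X s≤t = s≤t
 ⟦⟧-mono(p ⊕ q)s≤t = +-mono-≤(⟦⟧-mono p s≤t)(⟦⟧-mono q s≤t)
 ⟦⟧-mono(p ⊗ q)s≤t = *-mono-≤(⟦⟧-mono p s≤t)(⟦⟧-mono q s≤t)
 ⟦⟧-mono(p ⊚ q)s≤t = ⟦⟧-mono p(⟦⟧-mono q s≤t)

 data Exp : ℕ -> Set where
  var : ∀ {n} -> Fin n -> Exp n
  lf : ∀ {n} -> Exp n
  nd : ∀ {n} -> Exp n -> Exp n -> Exp n
  cs : ∀ {n} -> Exp n -> Exp n -> Exp(2 + n) -> Exp n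
  lt : ∀ {n} -> Exp n -> Exp(1 + n) -> Exp n
  rn : ∀ {m n} ->(Fin m -> Fin n) -> Exp m -> Exp n
  fold : ∀ {n} -> Exp n -> Exp n -> Exp n -> Exp(2 + n) -> Exp n
  rmap : ∀ {n} -> Exp n -> Exp(1 + n) -> Exp n

 infixr 5 _▹_
 _▹_ : ∀ {n}{A : Set} -> A ->(Fin n -> A) -> Fin(suc n) -> A
 (a ▹ γ)zero = a
 (a ▹ γ)(suc i) = γ i

 leb : ℕ -> ℕ -> Bool
 leb zero n = true
 leb(suc m)zero = false
 leb(suc m)(suc n) = leb m n

 leb-sound : ∀ m n -> leb m n ≡ true -> m ≤ n
 leb-sound zero n _ = z≤n
 leb-sound(suc m)(suc n)h = s≤s(leb-sound m n h)

 leb-complete : ∀ {m n} -> m ≤ n -> leb m n ≡ true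
 leb-complete z≤n = refl
 leb-complete(s≤s h) = leb-complete h

 -- An accumulator that outgrows the bound is discarded; this keeps every
 -- expression computable in polynomial time.
 clip : Tree -> Tree -> Tree -> Tree
 clip bnd acc r = if leb(size r)(size bnd) then r else acc

 foldTree :(Tree -> Tree -> Tree) -> Tree -> Tree -> Tree -> Tree
 foldTree f bnd leaf acc = acc
 foldTree f bnd(node h t)acc = foldTree f bnd t(clip bnd acc(f h acc))

 rmapTree :(Tree -> Tree) -> Tree -> Tree -> Tree
 rmapTree f leaf acc = acc
 rmapTree f(node h t)acc = rmapTree f t(node(f h)acc)

 caseTree : Tree -> Tree ->(Tree -> Tree -> Tree) -> Tree
 caseTree leaf a f = a
 caseTree(node l r)a f = f l r

 eval : ∀ {n} -> Exp n ->(Fin n -> Tree) -> Tree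
 eval(var i)γ = γ i
 eval lf γ = leaf
 eval(nd a b)γ = node(eval a γ)(eval b γ)
 eval(cs s a b)γ = caseTree(eval s γ)(eval a γ)(λ l r -> eval b(l ▹ r ▹ γ))
 eval(lt a b)γ = eval b(eval a γ ▹ γ)
 eval(rn ρ e)γ = eval e(γ ∘ ρ)
 eval(fold l i b f)γ = foldTree (λ h acc -> eval f(h ▹ acc ▹ γ))(eval b γ)(eval l γ)(eval i γ)
 eval(rmap l f)γ = rmapTree (λ h -> eval f(h ▹ γ))(eval l γ)leaf

 sp : ∀ {n} -> Exp n -> Poly
 sp(var i) = X
 sp lf = con 1
 sp(nd a b) = con 1 ⊕ (sp a ⊕ sp b)
 sp(cs s a b) = sp a ⊕ sp b ⊚ (X ⊕ sp s)
 sp(lt a b) = sp b ⊚ (X ⊕ sp a)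
 sp(rn ρ e) = sp e
 sp(fold l i b f) = sp i ⊕ sp b
 sp(rmap l f) = con 1 ⊕ sp l ⊗ (con 1 ⊕ sp f ⊚ (X ⊕ sp l))

 Below : ∀ {n} ->(Fin n -> Tree) -> ℕ -> Set
 Below γ N = ∀ i -> size(γ i)≤ N

 below-▹ : ∀ {n t}{γ : Fin n -> Tree}{N} -> size t ≤ N -> Below γ N -> Below(t ▹ γ)N
 below-▹ h b zero = h
 below-▹ h b(suc i) = b i

 below-weak : ∀ {n}{γ : Fin n -> Tree}{M N} -> M ≤ N -> Below γ M -> Below γ N
 below-weak le b i = b i << le

 clip-size : ∀ bnd acc r {M} -> size acc ≤ M -> size bnd ≤ M -> size(clip bnd acc r)≤ M
 clip-size bnd acc r ha hb with leb(size r)(size bnd) in eq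
 ... | true = leb-sound _ _ eq << hb
 ... | false = ha

 foldTree-size : ∀ f bnd t acc {M} -> size acc ≤ M -> size bnd ≤ M -> size(foldTree f bnd t acc)≤ M
 foldTree-size f bnd leaf acc ha hb = ha
 foldTree-size f bnd(node h t)acc ha hb = foldTree-size f bnd t _ (clip-size bnd acc(f h acc)ha hb)hb

 rmapTree-size : ∀ f t acc {L F} -> size t ≤ L ->(∀ h -> size h ≤ L -> size(f h)≤ F) ->
  size(rmapTree f t acc)≤ size acc + size t *(1 + F)
 rmapTree-size f leaf acc ht hf = m≤m+n _ _
 rmapTree-size f(node h t)acc {L}{F}ht hf = rmapTree-size f t _ ((m≤n+m _ _ << n≤1+n _)<< ht)hf <<
  +-monoˡ-≤ _ (s≤s(+-monoˡ-≤(size acc)(hf h((m≤m+n _ _ << n≤1+n _)<< ht))))<<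
  ≤-by(size h *(1 + F))(eq F(size acc)(size t)(size h)) where
  eq : ∀ f a t h -> suc(f + a)+ t *(1 + f)+ h *(1 + f)≡ a + suc(h + t)*(1 + f)
  eq = ring

 ev-size : ∀ {n}(e : Exp n)γ {N} -> Below γ N -> size(eval e γ)≤ ⟦ sp e ⟧ N
 ev-size(var i)γ b = b i
 ev-size lf γ b = ≤-refl
 ev-size(nd x y)γ b = s≤s(+-mono-≤(ev-size x γ b)(ev-size y γ b))
 ev-size(cs s x y)γ {N}b with eval s γ | ev-size s γ b
 ... | leaf | h = ev-size x γ b << m≤m+n _ _
 ... | node l r | h = ev-size y(l ▹ r ▹ γ)
  (below-▹((m≤m+n(size l)(size r)<< n≤1+n _)<< h')
  (below-▹((m≤n+m(size r)(size l)<< n≤1+n _)<< h')(below-weak(m≤m+n N _)b)))<< m≤n+m _ (⟦ sp x ⟧ N)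
  where h' = h << m≤n+m _ N
 ev-size(lt x y)γ {N}b = ev-size y _ (below-▹(ev-size x γ b << m≤n+m _ N)(below-weak(m≤m+n N _)b))
 ev-size(rn ρ e)γ b = ev-size e(γ ∘ ρ)(b ∘ ρ)
 ev-size(fold l i x f)γ b =
  foldTree-size _ _ (eval l γ)(eval i γ)(ev-size i γ b << m≤m+n _ _)(ev-size x γ b << m≤n+m _ _)
 ev-size(rmap l f)γ {N}b = ≤-trans
  (rmapTree-size (λ h -> eval f(h ▹ γ))(eval l γ)leaf {⟦ sp l ⟧ N}(ev-size l γ b)
   (λ h hh -> ev-size f(h ▹ γ){N + ⟦ sp l ⟧ N}(below-▹(hh << m≤n+m _ N)(below-weak(m≤m+n N _)b))))
  (s≤s(*-monoˡ-≤ _ (ev-size l γ b)))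

 overflow : Stack -> Stack -> Stack -> Stack
 overflow [] ys c = c
 overflow(x ∷ xs)[] c = overflow xs [] (sep ∷ c)
 overflow(x ∷ xs)(y ∷ ys)c = overflow xs ys c

 leftover : Stack -> Stack -> Stack
 leftover [] ys = ys
 leftover(x ∷ xs)[] = leftover xs []
 leftover(x ∷ xs)(y ∷ ys) = leftover xs ys

 overflow-leb : ∀ xs ys -> nonEmpty(top(overflow xs ys []))≡ not(leb(length xs)(length ys))
 overflow-leb [] ys = refl
 overflow-leb(x ∷ xs)[] = go xs [] where
  go : ∀ xs c -> nonEmpty(top(overflow xs [] (sep ∷ c)))≡ true
  go [] c = refl
  go(x ∷ xs)c = go xs(sep ∷ c)
 overflow-leb(x ∷ xs)(y ∷ ys) = overflow-leb xs ys

 overflow-length : ∀ xs ys c -> length(overflow xs ys c)≤ length xs + length c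
 overflow-length [] ys c = ≤-refl
 overflow-length(x ∷ xs)[] c = overflow-length xs [] _ <= +-suc(length xs)(length c)
 overflow-length(x ∷ xs)(y ∷ ys)c = overflow-length xs ys c << n≤1+n _

 leftover-length : ∀ xs ys -> length(leftover xs ys)≤ length ys
 leftover-length [] ys = ≤-refl
 leftover-length(x ∷ xs)[] = leftover-length xs []
 leftover-length(x ∷ xs)(y ∷ ys) = leftover-length xs ys << n≤1+n _

 rser-length : ∀ t a -> length(rser t a)≡ size t + length a
 rser-length leaf a = refl
 rser-length(node l r)a = rser-length r _ == cong(size r +_)(rser-length l _)== eq(size l)(size r)(length a) where
  eq : ∀ l r a -> r +(l + suc a)≡ suc(l + r)+ a
  eq = ring

 cmpLoop : Prog
 cmpLoop = loop iR nonEmpty(pull iR ⨾ ifp iA nonEmpty(pull iA)(push iC sep))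

 cmpLoop-runs : ∀ xs ys {io s c} -> Runs cmpLoop(io ∷ s ∷ ys ∷ xs ∷ c ∷ [])(5 * length xs + 1)
  (io ∷ s ∷ leftover xs ys ∷ [] ∷ overflow xs ys c ∷ [])
 cmpLoop-runs [] ys = r-stop refl
 cmpLoop-runs(x ∷ xs)[] = r-weak(≤-reflexive(eq(length xs)))(r-step refl(r-seq r-pull(r-else refl r-push))(cmpLoop-runs xs [])) where
  eq : ∀ n -> suc(1 + 3 +(5 * n + 1))≡ 5 * suc n + 1
  eq = ring
 cmpLoop-runs(x ∷ xs)(y ∷ ys) = r-weak(≤-by 1(eq(length xs)))(r-step refl(r-seq r-pull(r-then refl r-pull))(cmpLoop-runs xs ys)) where
  eq : ∀ n -> suc(1 + 2 +(5 * n + 1))+ 1 ≡ 5 * suc n + 1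
  eq = ring

 clear : Fin 5 -> Prog
 clear i = loop i nonEmpty(pull i)

 clearA-runs : ∀ xs {io s r c} -> Runs(clear iA)(io ∷ s ∷ xs ∷ r ∷ c ∷ [])(2 * length xs + 1)(io ∷ s ∷ [] ∷ r ∷ c ∷ [])
 clearA-runs [] = r-stop refl
 clearA-runs(x ∷ xs) = r-weak(≤-reflexive(eq(length xs)))(r-step refl r-pull(clearA-runs xs)) where
  eq : ∀ n -> suc(1 +(2 * n + 1))≡ 2 * suc n + 1
  eq = ring

 clearC-runs : ∀ xs {io s a r} -> Runs(clear iC)(io ∷ s ∷ a ∷ r ∷ xs ∷ [])(2 * length xs + 1)(io ∷ s ∷ a ∷ r ∷ [] ∷ [])
 clearC-runs [] = r-stop refl
 clearC-runs(x ∷ xs) = r-weak(≤-reflexive(eq(length xs)))(r-step refl r-pull(clearC-runs xs)) where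
  eq : ∀ n -> suc(1 +(2 * n + 1))≡ 2 * suc n + 1
  eq = ring

 choose : Prog -> Prog -> Prog
 choose p q = scan toA ⨾ scan toR ⨾ cmpLoop ⨾ clear iA ⨾ ifp iC nonEmpty(clear iC ⨾ q)p

 choose-runs : ∀ p q b r {σ io k m} -> Runs(if leb(size r)(size b) then p else q)(mem io σ)k m ->
  Runs(choose p q)(mem io(b ∷ r ∷ σ))(14 * size b + 19 * size r + 4 + k)m
 choose-runs p q b r {σ}{io}{k}{m}h =
  r-weak cost(r-seq(retarget(cong (λ z -> io ∷ ser r(sers σ [])∷ rser b [] ∷ z ∷ [] ∷ [])(out-const b []))(scan-runs toA b))
   (r-seq(retarget(cong (λ z -> io ∷ sers σ [] ∷ z ∷ rser r [] ∷ [] ∷ [])(out-const r(rser b [])))(scan-runs toR r))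
   (r-seq(cmpLoop-runs xs ys)
   (r-seq(clearA-runs(leftover xs ys))branch)))) where
  xs = rser r []
  ys = rser b []
  len : ∀ t -> length(rser t [])≡ size t
  len t = rser-length t [] == +-identityʳ(size t)
  branch : Runs(ifp iC nonEmpty(clear iC ⨾ q)p)(io ∷ sers σ [] ∷ [] ∷ [] ∷ overflow xs ys [] ∷ [])(2 * size r + 2 + k)m
  branch with overflow-leb xs ys | overflow-length xs ys []
  ... | e | o rewrite len r | len b with leb(size r)(size b) | overflow xs ys []
  branch | e | o | true | [] = r-weak(≤-by(2 * size r + 1)(eq(size r)k))(r-else refl h) where
   eq : ∀ r k -> suc k +(2 * r + 1)≡ 2 * r + 2 + k
   eq = ring
  branch | e | o | false | z ∷ zs = r-weak(s≤s(+-monoˡ-≤ k(+-monoˡ-≤ 1(*-monoʳ-≤ 2 o)))<= eq(size r)k)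
   (r-then refl(r-seq(clearC-runs(z ∷ zs))h)) where
   eq : ∀ r k -> suc(2 *(r + 0)+ 1 + k)≡ 2 * r + 2 + k
   eq = ring
  cost = +-monoʳ-≤(12 * size b)(+-monoʳ-≤(12 * size r)(+-monoʳ-≤(5 * length xs + 1)(+-monoˡ-≤ _ (+-monoˡ-≤ 1(*-monoʳ-≤ 2(leftover-length xs ys))))))<=
   cong₂ (λ x y -> 12 * size b +(12 * size r +(5 * x + 1 +(2 * y + 1 +(2 * size r + 2 + k)))))(len r)(len b)==
   eq(size b)(size r)k where
   eq : ∀ b r k -> 12 * b +(12 * r +(5 * r + 1 +(2 * b + 1 +(2 * r + 2 + k))))≡ 14 * b + 19 * r + 4 + k
   eq = ring

 shift : ∀ {n} -> ℕ ->(Fin n -> ℕ) -> Fin n -> ℕ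
 shift k ρ i = k + ρ i

 foldρ : ∀ {n} ->(Fin n -> ℕ) -> Fin(2 + n) -> ℕ
 foldρ ρ = 0 ▹ 2 ▹ shift 4 ρ

 rmapρ : ∀ {n} ->(Fin n -> ℕ) -> Fin(1 + n) -> ℕ
 rmapρ ρ = 0 ▹ shift 3 ρ

 foldUpdate rmapUpdate : Prog
 foldUpdate = pick 0 ⨾ pick 5 ⨾ choose(pick 4 ⨾ pick 1 ⨾ pick 4 ⨾ nip 3 5)(pick 4 ⨾ pick 4 ⨾ pick 4 ⨾ nip 3 5)
 rmapUpdate = pick 3 ⨾ pick 1 ⨾ push iS nd' ⨾ pick 3 ⨾ nip 2 4

 compile : ∀ {n} -> Exp n ->(Fin n -> ℕ) -> Prog
 compile(var i)ρ = pick(ρ i)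
 compile lf ρ = push iS lf'
 compile(nd a b)ρ = compile b ρ ⨾ compile a(shift 1 ρ) ⨾ push iS nd'
 compile(cs s a b)ρ = compile s ρ ⨾ ifp iS isNode(pull iS ⨾ compile b(0 ▹ 1 ▹ shift 2 ρ) ⨾ nip 1 2)(pull iS ⨾ compile a ρ)
 compile(lt a b)ρ = compile a ρ ⨾ compile b(0 ▹ shift 1 ρ) ⨾ nip 1 1
 compile(rn τ e)ρ = compile e(ρ ∘ τ)
 compile(fold l i b f)ρ = compile b ρ ⨾ compile i(shift 1 ρ) ⨾ compile l(shift 2 ρ) ⨾
  loop iS isNode(pull iS ⨾ compile f(foldρ ρ) ⨾ foldUpdate) ⨾ pull iS ⨾ nip 1 1
 compile(rmap l f)ρ = push iS lf' ⨾ compile l(shift 1 ρ) ⨾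
  loop iS isNode(pull iS ⨾ compile f(rmapρ ρ) ⨾ rmapUpdate) ⨾ pull iS

 Locates : ∀ {n} ->(Fin n -> ℕ) ->(Fin n -> Tree) -> List Tree -> Set
 Locates ρ γ σ = ∀ i -> At(ρ i)σ(γ i)

 loc-shift : ∀ {n}{ρ : Fin n -> ℕ}{γ σ}us -> Locates ρ γ σ -> Locates(shift(length us)ρ)γ(us ++ σ)
 loc-shift [] h i = h i
 loc-shift(u ∷ us)h i = there(loc-shift us h i)

 loc-▹ : ∀ {n}{ρ : Fin n -> ℕ}{γ σ j t} -> At j σ t -> Locates ρ γ σ -> Locates(j ▹ ρ)(t ▹ γ)σ
 loc-▹ a h zero = a
 loc-▹ a h(suc i) = h i

 loc-below : ∀ {n}{ρ : Fin n -> ℕ}{γ σ W} -> Locates ρ γ σ -> weight σ ≤ W -> Below γ W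
 loc-below h w i = at-size(h i)<< w

 tp : ∀ {n} -> Exp n -> Poly
 tp(var i) = con 24 ⊗ X
 tp lf = con 2
 tp(nd a b) = tp b ⊕ (tp a ⊚ (sp b ⊕ X) ⊕ con 2)
 tp(cs s a b) = tp s ⊕ (con 2 ⊕ (tp a ⊕ (tp b ⊚ V ⊕ (con 17 ⊗ (sp b ⊚ V ⊕ V) ⊕ con 1))))
  where V = sp s ⊕ X
 tp(lt a b) = tp a ⊕ (tp b ⊚ V ⊕ (con 17 ⊗ (sp b ⊚ V ⊕ V) ⊕ con 1))
  where V = sp a ⊕ X
 tp(rn τ e) = tp e
 tp(fold l i b f) = tp b ⊕ (tp i ⊚ (sp b ⊕ X) ⊕ (tp l ⊚ (sp i ⊕ (sp b ⊕ X)) ⊕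
  ((sp l ⊗ (tp f ⊚ V ⊕ con 400 ⊗ (con 1 ⊕ (sp f ⊚ V ⊕ V))) ⊕ con 1) ⊕ (con 1 ⊕ (con 17 ⊗ V ⊕ con 1)))))
  where V = sp l ⊕ ((sp i ⊕ sp b) ⊕ (sp b ⊕ X))
 tp(rmap l f) = con 2 ⊕ (tp l ⊚ (con 1 ⊕ X) ⊕ ((sp l ⊗ (tp f ⊚ V ⊕ con 400 ⊗ (con 1 ⊕ (sp f ⊚ V ⊕ V))) ⊕ con 1) ⊕ con 1))
  where V = sp l ⊕ (sp(rmap l f) ⊕ X)

 pick' : ∀ σ {j t io w} -> At j σ t -> weight σ ≤ w -> Runs(pick j)(mem io σ)(24 * w)(mem io(t ∷ σ))
 pick' σ a h = r-weak(*-monoʳ-≤ 24 h)(pick-runs a)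

 nip' : ∀ ts us σ {io w} -> weight(ts ++ us)≤ w -> Runs(nip(length ts)(length us))(mem io(ts ++ us ++ σ))(17 * w + 1)(mem io(ts ++ σ))
 nip' ts us σ h = r-weak(+-monoˡ-≤ 1(*-monoʳ-≤ 17 h))(nip-runs ts us)

 more : ∀ t σ {U}k -> size t ≤ U -> weight σ ≤ k * U -> weight(t ∷ σ)≤ suc k * U
 more t σ k h w = +-mono-≤ h w

 foldUpdate-runs : ∀ r h t acc bnd σ {io U} -> weight(r ∷ h ∷ t ∷ acc ∷ bnd ∷ σ)≤ U ->
  Runs foldUpdate(mem io(r ∷ h ∷ t ∷ acc ∷ bnd ∷ σ))(350 * U + 5)(mem io(t ∷ clip bnd acc r ∷ bnd ∷ σ))
 foldUpdate-runs r h t acc bnd σ {io}{U}w = r-weak(+-monoʳ-≤(24 *(1 * U))(+-monoʳ-≤(24 *(2 * U))(+-monoˡ-≤ k(+-monoˡ-≤ 4(+-mono-≤(*-monoʳ-≤ 14 bU)(*-monoʳ-≤ 19 rU)))))<<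
  ≤-by(33 * U)(eq U))
  (r-seq(pick' τ here w1)(r-seq(pick'(r ∷ τ)(there(there(there(there(there here)))))w2)(choose-runs _ _ bnd r {τ}branch))) where
  τ = r ∷ h ∷ t ∷ acc ∷ bnd ∷ σ
  k = 24 *(1 * U)+(24 *(2 * U)+(24 *(3 * U)+(17 *(3 * U + 1 * U)+ 1)))
  eq : ∀ U -> 24 *(1 * U)+(24 *(2 * U)+(14 * U + 19 * U + 4 +(24 *(1 * U)+(24 *(2 * U)+(24 *(3 * U)+(17 *(3 * U + 1 * U)+ 1))))))+ 33 * U ≡ 350 * U + 5
  eq = ring
  w1 = w <= sym(+-identityʳ U)
  sz : ∀ {j u} -> At j τ u -> size u ≤ U
  sz a = at-size a << w
  rU = sz here
  tU = sz(there(there here))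
  aU = sz(there(there(there here)))
  bU = sz(there(there(there(there here))))
  w2 = more r τ 1 rU w1
  old =(m≤m+n _ (weight σ)<= eqσ(size r)(size h)(size t)(size acc)(size bnd)(weight σ))<< w1 where
   eqσ : ∀ a b c d e w ->(a +(b +(c +(d +(e + 0)))))+ w ≡ a +(b +(c +(d +(e + w))))
   eqσ = ring
  nip'' : ∀ x -> size x ≤ U -> Runs(nip 3 5)(mem io(t ∷ x ∷ bnd ∷ τ))(17 *(3 * U + 1 * U)+ 1)(mem io(t ∷ x ∷ bnd ∷ σ))
  nip'' x xU = nip'(t ∷ x ∷ bnd ∷ [])(r ∷ h ∷ t ∷ acc ∷ bnd ∷ [])σ
   (weight-++(t ∷ x ∷ bnd ∷ [])(r ∷ h ∷ t ∷ acc ∷ bnd ∷ [])=< +-mono-≤(more t(x ∷ bnd ∷ [])2 tU(more x(bnd ∷ [])1 xU(more bnd [] 0 bU z≤n)))old)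
  branch : Runs(if leb(size r)(size bnd) then (pick 4 ⨾ pick 1 ⨾ pick 4 ⨾ nip 3 5) else (pick 4 ⨾ pick 4 ⨾ pick 4 ⨾ nip 3 5))
   (mem io τ)k(mem io(t ∷ clip bnd acc r ∷ bnd ∷ σ))
  branch with leb(size r)(size bnd)
  ... | true = r-seq(pick' τ(there(there(there(there here))))w1)(r-seq(pick'(bnd ∷ τ)(there here)(more bnd τ 1 bU w1))
   (r-seq(pick'(r ∷ bnd ∷ τ)(there(there(there(there here))))(more r(bnd ∷ τ)2 rU(more bnd τ 1 bU w1)))(nip'' r rU)))
  ... | false = r-seq(pick' τ(there(there(there(there here))))w1)(r-seq(pick'(bnd ∷ τ)(there(there(there(there here))))(more bnd τ 1 bU w1))
   (r-seq(pick'(acc ∷ bnd ∷ τ)(there(there(there(there here))))(more acc(bnd ∷ τ)2 aU(more bnd τ 1 bU w1)))(nip'' acc aU)))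

 rmapUpdate-runs : ∀ r h t acc σ {io U} -> weight(r ∷ h ∷ t ∷ acc ∷ σ)≤ U ->
  Runs rmapUpdate(mem io(r ∷ h ∷ t ∷ acc ∷ σ))(350 * U + 5)(mem io(t ∷ node r acc ∷ σ))
 rmapUpdate-runs r h t acc σ {io}{U}w = r-weak(≤-by(97 * U + 2)(eq U))
  (r-seq(pick' τ(there(there(there here)))w1)(r-seq(pick'(acc ∷ τ)(there here)(more acc τ 1 aU w1))
  (r-seq r-push(r-seq(pick'(node r acc ∷ τ)(there(there(there here)))w4)(nip'(t ∷ node r acc ∷ [])(r ∷ h ∷ t ∷ acc ∷ [])σ
   (weight-++(t ∷ node r acc ∷ [])(r ∷ h ∷ t ∷ acc ∷ [])=< +-mono-≤(+-mono-≤ tU(+-identityʳ _ =< nU))old)))))) where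
  τ = r ∷ h ∷ t ∷ acc ∷ σ
  eq : ∀ U -> 24 *(1 * U)+(24 *(2 * U)+(2 +(24 *(4 * U)+(17 *(4 * U + 1 * U)+ 1))))+(97 * U + 2)≡ 350 * U + 5
  eq = ring
  w1 = w <= sym(+-identityʳ U)
  sz : ∀ {j u} -> At j τ u -> size u ≤ U
  sz a = at-size a << w
  aU = sz(there(there(there here)))
  tU = sz(there(there here))
  rU = sz here
  nU = +-mono-≤(1≤size r << rU)(+-mono-≤ rU aU)<= eq' U where
   eq' : ∀ U -> U +(U + U)≡ 3 * U
   eq' = ring
  w4 = +-mono-≤ nU w1 <= eq' U where
   eq' : ∀ U -> 3 * U + 1 * U ≡ 4 * U
   eq' = ring
  old =(m≤m+n _ (weight σ)<= eqσ(size r)(size h)(size t)(size acc)(weight σ))<< w1 where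
   eqσ : ∀ a b c d w ->(a +(b +(c +(d + 0))))+ w ≡ a +(b +(c +(d + w)))
   eqσ = ring

 module _ {io : Stack} where

  foldLoop : ∀ {n}(f : Exp(2 + n))(ρ : Fin n -> ℕ)(γ : Fin n -> Tree)bnd σ {L M W} ->
   (∀ h t acc -> size h + size t ≤ L -> size acc ≤ M -> let V = L +(M + W) in
    Runs(compile f(foldρ ρ))(mem io(h ∷ t ∷ acc ∷ bnd ∷ σ))(⟦ tp f ⟧ V)(mem io(eval f(h ▹ acc ▹ γ)∷ h ∷ t ∷ acc ∷ bnd ∷ σ))
    × size(eval f(h ▹ acc ▹ γ))≤ ⟦ sp f ⟧ V) ->
   size bnd ≤ M -> weight(bnd ∷ σ)≤ W -> ∀ t acc -> size t ≤ L -> size acc ≤ M ->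
   let V = L +(M + W); K = ⟦ tp f ⟧ V + 400 *(1 +(⟦ sp f ⟧ V + V)) in
   Runs(loop iS isNode(pull iS ⨾ compile f(foldρ ρ) ⨾ foldUpdate))(mem io(t ∷ acc ∷ bnd ∷ σ))(size t * K + 1)
    (mem io(leaf ∷ foldTree (λ h acc -> eval f(h ▹ acc ▹ γ))bnd t acc ∷ bnd ∷ σ))
  foldLoop f ρ γ bnd σ hf hb hw leaf acc ht ha = r-weak(m≤n+m 1 _)(r-stop refl)
  foldLoop f ρ γ bnd σ {L}{M}{W}hf hb hw(node h t)acc ht ha =
   r-weak cost(r-step refl(r-seq r-pull(r-seq(proj₁ body)(foldUpdate-runs r h t acc bnd σ(+-mono-≤(proj₂ body)(sym(+-assoc(size h)(size t)_)=< +-mono-≤ ht'(+-mono-≤ ha hw))))))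
    (foldLoop f ρ γ bnd σ hf hb hw t _ (m≤n+m(size t)(size h)<< ht')(clip-size bnd acc r ha hb))) where
   V = L +(M + W)
   Fs = ⟦ sp f ⟧ V
   Ft = ⟦ tp f ⟧ V
   U = Fs + V
   K = Ft + 400 *(1 + U)
   ht' = n≤1+n _ << ht
   body = hf h t acc ht' ha
   r = eval f(h ▹ acc ▹ γ)
   cost = ≤-by(50 * U + 393 + size h * K)(eq Ft U(size t)(size h)) where
    eq : ∀ F U t h -> suc((1 +(F +(350 * U + 5)))+(t *(F + 400 *(1 + U))+ 1))+(50 * U + 393 + h *(F + 400 *(1 + U)))≡ suc(h + t)*(F + 400 *(1 + U))+ 1
    eq = ring

  rmapLoop : ∀ {n}(f : Exp(1 + n))(ρ : Fin n -> ℕ)(γ : Fin n -> Tree)σ {L M W} ->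
   (∀ h t acc -> size h + size t ≤ L -> size acc ≤ M -> let V = L +(M + W) in
    Runs(compile f(rmapρ ρ))(mem io(h ∷ t ∷ acc ∷ σ))(⟦ tp f ⟧ V)(mem io(eval f(h ▹ γ)∷ h ∷ t ∷ acc ∷ σ))
    × size(eval f(h ▹ γ))≤ ⟦ sp f ⟧ V) ->
   weight σ ≤ W -> ∀ {F} ->(∀ h -> size h ≤ L -> size(eval f(h ▹ γ))≤ F) ->
   ∀ t acc -> size t ≤ L -> size acc + size t *(1 + F)≤ M ->
   let V = L +(M + W); K = ⟦ tp f ⟧ V + 400 *(1 +(⟦ sp f ⟧ V + V)) in
   Runs(loop iS isNode(pull iS ⨾ compile f(rmapρ ρ) ⨾ rmapUpdate))(mem io(t ∷ acc ∷ σ))(size t * K + 1)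
    (mem io(leaf ∷ rmapTree (λ h -> eval f(h ▹ γ))t acc ∷ σ))
  rmapLoop f ρ γ σ hf hw hF leaf acc ht ha = r-weak(m≤n+m 1 _)(r-stop refl)
  rmapLoop f ρ γ σ {L}{M}{W}hf hw {F}hF(node h t)acc ht ha =
   r-weak cost(r-step refl(r-seq r-pull(r-seq(proj₁ body)(rmapUpdate-runs r h t acc σ wU)))
    (rmapLoop f ρ γ σ hf hw hF t _ (m≤n+m(size t)(size h)<< ht')ha')) where
   V = L +(M + W)
   Fs = ⟦ sp f ⟧ V
   Ft = ⟦ tp f ⟧ V
   U = Fs + V
   K = Ft + 400 *(1 + U)
   ht' = n≤1+n _ << ht
   body = hf h t acc ht'(m≤m+n _ _ << ha)
   r = eval f(h ▹ γ)
   ha' = +-monoˡ-≤(size t *(1 + F))(s≤s(+-monoˡ-≤(size acc)(hF h(m≤m+n(size h)(size t)<< ht'))))<<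
    ≤-by(size h *(1 + F))(eq F(size acc)(size t)(size h))<< ha where
    eq : ∀ f a t h -> suc(f + a)+ t *(1 + f)+ h *(1 + f)≡ a + suc(h + t)*(1 + f)
    eq = ring
   wU = +-mono-≤(proj₂ body)(sym(+-assoc(size h)(size t)_)=< +-mono-≤ ht'(+-mono-≤(m≤m+n _ _ << ha)hw))
   cost = ≤-by(50 * U + 393 + size h * K)(eq Ft U(size t)(size h)) where
    eq : ∀ F U t h -> suc((1 +(F +(350 * U + 5)))+(t *(F + 400 *(1 + U))+ 1))+(50 * U + 393 + h *(F + 400 *(1 + U)))≡ suc(h + t)*(F + 400 *(1 + U))+ 1
    eq = ring

  runs-ok : ∀ {n}(e : Exp n)(ρ : Fin n -> ℕ)(γ : Fin n -> Tree){σ W} -> Locates ρ γ σ -> weight σ ≤ W ->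
   Runs(compile e ρ)(mem io σ)(⟦ tp e ⟧ W)(mem io(eval e γ ∷ σ))

  scoped-runs : ∀ {n}(e : Exp n)(ρ : Fin n -> ℕ)(γ : Fin n -> Tree)us {σ V} -> Locates ρ γ(us ++ σ) -> weight(us ++ σ)≤ V ->
   Runs(compile e ρ ⨾ nip 1(length us))(mem io(us ++ σ))(⟦ tp e ⟧ V +(17 *(⟦ sp e ⟧ V + V)+ 1))(mem io(eval e γ ∷ σ))
  scoped-runs e ρ γ us {σ}{V}h w = r-seq(runs-ok e ρ γ h w)(nip'(eval e γ ∷ [])us σ
   (+-mono-≤(ev-size e γ(loc-below h w))((m≤m+n(weight us)(weight σ)<= sym(weight-++ us σ))<< w)))

  runs-ok(var i)ρ γ {σ}h w = pick' σ(h i)w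
  runs-ok lf ρ γ h w = r-push
  runs-ok(nd a b)ρ γ {σ}{W}h w =
   r-seq(runs-ok b ρ γ h w)
   (r-seq(runs-ok a(shift 1 ρ)γ(loc-shift(eval b γ ∷ [])h)(+-mono-≤(ev-size b γ(loc-below h w))w))r-push)
  runs-ok(cs s a b)ρ γ {σ}{W}h w = r-seq(runs-ok s ρ γ h w)(branch(eval s γ)(ev-size s γ(loc-below h w))) where
   V = ⟦ sp s ⟧ W + W
   branch : ∀ t -> size t ≤ ⟦ sp s ⟧ W ->
    Runs(ifp iS isNode(pull iS ⨾ compile b(0 ▹ 1 ▹ shift 2 ρ) ⨾ nip 1 2)(pull iS ⨾ compile a ρ))(mem io(t ∷ σ))
     (2 +(⟦ tp a ⟧ W +(⟦ tp b ⟧ V +(17 *(⟦ sp b ⟧ V + V)+ 1))))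
     (mem io(caseTree t(eval a γ)(λ l r -> eval b(l ▹ r ▹ γ))∷ σ))
   branch leaf ht = r-weak(s≤s(s≤s(m≤m+n(⟦ tp a ⟧ W)_)))(r-else refl(r-seq r-pull(runs-ok a ρ γ h w)))
   branch(node l r)ht = r-weak(s≤s(s≤s(m≤n+m _ (⟦ tp a ⟧ W))))(r-then refl(r-seq r-pull
    (scoped-runs b(0 ▹ 1 ▹ shift 2 ρ)(l ▹ r ▹ γ)(l ∷ r ∷ []){σ}(loc-▹ here(loc-▹(there here)(loc-shift(l ∷ r ∷ [])h)))
     (sym(+-assoc(size l)(size r)_)=< +-mono-≤(n≤1+n _ << ht)w))))
  runs-ok(lt a b)ρ γ h w =
   r-seq(runs-ok a ρ γ h w)
    (scoped-runs b(0 ▹ shift 1 ρ)(eval a γ ▹ γ)(eval a γ ∷ [])(loc-▹ here(loc-shift(eval a γ ∷ [])h))(+-mono-≤(ev-size a γ(loc-below h w))w))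
  runs-ok(rn τ e)ρ γ h w = runs-ok e(ρ ∘ τ)(γ ∘ τ)(h ∘ τ)w
  runs-ok(fold l i b f)ρ γ {σ}{W}h w =
   r-seq(runs-ok b ρ γ h w)
   (r-seq(runs-ok i(shift 1 ρ)γ(loc-shift(B ∷ [])h)wb)
   (r-seq(runs-ok l(shift 2 ρ)γ(loc-shift(I ∷ B ∷ [])h)(+-mono-≤(ev-size i γ below)wb))
   (r-seq(r-weak(+-monoˡ-≤ 1(*-monoˡ-≤ _ (ev-size l γ below)))
    (foldLoop f ρ γ B σ {⟦ sp l ⟧ W}{⟦ sp i ⟧ W + ⟦ sp b ⟧ W}{⟦ sp b ⟧ W + W}body
     (ev-size b γ below << m≤n+m _ _)wb(eval l γ)I(ev-size l γ below)(ev-size i γ below << m≤m+n _ _)))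
   (r-seq r-pull(nip'(res ∷ [])(B ∷ [])σ wres))))) where
   B = eval b γ
   I = eval i γ
   below = loc-below h w
   wb = +-mono-≤(ev-size b γ below)w
   M = ⟦ sp i ⟧ W + ⟦ sp b ⟧ W
   V = ⟦ sp l ⟧ W +(M +(⟦ sp b ⟧ W + W))
   body : ∀ x t acc -> size x + size t ≤ ⟦ sp l ⟧ W -> size acc ≤ M ->
    Runs(compile f(foldρ ρ))(mem io(x ∷ t ∷ acc ∷ B ∷ σ))(⟦ tp f ⟧ V)(mem io(eval f(x ▹ acc ▹ γ)∷ x ∷ t ∷ acc ∷ B ∷ σ))
    × size(eval f(x ▹ acc ▹ γ))≤ ⟦ sp f ⟧ V
   body x t acc hx ha = runs-ok f(foldρ ρ)(x ▹ acc ▹ γ)loc wV , ev-size f _ (loc-below loc wV) where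
    loc = loc-▹ here(loc-▹(there(there here))(loc-shift(x ∷ t ∷ acc ∷ B ∷ [])h))
    wV = sym(+-assoc(size x)(size t)_)=< +-mono-≤ hx(+-mono-≤ ha wb)
   res = foldTree (λ h acc -> eval f(h ▹ acc ▹ γ))B(eval l γ)I
   wres = +-mono-≤(ev-size(fold l i b f)γ below)(+-identityʳ(size B)=< ev-size b γ below << m≤m+n(⟦ sp b ⟧ W)W)<<
    m≤n+m _ (⟦ sp l ⟧ W)
  runs-ok(rmap l f)ρ γ {σ}{W}h w =
   r-seq r-push
   (r-seq(runs-ok l(shift 1 ρ)γ(loc-shift(leaf ∷ [])h)(s≤s w))
   (r-seq(r-weak(+-monoˡ-≤ 1(*-monoˡ-≤ _ (ev-size l γ below)))
    (rmapLoop f ρ γ σ {⟦ sp l ⟧ W}{⟦ sp(rmap l f) ⟧ W}{W}body w {⟦ sp f ⟧ (W + ⟦ sp l ⟧ W)}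
     (λ x hx -> ev-size f(x ▹ γ)(below-▹(hx << m≤n+m _ W)(below-weak(m≤m+n W _)below)))
     (eval l γ)leaf(ev-size l γ below)(s≤s(*-monoˡ-≤ _ (ev-size l γ below)))))
    r-pull)) where
   below = loc-below h w
   M = ⟦ sp(rmap l f) ⟧ W
   V = ⟦ sp l ⟧ W +(M + W)
   body : ∀ x t acc -> size x + size t ≤ ⟦ sp l ⟧ W -> size acc ≤ M ->
    Runs(compile f(rmapρ ρ))(mem io(x ∷ t ∷ acc ∷ σ))(⟦ tp f ⟧ V)(mem io(eval f(x ▹ γ)∷ x ∷ t ∷ acc ∷ σ))
    × size(eval f(x ▹ γ))≤ ⟦ sp f ⟧ V
   body x t acc hx ha = runs-ok f(rmapρ ρ)(x ▹ γ)loc wV , ev-size f _ (loc-below loc wV) where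
    loc = loc-▹ here(loc-shift(x ∷ t ∷ acc ∷ [])h)
    wV = sym(+-assoc(size x)(size t)_)=< +-mono-≤ hx(+-mono-≤ ha w)

 open import Data.Digit using (0b; 1b)
 open import Data.List.Base using (_ʳ++_)

 letterTree : Letter -> Tree
 letterTree sep = leaf
 letterTree(bit zero) = node leaf leaf
 letterTree(bit(suc _)) = node(node leaf leaf)leaf

 inputTree : List Letter -> Tree
 inputTree [] = leaf
 inputTree(x ∷ xs) = node(letterTree x)(inputTree xs)

 outLetter : Tree -> Letter
 outLetter leaf = sep
 outLetter(node leaf _) = bit 0b
 outLetter(node(node _ _)_) = bit 1b

 outLetters : Tree -> List Letter
 outLetters leaf = []
 outLetters(node h t) = outLetter h ∷ outLetters t

 outLetter-letterTree : ∀ x -> outLetter(letterTree x)≡ x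
 outLetter-letterTree sep = refl
 outLetter-letterTree(bit zero) = refl
 outLetter-letterTree(bit(suc zero)) = refl

 outLetters-inputTree : ∀ xs -> outLetters(inputTree xs)≡ xs
 outLetters-inputTree [] = refl
 outLetters-inputTree(x ∷ xs) = cong₂ _∷_ (outLetter-letterTree x)(outLetters-inputTree xs)

 isSep : Test
 isSep(just sep) = true
 isSep _ = false

 byLetter : Fin 5 ->(Letter -> Prog) -> Prog
 byLetter i p = ifp i isSep(p sep)(ifp i isNode(p(bit 1b))(p(bit 0b)))

 byLetter-runs : ∀ i p x xs m {k m'} -> Vec.lookup m i ≡ x ∷ xs -> Runs(p x)m k m' -> Runs(byLetter i p)m(2 + k)m'
 byLetter-runs i p sep xs m eq h = r-weak(n≤1+n _)(r-then(cong (λ s -> isSep(top s))eq)h)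
 byLetter-runs i p(bit zero)xs m eq h = r-else(cong (λ s -> isSep(top s))eq)(r-else(cong (λ s -> isNode(top s))eq)h)
 byLetter-runs i p(bit(suc zero))xs m eq h = r-else(cong (λ s -> isSep(top s))eq)(r-then(cong (λ s -> isNode(top s))eq)h)

 moveIn moveOut : Prog
 moveIn = loop iIO nonEmpty(byLetter iIO (λ x -> pull iIO ⨾ push iR x))
 moveOut = loop iR nonEmpty(byLetter iR (λ x -> pull iR ⨾ push iIO x))

 moveIn-runs : ∀ xs {s a r c} -> Runs moveIn(xs ∷ s ∷ a ∷ r ∷ c ∷ [])(6 * length xs + 1)([] ∷ s ∷ a ∷(xs ʳ++ r)∷ c ∷ [])
 moveIn-runs [] = r-stop refl
 moveIn-runs(x ∷ xs) = r-weak(≤-reflexive(eq(length xs)))(r-step refl(byLetter-runs iIO (λ x -> pull iIO ⨾ push iR x)x xs _ refl(r-seq r-pull r-push))(moveIn-runs xs)) where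
  eq : ∀ n -> suc(5 +(6 * n + 1))≡ 6 * suc n + 1
  eq = ring

 moveOut-runs : ∀ xs {io s a c} -> Runs moveOut(io ∷ s ∷ a ∷ xs ∷ c ∷ [])(6 * length xs + 1)((xs ʳ++ io)∷ s ∷ a ∷ [] ∷ c ∷ [])
 moveOut-runs [] = r-stop refl
 moveOut-runs(x ∷ xs) = r-weak(≤-reflexive(eq(length xs)))(r-step refl(byLetter-runs iR (λ x -> pull iR ⨾ push iIO x)x xs _ refl(r-seq r-pull r-push))(moveOut-runs xs)) where
  eq : ∀ n -> suc(5 +(6 * n + 1))≡ 6 * suc n + 1
  eq = ring

 pushLetter : Letter -> Prog
 pushLetter sep = pull iR ⨾ push iS lf' ⨾ push iS nd'
 pushLetter(bit zero) = pull iR ⨾ push iS lf' ⨾ push iS lf' ⨾ push iS nd' ⨾ push iS nd'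
 pushLetter(bit(suc _)) = pull iR ⨾ push iS lf' ⨾ push iS lf' ⨾ push iS lf' ⨾ push iS nd' ⨾ push iS nd' ⨾ push iS nd'

 build : Prog
 build = loop iR nonEmpty(byLetter iR pushLetter)

 unbuilt : List Letter -> Tree -> Tree
 unbuilt [] t = t
 unbuilt(x ∷ xs)t = unbuilt xs(node(letterTree x)t)

 build-runs : ∀ xs t {io a c} -> Runs build(io ∷ ser t [] ∷ a ∷ xs ∷ c ∷ [])(16 * length xs + 1)(io ∷ ser(unbuilt xs t)[] ∷ a ∷ [] ∷ c ∷ [])
 build-runs [] t = r-stop refl
 build-runs(x ∷ xs)t {io}{a}{c} = r-weak(≤-reflexive(eq(length xs)))(r-step refl(byLetter-runs iR pushLetter x xs _ refl(one x))(build-runs xs _)) where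
  eq : ∀ n -> suc(2 + 13 +(16 * n + 1))≡ 16 * suc n + 1
  eq = ring
  one : ∀ x -> Runs(pushLetter x)(io ∷ ser t [] ∷ a ∷(x ∷ xs)∷ c ∷ [])13(io ∷ ser(node(letterTree x)t)[] ∷ a ∷ xs ∷ c ∷ [])
  one sep = r-weak(m≤m+n 5 8)(r-seq r-pull(r-seq r-push r-push))
  one(bit zero) = r-weak(m≤m+n 9 4)(r-seq r-pull(r-seq r-push(r-seq r-push(r-seq r-push r-push))))
  one(bit(suc zero)) = r-seq r-pull(r-seq r-push(r-seq r-push(r-seq r-push(r-seq r-push(r-seq r-push r-push)))))

 unbuilt-ʳ++ : ∀ xs ys t -> unbuilt(xs ʳ++ ys)t ≡ unbuilt ys(List.foldr (λ x -> node(letterTree x))t xs)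
 unbuilt-ʳ++ [] ys t = refl
 unbuilt-ʳ++(x ∷ xs)ys t = unbuilt-ʳ++ xs(x ∷ ys)t

 inputTree-foldr : ∀ xs -> List.foldr (λ x -> node(letterTree x))leaf xs ≡ inputTree xs
 inputTree-foldr [] = refl
 inputTree-foldr(x ∷ xs) = cong(node(letterTree x))(inputTree-foldr xs)

 readInput : Prog
 readInput = moveIn ⨾ push iS lf' ⨾ build

 readInput-runs : ∀ xs -> Runs readInput(xs ∷ [] ∷ [] ∷ [] ∷ [] ∷ [])(22 * length xs + 4)(mem [] (inputTree xs ∷ []))
 readInput-runs xs = r-weak(≤-reflexive(cong (λ l -> 6 * length xs + 1 +(2 +(16 * l + 1)))(List.length-ʳ++ xs == +-identityʳ _)== eq(length xs)))
  (r-seq(moveIn-runs xs)(r-seq r-push(retarget(cong (λ t -> [] ∷ ser t [] ∷ [] ∷ [] ∷ [] ∷ [])(unbuilt-ʳ++ xs [] leaf == inputTree-foldr xs))(build-runs(xs ʳ++ [])leaf)))) where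
  eq : ∀ n -> 6 * n + 1 +(2 +(16 * n + 1))≡ 22 * n + 4
  eq = ring

 popItem unbuild : Prog
 popItem = ifp iS isNode(pull iS ⨾ ifp iS isNode(push iR(bit 1b))(push iR(bit 0b)) ⨾ scan drop ⨾ scan drop)(pull iS ⨾ push iR sep)
 unbuild = loop iS isNode(pull iS ⨾ popItem)

 popped : Tree -> Stack -> Stack
 popped leaf r = r
 popped(node h t)r = popped t(outLetter h ∷ r)

 drop-runs : ∀ t {io s a r} -> Runs(scan drop)(io ∷ ser t s ∷ a ∷ r ∷ [] ∷ [])(12 * size t)(io ∷ s ∷ a ∷ r ∷ [] ∷ [])
 drop-runs t {io}{s}{a}{r} = retarget(cong₂ (λ a r -> io ∷ s ∷ a ∷ r ∷ [] ∷ [])(out-const t a)(out-const t r))(scan-runs drop t)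

 popItem-ok : ∀ h {io s r} -> Runs popItem(io ∷ ser h s ∷ [] ∷ r ∷ [] ∷ [])(12 * size h)(io ∷ s ∷ [] ∷(outLetter h ∷ r)∷ [] ∷ [])
 popItem-ok leaf = r-weak(m≤m+n 4 8)(r-else refl(r-seq r-pull r-push))
 popItem-ok(node leaf q) = r-weak(≤-by 7(eq(size q)))(r-then refl(r-seq r-pull(r-seq(r-else refl r-push)(r-seq(drop-runs leaf)(drop-runs q))))) where
  eq : ∀ q -> suc(1 +(3 +(12 * 1 + 12 * q)))+ 7 ≡ 12 * suc(1 + q)
  eq = ring
 popItem-ok(node l@(node _ _)q) = r-weak(≤-by 7(eq(size l)(size q)))(r-then refl(r-seq r-pull(r-seq(r-then refl r-push)(r-seq(drop-runs l)(drop-runs q))))) where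
  eq : ∀ l q -> suc(1 +(3 +(12 * l + 12 * q)))+ 7 ≡ 12 * suc(l + q)
  eq = ring

 unbuild-ok : ∀ t {io s r} -> Runs unbuild(io ∷ ser t s ∷ [] ∷ r ∷ [] ∷ [])(12 * size t)(io ∷(lf' ∷ s)∷ [] ∷ popped t r ∷ [] ∷ [])
 unbuild-ok leaf = r-weak(m≤m+n 1 11)(r-stop refl)
 unbuild-ok(node h t) = r-weak(≤-by 10(eq(size h)(size t)))(r-step refl(r-seq r-pull(popItem-ok h))(unbuild-ok t)) where
  eq : ∀ h t -> suc(1 + 12 * h + 12 * t)+ 10 ≡ 12 * suc(h + t)
  eq = ring

 popped-length : ∀ t r -> length(popped t r)≤ size t + length r
 popped-length leaf r = n≤1+n _
 popped-length(node h t)r = popped-length t _ << +-suc(size t)(length r)=< s≤s(+-monoˡ-≤(length r)(m≤n+m(size t)(size h)))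

 popped-ʳ++ : ∀ t r ys -> popped t r ʳ++ ys ≡ r ʳ++(outLetters t ++ ys)
 popped-ʳ++ leaf r ys = refl
 popped-ʳ++(node h t)r ys = popped-ʳ++ t(outLetter h ∷ r)ys

 writeOutput : Prog
 writeOutput = unbuild ⨾ moveOut

 writeOutput-runs : ∀ t σ -> Σ[ s ∈ Stack ] Runs writeOutput(mem [] (t ∷ σ))(18 * size t + 1)(outLetters t ∷ s ∷ [] ∷ [] ∷ [] ∷ [])
 writeOutput-runs t σ = _ , r-weak(+-monoʳ-≤(12 * size t)(+-monoˡ-≤ 1(*-monoʳ-≤ 6(popped-length t [])))<= eq(size t))(r-seq(unbuild-ok t)(retarget(cong (λ io -> io ∷ _ ∷ [] ∷ [] ∷ [] ∷ [])(popped-ʳ++ t [] [] == List.++-identityʳ _))(moveOut-runs(popped t [])))) where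
  eq : ∀ t -> 12 * t +(6 *(t + 0)+ 1)≡ 18 * t + 1
  eq = ring

 size-letterTree : ∀ x -> size(letterTree x)≤ 5
 size-letterTree sep = s≤s z≤n
 size-letterTree(bit zero) = s≤s(s≤s(s≤s z≤n))
 size-letterTree(bit(suc _)) = ≤-refl

 size-inputTree : ∀ xs -> size(inputTree xs)≤ 6 * length xs + 1
 size-inputTree [] = ≤-refl
 size-inputTree(x ∷ xs) = s≤s(+-mono-≤(size-letterTree x)(size-inputTree xs))<= eq(length xs) where
  eq : ∀ n -> suc(5 +(6 * n + 1))≡ 6 * suc n + 1
  eq = ring

 ^-distrib-* : ∀ a b d ->(a * b) ^ d ≡ a ^ d * b ^ d
 ^-distrib-* a b zero = refl
 ^-distrib-* a b(suc d) = cong(a * b *_)(^-distrib-* a b d)== eq a b(a ^ d)(b ^ d) where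
  eq : ∀ a b c d ->(a * b)*(c * d)≡(a * c)*(b * d)
  eq = ring

 poly-bound : ∀ p -> Σ[ c ∈ ℕ ] Σ[ d ∈ ℕ ] ∀ s -> ⟦ p ⟧ s ≤ c * suc s ^ d
 poly-bound(con c) = c , 0 , λ s -> ≤-reflexive(sym(*-identityʳ c))
 poly-bound X = 1 , 1 , λ s -> n≤1+n s <= sym(+-identityʳ _ == *-identityʳ(suc s))
 poly-bound(p ⊕ q) with poly-bound p | poly-bound q
 ... | c , d , h | c' , d' , h' = c + c' , d + d' , λ s -> +-mono-≤(h s)(h' s)<<
  +-mono-≤(*-monoʳ-≤ c(^-monoʳ-≤(suc s)(m≤m+n d d')))(*-monoʳ-≤ c'(^-monoʳ-≤(suc s)(m≤n+m d' d)))<=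
   sym(*-distribʳ-+(suc s ^ (d + d'))c c')
 poly-bound(p ⊗ q) with poly-bound p | poly-bound q
 ... | c , d , h | c' , d' , h' = c * c' , d + d' , λ s -> *-mono-≤(h s)(h' s)<=
  eq c(suc s ^ d)c'(suc s ^ d')== cong(c * c' *_)(sym(^-distribˡ-+-*(suc s)d d')) where
  eq : ∀ a b c d ->(a * b)*(c * d)≡(a * c)*(b * d)
  eq = ring
 poly-bound(p ⊚ q) with poly-bound p | poly-bound q
 ... | c , d , h | c' , d' , h' = c * suc c' ^ d , d' * d , λ s -> h(⟦ q ⟧ s)<<
  *-monoʳ-≤ c(^-monoˡ-≤ d(s≤s(h' s)<< +-monoˡ-≤(c' * suc s ^ d')(m^n>0(suc s)d')))<=
   cong(c *_)(^-distrib-*(suc c')(suc s ^ d')d == cong(suc c' ^ d *_)(^-*-assoc(suc s)d' d))==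
    sym(*-assoc c(suc c' ^ d)(suc s ^ (d' * d)))

 polynomiallyBounded : ∀ p -> PolynomiallyBounded ⟦ p ⟧
 polynomiallyBounded p with poly-bound p
 ... | c , d , h = c * 2 ^ d , d , λ s -> h s << bound' s where
  bound' : ∀ s -> c * suc s ^ d ≤ c * 2 ^ d * s ^ d + c * 2 ^ d
  bound' zero = *-monoʳ-≤ c(^-monoˡ-≤ d {1}{2}(s≤s z≤n))<< m≤n+m _ _
  bound'(suc s) = *-monoʳ-≤ c(^-monoˡ-≤ d {suc(suc s)}{2 * suc s}(≤-by s(eq s)))<<
   cong(c *_)(^-distrib-* 2(suc s)d)== sym(*-assoc c(2 ^ d)(suc s ^ d))=< m≤m+n _ _ where
   eq : ∀ s -> suc(suc s)+ s ≡ 2 * suc s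
   eq = ring

 module Execution (P : Prog)(time : ℕ -> ℕ)(outs : List Letter -> List Letter)
  (runs : ∀ x -> Σ[ s ∈ Stack ] Runs P(x ∷ [] ∷ [] ∷ [] ∷ [] ∷ [])(time(length x))(outs x ∷ s ∷ [] ∷ [] ∷ [] ∷ [])) where

  open Sim P

  initial-rep : ∀ x -> Vec.zipWith stk(0 ∷ 0 ∷ 0 ∷ 0 ∷ 0 ∷ [])(x ∷ [] ∷ [] ∷ [] ∷ [] ∷ [])≡ Config.tapes(initial M x)
  initial-rep [] = refl
  initial-rep(x ∷ xs) = refl

  halted-run : ∀ {t}(bs : Vec Bool t)ts -> run M bs(conf nothing ts)≡ conf nothing ts
  halted-run [] ts = refl
  halted-run(b ∷ bs)ts = halted-run bs ts

  contents-stk : ∀ k xs -> contents(stk k xs)≡ xs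
  contents-stk k [] = refl
  contents-stk k(x ∷ xs) = cong(x ∷_)(letters-map xs) where
   letters-map : ∀ xs -> letters {0}(List.map letter xs)≡ xs
   letters-map [] = refl
   letters-map(x ∷ xs) = cong(x ∷_)(letters-map xs)

  final : ∀ x (coins : Vec Bool(time(length x))) ->
   Σ[ ts ∈ Vec(Tape 0)5 ] run M coins(initial M x)≡ conf nothing ts × contents(Vec.head ts)≡ outs x
  final x coins with runs x
  ... | s , r with run-program r {Config.tapes(initial M x)}(_ , sym(initial-rep x))
  ... | ts ,((k ∷ _ ∷ _ ∷ _ ∷ _ ∷ []), refl), reach len len≤ steps = ts , run≡ coins len≤ , contents-stk k _ where
   run≡ : ∀ {t}(coins : Vec Bool t) -> len ≤ t -> run M coins(initial M x)≡ conf nothing ts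
   run≡ coins len≤ with m≤n⇒∃[o]m+o≡n len≤
   ... | o , refl with Vec.splitAt len coins
   ... | bs1 , bs2 , refl = run-++ bs1 bs2(initial M x)== cong(run M bs2)(steps bs1)== halted-run bs2 ts

  halts : HaltsWithin M time
  halts x coins = let (ts , eq , _) = final x coins in cong Config.state eq

  output≡ : ∀ x (coins : Vec Bool(time(length x))) -> output M x coins ≡ outs x
  output≡ x coins = let (ts , eq , out≡) = final x coins in cong (λ C -> contents(Vec.head(Config.tapes C)))eq == out≡

 module Realise (e : Exp 1) where

  program : Prog
  program = readInput ⨾ compile e (λ _ -> 0) ⨾ writeOutput

  inputSize time : Poly
  inputSize = con 6 ⊗ X ⊕ con 1
  time =(con 22 ⊗ X ⊕ con 4) ⊕ ((tp e ⊚ inputSize) ⊕ (con 18 ⊗ (sp e ⊚ inputSize) ⊕ con 1))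

  result : List Letter -> Tree
  result x = eval e (λ _ -> inputTree x)

  program-runs : ∀ x -> Σ[ s ∈ Stack ] Runs program(x ∷ [] ∷ [] ∷ [] ∷ [] ∷ [])(⟦ time ⟧ (length x))(outLetters(result x)∷ s ∷ [] ∷ [] ∷ [] ∷ [])
  program-runs x = proj₁ w , r-seq(readInput-runs x)(r-seq(runs-ok e (λ _ -> 0)(λ _ -> inputTree x){inputTree x ∷ []}(λ _ -> here)(+-identityʳ _ =< size-inputTree x))
   (r-weak(+-monoˡ-≤ 1(*-monoʳ-≤ 18(ev-size e _ (λ _ -> size-inputTree x))))(proj₂ w))) where
   w = writeOutput-runs(result x)(inputTree x ∷ [])

  algorithm : Machine
  algorithm = machine program

  halts : HaltsWithin algorithm ⟦ time ⟧
  halts = Execution.halts program ⟦ time ⟧ (λ x -> outLetters(result x))program-runs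

  output≡ : ∀ x (coins : Vec Bool(⟦ time ⟧ (length x))) -> output algorithm x coins ≡ outLetters(result x)
  output≡ = Execution.output≡ program ⟦ time ⟧ (λ x -> outLetters(result x))program-runs

module Typed where

 open import Data.Fin.Base using (zero; suc)
 open import Data.List.Base using (reverse)
 open import Data.Nat.Base
 open import Data.Nat.Properties
 open import Data.Nat.Tactic.RingSolver using () renaming (solve-∀ to ring)
 open Machines using (Tree; leaf; node; size; ≤-by)
 open Machines
 open Chainℕ

 record Ty : Set1 where
  field
   Car : Set
   enc : Car -> Tree

 open Ty public

 Ctx : Set1
 Ctx = List Ty

 Env : Ctx -> Set
 Env [] = ⊤
 Env(A ∷ Γ) = Car A × Env Γ

 trees : ∀ {Γ} -> Env Γ -> Fin(length Γ) -> Tree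
 trees {A ∷ Γ}(a , γ)zero = enc A a
 trees {A ∷ Γ}(a , γ)(suc i) = trees γ i

 infix 3 _⊢_

 record _⊢_ (Γ : Ctx)(A : Ty) : Set where
  field
   fun : Env Γ -> Car A
   code : Exp(length Γ)
   ok : ∀ γ δ ->(∀ i -> δ i ≡ trees γ i) -> eval code δ ≡ enc A(fun γ)

 open _⊢_ public

 recast : ∀ {Γ A}(e : Γ ⊢ A)(f : Env Γ -> Car A) ->(∀ γ -> fun e γ ≡ f γ) -> Γ ⊢ A
 recast {A = A}e f h = record { fun = f ; code = code e ; ok = λ γ δ eq -> ok e γ δ eq == cong(enc A)(h γ) }

 private variable
  Γ Δ : Ctx
  A B C S : Ty

 ▹-trees : ∀ {n}{a : Tree}{f : Fin n -> Tree}{g : Fin(suc n) -> Tree} -> a ≡ g zero ->(∀ i -> f i ≡ g(suc i)) -> ∀ i ->(a ▹ f)i ≡ g i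
 ▹-trees p q zero = p
 ▹-trees p q(suc i) = q i

 v0 : A ∷ Γ ⊢ A
 v0 = record { fun = proj₁ ; code = var zero ; ok = λ γ δ eq -> eq zero }

 wk : Γ ⊢ A -> B ∷ Γ ⊢ A
 wk e = record { fun = λ γ -> fun e(proj₂ γ) ; code = rn suc(code e) ; ok = λ γ δ eq -> ok e(proj₂ γ)(δ ∘ suc)(eq ∘ suc) }

 v1 : B ∷ A ∷ Γ ⊢ A
 v1 = wk v0

 v2 : ∀ {B1 B2} -> B1 ∷ B2 ∷ A ∷ Γ ⊢ A
 v2 = wk v1

 v3 : ∀ {B1 B2 B3} -> B1 ∷ B2 ∷ B3 ∷ A ∷ Γ ⊢ A
 v3 = wk v2

 v4 : ∀ {B1 B2 B3 B4} -> B1 ∷ B2 ∷ B3 ∷ B4 ∷ A ∷ Γ ⊢ A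
 v4 = wk v3

 v5 : ∀ {B1 B2 B3 B4 B5} -> B1 ∷ B2 ∷ B3 ∷ B4 ∷ B5 ∷ A ∷ Γ ⊢ A
 v5 = wk v4

 v6 : ∀ {B1 B2 B3 B4 B5 B6} -> B1 ∷ B2 ∷ B3 ∷ B4 ∷ B5 ∷ B6 ∷ A ∷ Γ ⊢ A
 v6 = wk v5

 letT : Γ ⊢ A -> A ∷ Γ ⊢ B -> Γ ⊢ B
 letT a b = record
  { fun = λ γ -> fun b(fun a γ , γ) ; code = lt(code a)(code b)
  ; ok = λ γ δ eq -> ok b _ _ (▹-trees(ok a γ δ eq)eq) }

 restrict : ∀ Δ -> Env(Δ ++ Γ) -> Env Δ
 restrict [] γ = tt
 restrict(A ∷ Δ)(a , γ) = a , restrict Δ γ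

 embed : ∀ Δ -> Fin(length Δ) -> Fin(length(Δ ++ Γ))
 embed(A ∷ Δ)zero = zero
 embed(A ∷ Δ)(suc i) = suc(embed Δ i)

 closed : Δ ⊢ A -> Δ ++ Γ ⊢ A
 closed {Δ = Δ}{Γ = Γ}e = record
  { fun = λ γ -> fun e(restrict Δ γ) ; code = rn(embed Δ)(code e)
  ; ok = λ γ δ eq -> ok e(restrict Δ γ)(δ ∘ embed Δ)(λ i -> eq(embed Δ i)== go Δ γ i) } where
  go : ∀ Δ (γ : Env(Δ ++ Γ))i -> trees γ(embed Δ i)≡ trees(restrict Δ γ)i
  go(A ∷ Δ)γ zero = refl
  go(A ∷ Δ)γ(suc i) = go Δ(proj₂ γ)i

 call1 : A ∷ [] ⊢ S -> Γ ⊢ A -> Γ ⊢ S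
 call1 f a = letT a(closed f)

 call2 : A ∷ B ∷ [] ⊢ S -> Γ ⊢ A -> Γ ⊢ B -> Γ ⊢ S
 call2 f a b = letT b(letT(wk a)(closed f))

 call3 : A ∷ B ∷ C ∷ [] ⊢ S -> Γ ⊢ A -> Γ ⊢ B -> Γ ⊢ C -> Γ ⊢ S
 call3 f a b c = letT c(letT(wk b)(letT(wk(wk a))(closed f)))

 call4 : ∀ {D} -> A ∷ B ∷ C ∷ D ∷ [] ⊢ S -> Γ ⊢ A -> Γ ⊢ B -> Γ ⊢ C -> Γ ⊢ D -> Γ ⊢ S
 call4 f a b c d = letT d(letT(wk c)(letT(wk(wk b))(letT(wk(wk(wk a)))(closed f))))

 quoteTree : ∀ {n} -> Tree -> Exp n
 quoteTree leaf = lf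
 quoteTree(node l r) = nd(quoteTree l)(quoteTree r)

 eval-quote : ∀ {n}t (δ : Fin n -> Tree) -> eval(quoteTree t)δ ≡ t
 eval-quote leaf δ = refl
 eval-quote(node l r)δ = cong₂ node(eval-quote l δ)(eval-quote r δ)

 constT : Car A -> Γ ⊢ A
 constT {A}a = record { fun = λ _ -> a ; code = quoteTree(enc A a) ; ok = λ γ δ _ -> eval-quote(enc A a)δ }

 encBool : Bool -> Tree
 encBool false = leaf
 encBool true = node leaf leaf

 𝔹 : Ty
 𝔹 = record { Car = Bool ; enc = encBool }

 infixr 4 _⊠_
 _⊠_ : Ty -> Ty -> Ty
 A ⊠ B = record { Car = Car A × Car B ; enc = λ (a , b) -> node(enc A a)(enc B b) }

 encList : ∀ {A : Set} ->(A -> Tree) -> List A -> Tree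
 encList f [] = leaf
 encList f(x ∷ xs) = node(f x)(encList f xs)

 𝕃 : Ty -> Ty
 𝕃 A = record { Car = List(Car A) ; enc = encList(enc A) }

 encUnary : ℕ -> Tree
 encUnary zero = leaf
 encUnary(suc n) = node leaf(encUnary n)

 𝕌 : Ty
 𝕌 = record { Car = ℕ ; enc = encUnary }

 ifT : Γ ⊢ 𝔹 -> Γ ⊢ A -> Γ ⊢ A -> Γ ⊢ A
 ifT {A = A}c a b = record
  { fun = λ γ -> if fun c γ then fun a γ else fun b γ
  ; code = cs(code c)(code b)(rn (λ i -> suc(suc i))(code a))
  ; ok = λ γ δ eq -> cong (λ t -> caseTree t(eval(code b)δ)(λ _ _ -> eval(code a)δ))(ok c γ δ eq)== go γ δ eq(fun c γ) } where
  go : ∀ γ δ ->(∀ i -> δ i ≡ trees γ i) -> ∀ x -> caseTree(encBool x)(eval(code b)δ)(λ _ _ -> eval(code a)δ)≡ enc A(if x then fun a γ else fun b γ)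
  go γ δ eq true = ok a γ δ eq
  go γ δ eq false = ok b γ δ eq

 pairT : Γ ⊢ A -> Γ ⊢ B -> Γ ⊢ A ⊠ B
 pairT a b = record { fun = λ γ -> fun a γ , fun b γ ; code = nd(code a)(code b) ; ok = λ γ δ eq -> cong₂ node(ok a γ δ eq)(ok b γ δ eq) }

 fstT : Γ ⊢ A ⊠ B -> Γ ⊢ A
 fstT p = record { fun = λ γ -> proj₁(fun p γ) ; code = cs(code p)lf(var zero)
  ; ok = λ γ δ eq -> cong (λ t -> caseTree t leaf (λ l r -> l))(ok p γ δ eq) }

 sndT : Γ ⊢ A ⊠ B -> Γ ⊢ B
 sndT p = record { fun = λ γ -> proj₂(fun p γ) ; code = cs(code p)lf(var(suc zero))
  ; ok = λ γ δ eq -> cong (λ t -> caseTree t leaf (λ l r -> r))(ok p γ δ eq) }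

 nilT : Γ ⊢ 𝕃 A
 nilT = record { fun = λ _ -> [] ; code = lf ; ok = λ _ _ _ -> refl }

 consT : Γ ⊢ A -> Γ ⊢ 𝕃 A -> Γ ⊢ 𝕃 A
 consT a b = record { fun = λ γ -> fun a γ ∷ fun b γ ; code = nd(code a)(code b) ; ok = λ γ δ eq -> cong₂ node(ok a γ δ eq)(ok b γ δ eq) }

 listCase : ∀ {X Y : Set} -> List X -> Y ->(X -> List X -> Y) -> Y
 listCase [] n c = n
 listCase(x ∷ xs)n c = c x xs

 caseT : Γ ⊢ 𝕃 A -> Γ ⊢ B -> A ∷ 𝕃 A ∷ Γ ⊢ B -> Γ ⊢ B
 caseT {A = A}{B}l n c = record
  { fun = λ γ -> listCase(fun l γ)(fun n γ)(λ x xs -> fun c(x , xs , γ))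
  ; code = cs(code l)(code n)(code c)
  ; ok = λ γ δ eq -> cong (λ t -> caseTree t(eval(code n)δ)(λ l r -> eval(code c)(l ▹ r ▹ δ)))(ok l γ δ eq)== go γ δ eq(fun l γ) } where
  go : ∀ γ δ ->(∀ i -> δ i ≡ trees γ i) -> ∀ xs ->
   caseTree(enc(𝕃 A)xs)(eval(code n)δ)(λ l r -> eval(code c)(l ▹ r ▹ δ))≡ enc B(listCase xs(fun n γ)(λ x xs -> fun c(x , xs , γ)))
  go γ δ eq [] = ok n γ δ eq
  go γ δ eq(x ∷ xs) = ok c(x , xs , γ)_ (▹-trees refl(▹-trees refl eq))

 zeroT : Γ ⊢ 𝕌
 zeroT = constT zero

 sucT : Γ ⊢ 𝕌 -> Γ ⊢ 𝕌
 sucT a = record { fun = λ γ -> suc(fun a γ) ; code = nd lf(code a) ; ok = λ γ δ eq -> cong(node leaf)(ok a γ δ eq) }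

 lengthT : Γ ⊢ 𝕃 A -> Γ ⊢ 𝕌
 lengthT {A = A}l = record
  { fun = λ γ -> length(fun l γ) ; code = rmap(code l)lf
  ; ok = λ γ δ eq -> cong (λ t -> rmapTree (λ _ -> leaf)t leaf)(ok l γ δ eq)== go(fun l γ)0 == cong encUnary(+-identityʳ _) } where
  go : ∀ xs n -> rmapTree (λ _ -> leaf)(enc(𝕃 A)xs)(encUnary n)≡ encUnary(length xs + n)
  go [] n = refl
  go(x ∷ xs)n = go xs(suc n)== cong encUnary(+-suc(length xs)n)

 rmapTree-list : ∀ {X Y : Set}(e : X -> Tree)(e' : Y -> Tree)(f : Tree -> Tree)(g : X -> Y) ->(∀ x -> f(e x)≡ e'(g x)) -> ∀ xs ys ->
  rmapTree f(encList e xs)(encList e' ys)≡ encList e'(List.map g xs List.ʳ++ ys)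
 rmapTree-list e e' f g h [] ys = refl
 rmapTree-list e e' f g h(x ∷ xs)ys = cong (λ t -> rmapTree f(encList e xs)(node t(encList e' ys)))(h x)== rmapTree-list e e' f g h xs(g x ∷ ys)

 reverseT : Γ ⊢ 𝕃 A -> Γ ⊢ 𝕃 A
 reverseT {A = A}l = record
  { fun = λ γ -> reverse(fun l γ) ; code = rmap(code l)(var zero)
  ; ok = λ γ δ eq -> cong (λ t -> rmapTree (λ t -> t)t leaf)(ok l γ δ eq)==
   rmapTree-list(enc A)(enc A)(λ t -> t)(λ x -> x)(λ _ -> refl)(fun l γ)[] ==
    cong (λ xs -> encList(enc A)(xs List.ʳ++ []))(List.map-id(fun l γ)) }

 mapT : Γ ⊢ 𝕃 A -> A ∷ Γ ⊢ B -> Γ ⊢ 𝕃 B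
 mapT {Γ = Γ}{A = A}{B}l f = recast(reverseT mapped)(λ γ -> List.map (λ a -> fun f(a , γ))(fun l γ))
  (λ γ -> List.reverse-involutive _) where
  mapped = record
   { fun = λ γ -> reverse(List.map (λ a -> fun f(a , γ))(fun l γ)) ; code = rmap(code l)(code f)
   ; ok = λ γ δ eq -> cong (λ t -> rmapTree (λ h -> eval(code f)(h ▹ δ))t leaf)(ok l γ δ eq)==
    rmapTree-list(enc A)(enc B)_ (λ a -> fun f(a , γ))(λ a -> ok f(a , γ)_ (▹-trees refl eq))(fun l γ)[] }

 clipped :(S : Ty) -> ℕ -> Car S -> Car S -> Car S
 clipped S b s r = if leb(size(enc S r))b then r else s

 foldrC : ∀ {X : Set}(S : Ty) -> ℕ ->(X -> Car S -> Car S) -> Car S -> List X -> Car S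
 foldrC S b f i [] = i
 foldrC S b f i(x ∷ xs) = clipped S b(foldrC S b f i xs)(f x(foldrC S b f i xs))

 foldrT : Γ ⊢ 𝕃 A -> Γ ⊢ S -> Γ ⊢ C -> A ∷ S ∷ Γ ⊢ S -> Γ ⊢ S
 foldrT {A = A}{S}{C}l i b f = record
  { fun = λ γ -> foldrC S(size(enc C(fun b γ)))(λ a s -> fun f(a , s , γ))(fun i γ)(fun l γ)
  ; code = fold(code(reverseT l))(code i)(code b)(code f)
  ; ok = λ γ δ eq -> let F = λ h acc -> eval(code f)(h ▹ acc ▹ δ) in
   cong (λ B -> foldTree F B(eval(code(reverseT l))δ)(eval(code i)δ))(ok b γ δ eq)==
   cong₂(foldTree F(enc C(fun b γ)))(cong (λ t -> rmapTree (λ t -> t)t leaf)(ok l γ δ eq)== refl)(ok i γ δ eq)==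
   go γ δ eq(fun l γ)leaf } where
  go : ∀ γ δ ->(∀ i -> δ i ≡ trees γ i) -> ∀ xs t ->
   foldTree (λ h acc -> eval(code f)(h ▹ acc ▹ δ))(enc C(fun b γ))(rmapTree (λ t -> t)(enc(𝕃 A)xs)t)(enc S(fun i γ))
   ≡ foldTree (λ h acc -> eval(code f)(h ▹ acc ▹ δ))(enc C(fun b γ))t
    (enc S(foldrC S(size(enc C(fun b γ)))(λ a s -> fun f(a , s , γ))(fun i γ)xs))
  go γ δ eq [] t = refl
  go γ δ eq(x ∷ xs)t = go γ δ eq xs(node(enc A x)t)== cong(foldTree _ _ t)stage where
   s = foldrC S(size(enc C(fun b γ)))(λ a s -> fun f(a , s , γ))(fun i γ)xs
   stage : clip(enc C(fun b γ))(enc S s)(eval(code f)(enc A x ▹ enc S s ▹ δ))≡ enc S(clipped S(size(enc C(fun b γ)))s(fun f(x , s , γ)))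
   stage rewrite ok f(x , s , γ)(enc A x ▹ enc S s ▹ δ)(▹-trees refl(▹-trees refl eq))
    with leb(size(enc S(fun f(x , s , γ))))(size(enc C(fun b γ)))
   ... | true = refl
   ... | false = refl

 foldrC-unclip : ∀ {X : Set}(S : Ty){b f i}(M : List X -> ℕ) ->(∀ x xs -> M xs ≤ M(x ∷ xs)) ->
  (∀ x xs -> size(enc S(List.foldr f i(x ∷ xs)))≤ M(x ∷ xs)) ->
  ∀ xs -> M xs ≤ b -> foldrC S b f i xs ≡ List.foldr f i xs
 foldrC-unclip S M mono h [] le = refl
 foldrC-unclip S {b}{f}{i}M mono h(x ∷ xs)le
  rewrite foldrC-unclip S {b}{f}{i}M mono h xs(mono x xs << le) | leb-complete(h x xs << le) = refl

 foldrT-exact :(l : Γ ⊢ 𝕃 A)(i : Γ ⊢ S)(b : Γ ⊢ C)(f : A ∷ S ∷ Γ ⊢ S)(g : Env Γ -> Car S)(M : Env Γ -> List(Car A) -> ℕ) ->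
  (∀ γ x xs -> M γ xs ≤ M γ(x ∷ xs)) ->
  (∀ γ x xs -> size(enc S(List.foldr (λ a s -> fun f(a , s , γ))(fun i γ)(x ∷ xs)))≤ M γ(x ∷ xs)) ->
  (∀ γ -> M γ(fun l γ)≤ size(enc C(fun b γ))) ->
  (∀ γ -> List.foldr (λ a s -> fun f(a , s , γ))(fun i γ)(fun l γ)≡ g γ) -> Γ ⊢ S
 foldrT-exact {S = S}l i b f g M mono h le eq = recast(foldrT l i b f)g
  (λ γ -> foldrC-unclip S(M γ)(mono γ)(h γ)(fun l γ)(le γ)== eq γ)

 iter : ∀ {X : Set} ->(X -> X) -> ℕ -> X -> X
 iter f zero x = x
 iter f(suc n)x = f(iter f n x)

 iterC :(S : Ty) -> ℕ ->(Car S -> Car S) -> ℕ -> Car S -> Car S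
 iterC S b f zero s = s
 iterC S b f(suc n)s = clipped S b(iterC S b f n s)(f(iterC S b f n s))

 iterC-unclip : ∀ S {b f}s n ->(∀ k -> k < n -> size(enc S(iter f(suc k)s))≤ b) -> iterC S b f n s ≡ iter f n s
 iterC-unclip S s zero h = refl
 iterC-unclip S {b}{f}s(suc n)h rewrite iterC-unclip S {b}{f}s n (λ k k<n -> h k(m<n⇒m<1+n k<n)) | leb-complete(h n ≤-refl) = refl

 unaryList : Γ ⊢ 𝕌 -> Γ ⊢ 𝕃 𝕌
 unaryList n = record { fun = λ γ -> List.replicate(fun n γ)0 ; code = code n ; ok = λ γ δ eq -> ok n γ δ eq == go(fun n γ) } where
  go : ∀ n -> encUnary n ≡ encList encUnary(List.replicate n 0)
  go zero = refl
  go(suc n) = cong(node leaf)(go n)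

 iterT : Γ ⊢ 𝕌 -> Γ ⊢ S -> Γ ⊢ C -> S ∷ Γ ⊢ S -> Γ ⊢ S
 iterT {S = S}{C}n i b f = recast(foldrT(unaryList n)i b(wk f))(λ γ -> iterC S(size(enc C(fun b γ)))(λ s -> fun f(s , γ))(fun n γ)(fun i γ))
  (λ γ -> go(size(enc C(fun b γ)))(λ s -> fun f(s , γ))(fun i γ)(fun n γ)) where
  go : ∀ b f i n -> foldrC S b(λ (_ : ℕ)s -> f s)i(List.replicate n 0)≡ iterC S b f n i
  go b f i zero = refl
  go b f i(suc n) = cong (λ s -> clipped S b s(f s))(go b f i n)

 iterT-exact :(n : Γ ⊢ 𝕌)(i : Γ ⊢ S)(b : Γ ⊢ C)(f : S ∷ Γ ⊢ S)(g : Env Γ -> Car S) ->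
  (∀ γ k -> k < fun n γ -> size(enc S(iter (λ s -> fun f(s , γ))(suc k)(fun i γ)))≤ size(enc C(fun b γ))) ->
  (∀ γ -> iter (λ s -> fun f(s , γ))(fun n γ)(fun i γ)≡ g γ) -> Γ ⊢ S
 iterT-exact {S = S}n i b f g h eq = recast(iterT n i b f)g (λ γ -> iterC-unclip S(fun i γ)(fun n γ)(h γ)== eq γ)

 size-unary : ∀ n -> size(encUnary n)≡ suc(2 * n)
 size-unary zero = refl
 size-unary(suc n) = cong suc(cong suc(size-unary n)== sym(*-suc 2 n))

 sz :(A : Ty) -> Car A -> ℕ
 sz A a = size(enc A a)

 appendT : 𝕃 A ∷ 𝕃 A ∷ [] ⊢ 𝕃 A
 appendT {A} = foldrT-exact v0 v1(pairT v0 v1)(consT v0 v1)(λ (xs , ys , _) -> xs ++ ys)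
  (λ (_ , ys , _)xs -> sz(𝕃 A)xs + sz(𝕃 A)ys)
  (λ _ x xs -> +-monoˡ-≤ _ (m≤n+m(sz(𝕃 A)xs)(sz A x)<< n≤1+n _))
  (λ (_ , ys , _)x xs -> size-foldr ys(x ∷ xs))
  (λ _ -> n≤1+n _)
  (λ (xs , ys , _) -> foldr-++ ys xs) where
  foldr-++ : ∀ ys xs -> List.foldr _∷_ ys xs ≡ xs ++ ys
  foldr-++ ys [] = refl
  foldr-++ ys(x ∷ xs) = cong(x ∷_)(foldr-++ ys xs)
  size-foldr : ∀ ys xs -> sz(𝕃 A)(List.foldr _∷_ ys xs)≤ sz(𝕃 A)xs + sz(𝕃 A)ys
  size-foldr ys [] = n≤1+n _
  size-foldr ys(x ∷ xs) = s≤s(+-monoʳ-≤(sz A x)(size-foldr ys xs)<= sym(+-assoc(sz A x)_ _))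

 addT : 𝕌 ∷ 𝕌 ∷ [] ⊢ 𝕌
 addT = iterT-exact v0 v1(pairT v0 v1)(sucT v0)(λ (m , n , _) -> m + n)
  (λ (m , n , _)k k<m -> cong (λ z -> size(encUnary(suc z)))(iter-suc n k)== size-unary(suc k + n)=<
   s≤s(*-monoʳ-≤ 2(+-monoˡ-≤ n k<m))<< ≤-by 2(eq m n == sym(cong suc(cong₂ _+_ (size-unary m)(size-unary n)))))
  (λ (m , n , _) -> iter-suc n m) where
  iter-suc : ∀ n m -> iter suc m n ≡ m + n
  iter-suc n zero = refl
  iter-suc n(suc m) = cong suc(iter-suc n m)
  eq : ∀ m n -> suc(2 *(m + n))+ 2 ≡ suc(suc(2 * m)+ suc(2 * n))
  eq = ring

 mulT : 𝕌 ∷ 𝕌 ∷ [] ⊢ 𝕌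
 mulT = iterT-exact v0 zeroT(mapT(unaryList v0)v2)(call2 addT v2 v0)(λ (m , n , _) -> m * n)
  (λ (m , n , _)k k<m -> cong (λ z -> size(encUnary(n + z)))(iter-add n k)== size-unary(suc k * n)=<
   s≤s(*-monoʳ-≤ 2(*-monoˡ-≤ n k<m))<< copies m n)
  (λ (m , n , _) -> iter-add n m) where
  iter-add : ∀ n m -> iter(n +_)m 0 ≡ m * n
  iter-add n zero = refl
  iter-add n(suc m) = cong(n +_)(iter-add n m)
  copies : ∀ m n -> suc(2 *(m * n))≤ sz(𝕃 𝕌)(List.map (λ _ -> n)(List.replicate m 0))
  copies zero n = ≤-refl
  copies(suc m)n = s≤s((*-distribˡ-+ 2 n(m * n)=< +-mono-≤(n≤1+n _ <= sym(size-unary n))(n≤1+n _))<<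
   +-monoʳ-≤(sz 𝕌 n)(copies m n))

module Arithmetic where

 open import Data.Bool.Base using (_xor_)
 open import Data.Bool.Properties using (T-≡)
 open import Data.List.Base using (reverse)
 open import Data.Nat.Base
 open import Data.Nat.Properties
 open import Data.Nat.Tactic.RingSolver using () renaming (solve-∀ to ring)
 open import Data.Sign.Base as Sign using ()
 open import Function.Bundles using (Equivalence)
 open Machines using (1≤size; ≤-by)
 open Typed
 open Chainℕ

 private variable
  Γ : Ctx
  A B C S : Ty

 b2n : Bool -> ℕ
 b2n false = 0
 b2n true = 1

 dbl : ℕ -> ℕ
 dbl zero = zero
 dbl(suc n) = suc(suc(dbl n))

 dbl≡ : ∀ n -> dbl n ≡ n + n
 dbl≡ zero = refl
 dbl≡(suc n) = cong suc(cong suc(dbl≡ n)== sym(+-suc n n))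

 dbl-+ : ∀ m n -> dbl(m + n)≡ dbl m + dbl n
 dbl-+ zero n = refl
 dbl-+(suc m)n = cong (λ z -> suc(suc z))(dbl-+ m n)

 -- Binary digits, least significant first, without superfluous zeros.
 inc : List Bool -> List Bool
 inc [] = true ∷ []
 inc(false ∷ bs) = true ∷ bs
 inc(true ∷ bs) = false ∷ inc bs

 bits : ℕ -> List Bool
 bits zero = []
 bits(suc n) = inc(bits n)

 val : List Bool -> ℕ
 val [] = 0
 val(b ∷ bs) = b2n b + dbl(val bs)

 cons0 : Bool -> List Bool -> List Bool
 cons0 b bs = if b then true ∷ bs else listCase bs [] (λ _ _ -> false ∷ bs)

 cons0-inc : ∀ bs -> cons0 false(inc bs)≡ false ∷ inc bs
 cons0-inc [] = refl
 cons0-inc(false ∷ bs) = refl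
 cons0-inc(true ∷ bs) = refl

 inc-cons0 : ∀ bs -> inc(cons0 false bs)≡ true ∷ bs
 inc-cons0 [] = refl
 inc-cons0(_ ∷ bs) = refl

 bits-dbl : ∀ n -> bits(dbl n)≡ cons0 false(bits n)
 bits-dbl zero = refl
 bits-dbl(suc n) = cong(inc ∘ inc)(bits-dbl n)== cong inc(inc-cons0(bits n))== sym(cons0-inc(bits n))

 bits-cons : ∀ b n -> bits(b2n b + dbl n)≡ cons0 b(bits n)
 bits-cons false n = bits-dbl n
 bits-cons true n = cong inc(bits-dbl n)== inc-cons0(bits n)

 val-inc : ∀ bs -> val(inc bs)≡ suc(val bs)
 val-inc [] = refl
 val-inc(false ∷ bs) = refl
 val-inc(true ∷ bs) = cong dbl(val-inc bs)

 val-bits : ∀ n -> val(bits n)≡ n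
 val-bits zero = refl
 val-bits(suc n) = val-inc(bits n)== cong suc(val-bits n)

 half : ∀ n -> Σ[ b ∈ Bool ] Σ[ m ∈ ℕ ] n ≡ b2n b + dbl m
 half zero = false , 0 , refl
 half(suc n) with half n
 ... | false , m , refl = true , m , refl
 ... | true , m , refl = false , suc m , refl

 b2n≤1 : ∀ b -> b2n b ≤ 1
 b2n≤1 false = z≤n
 b2n≤1 true = ≤-refl

 2*-dbl : ∀ n -> 2 * n ≡ dbl n
 2*-dbl n = cong (λ z -> n + z)(+-identityʳ n)== sym(dbl≡ n)

 val<2^ : ∀ bs -> val bs < 2 ^ length bs
 val<2^ [] = ≤-refl
 val<2^(b ∷ bs) = s≤s(+-monoˡ-≤(dbl(val bs))(b2n≤1 b))<< sym(2*-dbl(suc(val bs)))=< *-monoʳ-≤ 2(val<2^ bs)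

 ∥_∥ᵇ : ℕ -> ℕ
 ∥ n ∥ᵇ = length(bits n)

 length-cons0 : ∀ b bs -> length(cons0 b bs)≤ suc(length bs)
 length-cons0 true bs = ≤-refl
 length-cons0 false [] = z≤n
 length-cons0 false(x ∷ bs) = ≤-refl

 bits-length : ∀ k n -> n < 2 ^ k -> ∥ n ∥ᵇ ≤ k
 bits-length zero zero h = z≤n
 bits-length zero(suc n)(s≤s())
 bits-length(suc k)n h with half n
 ... | b , m , refl rewrite bits-cons b m = length-cons0 b(bits m)<< s≤s(bits-length k m
  (*-cancelˡ-< 2 m(2 ^ k)(≤-<-trans(2*-dbl m =< m≤n+m(dbl m)(b2n b))h)))

 n<2^∥n∥ : ∀ n -> n < 2 ^ ∥ n ∥ᵇ
 n<2^∥n∥ n = subst(_< 2 ^ ∥ n ∥ᵇ)(val-bits n)(val<2^(bits n))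

 ∥*∥ : ∀ m n -> ∥ m * n ∥ᵇ ≤ ∥ m ∥ᵇ + ∥ n ∥ᵇ
 ∥*∥ m n = bits-length _ _ (*-mono-<(n<2^∥n∥ m)(n<2^∥n∥ n)<= sym(^-distribˡ-+-* 2 ∥ m ∥ᵇ ∥ n ∥ᵇ))

 ∥∥-mono : ∀ {m n} -> m ≤ n -> ∥ m ∥ᵇ ≤ ∥ n ∥ᵇ
 ∥∥-mono {m}{n}h = bits-length _ m(≤-<-trans h(n<2^∥n∥ n))

 1≤2^ : ∀ k -> 1 ≤ 2 ^ k
 1≤2^ k = m^n>0 2 k

 ∥+∥ : ∀ m n -> ∥ m + n ∥ᵇ ≤ suc(∥ m ∥ᵇ + ∥ n ∥ᵇ)
 ∥+∥ m n = bits-length _ _ (+-mono-<-≤(n<2^∥n∥ m << ^-monoʳ-≤ 2(m≤m+n ∥ m ∥ᵇ ∥ n ∥ᵇ))(<⇒≤ (n<2^∥n∥ n << ^-monoʳ-≤ 2(m≤n+m ∥ n ∥ᵇ ∥ m ∥ᵇ)))<=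
  cong (λ z -> 2 ^ (∥ m ∥ᵇ + ∥ n ∥ᵇ)+ z)(sym(+-identityʳ _)))

 ℕt : Ty
 ℕt = record { Car = ℕ ; enc = λ n -> enc(𝕃 𝔹)(bits n) }

 size-digits≤ : ∀ bs -> sz(𝕃 𝔹)bs ≤ suc(4 * length bs)
 size-digits≤ [] = ≤-refl
 size-digits≤(b ∷ bs) = s≤s(+-mono-≤(bool≤ b)(size-digits≤ bs))<= cong suc(sym(*-suc 4(length bs))) where
  bool≤ : ∀ b -> sz 𝔹 b ≤ 3
  bool≤ false = s≤s z≤n
  bool≤ true = ≤-refl

 size-digits≥ : ∀ bs -> suc(2 * length bs)≤ sz(𝕃 𝔹)bs
 size-digits≥ [] = ≤-refl
 size-digits≥(b ∷ bs) = s≤s(*-suc 2(length bs)=< +-mono-≤(1≤size(encBool b))(size-digits≥ bs))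

 asBits : Γ ⊢ ℕt -> Γ ⊢ 𝕃 𝔹
 asBits e = record { fun = λ γ -> bits(fun e γ) ; code = code e ; ok = ok e }

 asNat :(e : Γ ⊢ 𝕃 𝔹)(g : Env Γ -> ℕ) ->(∀ γ -> fun e γ ≡ bits(g γ)) -> Γ ⊢ ℕt
 asNat e g h = record { fun = g ; code = code e ; ok = λ γ δ eq -> ok e γ δ eq == cong(enc(𝕃 𝔹))(h γ) }

 notT : Γ ⊢ 𝔹 -> Γ ⊢ 𝔹
 notT a = recast(ifT a(constT false)(constT true))(λ γ -> not(fun a γ))(λ γ -> go(fun a γ)) where
  go : ∀ x ->(if x then false else true)≡ not x
  go true = refl
  go false = refl

 xorT : 𝔹 ∷ 𝔹 ∷ [] ⊢ 𝔹
 xorT = recast(ifT v0(notT v1)v1)(λ (a , b , _) -> a xor b) λ { (true , b , _) -> refl ; (false , b , _) -> refl }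

 majT : 𝔹 ∷ 𝔹 ∷ 𝔹 ∷ [] ⊢ 𝔹
 majT = ifT v0(ifT v1(constT true)v2)(ifT v1 v2(constT false))

 hd0 : List Bool -> Bool
 hd0 bs = listCase bs false (λ x _ -> x)

 tl0 : List Bool -> List Bool
 tl0 bs = listCase bs [] (λ _ xs -> xs)

 val-split : ∀ bs -> val bs ≡ b2n(hd0 bs)+ dbl(val(tl0 bs))
 val-split [] = refl
 val-split(b ∷ bs) = refl

 hdT : Γ ⊢ 𝕃 𝔹 -> Γ ⊢ 𝔹
 hdT l = caseT l(constT false)v0

 tlT : Γ ⊢ 𝕃 𝔹 -> Γ ⊢ 𝕃 𝔹
 tlT l = caseT l nilT v1

 DigitState : Ty
 DigitState = 𝕃 𝔹 ⊠ 𝕃 𝔹 ⊠ 𝔹 ⊠ 𝕃 𝔹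

 -- Digit-serial arithmetic: F maps two digits and a carry to a digit and a carry.
 digitStep :(Bool -> Bool -> Bool -> Bool × Bool) -> Car DigitState -> Car DigitState
 digitStep F(a , b , c , o) = tl0 a , tl0 b , proj₂(F(hd0 a)(hd0 b)c), proj₁(F(hd0 a)(hd0 b)c)∷ o

 digitRun :(Bool -> Bool -> Bool -> Bool × Bool) -> List Bool -> List Bool -> Car DigitState
 digitRun F a b = iter(digitStep F)(length a + length b)(a , b , false , [])

 digitsT :(F : 𝔹 ∷ 𝔹 ∷ 𝔹 ∷ [] ⊢ 𝔹 ⊠ 𝔹) -> 𝕃 𝔹 ∷ 𝕃 𝔹 ∷ [] ⊢ DigitState
 digitsT F = iterT-exact(call2 addT(lengthT v0)(lengthT v1))(pairT v0(pairT v1(pairT(constT false)nilT)))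
  (pairT(pairT(pairT v0 v1)(pairT v0 v1))(pairT(pairT v0 v1)(pairT v0 v1)))
  (letT(call3 F(hdT(fstT v0))(hdT(fstT(sndT v0)))(fstT(sndT(sndT v0))))
   (pairT(tlT(fstT v1))(pairT(tlT(fstT(sndT v1)))(pairT(sndT v0)(consT(fstT v0)(sndT(sndT(sndT v1))))))))
  (λ (a , b , _) -> digitRun (λ x y z -> fun F(x , y , z , tt))a b)
  (λ (a , b , _)k k< -> bound a b(suc k)<< +-monoʳ-≤(size' a + size' b)(+-monoˡ-≤ 7(*-monoʳ-≤ 4 k<))<< fits a b)
  (λ _ -> refl) where
  G : Bool -> Bool -> Bool -> Bool × Bool
  G x y z = fun F(x , y , z , tt)
  size' = sz(𝕃 𝔹)
  tl-size : ∀ a -> size'(tl0 a)≤ size' a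
  tl-size [] = ≤-refl
  tl-size(b ∷ a) = m≤n+m(size' a)(sz 𝔹 b)<< n≤1+n _
  bool≤ : ∀ b -> sz 𝔹 b ≤ 3
  bool≤ false = s≤s z≤n
  bool≤ true = ≤-refl
  inv : ∀ a b k -> let (a' , b' , c , o) = iter(digitStep G)k(a , b , false , []) in
   size' a' ≤ size' a × size' b' ≤ size' b × size' o ≤ suc(4 * k)
  inv a b zero = ≤-refl , ≤-refl , ≤-refl
  inv a b(suc k) with iter(digitStep G)k(a , b , false , []) | inv a b k
  ... | a' , b' , c , o | p , q , r = tl-size a' << p , tl-size b' << q ,
   s≤s(+-mono-≤(bool≤ _)r)<= cong suc(sym(*-suc 4 k))
  bound : ∀ a b k -> sz DigitState(iter(digitStep G)k(a , b , false , []))≤ size' a + size' b +(4 * k + 7)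
  bound a b k with iter(digitStep G)k(a , b , false , []) | inv a b k
  ... | a' , b' , c , o | p , q , r = s≤s(+-mono-≤ p(s≤s(+-mono-≤ q(s≤s(+-mono-≤(bool≤ c)r)))))<= eq(size' a)(size' b)k where
   eq : ∀ x y k -> suc(x + suc(y + suc(3 + suc(4 * k))))≡ x + y +(4 * k + 7)
   eq = ring
  fits : ∀ a b -> size' a + size' b +(4 *(length a + length b)+ 7)≤ suc(suc(suc(size' a + size' b)+ suc(size' a + size' b))+ suc(suc(size' a + size' b)+ suc(size' a + size' b)))
  fits a b = +-monoʳ-≤(size' a + size' b)(eq(length a)(length b)=< s≤s(s≤s(s≤s(+-mono-≤(*-monoʳ-≤ 2(size-digits≥ a))(*-monoʳ-≤ 2(size-digits≥ b))))))<<
   ≤-by(4 +(size' a + size' b))(eq'(size' a)(size' b)) where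
   eq : ∀ x y -> 4 *(x + y)+ 7 ≡ 3 +(2 * suc(2 * x)+ 2 * suc(2 * y))
   eq = ring
   eq' : ∀ x y -> x + y +(3 +(2 * x + 2 * y))+(4 +(x + y))≡ suc(suc(suc(x + y)+ suc(x + y))+ suc(suc(x + y)+ suc(x + y)))
   eq' = ring

 -- The number with digits o, given from the most significant one and preceded by r.
 above : List Bool -> ℕ -> ℕ
 above [] r = r
 above(d ∷ o)r = above o(b2n d + dbl r)

 above-linear : ∀ o r -> above o r ≡ above o 0 + 2 ^ length o * r
 above-linear [] r = sym(+-identityʳ r)
 above-linear(d ∷ o)r = above-linear o(b2n d + dbl r)== cong (λ z -> above o 0 + 2 ^ length o *(b2n d + z))(sym(2*-dbl r))==
  eq(above o 0)(2 ^ length o)(b2n d)r == cong(_+ 2 ^ length(d ∷ o)* r)(cong (λ z -> above o 0 + 2 ^ length o * z)(sym(+-identityʳ(b2n d)))== sym(above-linear o(b2n d + 0))) where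
  eq : ∀ a p d r -> a + p *(d + 2 * r)≡(a + p * d)+(2 * p)* r
  eq = ring

 above-<2^ : ∀ o -> above o 0 < 2 ^ length o
 above-<2^ [] = ≤-refl
 above-<2^(d ∷ o) = subst (λ z -> z < 2 ^ suc(length o))(sym(above-linear o(b2n d + 0)))
  (+-mono-<-≤(above-<2^ o)(*-monoʳ-≤(2 ^ length o)(+-identityʳ(b2n d)=< b2n≤1 d))<= eq(2 ^ length o)) where
  eq : ∀ p -> p + p * 1 ≡ 2 * p
  eq = ring

 cons0T : 𝔹 ∷ 𝕃 𝔹 ∷ [] ⊢ 𝕃 𝔹
 cons0T = ifT v0(consT(constT true)v1)(caseT v1 nilT(consT(constT false)v3))

 normT : 𝕃 𝔹 ∷ ℕt ∷ [] ⊢ ℕt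
 normT = asNat(foldrT-exact(reverseT v0)(asBits v1)(pairT(pairT v0 v0)(asBits v1))(call2 cons0T v0 v1)
  (λ (o , r , _) -> List.foldr cons0(bits r)(reverse o))(λ (o , r , _)xs -> 4 * length xs + sz ℕt r)
  (λ (_ , r , _)x xs -> +-monoˡ-≤(sz ℕt r)(*-monoʳ-≤ 4(n≤1+n _)))
  (λ (_ , r , _)x xs -> size-foldr r(x ∷ xs))
  (λ (o , r , _) -> +-monoˡ-≤(sz ℕt r)(*-monoʳ-≤ 4(≤-reflexive(List.length-reverse o))<< lem o << n≤1+n _)<< n≤1+n _)
  (λ _ -> refl))
  (λ (o , r , _) -> above o r)
  (λ (o , r , _) -> List.reverse-foldr cons0(bits r)o == go o r) where
  lem : ∀ o -> 4 * length o ≤ sz(𝕃 𝔹)o + sz(𝕃 𝔹)o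
  lem o = ≤-by 2(eq(length o))<< +-mono-≤(size-digits≥ o)(size-digits≥ o) where
   eq : ∀ n -> 4 * n + 2 ≡ suc(2 * n)+ suc(2 * n)
   eq = ring
  size-cons0 : ∀ b bs -> sz(𝕃 𝔹)(cons0 b bs)≤ 4 + sz(𝕃 𝔹)bs
  size-cons0 true bs = ≤-refl
  size-cons0 false [] = s≤s z≤n
  size-cons0 false(x ∷ bs) = s≤s(s≤s(n≤1+n _ << n≤1+n _))
  size-foldr : ∀ r xs -> sz(𝕃 𝔹)(List.foldr cons0(bits r)xs)≤ 4 * length xs + sz ℕt r
  size-foldr r [] = ≤-refl
  size-foldr r(x ∷ xs) = size-cons0 x(List.foldr cons0(bits r)xs)<< +-monoʳ-≤ 4(size-foldr r xs)<=
   sym(+-assoc 4(4 * length xs)(sz ℕt r))== cong(_+ sz ℕt r)(sym(*-suc 4(length xs)))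
  go : ∀ o r -> List.foldl (λ acc d -> cons0 d acc)(bits r)o ≡ bits(above o r)
  go [] r = refl
  go(d ∷ o)r = cong (λ z -> List.foldl (λ acc d -> cons0 d acc)z o)(sym(bits-cons d r))== go o(b2n d + dbl r)

 fullAdd fullSub : Bool -> Bool -> Bool -> Bool × Bool
 fullAdd a b c = a xor(b xor c),(if a then (if b then true else c) else (if b then c else false))
 fullSub a b c = a xor(b xor c),(if not a then (if b then true else c) else (if b then c else false))

 fullAddT fullSubT : 𝔹 ∷ 𝔹 ∷ 𝔹 ∷ [] ⊢ 𝔹 ⊠ 𝔹
 fullAddT = pairT(call2 xorT v0(call2 xorT v1 v2))(call3 majT v0 v1 v2)
 fullSubT = pairT(call2 xorT v0(call2 xorT v1 v2))(call3 majT(notT v0)v1 v2)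

 fullAdd-val : ∀ a b c -> let (d , e) = fullAdd a b c in b2n a + b2n b + b2n c ≡ b2n d + dbl(b2n e)
 fullAdd-val false false false = refl
 fullAdd-val false false true = refl
 fullAdd-val false true false = refl
 fullAdd-val false true true = refl
 fullAdd-val true false false = refl
 fullAdd-val true false true = refl
 fullAdd-val true true false = refl
 fullAdd-val true true true = refl

 fullSub-val : ∀ a b c -> let (d , e) = fullSub a b c in b2n a + dbl(b2n e)≡ b2n d +(b2n b + b2n c)
 fullSub-val false false false = refl
 fullSub-val false false true = refl
 fullSub-val false true false = refl
 fullSub-val false true true = refl
 fullSub-val true false false = refl
 fullSub-val true false true = refl
 fullSub-val true true false = refl
 fullSub-val true true true = refl

 length-tl0 : ∀ a -> length(tl0 a)≡ pred(length a)
 length-tl0 [] = refl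
 length-tl0(_ ∷ a) = refl

 digit-lengths : ∀ F a b c o k -> let (a' , b' , _ , _) = iter(digitStep F)k(a , b , c , o) in
  length a' ≡ length a ∸ k × length b' ≡ length b ∸ k
 digit-lengths F a b c o zero = refl , refl
 digit-lengths F a b c o(suc k) with iter(digitStep F)k(a , b , c , o) | digit-lengths F a b c o k
 ... | a' , b' , _ | p , q = length-tl0 a' == cong pred p == pred[m∸n]≡m∸[1+n](length a)k ,
  length-tl0 b' == cong pred q == pred[m∸n]≡m∸[1+n](length b)k

 empty : ∀ {X : Set}(xs : List X) -> length xs ≡ 0 -> xs ≡ []
 empty [] _ = refl

 digits-done : ∀ F a b -> let (a' , b' , _ , _) = digitRun F a b in a' ≡ [] × b' ≡ []
 digits-done F a b with digit-lengths F a b false [] (length a + length b)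
 ... | p , q = empty _ (p == m≤n⇒m∸n≡0(m≤m+n(length a)(length b))), empty _ (q == m≤n⇒m∸n≡0(m≤n+m(length b)(length a)))

 addDigits : List Bool -> List Bool -> ℕ
 addDigits a b = let (_ , _ , c , o) = digitRun fullAdd a b in above o(b2n c)

 addDigits≡ : ∀ a b -> addDigits a b ≡ val a + val b
 addDigits≡ a b with digitRun fullAdd a b | digits-done fullAdd a b | inv(length a + length b) where
  inv : ∀ k -> let (a' , b' , c , o) = iter(digitStep fullAdd)k(a , b , false , []) in above o(val a' + val b' + b2n c)≡ val a + val b
  inv zero = +-identityʳ _
  inv(suc k) with iter(digitStep fullAdd)k(a , b , false , []) | inv k
  ... | a' , b' , c , o | h = cong(above o)(sym stage)== h where
   d = proj₁(fullAdd(hd0 a')(hd0 b')c)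
   e = proj₂(fullAdd(hd0 a')(hd0 b')c)
   eq : ∀ x x' y y' c -> x + x' +(y + y')+ c ≡ x + y + c +(x' + y')
   eq = ring
   eq' : ∀ d e z -> d + e + z ≡ d +(z + e)
   eq' = ring
   stage = cong₂ (λ x y -> x + y + b2n c)(val-split a')(val-split b')==
    eq(b2n(hd0 a'))(dbl(val(tl0 a')))(b2n(hd0 b'))(dbl(val(tl0 b')))(b2n c)==
    (cong₂ _+_ (fullAdd-val(hd0 a')(hd0 b')c)(sym(dbl-+(val(tl0 a'))(val(tl0 b')))))==
    eq'(b2n d)(dbl(b2n e))_ ==
    cong(b2n d +_)(sym(dbl-+(val(tl0 a')+ val(tl0 b'))(b2n e)))
 ... | _ , _ , c , o | refl , refl | h = h

 bitT : 𝔹 ∷ [] ⊢ ℕt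
 bitT = asNat(ifT v0(consT(constT true)nilT)nilT)(λ (b , _) -> b2n b) λ { (true , _) -> refl ; (false , _) -> refl }

 addℕ : ℕt ∷ ℕt ∷ [] ⊢ ℕt
 addℕ = recast(letT(call2(digitsT fullAddT)(asBits v0)(asBits v1))(call2 normT(sndT(sndT(sndT v0)))(call1 bitT(fstT(sndT(sndT v0))))))
  (λ (m , n , _) -> m + n)
  (λ (m , n , _) -> addDigits≡(bits m)(bits n)==(cong₂ _+_ (val-bits m)(val-bits n)))

 -- A final borrow signals a < b.
 subDigits : ∀ a b -> let (_ , _ , c , o) = digitRun fullSub a b in
  val a + 2 ^ length o * b2n c ≡ val b + above o 0
 subDigits a b with digitRun fullSub a b | digits-done fullSub a b | inv(length a + length b) where
  inv : ∀ k -> let (a' , b' , c , o) = iter(digitStep fullSub)k(a , b , false , []) in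
   val a + 2 ^ length o *(val b' + b2n c)≡ val b +(above o 0 + 2 ^ length o * val a')
  inv zero = cong(val a +_)(+-identityʳ _ == +-identityʳ _)== +-comm(val a)(val b)== cong(val b +_)(sym(+-identityʳ(val a)))
  inv(suc k) with iter(digitStep fullSub)k(a , b , false , []) | inv k
  ... | a' , b' , c , o | h = +-cancelʳ-≡(p * b2n x)_ _ ( eq1(val a)p w(b2n e)(b2n x)==
   cong (λ z -> val a + p *(2 * w +(b2n x + z)))(2*-dbl(b2n e))==
   cong (λ z -> val a + p *(2 * w + z))(fullSub-val x y c)==
   eq2(val a)p w(b2n d)(b2n y)(b2n c)==
   cong (λ z -> val a + p *(z + b2n c)+ p * b2n d)(sym(halves° b'))==
   cong(_+ p * b2n d)h ==
   cong (λ z -> val b +(above o 0 + p * z)+ p * b2n d)(halves° a')==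
   eq3(val b)(above o 0)p(b2n x)u(b2n d)==
   cong (λ z -> val b +(z +(2 * p)* u)+ p * b2n x)(sym(above-linear o(b2n d))== cong(above o)(sym(+-identityʳ(b2n d))))) where
   x = hd0 a'
   y = hd0 b'
   u = val(tl0 a')
   w = val(tl0 b')
   p = 2 ^ length o
   d = proj₁(fullSub x y c)
   e = proj₂(fullSub x y c)
   halves° : ∀ l -> val l ≡ b2n(hd0 l)+ 2 * val(tl0 l)
   halves° l = val-split l == cong(b2n(hd0 l) +_)(sym(2*-dbl(val(tl0 l))))
   eq1 : ∀ a p w e x -> a +(2 * p)*(w + e)+ p * x ≡ a + p *(2 * w +(x + 2 * e))
   eq1 = ring
   eq2 : ∀ a p w d y c -> a + p *(2 * w +(d +(y + c)))≡ a + p *(y + 2 * w + c)+ p * d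
   eq2 = ring
   eq3 : ∀ b o p x u d -> b +(o + p *(x + 2 * u))+ p * d ≡ b +((o + p * d)+(2 * p)* u)+ p * x
   eq3 = ring
 ... | _ , _ , c , o | refl , refl | h = h == cong(val b +_)(cong(above o 0 +_)(*-zeroʳ(2 ^ length o))== +-identityʳ _)

 <ᵇ-true : ∀ {m n} -> m < n ->(m <ᵇ n)≡ true
 <ᵇ-true h = Equivalence.to T-≡(<⇒<ᵇ h)

 <ᵇ-false : ∀ {m n} -> n ≤ m ->(m <ᵇ n)≡ false
 <ᵇ-false {m}{n}h with m <ᵇ n in eq
 ... | false = refl
 ... | true = contradiction(<ᵇ⇒< m n(Equivalence.from T-≡ eq))(≤⇒≯ h)

 borrow-spec : ∀ m n -> let (_ , _ , c , o) = digitRun fullSub(bits m)(bits n) in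
  c ≡(m <ᵇ n)× (if c then 0 else above o 0)≡ m ∸ n
 borrow-spec m n with digitRun fullSub(bits m)(bits n) | subDigits(bits m)(bits n)
 ... | _ , _ , false , o | h = sym(<ᵇ-false(m≤m+n n _ <= sym h')), sym(m+n∸m≡n n(above o 0))== cong(_∸ n)(sym h') where
  h' = sym(val-bits m)== sym(+-identityʳ _)== cong(val(bits m) +_)(sym(*-zeroʳ(2 ^ length o)))== h == cong(_+ above o 0)(val-bits n)
 ... | _ , _ , true , o | h = sym(<ᵇ-true m<n), sym(m≤n⇒m∸n≡0(<⇒≤ m<n)) where
  h' =(cong₂ _+_ (sym(val-bits m))(sym(*-identityʳ(2 ^ length o))))== h == cong(_+ above o 0)(val-bits n)
  m<n = +-cancelʳ-<(2 ^ length o)m n(s≤s(≤-reflexive h')<< sym(+-suc n(above o 0))=< +-monoʳ-≤ n(above-<2^ o))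

 subDigitsT : 𝕃 𝔹 ∷ 𝕃 𝔹 ∷ [] ⊢ DigitState
 subDigitsT = digitsT fullSubT

 subT : ℕt ∷ ℕt ∷ [] ⊢ ℕt
 subT = recast(letT(call2 subDigitsT(asBits v0)(asBits v1))(ifT(fstT(sndT(sndT v0)))(constT 0)(call2 normT(sndT(sndT(sndT v0)))(constT 0))))
  (λ (m , n , _) -> m ∸ n)(λ (m , n , _) -> proj₂(borrow-spec m n))

 ltT : ℕt ∷ ℕt ∷ [] ⊢ 𝔹
 ltT = recast(letT(call2 subDigitsT(asBits v0)(asBits v1))(fstT(sndT(sndT v0))))
  (λ (m , n , _) -> m <ᵇ n)(λ (m , n , _) -> proj₁(borrow-spec m n))

 size-ℕ≤ : ∀ n -> sz ℕt n ≤ suc(4 * ∥ n ∥ᵇ)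
 size-ℕ≤ n = size-digits≤(bits n)

 size-ℕ≥ : ∀ n -> suc(2 * ∥ n ∥ᵇ)≤ sz ℕt n
 size-ℕ≥ n = size-digits≥(bits n)

 mulℕ : ℕt ∷ ℕt ∷ [] ⊢ ℕt
 mulℕ = foldrT-exact(asBits v0)(constT 0)(pairT(pairT v0 v1)(pairT v0 v1))
  (letT(call2 addℕ v1 v1)(ifT v1(call2 addℕ v4 v0)v0))
  (λ (m , n , _) -> m * n)
  (λ (_ , n , _)l -> suc(4 *(length l + ∥ n ∥ᵇ)))
  (λ _ x xs -> s≤s(*-monoʳ-≤ 4(n≤1+n _)))
  (λ (_ , n , _)x xs -> size-ℕ≤(List.foldr(horner n)0(x ∷ xs))<< s≤s(*-monoʳ-≤ 4(∥∥-mono(≤-reflexive(go n(x ∷ xs)))<<(∥*∥ (val(x ∷ xs))n)<<(+-monoˡ-≤ ∥ n ∥ᵇ(bits-length _ _ (val<2^(x ∷ xs)))))))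
  (λ (m , n , _) -> ≤-by 6(eq ∥ m ∥ᵇ ∥ n ∥ᵇ)<< s≤s(+-mono-≤(s≤s(+-mono-≤(size-ℕ≥ m)(size-ℕ≥ n)))(s≤s(+-mono-≤(size-ℕ≥ m)(size-ℕ≥ n)))))
  (λ (m , n , _) -> go n(bits m)== cong(_* n)(val-bits m)) where
  eq : ∀ a b -> suc(4 *(a + b))+ 6 ≡ suc(suc(suc(2 * a)+ suc(2 * b))+ suc(suc(2 * a)+ suc(2 * b)))
  eq = ring
  horner : ℕ -> Bool -> ℕ -> ℕ
  horner n a s = if a then n +(s + s) else (s + s)
  go : ∀ n l -> List.foldr(horner n)0 l ≡ val l * n
  go n [] = refl
  go n(false ∷ l) rewrite go n l | dbl≡(val l) = sym(*-distribʳ-+ n(val l)(val l))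
  go n(true ∷ l) rewrite go n l | dbl≡(val l) = cong(n +_)(sym(*-distribʳ-+ n(val l)(val l)))

 open import Data.Integer.Base using (-[1+_]; ∣_∣)
 open import Data.List.Base using (_ʳ++_; zip; zipWith)
 import Data.Sign.Base as Sign
 open Machines using (node)
 open Machines

 isNeg : ℤ -> Bool
 isNeg(Z.+ _) = false
 isNeg -[1+ _ ] = true

 ℤt : Ty
 ℤt = record { Car = ℤ ; enc = λ z -> node(encBool(isNeg z))(enc ℕt ∣ z ∣) }

 asInt :(e : Γ ⊢ 𝔹 ⊠ ℕt)(g : Env Γ -> ℤ) ->(∀ γ -> fun e γ ≡(isNeg(g γ), ∣ g γ ∣)) -> Γ ⊢ ℤt
 asInt e g h = record { fun = g ; code = code e ; ok = λ γ δ eq -> ok e γ δ eq == cong(enc(𝔹 ⊠ ℕt))(h γ) }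

 fromInt : Γ ⊢ ℤt -> Γ ⊢ 𝔹 ⊠ ℕt
 fromInt e = record { fun = λ γ -> isNeg(fun e γ), ∣ fun e γ ∣ ; code = code e ; ok = ok e }

 negativeT : Γ ⊢ ℤt -> Γ ⊢ 𝔹
 negativeT e = fstT(fromInt e)

 absT : Γ ⊢ ℤt -> Γ ⊢ ℕt
 absT e = sndT(fromInt e)

 signed : Bool -> ℕ -> ℤ
 signed true n = Z.- (Z.+ n)
 signed false n = Z.+ n

 signedT : 𝔹 ∷ ℕt ∷ [] ⊢ ℤt
 signedT = asInt(pairT(caseT(asBits v1)(constT false)v2)v1)(λ (s , n , _) -> signed s n)(λ (s , n , _) -> go s n) where
  inc-case : ∀ bs (s : Bool) -> listCase(inc bs)false (λ _ _ -> s)≡ s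
  inc-case [] s = refl
  inc-case(false ∷ bs)s = refl
  inc-case(true ∷ bs)s = refl
  go : ∀ s n ->(listCase(bits n)false (λ _ _ -> s), n)≡(isNeg(signed s n), ∣ signed s n ∣)
  go false zero = refl
  go true zero = refl
  go false(suc n) = cong(_, suc n)(inc-case(bits n)false)
  go true(suc n) = cong(_, suc n)(inc-case(bits n)true)

 natℤ : Γ ⊢ ℕt -> Γ ⊢ ℤt
 natℤ e = asInt(pairT(constT false)e)(λ γ -> Z.+ fun e γ)(λ γ -> refl)

 addSigned : Bool -> ℕ -> Bool -> ℕ -> ℤ
 addSigned s m t n = if s xor t then (if m <ᵇ n then signed t(n ∸ m) else signed s(m ∸ n)) else signed s(m + n)

 diff : ∀ m n ->(if m <ᵇ n then Z.- (Z.+ (n ∸ m)) else Z.+ (m ∸ n))≡ m Z.⊖ n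
 diff m n with m <ᵇ n
 ... | true = refl
 ... | false = refl

 addSigned≡ : ∀ x y -> addSigned(isNeg x)(∣ x ∣)(isNeg y)(∣ y ∣)≡ x Z.+ y
 addSigned≡(Z.+ m)(Z.+ n) = refl
 addSigned≡(Z.+ m)-[1+ n ] = diff m(suc n)
 addSigned≡ -[1+ m ] (Z.+ n) = swap(suc m)n == sym(Z.⊖-swap n(suc m)) where
  swap : ∀ m n ->(if m <ᵇ n then Z.+ (n ∸ m) else Z.- (Z.+ (m ∸ n)))≡ Z.- (m Z.⊖ n)
  swap m n with m <ᵇ n
  ... | true = sym(Z.neg-involutive _)
  ... | false = refl
 addSigned≡ -[1+ m ] -[1+ n ] = cong -[1+_](+-suc m n)

 addℤ : ℤt ∷ ℤt ∷ [] ⊢ ℤt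
 addℤ = recast
  (ifT(call2 xorT(negativeT v0)(negativeT v1))
   (ifT(call2 ltT(absT v0)(absT v1))(call2 signedT(negativeT v1)(call2 subT(absT v1)(absT v0)))(call2 signedT(negativeT v0)(call2 subT(absT v0)(absT v1))))
   (call2 signedT(negativeT v0)(call2 addℕ(absT v0)(absT v1))))
  (λ (x , y , _) -> x Z.+ y)(λ (x , y , _) -> addSigned≡ x y)

 mulℤ : ℤt ∷ ℤt ∷ [] ⊢ ℤt
 mulℤ = recast(call2 signedT(call2 xorT(negativeT v0)(negativeT v1))(call2 mulℕ(absT v0)(absT v1)))(λ (x , y , _) -> x Z.* y)(λ (x , y , _) -> go x y) where
  neg-signed : ∀ n -> Z.- (Z.+ n)≡ Sign.- Z.◃ n
  neg-signed zero = refl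
  neg-signed(suc n) = refl
  go : ∀ x y -> signed(isNeg x xor isNeg y)(∣ x ∣ * ∣ y ∣)≡ x Z.* y
  go(Z.+ m)(Z.+ n) = sym(Z.+◃n≡+n(m * n))
  go(Z.+ m)-[1+ n ] = neg-signed(m * suc n)
  go -[1+ m ] (Z.+ n) = neg-signed(suc m * n)
  go -[1+ m ] -[1+ n ] = refl

 negℤ : Γ ⊢ ℤt -> Γ ⊢ ℤt
 negℤ e = recast(call2 signedT(notT(negativeT e))(absT e))(λ γ -> Z.- fun e γ)(λ γ -> go(fun e γ)) where
  go : ∀ x -> signed(not(isNeg x)) ∣ x ∣ ≡ Z.- x
  go(Z.+ zero) = refl
  go(Z.+ (suc n)) = refl
  go -[1+ n ] = refl

 infixl 6 _+t_
 infixl 7 _*t_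
 _+t_ _*t_ : Γ ⊢ ℤt -> Γ ⊢ ℤt -> Γ ⊢ ℤt
 _+t_ = call2 addℤ
 _*t_ = call2 mulℤ

 infix 5 _≤t_
 opaque
  _≤?b_ : ℤ -> ℤ -> Bool
  x ≤?b y = not(isNeg(y Z.+ Z.- x))

  ≤?b-def : ∀ x y -> not(isNeg(y Z.+ Z.- x))≡(x ≤?b y)
  ≤?b-def x y = refl

 _≤t_ : Γ ⊢ ℤt -> Γ ⊢ ℤt -> Γ ⊢ 𝔹
 x ≤t y = recast(notT(negativeT(y +t negℤ x)))(λ γ -> fun x γ ≤?b fun y γ)(λ γ -> ≤?b-def(fun x γ)(fun y γ))

 ∥_∥z : ℤ -> ℕ
 ∥ z ∥z = ∥ ∣ z ∣ ∥ᵇ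

 ∥+∥z : ∀ x y -> ∥ x Z.+ y ∥z ≤ suc(∥ x ∥z + ∥ y ∥z)
 ∥+∥z x y = ∥∥-mono(Z.∣i+j∣≤∣i∣+∣j∣ x y)<<(∥+∥ ∣ x ∣ ∣ y ∣)

 ∥*∥z : ∀ x y -> ∥ x Z.* y ∥z ≤ ∥ x ∥z + ∥ y ∥z
 ∥*∥z x y = cong ∥_∥ᵇ(Z.abs-* x y)=<(∥*∥ ∣ x ∣ ∣ y ∣)

 size-ℤ≤ : ∀ z -> sz ℤt z ≤ 5 + 4 * ∥ z ∥z
 size-ℤ≤ z = s≤s(+-mono-≤(bool≤(isNeg z))(size-ℕ≤ ∣ z ∣)) where
  bool≤ : ∀ b -> sz 𝔹 b ≤ 3
  bool≤ false = s≤s z≤n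
  bool≤ true = ≤-refl

 size-ℤ≥ : ∀ z -> 3 + 2 * ∥ z ∥z ≤ sz ℤt z
 size-ℤ≥ z = s≤s(+-mono-≤(1≤size(encBool(isNeg z)))(size-ℕ≥ ∣ z ∣))

 quadT : Γ ⊢ A -> Γ ⊢ (A ⊠ A) ⊠ (A ⊠ A)
 quadT e = pairT(pairT e e)(pairT e e)

 quad : ∀ {x m} -> m ≤ x -> 3 + 4 * m ≤ suc(suc(x + x)+ suc(x + x))
 quad {x}{m}h = +-monoʳ-≤ 3(*-monoʳ-≤ 4 h)<= eq x where
  eq : ∀ x -> 3 + 4 * x ≡ suc(suc(x + x)+ suc(x + x))
  eq = ring

 bitsum : List ℤ -> ℕ
 bitsum [] = 0
 bitsum(z ∷ zs) = suc ∥ z ∥z + bitsum zs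

 size-vec≥ : ∀ zs -> suc(2 * bitsum zs)≤ sz(𝕃 ℤt)zs
 size-vec≥ [] = ≤-refl
 size-vec≥(z ∷ zs) = s≤s(≤-by 0(+-identityʳ _ ==(eq ∥ z ∥z(bitsum zs)))<< +-mono-≤(n≤1+n _ << size-ℤ≥ z)(n≤1+n _ << size-vec≥ zs)) where
  eq : ∀ a b -> 2 *(suc a + b)≡ 2 + 2 * a + 2 * b
  eq = ring

 size-vec≤ : ∀ zs -> sz(𝕃 ℤt)zs ≤ suc(6 * bitsum zs)
 size-vec≤ [] = ≤-refl
 size-vec≤(z ∷ zs) = s≤s(+-mono-≤(size-ℤ≤ z)(size-vec≤ zs)<< ≤-by(2 * ∥ z ∥z)(eq ∥ z ∥z(bitsum zs))) where
  eq : ∀ a b -> 5 + 4 * a + suc(6 * b)+ 2 * a ≡ 6 *(suc a + b)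
  eq = ring

 sumℤ prodℤ : List ℤ -> ℤ
 sumℤ = List.foldr Z._+_ 0ℤ
 prodℤ = List.foldr Z._*_ 1ℤ

 sumT : 𝕃 ℤt ∷ [] ⊢ ℤt
 sumT = foldrT-exact v0(constT 0ℤ)(quadT v0)(v0 +t v1)(λ (zs , _) -> sumℤ zs)(λ _ zs -> 5 + 4 * bitsum zs)
  (λ _ z zs -> +-monoʳ-≤ 5(*-monoʳ-≤ 4(m≤n+m(bitsum zs)(suc ∥ z ∥z))))
  (λ _ z zs -> size-ℤ≤(sumℤ(z ∷ zs))<< +-monoʳ-≤ 5(*-monoʳ-≤ 4(go(z ∷ zs))))
  (λ (zs , _) -> ≤-by(2 + 4 * bitsum zs)(eq(bitsum zs))<< quad(size-vec≥ zs))
  (λ _ -> refl) where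
  eq : ∀ b -> 5 + 4 * b +(2 + 4 * b)≡ 3 + 4 * suc(2 * b)
  eq = ring
  go : ∀ zs -> ∥ sumℤ zs ∥z ≤ bitsum zs
  go [] = z≤n
  go(z ∷ zs) = ∥+∥z z(sumℤ zs)<< s≤s(+-monoʳ-≤ ∥ z ∥z(go zs))

 prodT : 𝕃 ℤt ∷ [] ⊢ ℤt
 prodT = foldrT-exact v0(constT 1ℤ)(quadT(pairT v0 v0))(v0 *t v1)(λ (zs , _) -> prodℤ zs)(λ _ zs -> 9 + 4 * bitsum zs)
  (λ _ z zs -> +-monoʳ-≤ 9(*-monoʳ-≤ 4(m≤n+m(bitsum zs)(suc ∥ z ∥z))))
  (λ _ z zs -> size-ℤ≤(prodℤ(z ∷ zs))<< +-monoʳ-≤ 5(*-monoʳ-≤ 4(go(z ∷ zs)))<= cong(5 +_)(*-suc 4(bitsum(z ∷ zs))))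
  (λ (zs , _) -> ≤-by(6 + 12 * bitsum zs)(eq(bitsum zs))<< quad(s≤s(+-mono-≤(size-vec≥ zs)(size-vec≥ zs))))
  (λ _ -> refl) where
  eq : ∀ b -> 9 + 4 * b +(6 + 12 * b)≡ 3 + 4 * suc(suc(2 * b)+ suc(2 * b))
  eq = ring
  go : ∀ zs -> ∥ prodℤ zs ∥z ≤ suc(bitsum zs)
  go [] = ≤-refl
  go(z ∷ zs) = ∥*∥z z(prodℤ zs)<<(+-monoʳ-≤ ∥ z ∥z(go zs))<<(+-suc ∥ z ∥z(bitsum zs))=< n≤1+n _

 size-reverse : ∀ (xs ys : List(Car A)) -> suc(sz(𝕃 A)(xs ʳ++ ys))≡ sz(𝕃 A)xs + sz(𝕃 A)ys
 size-reverse [] ys = refl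
 size-reverse {A}(x ∷ xs)ys = size-reverse {A}xs(x ∷ ys)== eq(sz(𝕃 A)xs)(sz A x)(sz(𝕃 A)ys) where
  eq : ∀ a x b -> a + suc(x + b)≡ suc(x + a)+ b
  eq = ring

 size-rev : ∀ xs -> sz(𝕃 A)(reverse xs)≡ sz(𝕃 A)xs
 size-rev {A}xs = suc-injective(size-reverse {A}xs [] == +-comm(sz(𝕃 A)xs)1)

 zipT : 𝕃 A ∷ 𝕃 B ∷ [] ⊢ 𝕃(A ⊠ B)
 zipT {A}{B} = recast(reverseT(sndT run°))(λ (as , bs , _) -> zip as bs)
  (λ (as , bs , _) -> cong (λ s -> reverse(proj₂ s))(List.reverse-foldr stage(bs , [])as)==
   cong reverse(go as bs [])== List.reverse-involutive(zip as bs)) where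
  stage : Car A -> List(Car B)× List(Car A × Car B) -> List(Car B)× List(Car A × Car B)
  stage a(bs , o) = listCase bs(bs , o)(λ b bs' -> bs' ,(a , b)∷ o)
  bound : ∀ bs l -> let (bs' , o) = List.foldr stage(bs , [])l in sz(𝕃 B)bs' + sz(𝕃(A ⊠ B))o ≤ sz(𝕃 A)l + sz(𝕃 B)bs
  bound bs [] = ≤-reflexive(+-comm(sz(𝕃 B)bs)1)
  bound bs(a ∷ l) with List.foldr stage(bs , [])l | bound bs l
  ... | [] , o | h = h << +-monoˡ-≤(sz(𝕃 B)bs)(m≤n+m(sz(𝕃 A)l)(sz A a)<< n≤1+n _)
  ... | b ∷ bs' , o | h = eq(sz(𝕃 B)bs')(sz A a)(sz B b)(sz(𝕃(A ⊠ B))o)=<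
   +-monoʳ-≤(suc(sz A a))h <= sym(cong suc(+-assoc(sz A a)(sz(𝕃 A)l)(sz(𝕃 B)bs))) where
   eq : ∀ s a b o -> s + suc(suc(a + b)+ o)≡ suc a +(suc(b + s)+ o)
   eq = ring
  run° = foldrT-exact(reverseT v0)(pairT v1 nilT)(pairT v0 v1)
   (caseT(fstT v1)v1(pairT v1(consT(pairT v2 v0)(sndT v3))))
   (λ (as , bs , _) -> List.foldr stage(bs , [])(reverse as))
   (λ (_ , bs , _)l -> suc(sz(𝕃 A)l + sz(𝕃 B)bs))
   (λ (_ , bs , _)x xs -> s≤s(+-monoˡ-≤ _ (m≤n+m(sz(𝕃 A)xs)(sz A x)<< n≤1+n _)))
   (λ (_ , bs , _)x xs -> s≤s(bound bs(x ∷ xs)))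
   (λ (as , bs , _) -> ≤-reflexive(cong (λ z -> suc(z + sz(𝕃 B)bs))(size-rev {A}as)))
   (λ _ -> refl)
  go : ∀ as bs o -> proj₂(List.foldl (λ s a -> stage a s)(bs , o)as)≡ zip as bs ʳ++ o
  go [] bs o = refl
  go(a ∷ as)[] o = go' as o where
   go' : ∀ as o -> proj₂(List.foldl (λ s a -> stage a s)([] , o)as)≡ o
   go' [] o = refl
   go'(a ∷ as)o = go' as o
  go(a ∷ as)(b ∷ bs)o = go as bs((a , b)∷ o)

 map-zip : ∀ {X Y Z : Set}(f : X -> Y -> Z)as bs -> List.map(λ (a , b) -> f a b)(zip as bs)≡ zipWith f as bs
 map-zip f [] bs = refl
 map-zip f(a ∷ as)[] = refl
 map-zip f(a ∷ as)(b ∷ bs) = cong(f a b ∷_)(map-zip f as bs)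

 zipWithT : A ∷ B ∷ [] ⊢ C -> Γ ⊢ 𝕃 A -> Γ ⊢ 𝕃 B -> Γ ⊢ 𝕃 C
 zipWithT f as bs = recast(mapT(call2 zipT as bs)(call2 f(fstT v0)(sndT v0)))
  (λ γ -> zipWith (λ a b -> fun f(a , b , tt))(fun as γ)(fun bs γ))(λ γ -> map-zip _ (fun as γ)(fun bs γ))

 infix 7 _∙_
 infixl 6 _⊞_
 infixr 7 _⊡_
 _∙_ : List ℤ -> List ℤ -> ℤ
 u ∙ v = sumℤ(zipWith Z._*_ u v)

 _⊞_ : List ℤ -> List ℤ -> List ℤ
 _⊞_ = zipWith Z._+_

 _⊡_ : ℤ -> List ℤ -> List ℤ
 c ⊡ v = List.map(c Z.*_)v

 _∙t_ : Γ ⊢ 𝕃 ℤt -> Γ ⊢ 𝕃 ℤt -> Γ ⊢ ℤt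
 u ∙t v = call1 sumT(zipWithT mulℤ u v)

 _⊞t_ : Γ ⊢ 𝕃 ℤt -> Γ ⊢ 𝕃 ℤt -> Γ ⊢ 𝕃 ℤt
 _⊞t_ = zipWithT addℤ

 _⊡t_ : Γ ⊢ ℤt -> Γ ⊢ 𝕃 ℤt -> Γ ⊢ 𝕃 ℤt
 c ⊡t v = mapT v(wk c *t v0)

 sumsT : 𝕃(𝕃 ℤt)∷ 𝕃 ℤt ∷ [] ⊢ 𝕃 ℤt
 sumsT = foldrT-exact v0 v1(quadT(pairT v0 v1))(v0 ⊞t v1)(λ (vs , z , _) -> List.foldr _⊞_ z vs)(λ (_ , z , _)l -> suc(6 *(total l + bitsum z)))
  (λ (_ , z , _)v l -> s≤s(*-monoʳ-≤ 6(+-monoˡ-≤(bitsum z)(m≤n+m(total l)(bitsum v)))))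
  (λ (_ , z , _)v l -> size-vec≤(List.foldr _⊞_ z(v ∷ l))<< s≤s(*-monoʳ-≤ 6(go z(v ∷ l))))
  (λ (vs , z , _) -> ≤-by(14 + 2 *(total vs + bitsum z))(eq(total vs)(bitsum z))<< quad(s≤s(+-mono-≤(total≤ vs)(size-vec≥ z))))
  (λ _ -> refl) where
  total : List(List ℤ) -> ℕ
  total [] = 0
  total(v ∷ vs) = bitsum v + total vs
  total≤ : ∀ vs -> suc(2 * total vs)≤ sz(𝕃(𝕃 ℤt))vs
  total≤ [] = ≤-refl
  total≤(v ∷ vs) = s≤s(*-distribˡ-+ 2(bitsum v)(total vs)=< +-mono-≤(n≤1+n _ << size-vec≥ v)(n≤1+n _ << total≤ vs))
  eq : ∀ a b -> suc(6 *(a + b))+(14 + 2 *(a + b))≡ 3 + 4 * suc(suc(2 * a)+ suc(2 * b))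
  eq = ring
  add-bitsum : ∀ u v -> bitsum(u ⊞ v)≤ bitsum u + bitsum v
  add-bitsum [] v = z≤n
  add-bitsum(x ∷ u)[] = z≤n
  add-bitsum(x ∷ u)(y ∷ v) = s≤s(+-mono-≤(∥+∥z x y)(add-bitsum u v))<=(eq' ∥ x ∥z ∥ y ∥z(bitsum u)(bitsum v)) where
   eq' : ∀ x y u v -> suc(suc(x + y)+(u + v))≡ suc x + u +(suc y + v)
   eq' = ring
  go : ∀ z l -> bitsum(List.foldr _⊞_ z l)≤ total l + bitsum z
  go z [] = ≤-refl
  go z(v ∷ l) = add-bitsum v _ << +-monoʳ-≤(bitsum v)(go z l)<= sym(+-assoc(bitsum v)(total l)(bitsum z))

 powT : ℤt ∷ 𝕌 ∷ [] ⊢ ℤt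
 powT = iterT-exact v1(constT 1ℤ)(mapT(unaryList v1)(quadT v1))(v1 *t v0)(λ (b , n , _) -> b Z.^ n)
  (λ (b , n , _)k k<n -> size-ℤ≤(iter(b Z.*_)(suc k)1ℤ)<< +-monoʳ-≤ 5(*-monoʳ-≤ 4(go b(suc k)<< s≤s(*-monoˡ-≤ ∥ b ∥z k<n)))<< copies b n(s≤s z≤n << k<n))
  (λ (b , n , _) -> exact b n) where
  exact : ∀ b n -> iter(b Z.*_)n 1ℤ ≡ b Z.^ n
  exact b zero = refl
  exact b(suc n) = cong(b Z.*_)(exact b n)
  go : ∀ b k -> ∥ iter(b Z.*_)k 1ℤ ∥z ≤ suc(k * ∥ b ∥z)
  go b zero = ≤-refl
  go b(suc k) = ∥*∥z b _ <<(+-monoʳ-≤ ∥ b ∥z(go b k))<=(+-suc ∥ b ∥z(k * ∥ b ∥z))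
  Q =(ℤt ⊠ ℤt) ⊠ (ℤt ⊠ ℤt)
  lower : ∀ b n -> n *(15 + 4 * ∥ b ∥z)≤ sz(𝕃 Q)(List.map (λ _ ->(b , b),(b , b))(List.replicate n 0))
  lower b zero = z≤n
  lower b(suc n) = +-mono-≤(≤-by(4 * ∥ b ∥z)(eq ∥ b ∥z)<< quad(size-ℤ≥ b))(lower b n)<< n≤1+n _ where
   eq : ∀ b -> 15 + 4 * b + 4 * b ≡ 3 + 4 *(3 + 2 * b)
   eq = ring
  copies : ∀ b n -> 1 ≤ n -> 5 + 4 * suc(n * ∥ b ∥z)≤ sz(𝕃 Q)(List.map (λ _ ->(b , b),(b , b))(List.replicate n 0))
  copies b n 1≤n =(≤-by 6(eq n ∥ b ∥z)<< +-monoˡ-≤(4 *(n * ∥ b ∥z))(*-monoʳ-≤ 15 1≤n)<=(eq' n ∥ b ∥z))<< lower b n where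
   eq : ∀ n b -> 5 + 4 * suc(n * b)+ 6 ≡ 15 * 1 + 4 *(n * b)
   eq = ring
   eq' : ∀ n b -> 15 * n + 4 *(n * b)≡ n *(15 + 4 * b)
   eq' = ring

 n<2^n : ∀ n -> n < 2 Data.Nat.Base.^ n
 n<2^n zero = ≤-refl
 n<2^n(suc n) = +-mono-≤(1≤2^ n)(n<2^n n)<< +-monoʳ-≤(2 Data.Nat.Base.^ n)(m≤m+n(2 Data.Nat.Base.^ n)0)

 countT : 𝕌 ∷ [] ⊢ ℤt
 countT = natℤ(iterT-exact v0(constT 0)(quadT v0)(call2 addℕ(constT 1)v0)(λ (n , _) -> n)
  (λ (n , _)k k<n -> size-ℕ≤(iter suc(suc k)0)<< s≤s(*-monoʳ-≤ 4(cong ∥_∥ᵇ(exact(suc k))=< ∥∥-mono k<n << bits-length n n(n<2^n n)))<<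
   ≤-by(6 + 4 * n)(eq n)<< quad(≤-reflexive(sym(size-unary n))))
  (λ (n , _) -> exact n)) where
  exact : ∀ n -> iter suc n 0 ≡ n
  exact zero = refl
  exact(suc n) = cong suc(exact n)
  eq : ∀ n -> suc(4 * n)+(6 + 4 * n)≡ 3 + 4 * suc(2 * n)
  eq = ring

 open import Data.List.Base using (take)
 open import Defs using (Letter; bit; sep)

 concatT : 𝕃(𝕃 A)∷ [] ⊢ 𝕃 A
 concatT {A} = foldrT-exact v0 nilT v0(call2 appendT v0 v1)(λ (xss , _) -> List.concat xss)(λ _ -> sz(𝕃(𝕃 A)))
  (λ _ x xs -> m≤n+m(sz(𝕃(𝕃 A))xs)(sz(𝕃 A)x)<< n≤1+n _)
  (λ _ x xs -> go(x ∷ xs))(λ _ -> ≤-refl)(λ _ -> refl) where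
  size-++ : ∀ xs ys -> sz(𝕃 A)(xs ++ ys)≤ sz(𝕃 A)xs + sz(𝕃 A)ys
  size-++ [] ys = n≤1+n _
  size-++(x ∷ xs)ys = s≤s(+-monoʳ-≤(sz A x)(size-++ xs ys)<= sym(+-assoc(sz A x)_ _))
  go : ∀ xss -> sz(𝕃 A)(List.concat xss)≤ sz(𝕃(𝕃 A))xss
  go [] = ≤-refl
  go(xs ∷ xss) = size-++ xs(List.concat xss)<< +-monoʳ-≤(sz(𝕃 A)xs)(go xss)<< n≤1+n _

 iter-shift : ∀ {X : Set}(f : X -> X)n x -> iter f n(f x)≡ f(iter f n x)
 iter-shift f zero x = refl
 iter-shift f(suc n)x = cong f(iter-shift f n x)

 module _ {A : Ty} where

  private
   Sₛ : Ty
   Sₛ = 𝕃 A ⊠ 𝕃 A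

   stage : Car Sₛ -> Car Sₛ
   stage(xs , o) = listCase xs(xs , o)(λ x xs' -> xs' , x ∷ o)

   size-step : ∀ s -> sz Sₛ(stage s)≡ sz Sₛ s
   size-step([] , o) = refl
   size-step(x ∷ xs , o) = cong suc(eq(sz A x)(sz(𝕃 A)xs)(sz(𝕃 A)o)) where
    eq : ∀ x s o -> s + suc(x + o)≡ suc(x + s)+ o
    eq = ring

   size-iter : ∀ k s -> sz Sₛ(iter stage k s)≡ sz Sₛ s
   size-iter zero s = refl
   size-iter(suc k)s = size-step(iter stage k s)== size-iter k s

   go : ∀ k xs o -> iter stage k(xs , o)≡(List.drop k xs , take k xs ʳ++ o)
   go zero xs o = refl
   go(suc k)[] o = sym(iter-shift stage k([] , o))== go k [] o == cong₂ (λ a b -> a , b ʳ++ o)(drop-[] k)(take-[] k) where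
    drop-[] : ∀ k -> List.drop k([] {A = Car A})≡ []
    drop-[] zero = refl
    drop-[](suc k) = refl
    take-[] : ∀ k -> take k([] {A = Car A})≡ []
    take-[] zero = refl
    take-[](suc k) = refl
   go(suc k)(x ∷ xs)o = sym(iter-shift stage k(x ∷ xs , o))== go k xs(x ∷ o)

  splitT : 𝕌 ∷ 𝕃 A ∷ [] ⊢ 𝕃 A ⊠ 𝕃 A
  splitT = letT(iterT-exact v0(pairT v1 nilT)(pairT v1(nilT {A = A}))(caseT(fstT v0)v0(pairT v1(consT v0(sndT v2))))
   (λ (n , xs , _) -> List.drop n xs , take n xs ʳ++ [])
   (λ (n , xs , _)k _ -> ≤-reflexive(size-iter(suc k)(xs , [])))
   (λ (n , xs , _) -> go n xs []))
   (pairT(reverseT(sndT v0))(fstT v0))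

  halves° : ℕ -> List(Car A) -> List(Car A)× List(Car A)
  halves° n xs = take n xs , List.drop n xs

  splitT' : 𝕌 ∷ 𝕃 A ∷ [] ⊢ 𝕃 A ⊠ 𝕃 A
  splitT' = recast splitT(λ (n , xs , _) -> halves° n xs)(λ (n , xs , _) -> cong(_, List.drop n xs)(List.reverse-involutive(take n xs)))

  -- The first m blocks of length n, followed by the remaining elements.
  chunks : ℕ -> ℕ -> List(Car A) -> List(List(Car A))× List(Car A)
  chunks n zero xs = [] , xs
  chunks n(suc m)xs = let (yss , r) = chunks n m(List.drop n xs) in take n xs ∷ yss , r

  private
   cstep : ℕ -> List(Car A)× List(List(Car A)) -> List(Car A)× List(List(Car A))
   cstep n(xs , o) = List.drop n xs , take n xs ∷ o

   cgo : ∀ n m xs o -> let (yss , r) = chunks n m xs in iter(cstep n)m(xs , o)≡(r , yss ʳ++ o)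
   cgo n zero xs o = refl
   cgo n(suc m)xs o = sym(iter-shift(cstep n)m(xs , o))== cgo n m(List.drop n xs)(take n xs ∷ o)

   Cₛ : Ty
   Cₛ = 𝕃 A ⊠ 𝕃(𝕃 A)

   size-take-drop : ∀ n xs -> sz(𝕃 A)(List.drop n xs)+ sz(𝕃 A)(take n xs)≡ suc(sz(𝕃 A)xs)
   size-take-drop zero xs = +-comm(sz(𝕃 A)xs)1
   size-take-drop(suc n)[] = refl
   size-take-drop(suc n)(x ∷ xs) = eq(sz(𝕃 A)(List.drop n xs))(sz A x)(sz(𝕃 A)(take n xs))==
    cong (λ z -> suc(sz A x + z))(size-take-drop n xs)== cong suc(+-suc(sz A x)(sz(𝕃 A)xs)) where
    eq : ∀ d x t -> d + suc(x + t)≡ suc(x +(d + t))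
    eq = ring

   size-cstep : ∀ n s -> sz Cₛ(cstep n s)≡ 2 + sz Cₛ s
   size-cstep n(xs , o) = eq(sz(𝕃 A)(List.drop n xs))(sz(𝕃 A)(take n xs))(sz(𝕃(𝕃 A))o)== cong (λ z -> suc(suc(z + sz(𝕃(𝕃 A))o)))(size-take-drop n xs) where
    eq : ∀ x y z -> suc(x + suc(y + z))≡ suc(suc(x + y + z))
    eq x y z = cong suc(+-suc x(y + z)== cong suc(sym(+-assoc x y z)))

   size-citer : ∀ n k s -> sz Cₛ(iter(cstep n)k s)≡ 2 * k + sz Cₛ s
   size-citer n zero s = refl
   size-citer n(suc k)s = size-cstep n(iter(cstep n)k s)== cong(2 +_)(size-citer n k s)== eq k(sz Cₛ s) where
    eq : ∀ k s -> 2 +(2 * k + s)≡ 2 * suc k + s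
    eq = ring

  chunksT : 𝕌 ∷ 𝕌 ∷ 𝕃 A ∷ [] ⊢ 𝕃(𝕃 A) ⊠ 𝕃 A
  chunksT = recast(letT(iterT-exact v1(pairT v2 nilT)(pairT v1 v2)
   (letT(call2 splitT' v1(fstT v0))(pairT(sndT v0)(consT(fstT v0)(sndT v1))))
   (λ (n , m , xs , _) -> let (yss , r) = chunks n m xs in r , yss ʳ++ [])
   (λ (n , m , xs , _)k k<m -> size-citer n(suc k)(xs , [])=< +-monoˡ-≤(suc(sz(𝕃 A)xs + 1))(*-monoʳ-≤ 2 k<m)<=
    eq m(sz(𝕃 A)xs)== cong (λ z -> suc(z + sz(𝕃 A)xs))(sym(size-unary m)))
   (λ (n , m , xs , _) -> cgo n m xs []))
   (pairT(reverseT(sndT v0))(fstT v0)))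
   (λ (n , m , xs , _) -> chunks n m xs)
   (λ (n , m , xs , _) -> cong(_, proj₂(chunks n m xs))(List.reverse-involutive(proj₁(chunks n m xs)))) where
   eq : ∀ m s -> 2 * m + suc(s + 1)≡ suc(suc(2 * m)+ s)
   eq = ring

 trues : List Bool -> ℕ
 trues [] = 0
 trues(true ∷ bs) = suc(trues bs)
 trues(false ∷ bs) = trues bs

 countTrueT : 𝕃 𝔹 ∷ [] ⊢ 𝕌
 countTrueT = foldrT-exact v0 zeroT v0(ifT v0(sucT v1)v1)(λ (bs , _) -> trues bs)(λ _ -> sz(𝕃 𝔹))
  (λ _ x xs -> m≤n+m(sz(𝕃 𝔹)xs)(sz 𝔹 x)<< n≤1+n _)
  (λ _ x xs -> cong(size ∘ encUnary)(go(x ∷ xs))=< size≤(x ∷ xs))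
  (λ _ -> ≤-refl)(λ (bs , _) -> go bs) where
  go : ∀ bs -> List.foldr (λ a s -> if a then suc s else s)0 bs ≡ trues bs
  go [] = refl
  go(true ∷ bs) = cong suc(go bs)
  go(false ∷ bs) = go bs
  size≤ : ∀ bs -> sz 𝕌(trues bs)≤ sz(𝕃 𝔹)bs
  size≤ [] = ≤-refl
  size≤(true ∷ bs) = s≤s(+-mono-≤ {1}{3}(s≤s z≤n)(size≤ bs))
  size≤(false ∷ bs) = size≤ bs << n≤1+n _ << n≤1+n _

 falses : ℕ -> List Bool
 falses n = List.replicate n false

 unitRows : ℕ -> List(List Bool)
 unitRows zero = []
 unitRows(suc n) =(true ∷ falses n)∷ List.map(false ∷_)(unitRows n)

 unitRowsT : 𝕌 ∷ [] ⊢ 𝕃(𝕃 𝔹)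
 unitRowsT = sndT(iterT-exact v0(pairT nilT nilT)(quadT(mapT(unaryList v0)v1))
  (pairT(consT(constT false)(fstT v0))(consT(consT(constT true)(fstT v0))(mapT(sndT v0)(consT(constT false)v0))))
  (λ (n , _) -> falses n , unitRows n)
  (λ (n , _)k k<n -> cong(sz(𝕃 𝔹 ⊠ 𝕃(𝕃 𝔹)))(exact(suc k))=< bound(suc k)<< mono k<n << fits n(s≤s z≤n << k<n))
  (λ (n , _) -> exact n)) where
  exact : ∀ n -> iter(λ (f , r) -> false ∷ f ,(true ∷ f)∷ List.map(false ∷_)r)n([] , [])≡(falses n , unitRows n)
  exact zero = refl
  exact(suc n) rewrite exact n = refl
  size-falses : ∀ n -> sz(𝕃 𝔹)(falses n)≡ suc(2 * n)
  size-falses zero = refl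
  size-falses(suc n) = cong suc(cong suc(size-falses n)== sym(*-suc 2 n))
  size-map : ∀ rs -> sz(𝕃(𝕃 𝔹))(List.map(false ∷_)rs)≡ sz(𝕃(𝕃 𝔹))rs + 2 * length rs
  size-map [] = refl
  size-map(r ∷ rs) = cong suc(cong (λ z -> suc(suc(sz(𝕃 𝔹)r))+ z)(size-map rs)== eq(sz(𝕃 𝔹)r)(sz(𝕃(𝕃 𝔹))rs)(length rs)) where
   eq : ∀ r s l -> suc(suc r)+(s + 2 * l)≡ r + s + 2 * suc l
   eq = ring
  length-rows : ∀ n -> length(unitRows n)≡ n
  length-rows zero = refl
  length-rows(suc n) = cong suc(List.length-map _ (unitRows n)== length-rows n)
  rows : ∀ n -> sz(𝕃(𝕃 𝔹))(unitRows n)≤ suc(2 * n * n + 4 * n)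
  rows zero = ≤-refl
  rows(suc n) = cong suc(cong₂ (λ x y -> suc(3 + x)+ y)(size-falses n)(size-map(unitRows n)== cong (λ z -> sz(𝕃(𝕃 𝔹))(unitRows n)+ 2 * z)(length-rows n)))=<
   s≤s(+-monoʳ-≤(suc(3 + suc(2 * n)))(+-monoˡ-≤(2 * n)(rows n)))<= eq n where
   eq : ∀ n -> suc(suc(3 + suc(2 * n))+(suc(2 * n * n + 4 * n)+ 2 * n))≡ suc(2 * suc n * suc n + 4 * suc n)
   eq = ring
  bound : ∀ n -> sz(𝕃 𝔹 ⊠ 𝕃(𝕃 𝔹))(falses n , unitRows n)≤ 2 * n * n + 6 * n + 3
  bound n = s≤s(+-mono-≤(≤-reflexive(size-falses n))(rows n))<= eq n where
   eq : ∀ n -> suc(suc(2 * n)+ suc(2 * n * n + 4 * n))≡ 2 * n * n + 6 * n + 3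
   eq = ring
  mono : ∀ {k n} -> k ≤ n -> 2 * k * k + 6 * k + 3 ≤ 2 * n * n + 6 * n + 3
  mono h = +-monoˡ-≤ 3(+-mono-≤(*-mono-≤(*-monoʳ-≤ 2 h)h)(*-monoʳ-≤ 6 h))
  copies : ∀ m n -> m *(2 * n + 2)≤ sz(𝕃 𝕌)(List.map (λ _ -> n)(List.replicate m 0))
  copies zero n = z≤n
  copies(suc m)n = +-mono-≤(+-comm(2 * n)2 =< s≤s(≤-reflexive(sym(size-unary n))))(copies m n)<< ≤-refl
  fits : ∀ n -> 1 ≤ n -> 2 * n * n + 6 * n + 3 ≤ suc(suc(sz(𝕃 𝕌)(List.map (λ _ -> n)(List.replicate n 0))+ sz(𝕃 𝕌)(List.map (λ _ -> n)(List.replicate n 0)))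
   + suc(sz(𝕃 𝕌)(List.map (λ _ -> n)(List.replicate n 0))+ sz(𝕃 𝕌)(List.map (λ _ -> n)(List.replicate n 0))))
  fits n _ = ≤-by(6 * n * n + 2 * n)(eq n)<< quad(copies n n) where
   eq : ∀ n -> 2 * n * n + 6 * n + 3 +(6 * n * n + 2 * n)≡ 3 + 4 *(n *(2 * n + 2))
   eq = ring

 𝕋 : Ty
 𝕋 = record { Car = Letter ; enc = letterTree }

 letterBits : Letter -> List Bool
 letterBits sep = []
 letterBits(bit Fin.zero) = false ∷ []
 letterBits(bit(Fin.suc _)) = true ∷ []

 letterBitsT : Γ ⊢ 𝕋 -> Γ ⊢ 𝕃 𝔹
 letterBitsT e = record { fun = λ γ -> letterBits(fun e γ) ; code = code e ; ok = λ γ δ eq -> ok e γ δ eq == go(fun e γ) } where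
  go : ∀ x -> letterTree x ≡ enc(𝕃 𝔹)(letterBits x)
  go sep = refl
  go(bit Fin.zero) = refl
  go(bit(Fin.suc _)) = refl

 bitLetter : Bool -> Letter
 bitLetter false = bit Fin.zero
 bitLetter true = bit(Fin.suc Fin.zero)

 bitLetterT : 𝔹 ∷ [] ⊢ 𝕋
 bitLetterT = recast(ifT v0(constT(bit(Fin.suc Fin.zero)))(constT(bit Fin.zero)))(λ (b , _) -> bitLetter b) λ { (true , _) -> refl ; (false , _) -> refl }

 inputTree-list : ∀ xs -> inputTree xs ≡ enc(𝕃 𝕋)xs
 inputTree-list [] = refl
 inputTree-list(x ∷ xs) = cong(node(letterTree x))(inputTree-list xs)

 tokens : List Letter -> List(List Bool)
 tokens [] = []
 tokens(x ∷ xs) = listCase(letterBits x)([] ∷ tokens xs)(λ b _ -> listCase(tokens xs)[] (λ t ts ->(b ∷ t)∷ ts))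

 tokensT : 𝕃 𝕋 ∷ [] ⊢ 𝕃(𝕃 𝔹)
 tokensT = foldrT-exact v0 nilT v0(caseT(letterBitsT v0)(consT nilT v1)(caseT v3 nilT(consT(consT v2 v0)v1)))
  (λ (xs , _) -> tokens xs)(λ _ -> sz(𝕃 𝕋))
  (λ _ x xs -> m≤n+m(sz(𝕃 𝕋)xs)(sz 𝕋 x)<< n≤1+n _)
  (λ _ x xs -> cong(sz(𝕃(𝕃 𝔹)))(exact(x ∷ xs))=< size≤(x ∷ xs))
  (λ _ -> ≤-refl)(λ (xs , _) -> exact xs) where
  exact : ∀ xs -> List.foldr (λ x s -> listCase(letterBits x)([] ∷ s)(λ b _ -> listCase s [] (λ t ts ->(b ∷ t)∷ ts)))[] xs ≡ tokens xs
  exact [] = refl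
  exact(x ∷ xs) = cong (λ s -> listCase(letterBits x)([] ∷ s)(λ b _ -> listCase s [] (λ t ts ->(b ∷ t)∷ ts)))(exact xs)
  grow : ∀ b ts -> sz(𝕃(𝕃 𝔹))(listCase ts [] (λ t ts ->(b ∷ t)∷ ts))≤ suc(sz 𝔹 b)+ sz(𝕃(𝕃 𝔹))ts
  grow b [] = s≤s z≤n
  grow b(t ∷ ts) = ≤-reflexive(eq(sz 𝔹 b)(sz(𝕃 𝔹)t)(sz(𝕃(𝕃 𝔹))ts)) where
   eq : ∀ b t s -> suc(suc(b + t)+ s)≡ suc b + suc(t + s)
   eq = ring
  size≤ : ∀ xs -> sz(𝕃(𝕃 𝔹))(tokens xs)≤ sz(𝕃 𝕋)xs
  size≤ [] = ≤-refl
  size≤(sep ∷ xs) = s≤s(s≤s(size≤ xs))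
  size≤(bit Fin.zero ∷ xs) = grow false(tokens xs)<< +-monoʳ-≤ 2(size≤ xs)<< n≤1+n _ << n≤1+n _
  size≤(bit(Fin.suc _)∷ xs) = grow true(tokens xs)<< +-monoʳ-≤ 4(size≤ xs)<< n≤1+n _ << n≤1+n _

 -- A natural number in unary, if it does not exceed the size of the bound.
 unaryT : 𝕃 𝔹 ∷ 𝕃 𝕋 ∷ [] ⊢ 𝕌
 unaryT = foldrT v0 zeroT(quadT v1)(letT(call2 addT v1 v1)(ifT v1(sucT v0)v0))

 unaryT≡ : ∀ bs x -> val bs ≤ length x -> fun unaryT(bs , x , tt)≡ val bs
 unaryT≡ bs x h = foldrC-unclip 𝕌 (λ l -> suc(2 * val l))(λ b l -> s≤s(*-monoʳ-≤ 2(grow b l)))(λ b l -> ≤-reflexive(size-unary _ == cong (λ z -> suc(2 * z))(exact(b ∷ l))))bs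
  ((s≤s(*-monoʳ-≤ 2 h)<< ≤-by(2 + 2 * length x)(eq(length x)))<< quad(len≤ x))== exact bs where
  grow : ∀ b l -> val l ≤ val(b ∷ l)
  grow b l =(m≤m+n(val l)(val l)<= sym(dbl≡(val l)))<< m≤n+m(dbl(val l))(b2n b)
  exact : ∀ l -> List.foldr (λ a s -> if a then suc(s + s) else (s + s))0 l ≡ val l
  exact [] = refl
  exact(true ∷ l) rewrite exact l = cong suc(sym(dbl≡(val l)))
  exact(false ∷ l) rewrite exact l = sym(dbl≡(val l))
  len≤ : ∀ x -> length x ≤ sz(𝕃 𝕋)x
  len≤ [] = z≤n
  len≤(a ∷ x) = s≤s(len≤ x << m≤n+m _ (sz 𝕋 a))
  eq : ∀ n -> suc(2 * n)+(2 + 2 * n)≡ 3 + 4 * n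
  eq = ring

module Walks where

 open import Data.Integer.Base hiding (suc)
 open import Data.Integer.Properties
 open import Data.Integer.Tactic.RingSolver using () renaming (solve-∀ to ring)
 open import Data.List.Relation.Unary.All as All using ([]; _∷_)
 open Chainℤ

 ≤-diff : ∀ {x y}d -> 0ℤ ≤ d -> x + d ≡ y -> x ≤ y
 ≤-diff {x}d 0≤d eq =(sym(+-identityʳ x)=< +-monoʳ-≤ x 0≤d)<= eq

 0≤pos : ∀ n -> 0ℤ ≤ + n
 0≤pos n = +≤+ N.z≤n

 0≤+ : ∀ {x y} -> 0ℤ ≤ x -> 0ℤ ≤ y -> 0ℤ ≤ x + y
 0≤+ = +-mono-≤

 0≤* : ∀ {x y} -> 0ℤ ≤ x -> 0ℤ ≤ y -> 0ℤ ≤ x * y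
 0≤* {+ m}{+ n}_ _ =(+≤+ N.z≤n)<= pos-* m n

 0<* : ∀ {x y} -> 0ℤ < x -> 0ℤ < y -> 0ℤ < x * y
 0<* {+ suc m}{+ suc n}_ _ = +<+ (N.s≤s N.z≤n)
 0<* {+ zero}(+<+ ())
 0<* {+ suc m}{+ zero}_ (+<+ ())

 sq≥0 : ∀ x -> 0ℤ ≤ x * x
 sq≥0(+ n) = 0≤* {+ n}{+ n}(+≤+ N.z≤n)(+≤+ N.z≤n)
 sq≥0(-[1+ n ]) = +≤+ N.z≤n

 0≤-sub : ∀ {x y} -> x ≤ y -> 0ℤ ≤ y - x
 0≤-sub {x}{y}h = sym(+-inverseʳ x)=< +-monoˡ-≤(- x)h

 *-monoˡ : ∀ {c x y} -> 0ℤ ≤ c -> x ≤ y -> c * x ≤ c * y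
 *-monoˡ {c}{x}{y}0≤c x≤y = ≤-diff(c *(y - x))(0≤* 0≤c(0≤-sub x≤y))(eq c x y) where
  eq : ∀ c x y -> c * x + c *(y - x)≡ c * y
  eq = ring

 *-monoʳ : ∀ {c x y} -> 0ℤ ≤ c -> x ≤ y -> x * c ≤ y * c
 *-monoʳ {c}{x}{y}0≤c h = *-comm x c =< *-monoˡ 0≤c h <= *-comm c y

 *-mono : ∀ {a b c d} -> 0ℤ ≤ b -> 0ℤ ≤ c -> a ≤ b -> c ≤ d -> a * c ≤ b * d
 *-mono 0≤b 0≤c a≤b c≤d = *-monoʳ 0≤c a≤b << *-monoˡ 0≤b c≤d

 *-cancel : ∀ {c x y} -> 0ℤ < c -> c * x ≤ c * y -> x ≤ y
 *-cancel {+ suc c}{x}{y}_ h = *-cancelˡ-≤-pos x y(+ suc c)h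
 *-cancel {+ zero}(+<+ ())

 infix 8 _·_
 infixl 6 _⊹_
 infixr 7 _⋆_

 _·_ : ∀ {n} -> Vec ℤ n -> Vec ℤ n -> ℤ
 [] · [] = 0ℤ
 (a ∷ u)·(b ∷ v) = a * b + u · v

 _⊹_ : ∀ {n} -> Vec ℤ n -> Vec ℤ n -> Vec ℤ n
 _⊹_ = Vec.zipWith _+_

 _⋆_ : ∀ {n} -> ℤ -> Vec ℤ n -> Vec ℤ n
 c ⋆ u = Vec.map(c *_)u

 zeros : ∀ {n} -> Vec ℤ n
 zeros = Vec.replicate _ 0ℤ

 ·-comm : ∀ {n}(u v : Vec ℤ n) -> u · v ≡ v · u
 ·-comm [] [] = refl
 ·-comm(a ∷ u)(b ∷ v) = cong₂ _+_ (*-comm a b)(·-comm u v)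

 ·-addʳ : ∀ {n}(u v w : Vec ℤ n) -> u ·(v ⊹ w)≡ u · v + u · w
 ·-addʳ [] [] [] = refl
 ·-addʳ(a ∷ u)(b ∷ v)(c ∷ w) = cong (λ z -> a *(b + c)+ z)(·-addʳ u v w)== eq a b c(u · v)(u · w) where
  eq : ∀ a b c x y -> a *(b + c)+(x + y)≡ a * b + x +(a * c + y)
  eq = ring

 ·-scaleʳ : ∀ {n}c (u v : Vec ℤ n) -> u ·(c ⋆ v)≡ c *(u · v)
 ·-scaleʳ c [] [] = sym(*-zeroʳ c)
 ·-scaleʳ c(a ∷ u)(b ∷ v) = cong (λ z -> a *(c * b)+ z)(·-scaleʳ c u v)== eq a b c(u · v) where
  eq : ∀ a b c x -> a *(c * b)+ c * x ≡ c *(a * b + x)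
  eq = ring

 ·-zeroʳ : ∀ {n}(u : Vec ℤ n) -> u · zeros ≡ 0ℤ
 ·-zeroʳ [] = refl
 ·-zeroʳ(a ∷ u) =(cong₂ _+_ (*-zeroʳ a)(·-zeroʳ u))== refl

 ·-addˡ : ∀ {n}(u v w : Vec ℤ n) ->(u ⊹ v)· w ≡ u · w + v · w
 ·-addˡ u v w = ·-comm(u ⊹ v)w == ·-addʳ w u v ==(cong₂ _+_ (·-comm w u)(·-comm w v))

 ·-scaleˡ : ∀ {n}c (u v : Vec ℤ n) ->(c ⋆ u)· v ≡ c *(u · v)
 ·-scaleˡ c u v = ·-comm(c ⋆ u)v == ·-scaleʳ c v u == cong(c *_)(·-comm v u)

 ·-self≥0 : ∀ {n}(u : Vec ℤ n) -> 0ℤ ≤ u · u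
 ·-self≥0 [] = ≤-refl
 ·-self≥0(a ∷ u) = 0≤+(sq≥0 a)(·-self≥0 u)

 square-comb : ∀ {n}c (u : Vec ℤ n)d v ->(c ⋆ u ⊹ d ⋆ v)·(c ⋆ u ⊹ d ⋆ v)≡ c * c *(u · u)+ + 2 *(c * d *(u · v))+ d * d *(v · v)
 square-comb c u d v = ·-addˡ(c ⋆ u)(d ⋆ v)_ ==
  (cong₂ _+_ (half c u)(half d v))==
  cong (λ z -> c *(c *(u · u)+ d *(u · v))+ d *(c * z + d *(v · v)))(·-comm v u)==
  eq c d(u · u)(u · v)(v · v) where
  half : ∀ k w ->(k ⋆ w)·(c ⋆ u ⊹ d ⋆ v)≡ k *(c *(w · u)+ d *(w · v))
  half k w = ·-scaleˡ k w _ == cong(k *_)(·-addʳ w(c ⋆ u)(d ⋆ v)==(cong₂ _+_ (·-scaleʳ c w u)(·-scaleʳ d w v)))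
  eq : ∀ c d x y z -> c *(c * x + d * y)+ d *(c * y + d * z)≡ c * c * x + + 2 *(c * d * y)+ d * d * z
  eq = ring

 cauchy-schwarz : ∀ {n}(u v : Vec ℤ n) ->(u · v)*(u · v)≤(u · u)*(v · v)
 cauchy-schwarz [] [] = ≤-refl
 cauchy-schwarz(a ∷ u)(b ∷ v) = ≤-diff(((u · u)*(v · v) -(u · v)*(u · v))+(a ⋆ v ⊹ (- b) ⋆ u)·(a ⋆ v ⊹ (- b) ⋆ u))
  (0≤+(0≤-sub(cauchy-schwarz u v))(·-self≥0(a ⋆ v ⊹ (- b) ⋆ u)))
  (cong (λ z ->(a * b + u · v)*(a * b + u · v)+(((u · u)*(v · v) -(u · v)*(u · v))+ z))(square-comb a v(- b)u == cong (λ z -> a * a *(v · v)+ + 2 *(a *(- b)* z)+ - b * - b *(u · u))(·-comm v u))==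
   eq a b(u · u)(u · v)(v · v)) where
  eq : ∀ a b p s r ->(a * b + s)*(a * b + s)+((p * r - s * s)+(a * a * r + + 2 *(a *(- b)* s)+ - b * - b * p))≡(a * a + p)*(b * b + r)
  eq = ring

 norm-zero : ∀ {n}(u v : Vec ℤ n) -> v · v ≡ 0ℤ -> u · v ≡ 0ℤ
 norm-zero u v eq with u · v | cauchy-schwarz u v
 ... | + zero | h = refl
 ... | + suc k | h rewrite eq | *-zeroʳ(u · u) with h
 ... | +≤+ ()
 norm-zero u v eq | -[1+ k ] | h rewrite eq | *-zeroʳ(u · u) with h
 ... | +≤+ ()

 Rows : ℕ -> Set
 Rows n = List(Vec ℤ n)

 gram : ∀ {n} -> Rows n -> Vec ℤ n -> Vec ℤ n
 gram [] u = zeros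
 gram(B ∷ Bs)u =(B · u) ⋆ B ⊹ gram Bs u

 qform : ∀ {n} -> Rows n -> Vec ℤ n -> ℤ
 qform [] u = 0ℤ
 qform(B ∷ Bs)u =(B · u)*(B · u)+ qform Bs u

 total : ∀ {n} -> Rows n -> ℤ
 total [] = 0ℤ
 total(B ∷ Bs) = B · B + total Bs

 quadratic≥0 : ∀ {n}(Bs : Rows n)u -> 0ℤ ≤ qform Bs u
 quadratic≥0 [] u = ≤-refl
 quadratic≥0(B ∷ Bs)u = 0≤+(sq≥0(B · u))(quadratic≥0 Bs u)

 total≥0 : ∀ {n}(Bs : Rows n) -> 0ℤ ≤ total Bs
 total≥0 [] = ≤-refl
 total≥0(B ∷ Bs) = 0≤+(·-self≥0 B)(total≥0 Bs)

 gram-· : ∀ {n}(Bs : Rows n)u -> gram Bs u · u ≡ qform Bs u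
 gram-· [] u = ·-comm zeros u == ·-zeroʳ u
 gram-·(B ∷ Bs)u = ·-addˡ((B · u) ⋆ B)(gram Bs u)u ==(cong₂ _+_ (·-scaleˡ(B · u)B u)(gram-· Bs u))

 gram-sym : ∀ {n}(Bs : Rows n)u v -> gram Bs u · v ≡ u · gram Bs v
 gram-sym [] u v =(·-comm zeros v == ·-zeroʳ v)== sym(·-zeroʳ u)
 gram-sym(B ∷ Bs)u v = ·-addˡ((B · u) ⋆ B)(gram Bs u)v ==
  (cong₂ _+_ (·-scaleˡ(B · u)B v == *-comm(B · u)(B · v)== cong(B · v *_)(·-comm B u))(gram-sym Bs u v))==
  cong(_+ u · gram Bs v)(sym(·-scaleʳ(B · v)u B))==
  sym(·-addʳ u((B · v) ⋆ B)(gram Bs v))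

 -- Lagrange's identity: the difference of the two sides is a sum of squares.
 gram-norm : ∀ {n}(Bs : Rows n)u -> gram Bs u · gram Bs u ≤ total Bs * qform Bs u
 gram-norm {n}[] u = ≤-reflexive(·-zeroʳ(zeros {n}))
 gram-norm {n}(B ∷ Bs)u = ≤-diff((total Bs * qform Bs u - gram Bs u · gram Bs u)+ cross Bs)
  (0≤+(0≤-sub(gram-norm Bs u))(cross≥0 Bs))
  (cong₂ (λ x y -> x +((total Bs * qform Bs u - gram Bs u · gram Bs u)+ y))expand(cross≡ Bs)== eq c(B · B)(B · gram Bs u)(gram Bs u · gram Bs u)(total Bs)(qform Bs u)) where
  c = B · u
  w : Vec ℤ n -> Vec ℤ n
  w C = c ⋆ C ⊹ (- (C · u)) ⋆ B
  cross : Rows n -> ℤ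
  cross [] = 0ℤ
  cross(C ∷ Cs) = w C · w C + cross Cs
  cross≥0 : ∀ Cs -> 0ℤ ≤ cross Cs
  cross≥0 [] = ≤-refl
  cross≥0(C ∷ Cs) = 0≤+(·-self≥0(w C))(cross≥0 Cs)
  cross≡ : ∀ Cs -> cross Cs ≡ c * c * total Cs - + 2 *(c *(B · gram Cs u))+(B · B)* qform Cs u
  cross≡ [] = sym(cong (λ z -> c * c * 0ℤ - + 2 *(c * z)+(B · B)* 0ℤ)(·-zeroʳ B)== z c(B · B)) where
   z : ∀ c b -> c * c * 0ℤ - + 2 *(c * 0ℤ)+ b * 0ℤ ≡ 0ℤ
   z = ring
  cross≡(C ∷ Cs) =(cong₂ _+_ (square-comb c C(- (C · u))B)(cross≡ Cs))==
   cong (λ x -> c * c *(C · C)+ + 2 *(c *(- (C · u))* x)+ -(C · u)* -(C · u)*(B · B)+(c * c * total Cs - + 2 *(c *(B · gram Cs u))+(B · B)* qform Cs u))(·-comm C B)==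
   e c(C · C)(C · u)(B · C)(B · B)(total Cs)(B · gram Cs u)(qform Cs u)==
   cong (λ x -> c * c * total(C ∷ Cs) - + 2 *(c * x)+(B · B)* qform(C ∷ Cs)u)(sym(·-addʳ B((C · u) ⋆ C)(gram Cs u)== cong(_+ B · gram Cs u)(·-scaleʳ(C · u)B C))) where
   e : ∀ c cc d bc bb t g q -> c * c * cc + + 2 *(c *(- d)* bc)+ - d * - d * bb +(c * c * t - + 2 *(c * g)+ bb * q)
    ≡ c * c *(cc + t) - + 2 *(c *(d * bc + g))+ bb *(d * d + q)
   e = ring
  expand = ·-addˡ(c ⋆ B)g(c ⋆ B ⊹ g)==(cong₂ _+_ (·-scaleˡ c B _ == cong(c *_)(·-addʳ B(c ⋆ B)g == cong(_+ B · g)(·-scaleʳ c B B)))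
   (·-addʳ g(c ⋆ B)g == cong(_+ g · g)(·-scaleʳ c g B == cong(c *_)(·-comm g B))))==
   e c(B · B)(B · g)(g · g) where
   g = gram Bs u
   e : ∀ c b x y -> c *(c * b + x)+(c * x + y)≡ c * c * b + + 2 *(c * x)+ y
   e = ring
  eq : ∀ c b x g t q -> c * c * b + + 2 *(c * x)+ g +((t * q - g)+(c * c * t - + 2 *(c * x)+ b * q))≡(b + t)*(c * c + q)
  eq = ring

 quadratic-bound : ∀ {n}(Bs : Rows n)v -> qform Bs v ≤ total Bs *(v · v)
 quadratic-bound [] v = ≤-refl
 quadratic-bound(B ∷ Bs)v = +-mono-≤(cauchy-schwarz B v)(quadratic-bound Bs v)<= sym(*-distribʳ-+(v · v)(B · B)(total Bs))

 open import Data.List.Relation.Unary.All as All using (All)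
 open Typed using (iter)

 quadratic-comb : ∀ {n}(Bs : Rows n)c u d v ->
  qform Bs(c ⋆ u ⊹ d ⋆ v)≡ c * c * qform Bs u + + 2 *(c * d *(gram Bs u · v))+ d * d * qform Bs v
 quadratic-comb [] c u d v = sym(cong (λ z -> c * c * 0ℤ + + 2 *(c * d * z)+ d * d * 0ℤ)(·-comm zeros v == ·-zeroʳ v)== eq c d) where
  eq : ∀ c d -> c * c * 0ℤ + + 2 *(c * d * 0ℤ)+ d * d * 0ℤ ≡ 0ℤ
  eq = ring
 quadratic-comb(B ∷ Bs)c u d v = cong₂ (λ x y -> x * x + y)(·-addʳ B(c ⋆ u)(d ⋆ v)==(cong₂ _+_ (·-scaleʳ c B u)(·-scaleʳ d B v)))(quadratic-comb Bs c u d v)==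
  eq c d(B · u)(B · v)(qform Bs u)(gram Bs u · v)(qform Bs v)==
  cong (λ z -> c * c * qform(B ∷ Bs)u + + 2 *(c * d * z)+ d * d * qform(B ∷ Bs)v)
   (sym(·-addˡ((B · u) ⋆ B)(gram Bs u)v == cong(_+ gram Bs u · v)(·-scaleˡ(B · u)B v))) where
  eq : ∀ c d x y q g r ->(c * x + d * y)*(c * x + d * y)+(c * c * q + + 2 *(c * d * g)+ d * d * r)
   ≡ c * c *(x * x + q)+ + 2 *(c * d *(x * y + g))+ d * d *(y * y + r)
  eq = ring

 Orthogonal : ∀ {n} -> Rows n -> Vec ℤ n -> Set
 Orthogonal Bs w = All (λ B -> B · w ≡ 0ℤ)Bs

 gram-orthogonal : ∀ {n}(Bs : Rows n)u {w} -> Orthogonal Bs w -> gram Bs u · w ≡ 0ℤ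
 gram-orthogonal [] u {w}[] = ·-comm zeros w == ·-zeroʳ w
 gram-orthogonal(B ∷ Bs)u {w}(h ∷ hs) = ·-addˡ((B · u) ⋆ B)(gram Bs u)w ==
  (cong₂ _+_ (·-scaleˡ(B · u)B w == cong(B · u *_)h == *-zeroʳ(B · u))(gram-orthogonal Bs u hs))== refl

 0≤^ : ∀ {x}n -> 0ℤ ≤ x -> 0ℤ ≤ x ^ n
 0≤^ zero h = +≤+ N.z≤n
 0≤^(suc n)h = 0≤* h(0≤^ n h)

 module Heat {n}(Bs : Rows n)(D : ℤ)(total≤D : total Bs ≤ D) where

  0≤D : 0ℤ ≤ D
  0≤D = total≥0 Bs << total≤D

  -- D times one explicit Euler step of length 1/D of the flow u' = - gram u.
  heat : Vec ℤ n -> Vec ℤ n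
  heat u = D ⋆ u ⊹ -1ℤ ⋆ gram Bs u

  heat-norm1 : ∀ u -> heat u · heat u ≤ D * D *(u · u) - D * qform Bs u
  heat-norm1 u = ≤-diff(D * qform Bs u - gram Bs u · gram Bs u)
   (0≤-sub(gram-norm Bs u << *-monoʳ(quadratic≥0 Bs u)total≤D))
   (cong(_+ (D * qform Bs u - gram Bs u · gram Bs u))(square-comb D u -1ℤ(gram Bs u)== cong (λ z -> D * D *(u · u)+ + 2 *(D * -1ℤ * z)+ -1ℤ * -1ℤ *(gram Bs u · gram Bs u))(·-comm u(gram Bs u)== gram-· Bs u))==
    eq D(u · u)(qform Bs u)(gram Bs u · gram Bs u)) where
   eq : ∀ D x q g -> D * D * x + + 2 *(D * -1ℤ * q)+ -1ℤ * -1ℤ * g +(D * q - g)≡ D * D * x - D * q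
   eq = ring

  heat-quadratic1 : ∀ u -> qform Bs(heat u)≤ D * D * qform Bs u
  heat-quadratic1 u = ≤-diff((D *(g · g) - qform Bs g)+ D *(g · g))
   (0≤+(0≤-sub(quadratic-bound Bs g << *-monoʳ(·-self≥0 g)total≤D))(0≤* 0≤D(·-self≥0 g)))
   (cong(_+ ((D *(g · g) - qform Bs g)+ D *(g · g)))(quadratic-comb Bs D u -1ℤ g)== eq D(qform Bs u)(g · g)(qform Bs g)) where
   g = gram Bs u
   eq : ∀ D q x r -> D * D * q + + 2 *(D * -1ℤ * x)+ -1ℤ * -1ℤ * r +((D * x - r)+ D * x)≡ D * D * q
   eq = ring

  flow : ℕ -> Vec ℤ n -> Vec ℤ n
  flow = iter heat

  flow-energy : ∀ R u -> D *(flow R u · flow R u)+ + R * qform Bs(flow R u)≤ D ^ R * D ^ R *(D *(u · u))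
  flow-energy zero u = ≤-reflexive(eq D(u · u)(qform Bs u)) where
   eq : ∀ D x q -> D * x + 0ℤ * q ≡ 1ℤ * 1ℤ *(D * x)
   eq = ring
  flow-energy(suc R)u = +-mono-≤(*-monoˡ 0≤D(heat-norm1 v))(*-monoˡ {+ suc R}(+≤+ N.z≤n)(heat-quadratic1 v))<<
   cong (λ z -> D *(D * D *(v · v) - D * qform Bs v)+ z *(D * D * qform Bs v))(pos-+ 1 R)=<
   eq D(v · v)(qform Bs v)(+ R)=<
   *-monoˡ(sq≥0 D)(flow-energy R u)<=
   eq' D(D ^ R)(D *(u · u)) where
   v = flow R u
   eq : ∀ D x q r -> D *(D * D * x - D * q)+(1ℤ + r)*(D * D * q)≡ D * D *(D * x + r * q)
   eq = ring
   eq' : ∀ D p x -> D * D *(p * p * x)≡ D * p *(D * p)* x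
   eq' = ring

  flow-norm : ∀ R u -> flow R u · flow R u ≤ D ^ R * D ^ R *(u · u)
  flow-norm zero u = ≤-reflexive(sym(*-identityˡ(u · u)))
  flow-norm(suc R)u = heat-norm1 v << ≤-diff(D * qform Bs v)(0≤* 0≤D(quadratic≥0 Bs v))(eq D(v · v)(qform Bs v))<<
   *-monoˡ(sq≥0 D)(flow-norm R u)<= eq' D(D ^ R)(u · u) where
   v = flow R u
   eq : ∀ D x q -> D * D * x - D * q + D * q ≡ D * D * x
   eq = ring
   eq' : ∀ D p x -> D * D *(p * p * x)≡ D * p *(D * p)* x
   eq' = ring

  flow-quadratic : ∀ R u -> + R * qform Bs(flow R u)≤ D ^ R * D ^ R *(D *(u · u))
  flow-quadratic R u = ≤-diff(D *(flow R u · flow R u))(0≤* 0≤D(·-self≥0(flow R u)))(+-comm _ (D *(flow R u · flow R u)))<< flow-energy R u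

  heat-sym : ∀ u v -> heat u · v ≡ u · heat v
  heat-sym u v = ·-addˡ(D ⋆ u)(-1ℤ ⋆ gram Bs u)v ==
   (cong₂ _+_ (·-scaleˡ D u v == sym(·-scaleʳ D u v))(·-scaleˡ -1ℤ(gram Bs u)v == cong(-1ℤ *_)(gram-sym Bs u v)== sym(·-scaleʳ -1ℤ u(gram Bs v))))==
   sym(·-addʳ u(D ⋆ v)(-1ℤ ⋆ gram Bs v))

  flow-sym : ∀ R u v -> flow R u · v ≡ u · flow R v
  flow-sym zero u v = refl
  flow-sym(suc R)u v = heat-sym(flow R u)v == flow-sym R u(heat v)== cong(u ·_)(iter-shift' R v) where
   iter-shift' : ∀ R v -> flow R(heat v)≡ heat(flow R v)
   iter-shift' zero v = refl
   iter-shift'(suc R)v = cong heat(iter-shift' R v)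

  flow-fixed : ∀ R u {w} -> Orthogonal Bs w -> flow R u · w ≡ D ^ R *(u · w)
  flow-fixed zero u ort = sym(*-identityˡ _)
  flow-fixed(suc R)u {w}ort = ·-addˡ(D ⋆ v)(-1ℤ ⋆ gram Bs v)w ==
   (cong₂ _+_ (·-scaleˡ D v w)(·-scaleˡ -1ℤ(gram Bs v)w == cong(-1ℤ *_)(gram-orthogonal Bs v ort)))==
   +-identityʳ _ ==
   cong(D *_)(flow-fixed R u ort)==
   sym(*-assoc D(D ^ R)(u · w)) where
   v = flow R u

 ∑l : ∀ {A : Set} -> List A ->(A -> ℤ) -> ℤ
 ∑l [] f = 0ℤ
 ∑l(x ∷ xs)f = f x + ∑l xs f

 ∑-mono : ∀ {A : Set}(xs : List A){f g : A -> ℤ} ->(∀ x -> f x ≤ g x) -> ∑l xs f ≤ ∑l xs g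
 ∑-mono [] h = ≤-refl
 ∑-mono(x ∷ xs)h = +-mono-≤(h x)(∑-mono xs h)

 ∑-cong : ∀ {A : Set}(xs : List A){f g : A -> ℤ} ->(∀ x -> f x ≡ g x) -> ∑l xs f ≡ ∑l xs g
 ∑-cong [] h = refl
 ∑-cong(x ∷ xs)h = cong₂ _+_ (h x)(∑-cong xs h)

 ∑-scale : ∀ {A : Set}c (xs : List A)(f : A -> ℤ) -> ∑l xs (λ x -> c * f x)≡ c * ∑l xs f
 ∑-scale c [] f = sym(*-zeroʳ c)
 ∑-scale c(x ∷ xs)f = cong (λ z -> c * f x + z)(∑-scale c xs f)== sym(*-distribˡ-+ c(f x)(∑l xs f))

 ∑-+ : ∀ {A : Set}(xs : List A)(f g : A -> ℤ) -> ∑l xs (λ x -> f x + g x)≡ ∑l xs f + ∑l xs g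
 ∑-+ [] f g = refl
 ∑-+ (x ∷ xs)f g = cong (λ z -> f x + g x + z)(∑-+ xs f g)== eq(f x)(g x)(∑l xs f)(∑l xs g) where
  eq : ∀ a b c d -> a + b +(c + d)≡ a + c +(b + d)
  eq = ring

 ∑-map : ∀ {A B : Set}(g : A -> B)(xs : List A)(f : B -> ℤ) -> ∑l(List.map g xs)f ≡ ∑l xs (λ x -> f(g x))
 ∑-map g [] f = refl
 ∑-map g(x ∷ xs)f = cong (λ z -> f(g x)+ z)(∑-map g xs f)

 units : ∀ n -> List(Vec ℤ n)
 units zero = []
 units(suc n) =(1ℤ ∷ zeros)∷ List.map(0ℤ ∷_)(units n)

 units-square : ∀ {n}(b : Vec ℤ n) -> ∑l(units n)(λ e ->(b · e)*(b · e))≡ b · b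
 units-square [] = refl
 units-square {suc n}(a ∷ b) = cong₂ _+_ (cong (λ z ->(a * 1ℤ + z)*(a * 1ℤ + z))(·-zeroʳ b)== eq a)
  (∑-map(0ℤ ∷_)(units n)_ == ∑-cong(units n)(λ e -> cong (λ z ->(z + b · e)*(z + b · e))(*-zeroʳ a)==(cong₂ _*_ (+-identityˡ(b · e))(+-identityˡ(b · e))))== units-square b) where
  eq : ∀ a ->(a * 1ℤ + 0ℤ)*(a * 1ℤ + 0ℤ)≡ a * a
  eq = ring

 mask : ∀ {n} -> Vec Bool n -> Vec ℤ n -> Vec ℤ n
 mask = Vec.zipWith (λ b v -> if b then v else 0ℤ)

 mask-sym : ∀ {n}a (u v : Vec ℤ n) -> mask a u · v ≡ u · mask a v
 mask-sym [] [] [] = refl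
 mask-sym(true ∷ a)(x ∷ u)(y ∷ v) = cong (λ z -> x * y + z)(mask-sym a u v)
 mask-sym(false ∷ a)(x ∷ u)(y ∷ v) = cong₂ _+_ (sym(*-zeroʳ x))(mask-sym a u v)

 mask-norm : ∀ {n}a (u : Vec ℤ n) -> mask a u · mask a u ≤ u · u
 mask-norm [] [] = ≤-refl
 mask-norm(true ∷ a)(x ∷ u) = +-monoʳ-≤(x * x)(mask-norm a u)
 mask-norm(false ∷ a)(x ∷ u) = +-mono-≤(sq≥0 x)(mask-norm a u)

 mask-mask : ∀ {n}a (u : Vec ℤ n) -> mask a(mask a u)≡ mask a u
 mask-mask [] [] = refl
 mask-mask(true ∷ a)(x ∷ u) = cong(x ∷_)(mask-mask a u)
 mask-mask(false ∷ a)(x ∷ u) = cong(0ℤ ∷_)(mask-mask a u)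

 mask-zeros : ∀ {n}(a : Vec Bool n) -> mask a zeros ≡ zeros
 mask-zeros [] = refl
 mask-zeros(true ∷ a) = cong(0ℤ ∷_)(mask-zeros a)
 mask-zeros(false ∷ a) = cong(0ℤ ∷_)(mask-zeros a)

 count : ∀ {n} -> Vec Bool n -> ℕ
 count [] = 0
 count(true ∷ a) = suc(count a)
 count(false ∷ a) = count a

 units-trace : ∀ {n}(a : Vec Bool n) -> ∑l(units n)(λ e -> mask a e · mask a e)≡ + count a
 units-trace [] = refl
 units-trace {suc n}(x ∷ a) =(cong₂ _+_ (head x)(∑-map(0ℤ ∷_)(units n)_ == ∑-cong(units n)(tail x)== units-trace a))== fin x where
  head : ∀ x -> mask(x ∷ a)(1ℤ ∷ zeros)· mask(x ∷ a)(1ℤ ∷ zeros)≡(if x then 1ℤ else 0ℤ)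
  head true rewrite mask-zeros a = cong (λ z -> 1ℤ + z)(·-zeroʳ(zeros {n}))
  head false rewrite mask-zeros a = cong (λ z -> 0ℤ + z)(·-zeroʳ(zeros {n}))
  tail : ∀ x e -> mask(x ∷ a)(0ℤ ∷ e)· mask(x ∷ a)(0ℤ ∷ e)≡ mask a e · mask a e
  tail true e = +-identityˡ _
  tail false e = +-identityˡ _
  fin : ∀ x ->(if x then 1ℤ else 0ℤ)+ + count a ≡ + count(x ∷ a)
  fin true = refl
  fin false = refl

 -- A positive multiple c of the orthogonal projection onto the complement of the rows.
 record Projection {n}(act : Vec Bool n)(Bs : Rows n) : Set where
  field
   K : Vec ℤ n -> Vec ℤ n
   c : ℤ
   c>0 : 0ℤ < c
   orthogonal : ∀ v -> Orthogonal Bs(K v)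
   scales : ∀ v {w} -> Orthogonal Bs w -> K v · w ≡ c *(v · w)
   trace : c *(+ count act - + length Bs)≤ ∑l(units n)(λ e -> mask act e · K(mask act e))

  K-sym : ∀ v w -> K v · w ≡ v · K w
  K-sym v w = *-cancelˡ-≡ c(K v · w)(v · K w){{>-nonZero c>0}}( cong(c *_)(·-comm(K v)w)==
   sym(scales w(orthogonal v))==
   ·-comm(K w)(K v)==
   scales v(orthogonal w))

 projection : ∀ {n}(act : Vec Bool n)(Bs : Rows n) -> Projection act Bs
 projection act [] = record
  { K = λ v -> v ; c = 1ℤ ; c>0 = +<+ (N.s≤s N.z≤n) ; orthogonal = λ _ -> [] ; scales = λ v _ -> sym(*-identityˡ _)
  ; trace = ≤-reflexive(*-identityˡ _ == +-identityʳ _ == sym(units-trace act)) }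
 projection {n}act(B ∷ Bs) = result where
  open Projection (projection act Bs)
  g = K B
  β = g · B
  cβ = scales B(orthogonal B)== cong(c *_)(·-comm B g)
  Kv·B : ∀ v -> K v · B ≡ v · g
  Kv·B v = K-sym v B
  len = pos-+ 1(length Bs)
  K1 : Vec ℤ n -> Vec ℤ n
  K1 v = β ⋆ K v ⊹ (- (v · g)) ⋆ g
  dot1 : ∀ v w -> w · K1 v ≡ β *(w · K v)+ -(v · g)*(w · g)
  dot1 v w = ·-addʳ w(β ⋆ K v)_ ==(cong₂ _+_ (·-scaleʳ β w(K v))(·-scaleʳ(- (v · g))w g))
  result : Projection act(B ∷ Bs)
  result with <-cmp 0ℤ β
  ... | tri> _ _ β<0 = record { K = K ; c = c ; c>0 = c>0 ; orthogonal = λ v -> ⊥-elim bad ∷ orthogonal v ; scales = λ v ort -> ⊥-elim bad ; trace = ⊥-elim bad } where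
   open import Data.Empty using (⊥; ⊥-elim)
   bad = <⇒≱ β<0(*-cancel c>0(*-zeroʳ c =<(subst(0ℤ ≤_)cβ(·-self≥0 g))))
  ... | tri≈ _ 0≡β _ = record
   { K = K ; c = c ; c>0 = c>0
   ; orthogonal = λ v -> ·-comm B(K v)== Kv·B v == norm-zero v g(cβ == cong(c *_)(sym 0≡β)== *-zeroʳ c)∷ orthogonal v
   ; scales = λ { v(_ ∷ ort) -> scales v ort }
   ; trace = ≤-diff c(<⇒≤ c>0)(cong (λ z -> c *(+ count act - z)+ c)len == eq c(+ count act)(+ length Bs))<< trace } where
   eq : ∀ c k l -> c *(k -(1ℤ + l))+ c ≡ c *(k - l)
   eq = ring
  ... | tri< 0<β _ _ = record
   { K = K1 ; c = β * c ; c>0 = 0<* 0<β c>0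
   ; orthogonal = λ v -> dot1 v B == cong₂ (λ x y -> β * x + -(v · g)* y)(·-comm B(K v)== Kv·B v)(·-comm B g)== eq1 β(v · g)
    ∷ All.zipWith(λ {C}(p , q) -> dot1 v C == cong₂ (λ x y -> β * x + -(v · g)* y)p q == eq2 β(v · g))(orthogonal v , orthogonal B)
   ; scales = λ { v {w}(h ∷ ort) -> ·-comm(K1 v)w == dot1 v w == cong₂ (λ x y -> β * x + -(v · g)* y)(·-comm w(K v)== scales v ort)(·-comm w g == scales B ort == cong(c *_)h == *-zeroʳ c)== eq3 β c(v · w)(v · g) }
   ; trace = cong (λ z -> β * c *(+ count act - z))len =<
    eq4 β c(+ count act)(+ length Bs)=<
    +-mono-≤(*-monoˡ(<⇒≤ 0<β)trace)(neg-mono-≤(mask-norm act g <= cβ))<=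
    (cong₂ _+_ (sym(∑-scale β(units n)_))(neg-1* _ == cong(-1ℤ *_)(sym(units-square(mask act g)))== sym(∑-scale -1ℤ(units n)_)))==
    sym(∑-+ (units n)_ _)==
    ∑-cong(units n)(λ e -> cong (λ z -> β *(mask act e · K(mask act e))+ -1ℤ *(z * z))(mask-sym act g e == ·-comm g(mask act e))== cong (λ z -> β *(mask act e · K(mask act e))+ z)(neg2(mask act e · g))== sym(dot1(mask act e)(mask act e))) } where
   eq1 : ∀ β x -> β * x + - x * β ≡ 0ℤ
   eq1 = ring
   eq2 : ∀ β x -> β * 0ℤ + - x * 0ℤ ≡ 0ℤ
   eq2 = ring
   eq3 : ∀ β c x y -> β *(c * x)+ - y * 0ℤ ≡ β * c * x
   eq3 = ring
   eq4 : ∀ β c k l -> β * c *(k -(1ℤ + l))≡ β *(c *(k - l))+ -(c * β)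
   eq4 = ring
   neg-1* : ∀ x -> - x ≡ -1ℤ * x
   neg-1* = ring
   neg2 : ∀ x -> -1ℤ *(x * x)≡ - x * x
   neg2 = ring

 module _ {n}(act : Vec Bool n)(Bs : Rows n)(D : ℤ)(total≤D : total Bs ≤ D) where

  open Heat Bs D total≤D

  flow-correlation : ∀ R b -> ∑l(units n)(λ e ->(b · flow R(mask act e))*(b · flow R(mask act e)))≤ D ^ R * D ^ R *(b · b)
  flow-correlation R b = ∑-cong(units n)(λ e -> cong (λ z -> z * z)(eq e))== units-square(mask act(flow R b))=<
   mask-norm act(flow R b)<< flow-norm R b where
   eq : ∀ e -> b · flow R(mask act e)≡ mask act(flow R b)· e
   eq e = sym(flow-sym R b(mask act e))== sym(mask-sym act(flow R b)e)

  flow-total : ∀ R -> D ^ R * D ^ R *(+ count act - + length Bs)≤ ∑l(units n)(λ e -> flow R(mask act e)· flow R(mask act e))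
  flow-total R = *-cancel c>0( eq c(N * N)(+ count act - + length Bs)=<
   *-monoˡ(sq≥0 N)trace <<
   sym(∑-scale(N * N)(units n)_)=<
   ∑-mono(units n)(λ e -> one(mask act e))<=
   ∑-scale c(units n)_) where
   open Projection (projection act Bs)
   N = D ^ R
   eq : ∀ a b x -> a *(b * x)≡ b *(a * x)
   eq = ring
   one : ∀ v -> N * N *(v · K v)≤ c *(flow R v · flow R v)
   one v with <-cmp 0ℤ(v · K v)
   ... | tri< 0<p _ _ = *-cancel 0<p( eq1(v · K v)N =<
    cong (λ z -> z * z)(sym(flow-fixed R v(orthogonal v)))=<
    cauchy-schwarz(flow R v)(K v)<=
    cong(flow R v · flow R v *_)(scales v(orthogonal v))==
    eq2(flow R v · flow R v)c(v · K v)) where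
    eq1 : ∀ p N -> p *(N * N * p)≡ N * p *(N * p)
    eq1 = ring
    eq2 : ∀ x c p -> x *(c * p)≡ p *(c * x)
    eq2 = ring
   ... | tri≈ _ 0≡p _ = cong(N * N *_)(sym 0≡p)== *-zeroʳ(N * N)=< 0≤*(<⇒≤ c>0)(·-self≥0(flow R v))
   ... | tri> _ _ p<0 = *-monoˡ(sq≥0 N)(<⇒≤ p<0)<< *-zeroʳ(N * N)=< 0≤*(<⇒≤ c>0)(·-self≥0(flow R v))

 -- (1 + 1/H)^j ≤ 1 + j/H + (j/H)² for 0 ≤ j ≤ H, and the same for -j.
 power-upper : ∀ {H}j -> 0ℤ ≤ H -> + j ≤ H ->(H + 1ℤ) ^ j *(H * H)≤ H ^ j *(H * H + H * + j + + j * + j)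
 power-upper {H}zero 0≤H j≤H = ≤-reflexive(eq H) where
  eq : ∀ H -> 1ℤ *(H * H)≡ 1ℤ *(H * H + H * 0ℤ + 0ℤ * 0ℤ)
  eq = ring
 power-upper {H}(suc j)0≤H j≤H = *-assoc(H + 1ℤ)((H + 1ℤ) ^ j)(H * H)=<
  *-monoˡ(0≤+ 0≤H(+≤+ N.z≤n))(power-upper j 0≤H j≤H')<<
  ≤-diff(H ^ j *(J *(H - J)+ H))(0≤*(0≤^ j 0≤H)(0≤+(0≤*(0≤pos j)(0≤-sub j≤H'))0≤H))(eq H(H ^ j)J)<=
  cong (λ z -> H * H ^ j *(H * H + H * z + z * z))(sym(pos-+ 1 j)) where
  J = + j
  j≤H' =(+≤+ (N.n≤1+n j))<< j≤H
  eq : ∀ H p j ->(H + 1ℤ)*(p *(H * H + H * j + j * j))+ p *(j *(H - j)+ H)≡ H * p *(H * H + H *(1ℤ + j)+(1ℤ + j)*(1ℤ + j))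
  eq = ring

 bernoulli : ∀ {H}j -> 0ℤ ≤ H -> H ^ j *(H + + j)≤(H + 1ℤ) ^ j * H
 bernoulli {H}zero 0≤H = ≤-reflexive(eq H) where
  eq : ∀ H -> 1ℤ *(H + 0ℤ)≡ 1ℤ * H
  eq = ring
 bernoulli {H}(suc j)0≤H = cong (λ z -> H * H ^ j *(H + z))(pos-+ 1 j)=<
  ≤-diff(H ^ j * + j)(0≤*(0≤^ j 0≤H)(+≤+ N.z≤n))(eq H(H ^ j)(+ j))<<
  *-monoˡ(0≤+ 0≤H(+≤+ N.z≤n))(bernoulli j 0≤H)<=
  sym(*-assoc(H + 1ℤ)((H + 1ℤ) ^ j)H) where
  eq : ∀ H p j -> H * p *(H +(1ℤ + j))+ p * j ≡(H + 1ℤ)*(p *(H + j))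
  eq = ring

 power-lower : ∀ {H}j -> 0ℤ < H -> + j ≤ H -> H ^ j *(H * H)≤(H + 1ℤ) ^ j *(H * H - H * + j + + j * + j)
 power-lower {H}j 0<H j≤H = *-cancel 0<H( ≤-diff(H ^ j *(J * J * J))(0≤*(0≤^ j 0≤H)(0≤*(sq≥0 J)(+≤+ N.z≤n)))(eq H(H ^ j)J)<<
  *-monoʳ 0≤F(bernoulli j 0≤H)<=
  eq' H((H + 1ℤ) ^ j)F) where
  J = + j
  0≤H = <⇒≤ 0<H
  F = H * H - H * J + J * J
  0≤F = 0≤+(0≤* 0≤H(0≤-sub j≤H))(sq≥0 J)<= eq'' H J where
   eq'' : ∀ H j -> H *(H - j)+ j * j ≡ H * H - H * j + j * j
   eq'' = ring
  eq : ∀ H p j -> H *(p *(H * H))+ p *(j * j * j)≡ p *(H + j)*(H * H - H * j + j * j)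
  eq = ring
  eq' : ∀ H p f -> p * H * f ≡ H *(p * f)
  eq' = ring

 power-double : ∀ h -> 0ℤ < + h -> ∀ i ->(+ 2) ^ i *(+ h) ^ (i N.* h)≤(+ h + 1ℤ) ^ (i N.* h)
 power-double h 0<h zero = ≤-refl
 power-double h 0<h(suc i) = cong((+ 2) ^ suc i *_)(^-distribˡ-+-*(+ h)h(i N.* h))=<
  eq(+ 2)((+ 2) ^ i)((+ h) ^ h)((+ h) ^ (i N.* h))=<
  *-mono(0≤^ h(+≤+ N.z≤n))(0≤*(0≤^ i(+≤+ N.z≤n))(0≤^(i N.* h)(+≤+ N.z≤n)))two(power-double h 0<h i)<=
  sym(^-distribˡ-+-*(+ h + 1ℤ)h(i N.* h)) where
  eq : ∀ a b c d -> a * b *(c * d)≡ a * c *(b * d)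
  eq = ring
  eq' : ∀ p h -> p *(h + h)≡ h *(+ 2 * p)
  eq' = ring
  two = *-cancel {+ h}0<h( sym(eq'((+ h) ^ h)(+ h))=<
   bernoulli h(+≤+ N.z≤n)<=
   *-comm _ (+ h))

 -- One multiplicative update in terms of integral exponents: the weight factor
 -- 1 + z + z² - d, with z = Z/H and d = s²/n⁹, is at least (1 + 1/H)^(Z - e) for e = 2 d H.
 record Exponent (H : ℤ) : Set where
  constructor _⟋_
  field
   up down : ℕ
  value : ℤ
  value = + up - + down
  numerator denominator : ℤ
  numerator =(H + 1ℤ) ^ up * H ^ down
  denominator =(H + 1ℤ) ^ down * H ^ up

 open Exponent public

 module _ {H H' p s : ℤ}(0<H : 0ℤ < H)(0≤p : 0ℤ ≤ p)(H≡ : H ≡ p * H')(0≤s : 0ℤ ≤ s)(0≤H' : 0ℤ ≤ H') where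

  private
   e = + 2 *(s * s)* H'
   0≤H = <⇒≤ 0<H
   0≤e : 0ℤ ≤ e
   0≤e = 0≤*(0≤*(0≤pos 2)(sq≥0 s))0≤H'

  factor : ℤ -> ℤ
  factor Z = p *(H * H + H * Z + Z * Z) - s * s *(H * H)

  factor-lower : ∀ Z -> 0ℤ ≤ H + + 4 * Z - + 2 * e -> let j = Z - e in p *(H * H + H * j + j * j)≤ factor Z
  factor-lower Z h = ≤-diff(s * s * H *(H + + 4 * Z - + 2 * e))(0≤*(0≤*(sq≥0 s)0≤H)h)
   (cong (λ H -> p *(H * H + H *(Z - e)+(Z - e)*(Z - e))+ s * s * H *(H + + 4 * Z - + 2 * e))H≡ ==
   eq p H' s Z == cong (λ H -> p *(H * H + H * Z + Z * Z) - s * s *(H * H))(sym H≡)) where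
   eq : ∀ p h s Z -> p *(p * h *(p * h)+ p * h *(Z - + 2 *(s * s)* h)+(Z - + 2 *(s * s)* h)*(Z - + 2 *(s * s)* h))+ s * s *(p * h)*(p * h + + 4 * Z - + 2 *(+ 2 *(s * s)* h))
    ≡ p *(p * h *(p * h)+ p * h * Z + Z * Z) - s * s *(p * h *(p * h))
   eq = ring

  -- V' q0 den' ≥ V0 q' num' follows from V q0 den ≥ V0 q num.
  exponent-step : ∀ Z -> 0ℤ ≤ H + + 4 * Z - + 2 * e -> Z ≤ H -> - Z + e ≤ H -> ∀ {V0 q0 V q} -> 0ℤ ≤ V0 -> 0ℤ ≤ q0 -> 0ℤ ≤ V -> 0ℤ ≤ q ->
   (x : Exponent H) -> V0 * q * numerator x ≤ V * q0 * denominator x ->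
   Σ[ y ∈ Exponent H ] value y ≡ value x +(Z - e)× V0 *(q *(p *(H * H)))* numerator y ≤ V * factor Z * q0 * denominator y
  exponent-step Z h Z≤H -Z≤H {V0}{q0}{V}{q}0≤V0 0≤q0 0≤V 0≤q(P ⟋ Q)inv with Z - e in jeq
  ... | + j =((P N.+ j) ⟋ Q), val ,( cong (λ z -> V0 *(q *(p *(H * H)))*(z * H ^ Q))(^-distribˡ-+-*(H + 1ℤ)P j)=<
   eq1 V0 q p(H * H)((H + 1ℤ) ^ P)((H + 1ℤ) ^ j)(H ^ Q)=<
   *-mono(0≤*(0≤* 0≤V 0≤q0)(0≤*(0≤^ Q 0≤H+1)(0≤^ P 0≤H)))(0≤* 0≤p(0≤*(0≤^ j 0≤H+1)(sq≥0 H)))inv step <=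
   eq2 V q0((H + 1ℤ) ^ Q)(H ^ P)(H ^ j)(factor Z)==
   cong (λ z -> V * factor Z * q0 *((H + 1ℤ) ^ Q * z))(sym(^-distribˡ-+-* H P j))) where
   0≤H+1 = 0≤+ 0≤H(+≤+ N.z≤n)
   j≤H =(sym jeq =< ≤-diff e 0≤e(eq Z e))<< Z≤H where
    eq : ∀ Z e -> Z - e + e ≡ Z
    eq = ring
   step = *-monoˡ 0≤p(power-upper j 0≤H j≤H)<< eq p(H ^ j)(H * H + H * + j + + j * + j)=< *-monoˡ(0≤^ j 0≤H)(subst (λ z -> p *(H * H + H * z + z * z)≤ factor Z)jeq(factor-lower Z h)) where
    eq : ∀ a b c -> a *(b * c)≡ b *(a * c)
    eq = ring
   val = cong(_- + Q)(pos-+ P j)== eq(+ P)(+ j)(+ Q) where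
    eq : ∀ a b c -> a + b - c ≡ a - c + b
    eq = ring
   eq1 : ∀ v q p h a b c -> v *(q *(p * h))*(a * b * c)≡ v * q *(a * c)*(p *(b * h))
   eq1 = ring
   eq2 : ∀ v q a b c f -> v * q *(a * b)*(c * f)≡ v * f * q *(a *(b * c))
   eq2 = ring
  ... | -[1+ k ] =(P ⟋ (Q N.+ j)), val ,( cong (λ z -> V0 *(q *(p *(H * H)))*((H + 1ℤ) ^ P * z))(^-distribˡ-+-* H Q j)=<
   eq1 V0 q p(H * H)((H + 1ℤ) ^ P)(H ^ Q)(H ^ j)=<
   *-mono(0≤*(0≤* 0≤V 0≤q0)(0≤*(0≤^ Q 0≤H+1)(0≤^ P 0≤H)))(0≤* 0≤p(0≤*(0≤^ j 0≤H)(sq≥0 H)))inv step <=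
   eq2 V q0((H + 1ℤ) ^ Q)(H ^ P)((H + 1ℤ) ^ j)(factor Z)==
   cong (λ z -> V * factor Z * q0 *(z * H ^ P))(sym(^-distribˡ-+-*(H + 1ℤ)Q j))) where
   j = suc k
   0≤H+1 = 0≤+ 0≤H(+≤+ N.z≤n)
   j≤H =((cong -_ (sym jeq))=< ≤-reflexive(eq Z e))<< -Z≤H where
    eq : ∀ Z e -> -(Z - e)≡ - Z + e
    eq = ring
   step = *-monoˡ 0≤p(power-lower j 0<H j≤H)<< eq p((H + 1ℤ) ^ j)H(+ j)=< *-monoˡ(0≤^ j 0≤H+1)(subst (λ z -> p *(H * H + H * z + z * z)≤ factor Z)jeq(factor-lower Z h)) where
    eq : ∀ a b H j -> a *(b *(H * H - H * j + j * j))≡ b *(a *(H * H + H *(- j)+ - j * - j))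
    eq = ring
   val = cong (λ z -> + P - z)(pos-+ Q j)== eq(+ P)(+ Q)(+ j) where
    eq : ∀ a b c -> a -(b + c)≡ a - b + - c
    eq = ring
   eq1 : ∀ v q p h a b c -> v *(q *(p * h))*(a *(b * c))≡ v * q *(a * b)*(p *(c * h))
   eq1 = ring
   eq2 : ∀ v q a b c f -> v * q *(a * b)*(c * f)≡ v * f * q *(a * c * b)
   eq2 = ring

 -- If (1 + 1/h)^(P - Q) ≤ 2^g then (P - Q)/h ≤ g + 1.
 exponent-bound : ∀ h -> 0ℤ < + h ->(x : Exponent(+ h)) -> ∀ g -> numerator x ≤(+ 2) ^ g * denominator x -> value x ≤ + suc g * + h
 exponent-bound h 0<h(P ⟋ Q)g le with ≤-total(+ P)(+ Q)
 ... | inj₁ P≤Q =(+-monoˡ-≤(- + Q)P≤Q <= +-inverseʳ(+ Q))<< 0≤* {+ suc g}{+ h}(+≤+ N.z≤n)(+≤+ N.z≤n)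
 ... | inj₂(+≤+ Q≤P) with N.m≤n⇒∃[o]m+o≡n Q≤P
 ... | k , refl with ≤-total(+ k)(+ suc g * + h)
 ... | inj₁ k≤ = cong(_- + Q)(pos-+ Q k)== eq(+ Q)(+ k)=< k≤ where
  eq : ∀ a b -> a + b - a ≡ b
  eq = ring
 ... | inj₂ ≤k with N.m≤n⇒∃[o]m+o≡n(drop‿+≤+(pos-*(suc g)h =< ≤k))
 ... | l , refl = ⊥-elim(<⇒≱ (+<+ (N.s≤s(N.s≤s N.z≤n)))(*-cancel {(H + 1ℤ) ^ Q * H ^ Q *((+ 2) ^ g * H ^ (suc g N.* h)* H ^ l)}pos>0( e1((H + 1ℤ) ^ Q)(H ^ Q)((+ 2) ^ g)(H ^ (suc g N.* h))(H ^ l)=<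
  *-monoˡ(0≤*(0≤^ Q 0≤H+1)(0≤^ Q 0≤H))(*-mono(0≤^(suc g N.* h)0≤H+1)(0≤^ l 0≤H)(power-double h 0<h(suc g))(^-monoˡ l))<<
  cong((H + 1ℤ) ^ Q * H ^ Q *_)(sym(^-distribˡ-+-*(H + 1ℤ)(suc g N.* h)l))=<
  e2((H + 1ℤ) ^ Q)(H ^ Q)((H + 1ℤ) ^ m)=<
  cong(_* H ^ Q)(sym(^-distribˡ-+-*(H + 1ℤ)Q k))=<
  le <=
  cong (λ z ->(+ 2) ^ g *((H + 1ℤ) ^ Q * z))(^-distribˡ-+-* H Q k == cong(H ^ Q *_)(^-distribˡ-+-* H(suc g N.* h)l))==
  e3((H + 1ℤ) ^ Q)(H ^ Q)((+ 2) ^ g)(H ^ (suc g N.* h))(H ^ l)))) where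
  open import Data.Empty using (⊥-elim)
  m = suc g N.* h N.+ l
  H = + h
  0≤H = +≤+ N.z≤n
  0≤H+1 = +≤+ N.z≤n
  0<^ : ∀ {x}n -> 0ℤ < x -> 0ℤ < x ^ n
  0<^ zero h = +<+ (N.s≤s N.z≤n)
  0<^(suc n)h = 0<* h(0<^ n h)
  ^-monoˡ : ∀ l -> H ^ l ≤(H + 1ℤ) ^ l
  ^-monoˡ zero = ≤-refl
  ^-monoˡ(suc l) = *-mono 0≤H+1(0≤^ l 0≤H)(i≤i+j H 1ℤ)(^-monoˡ l)
  pos>0 = 0<*(0<*(0<^ Q(<-≤-trans 0<h(i≤i+j H 1ℤ)))(0<^ Q 0<h))(0<*(0<*(0<^ g(+<+ (N.s≤s N.z≤n)))(0<^(suc g N.* h)0<h))(0<^ l 0<h))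
  e1 : ∀ a b c d e -> a * b *(c * d * e)* + 2 ≡ a * b *((+ 2 * c * d)* e)
  e1 = ring
  e2 : ∀ a b c -> a * b * c ≡ a * c * b
  e2 = ring
  e3 : ∀ a b c d e -> c *(a *(b *(d * e)))≡ a * b *(c * d * e)* 1ℤ
  e3 = ring

 open import Data.List.Membership.Propositional using (_∈_)
 open import Data.List.Relation.Unary.Any using (here; there)
 open import Data.List.Relation.Binary.Pointwise.Base using (Pointwise; []; _∷_)
 open import Data.List.Membership.Propositional.Properties using (∈-++⁺ˡ; ∈-++⁺ʳ; ∈-map⁺)
 import Data.List.Relation.Unary.All.Properties as All
 open Arithmetic using (isNeg; _≤?b_; ≤?b-def)
 open Chainℕ using () renaming (_<<_ to _ℕ<<_; _<=_ to _ℕ<=_)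

 ≤?b-true : ∀ x y ->(x ≤?b y)≡ true -> x ≤ y
 ≤?b-true x y h = ≤-diff(y + - x)(nonneg(y + - x)(≤?b-def x y == h))(eq x y) where
  nonneg : ∀ z -> not(isNeg z)≡ true -> 0ℤ ≤ z
  nonneg(+ n)_ = +≤+ N.z≤n
  eq : ∀ x y -> x +(y + - x)≡ y
  eq = ring

 ≤?b-complete : ∀ {x y} -> x ≤ y ->(x ≤?b y)≡ true
 ≤?b-complete {x}{y}h = sym(≤?b-def x y)== go(y + - x)(0≤-sub h) where
  go : ∀ z -> 0ℤ ≤ z -> not(isNeg z)≡ true
  go(+ n)_ = refl
  go -[1+ n ] ()

 ≤?b-false : ∀ x y ->(x ≤?b y)≡ false -> y < x
 ≤?b-false x y h with <-cmp y x
 ... | tri< y<x _ _ = y<x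
 ... | tri≈ _ refl _ with sym h == ≤?b-complete(≤-refl {y})
 ... | ()
 ≤?b-false x y h | tri> _ _ x<y with sym h == ≤?b-complete(<⇒≤ x<y)
 ... | ()

 square-≤ : ∀ {a b} -> 0ℤ ≤ b -> a * a ≤ b * b -> a ≤ b
 square-≤ {a}{b}0≤b h with ≤-total a b
 ... | inj₁ a≤b = a≤b
 ... | inj₂ b≤a with <-cmp a b
 ... | tri< a<b _ _ = <⇒≤ a<b
 ... | tri≈ _ refl _ = ≤-refl
 ... | tri> _ _ b<a = ⊥-elim(<⇒≱ (lt 0≤b b<a)h) where
  lt : ∀ {a b} -> 0ℤ ≤ b -> b < a -> b * b < a * a
  lt {+ m}{+ n}_ (+<+ n<m) = subst₂ _<_ (pos-* n n)(pos-* m m)(+<+ (N.*-mono-< n<m n<m))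

 abs-≤ : ∀ {a b} -> 0ℤ ≤ b -> a * a ≤ b * b -> + ∣ a ∣ ≤ b
 abs-≤ {+ a}0≤b h = square-≤ 0≤b h
 abs-≤ { -[1+ a ]}0≤b h = square-≤ 0≤b h

 ≤-abs : ∀ a -> a ≤ + ∣ a ∣
 ≤-abs(+ a) = ≤-refl
 ≤-abs -[1+ a ] = -≤+

 neg≤-abs : ∀ a -> - a ≤ + ∣ a ∣
 neg≤-abs(+ zero) = ≤-refl
 neg≤-abs(+ suc a) = -≤+
 neg≤-abs -[1+ a ] = ≤-refl

 abs-square : ∀ a -> + ∣ a ∣ * + ∣ a ∣ ≡ a * a
 abs-square(+ a) = refl
 abs-square -[1+ a ] = refl

 mask-add : ∀ {n}a (u v : Vec ℤ n) -> mask a(u ⊹ v)≡ mask a u ⊹ mask a v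
 mask-add [] [] [] = refl
 mask-add(true ∷ a)(x ∷ u)(y ∷ v) = cong(x + y ∷_)(mask-add a u v)
 mask-add(false ∷ a)(x ∷ u)(y ∷ v) = cong(0ℤ ∷_)(mask-add a u v)

 mask-scale : ∀ {n}a c (u : Vec ℤ n) -> mask a(c ⋆ u)≡ c ⋆ mask a u
 mask-scale [] c [] = refl
 mask-scale(true ∷ a)c(x ∷ u) = cong(c * x ∷_)(mask-scale a c u)
 mask-scale(false ∷ a)c(x ∷ u) = cong₂ _∷_ (sym(*-zeroʳ c))(mask-scale a c u)

 quadratic-member : ∀ {n}(Bs : Rows n)u {P : Vec ℤ n -> Set} -> All P Bs -> All (λ B ->(B · u)*(B · u)≤ qform Bs u)Bs
 quadratic-member [] u [] = []
 quadratic-member(B ∷ Bs)u(p ∷ ps) = ≤-diff(qform Bs u)(quadratic≥0 Bs u)refl ∷ All.map (λ h -> h << ≤-diff((B · u)*(B · u))(sq≥0(B · u))(+-comm(qform Bs u)_))(quadratic-member Bs u ps)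

 ∑-swap : ∀ {A B : Set}(xs : List A)(ys : List B)(f : A -> B -> ℤ) -> ∑l xs (λ x -> ∑l ys(f x))≡ ∑l ys (λ y -> ∑l xs (λ x -> f x y))
 ∑-swap [] ys f = sym(∑-cong ys (λ _ -> refl)== zero-sum ys) where
  zero-sum : ∀ {B : Set}(ys : List B) -> ∑l ys (λ _ -> 0ℤ)≡ 0ℤ
  zero-sum [] = refl
  zero-sum(y ∷ ys) = +-identityˡ _ == zero-sum ys
 ∑-swap(x ∷ xs)ys f = cong (λ z -> ∑l ys(f x)+ z)(∑-swap xs ys f)== sym(∑-+ ys(f x)(λ y -> ∑l xs (λ x -> f x y)))

 ∑-const : ∀ {A : Set}(xs : List A)c -> ∑l xs (λ _ -> c)≡ + length xs * c
 ∑-const [] c = sym(*-zeroˡ c)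
 ∑-const(x ∷ xs)c = cong (λ z -> c + z)(∑-const xs c)== eq c(+ length xs)== cong(_* c)(sym(pos-+ 1(length xs))) where
  eq : ∀ c l -> c + l * c ≡(1ℤ + l)* c
  eq = ring

 ∑-pos : ∀ {A : Set}x (xs : List A)(f : A -> ℤ) -> ∑l(x ∷ xs)f ≤ 0ℤ -> Σ[ y ∈ A ] y ∈ (x ∷ xs)× f y ≤ 0ℤ
 ∑-pos x [] f h = x , here refl , sym(+-identityʳ(f x))=< h
 ∑-pos x(y ∷ xs)f h with ≤-total(f x)0ℤ
 ... | inj₁ p = x , here refl , p
 ... | inj₂ p = let (z , z∈ , hz) = ∑-pos y xs f((sym(+-identityˡ _)=< +-monoˡ-≤(∑l(y ∷ xs)f)p)<< h)
  in z , there z∈ , hz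

 ∑-pos' : ∀ {A : Set}(xs : List A)(f : A -> ℤ) -> 1 N.≤ length xs -> ∑l xs f ≤ 0ℤ -> Σ[ y ∈ A ] y ∈ xs × f y ≤ 0ℤ
 ∑-pos'(x ∷ xs)f _ h = ∑-pos x xs f h

 length-units : ∀ n -> length(units n)≡ n
 length-units zero = refl
 length-units(suc n) = cong suc(length-map'(units n)== length-units n) where
  length-map' : ∀ {n}(xs : List(Vec ℤ n)) -> length(List.map(0ℤ ∷_)xs)≡ length xs
  length-map' [] = refl
  length-map'(x ∷ xs) = cong suc(length-map' xs)

 units-norm : ∀ n -> All (λ e -> e · e ≡ 1ℤ)(units n)
 units-norm zero = []
 units-norm(suc n) = cong (λ z -> 1ℤ + z)(·-zeroʳ(zeros {n}))∷ map0(units n)(units-norm n) where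
  map0 : ∀ {n}(es : List(Vec ℤ n)) -> All (λ e -> e · e ≡ 1ℤ)es -> All (λ e -> e · e ≡ 1ℤ)(List.map(0ℤ ∷_)es)
  map0 [] [] = []
  map0(e ∷ es)(h ∷ hs) = +-identityˡ _ == h ∷ map0 es hs

 record Row (n : ℕ) : Set where
  constructor row
  field
   s V : ℤ
   A : Vec ℤ n

 record State (n : ℕ) : Set where
  constructor state
  field
   x : Vec ℤ n
   rows : List(Row n)
   q : ℤ

 open Row public
 open State public

 0<pos : ∀ k -> 0ℤ < + suc k
 0<pos k = +<+ (N.s≤s N.z≤n)

 0<^ : ∀ {x}n -> 0ℤ < x -> 0ℤ < x ^ n
 0<^ zero h = +<+ (N.s≤s N.z≤n)
 0<^(suc n)h = 0<* h(0<^ n h)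

 1≤^ : ∀ {x}n -> 1ℤ ≤ x -> 1ℤ ≤ x ^ n
 1≤^ zero h = ≤-refl
 1≤^ {x}(suc n)h = *-mono {1ℤ}{x}{1ℤ}{x ^ n}(0≤pos 1 << h)(0≤pos 1)h(1≤^ n h)

 ^-mono-exp : ∀ {x}{i j} -> 1ℤ ≤ x -> i N.≤ j -> x ^ i ≤ x ^ j
 ^-mono-exp {x}{j = j}h N.z≤n = 1≤^ j h
 ^-mono-exp {x}h(N.s≤s i≤j) = *-monoˡ(0≤pos 1 << h)(^-mono-exp h i≤j)

 ^-mul : ∀ x y n ->(x * y) ^ n ≡ x ^ n * y ^ n
 ^-mul x y zero = refl
 ^-mul x y(suc n) = cong(x * y *_)(^-mul x y n)== eq x y(x ^ n)(y ^ n) where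
  eq : ∀ a b c d -> a * b *(c * d)≡ a * c *(b * d)
  eq = ring

 square-bound : ∀ {c Z H} -> 0ℤ ≤ H -> c * c *(Z * Z)≤ H * H -> c * Z ≤ H × -(c * Z)≤ H
 square-bound {c}{Z}{H}0≤H h = ≤-abs(c * Z)<< le , neg≤-abs(c * Z)<< le where
  eq : ∀ c z -> c * z *(c * z)≡ c * c *(z * z)
  eq = ring
  le = abs-≤ {c * Z}0≤H(eq c Z =< h)

 step-conditions : ∀ {H Z e} -> 0ℤ ≤ H -> + 8 * Z ≤ H -> -(+ 8 * Z)≤ H -> + 8 * e ≤ H ->
  0ℤ ≤ H + + 4 * Z - + 2 * e × Z ≤ H × - Z + e ≤ H
 step-conditions {H}{Z}{e}0≤H up lo de =
  *-cancel {+ 8}(0<pos 7)(≤-diff(+ 4 *(H - -(+ 8 * Z))+ + 2 *(H - + 8 * e)+ + 2 * H)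
   (0≤+(0≤+(0≤*(0≤pos 4)(0≤-sub lo))(0≤*(0≤pos 2)(0≤-sub de)))(0≤*(0≤pos 2)0≤H))(e1 H Z e)),
  *-cancel {+ 8}(0<pos 7)(≤-diff((H - + 8 * Z)+ + 7 * H)(0≤+(0≤-sub up)(0≤*(0≤pos 7)0≤H))(e2 H Z)),
  *-cancel {+ 8}(0<pos 7)(≤-diff((H - -(+ 8 * Z))+(H - + 8 * e)+ + 6 * H)(0≤+(0≤+(0≤-sub lo)(0≤-sub de))(0≤*(0≤pos 6)0≤H))(e3 H Z e)) where
  e1 : ∀ H Z e -> + 8 * 0ℤ +(+ 4 *(H - -(+ 8 * Z))+ + 2 *(H - + 8 * e)+ + 2 * H)≡ + 8 *(H + + 4 * Z - + 2 * e)
  e1 = ring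
  e2 : ∀ H Z -> + 8 * Z +((H - + 8 * Z)+ + 7 * H)≡ + 8 * H
  e2 = ring
  e3 : ∀ H Z e -> + 8 *(- Z + e)+((H - -(+ 8 * Z))+(H - + 8 * e)+ + 6 * H)≡ + 8 * H
  e3 = ring

 -- With c = n¹² for heavy rows.
 weight-heavy : ∀ {H Z c p s} -> 0ℤ ≤ H -> 0ℤ ≤ p -> 1ℤ ≤ c -> c * c *(Z * Z)≤ H * H -> c *(p *(H * H + H * Z + Z * Z) - s * s *(H * H))≤(c + + 2)*(p *(H * H))
 weight-heavy {H}{Z}{c}{p}{s}0≤H 0≤p 1≤c sq = ≤-diff(p *(H *(H - c * Z)+(H * H - c * c *(Z * Z))+(c - 1ℤ)* c *(Z * Z))+ c *(s * s)*(H * H))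
  (0≤+(0≤* 0≤p(0≤+(0≤+(0≤* 0≤H(0≤-sub(proj₁(square-bound {c}{Z}0≤H sq))))(0≤-sub sq))(0≤*(0≤*(0≤-sub 1≤c)0≤c)(sq≥0 Z))))(0≤*(0≤* 0≤c(sq≥0 s))(sq≥0 H)))
  (eq H Z c p s) where
  0≤c = 0≤pos 1 << 1≤c
  eq : ∀ H Z c p s -> c *(p *(H * H + H * Z + Z * Z) - s * s *(H * H))+(p *(H *(H - c * Z)+(H * H - c * c *(Z * Z))+(c - 1ℤ)* c *(Z * Z))+ c *(s * s)*(H * H))≡(c + + 2)*(p *(H * H))
  eq = ring

 weight-light : ∀ {H Z p s} -> 0ℤ ≤ H -> 0ℤ ≤ p -> + 64 *(Z * Z)≤ H * H -> p *(H * H + H * Z + Z * Z) - s * s *(H * H)≤ + 2 *(p *(H * H))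
 weight-light {H}{Z}{p}{s}0≤H 0≤p sq = *-cancel {+ 64}(0<pos 63)(≤-diff(p *(+ 8 * H *(H - + 8 * Z)+(H * H - + 64 *(Z * Z))+ + 55 *(H * H))+ + 64 *(s * s)*(H * H))
  (0≤+(0≤* 0≤p(0≤+(0≤+(0≤*(0≤*(0≤pos 8)0≤H)(0≤-sub(proj₁(square-bound {+ 8}{Z}0≤H sq))))(0≤-sub sq))(0≤*(0≤pos 55)(sq≥0 H))))(0≤*(0≤*(0≤pos 64)(sq≥0 s))(sq≥0 H)))
  (eq H Z p s)) where
  eq : ∀ H Z p s -> + 64 *(p *(H * H + H * Z + Z * Z) - s * s *(H * H))+(p *(+ 8 * H *(H - + 8 * Z)+(H * H - + 64 *(Z * Z))+ + 55 *(H * H))+ + 64 *(s * s)*(H * H))≡ + 64 *(+ 2 *(p *(H * H)))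
  eq = ring

 true≢false : ∀ {b} -> b ≡ true -> b ≡ false -> ⊥
 true≢false refl()

 pointwise-map : ∀ {A B : Set}{P Q : A -> B -> Set}{S : B -> Set}(f : B -> B) ->(∀ {a b} -> P a b -> S b -> Q a(f b)) ->
  ∀ {as bs} -> Pointwise P as bs -> All S bs -> Pointwise Q as(List.map f bs)
 pointwise-map f h [] [] = []
 pointwise-map f h(p ∷ ps)(s ∷ ss) = h p s ∷ pointwise-map f h ps ss

 exponent-bound' : ∀ {H} -> 0ℤ < H ->(x : Exponent H) -> ∀ g -> numerator x ≤(+ 2) ^ g * denominator x -> value x ≤ + suc g * H
 exponent-bound' {+ h}0<h x g le = exponent-bound h 0<h x g le
 exponent-bound' { -[1+ _ ]}()

 levels : ℕ -> ℕ
 levels k = 2 N.* (suc k N.* suc k)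

 -- q0 / V0 = 4^((k+1)²) for a row with s = k.
 record StartRow {n}(E q0 : ℤ)(r : Row n) : Set where
  field
   k : ℕ
   k≤n : k N.≤ n
   s≡k : s r ≡ + k
   A≤E : A r · A r ≤ E * E
   0<V : 0ℤ < V r
   V≡ : V r *(+ 2) ^ levels k ≡ q0

 module Walk (n R : ℕ)(E : ℤ)(64≤n : 64 N.≤ n)(R≥ : (+ n) ^ 24 ≤ + R)(1≤E : 1ℤ ≤ E) where

  m D N X H p Q XX : ℤ
  m = + n
  D = m *(E * E)
  N = D ^ R
  X = m ^ 4 * N
  H = X * E
  p = m ^ 9
  Q = p *(H * H)
  XX = X * X

  isActive : ℤ -> Bool
  isActive z =(+ ∣ z ∣ + N)≤?b X

  active : Vec ℤ n -> Vec Bool n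
  active = Vec.map isActive

  isHeavy : ℤ -> Row n -> Bool
  isHeavy q r = q ≤?b(+ 4 * V r)

  heavy : ℤ -> List(Row n) -> Rows n
  heavy q = List.foldr (λ r Bs -> if isHeavy q r then A r ∷ Bs else Bs)[]

  constrs : State n -> Rows n
  constrs st = List.map(mask(active(x st)))(heavy(q st)(rows st))

  heatStep : Rows n -> Vec ℤ n -> Vec ℤ n
  heatStep Bs u = D ⋆ u ⊹ -1ℤ ⋆ gram Bs u

  flowFrom : State n -> Vec ℤ n -> Vec ℤ n
  flowFrom st e = iter(heatStep(constrs st))R(mask(active(x st))e)

  weight : ℤ -> ℤ -> ℤ
  weight s Z = p *(H * H + H * Z + Z * Z) - s * s *(H * H)

  update : Vec ℤ n -> Row n -> Row n
  update u r = row(s r)(V r * weight(s r)(s r *(A r · u)))(A r)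

  move : State n -> Vec ℤ n -> State n
  move st u = state(x st ⊹ u)(List.map(update u)(rows st))(q st * Q)

  potential : State n -> ℤ
  potential st = + 64 * XX * ∑l(rows st)V - q st *(x st · x st)

  improves : State n -> State n -> Bool
  improves st st' =(+ 4 * m ^ 8 * potential st' + q st' * XX)≤?b(+ 4 * m ^ 8 * Q * potential st)

  direction : State n -> ℤ × Vec ℤ n -> Vec ℤ n
  direction st(σ , e) = σ ⋆ flowFrom st e

  attempt : ℤ × Vec ℤ n -> State n -> State n
  attempt c st = let st' = move st(direction st c) in if improves st st' then st' else st

  cands : List(ℤ × Vec ℤ n)
  cands = List.map(1ℤ ,_)(units n)List.++ List.map(-1ℤ ,_)(units n)

  sweep : State n -> State n
  sweep st = List.foldr attempt st cands

  even odd : State n -> Vec ℤ n -> ℤ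
  even st w = + 64 * XX * ∑l(rows st)(λ r -> V r *(p *((s r *(A r · w))*(s r *(A r · w))) - s r * s r *(H * H))) - q st * Q *(w · w)
  odd st w = + 64 * XX *(p * H * ∑l(rows st)(λ r -> V r *(s r *(A r · w)))) - + 2 *(q st * Q *(x st · w))

  potential-move : ∀ st σ w -> σ * σ ≡ 1ℤ -> potential(move st(σ ⋆ w))≡ Q * potential st + even st w + σ * odd st w
  potential-move st σ w σσ = cong₂ (λ a b -> + 64 * XX * a - q st * Q * b)sums norms ==
   eq(+ 64 * XX)(∑l(rows st)V)(∑l(rows st)ev)(p * H * ∑l(rows st)od)σ(q st)Q(x st · x st)(x st · w)(w · w) where
   od ev : Row n -> ℤ
   od r = V r *(s r *(A r · w))
   ev r = V r *(p *((s r *(A r · w))*(s r *(A r · w))) - s r * s r *(H * H))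
   one : ∀ r -> V r * weight(s r)(s r *(A r ·(σ ⋆ w)))≡ Q * V r + ev r + σ *(p * H * od r)
   one r = cong (λ z -> V r * weight(s r)(s r * z))(·-scaleʳ σ(A r)w)== e1(V r)p H(s r)(A r · w)σ ==
    cong (λ z -> p *(H * H)* V r + V r *(p *(z *((s r *(A r · w))*(s r *(A r · w)))) - s r * s r *(H * H))+ σ *(p * H * od r))σσ ==
     cong (λ z -> p *(H * H)* V r + V r *(p * z - s r * s r *(H * H))+ σ *(p * H * od r))(*-identityˡ _) where
    e1 : ∀ v p h s a t -> v *(p *(h * h + h *(s *(t * a))+ s *(t * a)*(s *(t * a))) - s * s *(h * h))
     ≡ p *(h * h)* v + v *(p *(t * t *(s * a *(s * a))) - s * s *(h * h))+ t *(p * h *(v *(s * a)))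
    e1 = ring
   sums = ∑-map(update(σ ⋆ w))(rows st)V == ∑-cong(rows st)one ==(∑-+ (rows st)_ _)==
    (cong₂ _+_ ((∑-+ (rows st)_ _)== cong(_+ ∑l(rows st)ev)(∑-scale Q(rows st)V))(∑-scale σ(rows st)_ == cong(σ *_)(∑-scale(p * H)(rows st)od)))
   norms = ·-addˡ(x st)(σ ⋆ w)_ ==(cong₂ _+_ (·-addʳ(x st)(x st)(σ ⋆ w)== cong (λ z -> x st · x st + z)(·-scaleʳ σ(x st)w))
    (·-scaleˡ σ w _ == cong(σ *_)(·-addʳ w(x st)(σ ⋆ w)==(cong₂ _+_ (·-comm w(x st))(·-scaleʳ σ w w)))))==
    e(x st · x st)(x st · w)(w · w)σ == cong (λ z -> x st · x st + + 2 *(σ *(x st · w))+ z *(w · w))σσ == cong (λ z -> x st · x st + + 2 *(σ *(x st · w))+ z)(*-identityˡ _) where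
    e : ∀ a b c t -> a + t * b + t *(b + t * c)≡ a + + 2 *(t * b)+ t * t * c
    e = ring
   eq : ∀ k v e o t q Q a b c -> k *(Q * v + e + t * o) - q * Q *(a + + 2 *(t * b)+ c)≡ Q *(k * v - q * a)+(k * e - q * Q * c)+ t *(k * o - + 2 *(q * Q * b))
   eq = ring

  gain : State n -> Vec ℤ n -> ℤ
  gain st w = + 4 * m ^ 8 * even st w + q st * Q * XX

  0≤m : 0ℤ ≤ m
  0≤m = 0≤pos n

  improving-sign : ∀ st e -> gain st(flowFrom st e)≤ 0ℤ -> Σ[ σ ∈ ℤ ] (σ ≡ 1ℤ ⊎ σ ≡ -1ℤ)× improves st(move st(direction st(σ , e)))≡ true
  improving-sign st e g = choose(≤-total(odd st w)0ℤ) where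
   w = flowFrom st e
   c = + 4 * m ^ 8
   accept : ∀ σ -> σ * σ ≡ 1ℤ -> σ * odd st w ≤ 0ℤ -> improves st(move st(σ ⋆ w))≡ true
   accept σ σσ h = ≤?b-complete(cong (λ z -> c * z + q st * Q * XX)(potential-move st σ w σσ)== eq c Q(potential st)(even st w)(σ * odd st w)(q st * Q * XX)=<
    +-monoʳ-≤(c * Q * potential st)(+-mono-≤ g(*-monoˡ(0≤*(0≤pos 4)(0≤^ 8 0≤m))h <= *-zeroʳ c))<= +-identityʳ(c * Q * potential st)) where
    eq : ∀ c Q P e o k -> c *(Q * P + e + o)+ k ≡ c * Q * P +(c * e + k + c * o)
    eq = ring
   choose : odd st w ≤ 0ℤ ⊎ 0ℤ ≤ odd st w -> _
   choose(inj₁ h) = 1ℤ , inj₁ refl , accept 1ℤ refl(*-identityˡ _ =< h)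
   choose(inj₂ h) = -1ℤ , inj₂ refl , accept -1ℤ refl(-1*i≡-i _ =< neg-mono-≤ h)

  record Good (st : State n) : Set where
   field
    q≥0 : 0ℤ ≤ q st
    rows≥ : All (λ r -> 0ℤ ≤ V r × A r · A r ≤ E * E)(rows st)
    total≤ : total(constrs st)≤ D

  -- Averaging the second-order terms over all starting points e.
  average : ∀ st -> Good st -> + 4 * + length(constrs st)+ m ≤ + 4 * + count(active(x st)) ->
   ∑l(units n)(λ e -> gain st(flowFrom st e))≤ 0ℤ
  average st good few =(∑-+ es (λ e -> c * even st(U e))(λ _ -> k))=<
   (cong₂ _+_ (∑-scale c es (λ e -> even st(U e))== cong(c *_)(∑-cong es (λ e -> split e)==(∑-+ es _ _)))(∑-const es k == cong (λ z -> + z * k)(length-units n)))=<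
   cong (λ z -> c * z + m * k)(cong₂ _+_ (∑-scale(+ 64 * XX)es S)(∑-scale(- (q st * Q))es (λ e -> U e · U e)))=<
   +-monoˡ-≤(m * k)(*-monoˡ(0≤*(0≤pos 4)(0≤^ 8 0≤m))(+-mono-≤(*-monoˡ(0≤*(0≤pos 64)(sq≥0 X))rows≤0)norms))<<
   eq(m ^ 8)(q st * Q)N d m XX =<
   cong (λ z -> q st * Q *(m * z - + 4 * d *(m ^ 8 *(N * N))))XX≡ =<
   eq'(q st * Q)m(m ^ 8 *(N * N))d =<
   neg-mono-≤(0≤*(0≤* 0≤qQ(0≤*(0≤^ 8 0≤m)(sq≥0 N)))(0≤-sub few <= eq''(+ length(constrs st))m(+ count(active(x st))))) where
   open Good good
   es = units n
   U = flowFrom st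
   c = + 4 * m ^ 8
   k = q st * Q * XX
   d = + count(active(x st)) - + length(constrs st)
   0≤qQ = 0≤* q≥0(0≤*(0≤^ 9 0≤m)(sq≥0 H))
   S : Vec ℤ n -> ℤ
   S e = ∑l(rows st)(λ r -> V r *(p *((s r *(A r · U e))*(s r *(A r · U e))) - s r * s r *(H * H)))
   split : ∀ e -> even st(U e)≡ + 64 * XX * S e + -(q st * Q)*(U e · U e)
   split e = cong (λ z -> + 64 * XX * S e + z)(neg-distribˡ-*(q st * Q)(U e · U e))
   XX≡ = e(m ^ 4)N == cong(_* (N * N))(sym(^-distribˡ-+-* m 4 4)) where
    e : ∀ a b -> a * b *(a * b)≡ a * a *(b * b)
    e = ring
   norms = sym(neg-distribˡ-*(q st * Q)_)=< neg-mono-≤(*-monoˡ 0≤qQ(flow-total(active(x st))(constrs st)D total≤ R))<= neg-distribˡ-*(q st * Q)_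
   rows≤0 = ∑-swap es(rows st)_ =< go(rows st)rows≥ where
    go : ∀ rs -> All (λ r -> 0ℤ ≤ V r × A r · A r ≤ E * E)rs ->
     ∑l rs (λ r -> ∑l es (λ e -> V r *(p *((s r *(A r · U e))*(s r *(A r · U e))) - s r * s r *(H * H))))≤ 0ℤ
    go [] [] = ≤-refl
    go(r ∷ rs)((0≤V , A≤)∷ hs) = +-mono-≤ one(go rs hs) where
     one = ∑-cong es (λ e -> e1(V r)p(s r)(A r · U e)H)=<
      (∑-+ es _ _)==(cong₂ _+_ (∑-scale(V r *(s r * s r)* p)es _)(∑-const es _ == cong (λ z -> + z * -(V r *(s r * s r)*(H * H)))(length-units n)))=<
      +-monoˡ-≤ _ (*-monoˡ(0≤*(0≤* 0≤V(sq≥0(s r)))(0≤^ 9 0≤m))(flow-correlation(active(x st))(constrs st)D total≤ R(A r)<< *-monoˡ(sq≥0 N)A≤))<=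
      cong (λ z -> V r *(s r * s r)* p *(N * N *(E * E))+ m * -(V r *(s r * s r)* z))HH≡ == e2(V r *(s r * s r))m(m ^ 8)(N * N *(E * E)) where
      HH≡ = e X E == cong(_* (E * E))XX≡ == *-assoc(m ^ 8)(N * N)(E * E) where
       e : ∀ a b -> a * b *(a * b)≡ a * a *(b * b)
       e = ring
      e1 : ∀ v p s a h -> v *(p *(s * a *(s * a)) - s * s *(h * h))≡ v *(s * s)* p *(a * a)+ -(v *(s * s)*(h * h))
      e1 = ring
      e2 : ∀ v m m8 y -> v *(m * m8)* y + m * -(v *(m8 * y))≡ 0ℤ
      e2 = ring
   eq : ∀ m8 qQ N d m xx -> + 4 * m8 *(+ 64 * xx * 0ℤ + - qQ *(N * N * d))+ m *(qQ * xx)≡ qQ *(m * xx - + 4 * d *(m8 *(N * N)))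
   eq = ring
   eq' : ∀ q m y d -> q *(m * y - + 4 * d * y)≡ -(q * y *(+ 4 * d - m))
   eq' = ring
   eq'' : ∀ l m c -> + 4 * c -(+ 4 * l + m)≡ + 4 *(c - l) - m
   eq'' = ring

  improvable : ∀ st -> Good st -> 1 N.≤ n -> + 4 * + length(constrs st)+ m ≤ + 4 * + count(active(x st)) ->
   Σ[ e ∈ Vec ℤ n ] e ∈ units n × Σ[ σ ∈ ℤ ] (σ ≡ 1ℤ ⊎ σ ≡ -1ℤ)× improves st(move st(direction st(σ , e)))≡ true
  improvable st good 1≤n few =
   let (e , e∈ , h) = ∑-pos'(units n)(λ e -> gain st(flowFrom st e))(1≤n ℕ<= sym(length-units n))(average st good few)
   in e , e∈ , improving-sign st e h

  64≤m : + 64 ≤ m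
  64≤m = +≤+ 64≤n

  1≤m : 1ℤ ≤ m
  1≤m =(+≤+ (N.s≤s N.z≤n))<< 64≤m

  0<m : 0ℤ < m
  0<m = <-≤-trans(+<+ (N.s≤s N.z≤n))1≤m

  0<E : 0ℤ < E
  0<E = <-≤-trans(+<+ (N.s≤s N.z≤n))1≤E

  0<D : 0ℤ < D
  0<D = 0<* 0<m(0<* 0<E 0<E)

  0<N : 0ℤ < N
  0<N = 0<^ R 0<D

  0<X : 0ℤ < X
  0<X = 0<*(0<^ 4 0<m)0<N

  0<H : 0ℤ < H
  0<H = 0<* 0<X 0<E

  0<XX : 0ℤ < XX
  0<XX = 0<* 0<X 0<X

  0<Q : 0ℤ < Q
  0<Q = 0<*(0<^ 9 0<m)(0<* 0<H 0<H)

  R≥5 : 5 N.≤ R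
  R≥5 = drop‿+≤+((((+≤+ (N.m≤m+n 5 59))<< 64≤m)<< sym(*-identityʳ m)=< ^-mono-exp {m}{1}{24}1≤m(N.s≤s N.z≤n))<< R≥)

  N' H' : ℤ
  N' =(E * E) ^ 5 * D ^ proj₁(N.m≤n⇒∃[o]m+o≡n R≥5)
  H' = N' * E

  0<H' : 0ℤ < H'
  0<H' = 0<*(0<*(0<^ 5(0<* 0<E 0<E))(0<^(proj₁(N.m≤n⇒∃[o]m+o≡n R≥5))0<D))0<E

  H≡ : H ≡ p * H'
  H≡ = cong (λ z -> m ^ 4 * z * E)N≡ == eq(m ^ 4)(m ^ 5)N' E == cong(_* (N' * E))(sym(^-distribˡ-+-* m 4 5)) where
   o = proj₁(N.m≤n⇒∃[o]m+o≡n R≥5)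
   N≡ = cong(D ^_)(sym(proj₂(N.m≤n⇒∃[o]m+o≡n R≥5)))== ^-distribˡ-+-* D 5 o == cong(_* D ^ o)(^-mul m(E * E)5)== *-assoc(m ^ 5)((E * E) ^ 5)(D ^ o)
   eq : ∀ a b c d -> a *(b * c)* d ≡ a * b *(c * d)
   eq = ring

  HH≡ : H * H ≡ m ^ 8 *(N * N *(E * E))
  HH≡ = eq(m ^ 4)N E == cong(_* (N * N *(E * E)))(sym(^-distribˡ-+-* m 4 4)) where
   eq : ∀ a b c -> a * b * c *(a * b * c)≡ a * a *(b * b *(c * c))
   eq = ring

  RowsOK : List(Row n) -> Set
  RowsOK = All (λ r -> 0ℤ ≤ V r × A r · A r ≤ E * E)

  Box : ∀ {k} -> Vec ℤ k -> Set
  Box [] = ⊤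
  Box(z ∷ v) = + ∣ z ∣ ≤ X × Box v

  drift : ℤ -> ℤ
  drift s = + 2 *(s * s)* H'

  record RowInv (t : ℕ)(xs : Vec ℤ n)(q q0 : ℤ)(r0 r : Row n) : Set where
   field
    s≡ : s r ≡ s r0
    A≡ : A r ≡ A r0
    0≤s : 0ℤ ≤ s r
    s≤m : s r ≤ m
    A≤E : A r · A r ≤ E * E
    0≤V0 : 0ℤ ≤ V r0
    0≤V : 0ℤ ≤ V r
    small : + 2 * m ^ 12 * V r ≤(m ^ 12 + + 8 * + t)* q
    expo : Σ[ y ∈ Exponent H ] value y ≡ s r *(A r · xs) - drift(s r)* + t × V r0 * q * numerator y ≤ V r * q0 * denominator y
    zero-row : s r ≡ 0ℤ -> + 4 * V r ≡ q × m ^ 11 * + ∣ A r · xs ∣ ≤ + t *(E * N)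

  record Inv (rows0 : List (Row n))(q0 : ℤ)(t : ℕ)(st : State n) : Set where
   field
    0≤q0 : 0ℤ ≤ q0
    0<q : 0ℤ < q st
    pot : + 4 * m ^ 8 * potential st + + t *(q st * XX)≤ + 4 * m ^ 8 *(+ 9 * m * XX * q st)
    box : Box(x st)
    rowInvs : Pointwise(RowInv t(x st)(q st)q0)rows0(rows st)
    q≡ : q st ≡ q0 * Q ^ t

  box-norm : ∀ {k}(v : Vec ℤ k) -> Box v -> v · v ≤ + k * XX
  box-norm [] _ = ≤-refl
  box-norm {suc k}(z ∷ v)(h , b) = +-mono-≤(sym(abs-square z)=< *-mono(<⇒≤ 0<X)(0≤pos ∣ z ∣)h h)(box-norm v b)<=
   eq XX(+ k)== cong(_* XX)(sym(pos-+ 1 k)) where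
   eq : ∀ x k -> x + k * x ≡(1ℤ + k)* x
   eq = ring

  module Facts {rows0 q0 t st}(inv : Inv rows0 q0 t st) where

   open Inv inv

   private
    m8 = m ^ 8
    0<m8 : 0ℤ < + 4 * m8
    0<m8 = 0<*(0<pos 3)(0<^ 8 0<m)
    xx≤ : q st *(x st · x st)≤ q st *(m * XX)
    xx≤ = *-monoˡ(<⇒≤ 0<q)(box-norm(x st)box)

   rows-V : RowsOK(rows st)
   rows-V = go rowInvs where
    go : ∀ {rs0 rs} -> Pointwise(RowInv t(x st)(q st)q0)rs0 rs -> RowsOK rs
    go [] = []
    go(h ∷ hs) =(RowInv.0≤V h , RowInv.A≤E h)∷ go hs

   ∑V≥0 : ∀ rs -> RowsOK rs -> 0ℤ ≤ ∑l rs V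
   ∑V≥0 [] [] = ≤-refl
   ∑V≥0(r ∷ rs)((h , _)∷ hs) = 0≤+ h(∑V≥0 rs hs)

   t≤ : + t ≤ + 40 * m ^ 9
   t≤ = *-cancel(0<* 0<q 0<XX)(≤-diff(+ 4 * m8 *(+ 64 * XX * ∑l(rows st)V)+ + 4 * m8 *(q st *(m * XX) - q st *(x st · x st)))
    (0≤+(0≤*(<⇒≤ 0<m8)(0≤*(0≤*(0≤pos 64)(<⇒≤ 0<XX))(∑V≥0(rows st)rows-V)))(0≤*(<⇒≤ 0<m8)(0≤-sub xx≤)))
    (eq(q st)XX(+ t)m8(+ 64 * XX * ∑l(rows st)V)(x st · x st)m)<<
    +-monoˡ-≤(+ 4 * m8 *(q st *(m * XX)))pot <= eq' m8 m XX(q st)) where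
    eq : ∀ q X t m8 S y m -> q * X * t +(+ 4 * m8 * S + + 4 * m8 *(q *(m * X) - q * y))≡ + 4 * m8 *(S - q * y)+ t *(q * X)+ + 4 * m8 *(q *(m * X))
    eq = ring
    eq' : ∀ m8 m X q -> + 4 * m8 *(+ 9 * m * X * q)+ + 4 * m8 *(q *(m * X))≡ q * X *(+ 40 *(m * m8))
    eq' = ring

   64∑V≤ : + 64 * ∑l(rows st)V ≤ + 10 * m * q st
   64∑V≤ = *-cancel(0<* 0<m8 0<XX)(≤-diff(+ t *(q st * XX)+ + 4 * m8 *(q st *(m * XX) - q st *(x st · x st)))
    (0≤+(0≤*(0≤pos t)(<⇒≤ (0<* 0<q 0<XX)))(0≤*(<⇒≤ 0<m8)(0≤-sub xx≤)))
    (eq(q st)XX(+ t)m8(∑l(rows st)V)(x st · x st)m)<<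
    +-monoˡ-≤(+ 4 * m8 *(q st *(m * XX)))pot <= eq' m8 m XX(q st)) where
    eq : ∀ q X t m8 S y m -> + 4 * m8 * X *(+ 64 * S)+(t *(q * X)+ + 4 * m8 *(q *(m * X) - q * y))≡ + 4 * m8 *(+ 64 * X * S - q * y)+ t *(q * X)+ + 4 * m8 *(q *(m * X))
    eq = ring
    eq' : ∀ m8 m X q -> + 4 * m8 *(+ 9 * m * X * q)+ + 4 * m8 *(q *(m * X))≡ + 4 * m8 * X *(+ 10 * m * q)
    eq' = ring

   length-heavy : ∀ rs -> RowsOK rs -> + length(heavy(q st)rs)* q st ≤ + 4 * ∑l rs V
   length-heavy [] [] = ≤-reflexive(*-zeroˡ(q st))
   length-heavy(r ∷ rs)((h , _)∷ hs) = step(isHeavy(q st)r)refl where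
    l = length(heavy(q st)rs)
    e : ∀ l q ->(1ℤ + l)* q ≡ q + l * q
    e = ring
    step : ∀ b -> isHeavy(q st)r ≡ b -> + length(if b then A r ∷ heavy(q st)rs else heavy(q st)rs)* q st ≤ + 4 *(V r + ∑l rs V)
    step true eq = cong(_* q st)(pos-+ 1 l)== e(+ l)(q st)=<
     +-mono-≤(≤?b-true(q st)(+ 4 * V r)eq)(length-heavy rs hs)<= sym(*-distribˡ-+(+ 4)(V r)(∑l rs V))
    step false _ = length-heavy rs hs << *-monoˡ(0≤pos 4)(≤-diff(V r)h(+-comm(∑l rs V)(V r)))

   length-constraints : + 16 * + length(constrs st)≤ + 10 * m
   length-constraints = *-cancel 0<q(cong (λ l -> q st *(+ 16 * + l))(length-map'(heavy(q st)(rows st)))== e(q st)(+ length(heavy(q st)(rows st)))=<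
    *-monoˡ(0≤pos 16)(length-heavy(rows st)rows-V)<< e'(∑l(rows st)V)=< 64∑V≤ <= *-comm(+ 10 * m)(q st)) where
    length-map' : ∀ Bs -> length(List.map(mask(active(x st)))Bs)≡ length Bs
    length-map' [] = refl
    length-map'(B ∷ Bs) = cong suc(length-map' Bs)
    e : ∀ q l -> q *(+ 16 * l)≡ + 16 *(l * q)
    e = ring
    e' : ∀ v -> + 16 *(+ 4 * v)≡ + 64 * v
    e' = ring

   total-constraints : total(constrs st)≤ D
   total-constraints = go(rows st)rows-V << *-monoʳ(<⇒≤ (0<* 0<E 0<E))l≤m where
    l≤m : + length(constrs st)≤ m
    l≤m = *-cancel {+ 16}(+<+ (N.s≤s N.z≤n))(length-constraints << *-monoʳ 0≤m(+≤+ (N.m≤m+n 10 6)))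
    go : ∀ rs -> RowsOK rs -> let Bs = List.map(mask(active(x st)))(heavy(q st)rs) in total Bs ≤ + length Bs *(E * E)
    go [] [] = ≤-reflexive(sym(*-zeroˡ(E * E)))
    go(r ∷ rs)((_ , h)∷ hs) = step(isHeavy(q st)r) where
     Bs = List.map(mask(active(x st)))(heavy(q st)rs)
     e : ∀ x l -> x + l * x ≡(1ℤ + l)* x
     e = ring
     step : ∀ b -> let Cs = List.map(mask(active(x st)))(if b then A r ∷ heavy(q st)rs else heavy(q st)rs) in total Cs ≤ + length Cs *(E * E)
     step false = go rs hs
     step true = +-mono-≤(mask-norm(active(x st))(A r)<< h)(go rs hs)<= e(E * E)(+ length Bs)== cong(_* (E * E))(sym(pos-+ 1(length Bs)))

   good : Good st
   good = record { q≥0 = <⇒≤ 0<q ; rows≥ = rows-V ; total≤ = total-constraints }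

  flow-masked : ∀ a Bs k u -> All (λ B -> mask a B ≡ B)Bs -> mask a(iter(heatStep Bs)k(mask a u))≡ iter(heatStep Bs)k(mask a u)
  flow-masked a Bs zero u hs = mask-mask a u
  flow-masked a Bs(suc k)u hs = mask-add a _ _ ==(cong₂ _⊹_ (mask-scale a D v == cong(D ⋆_)(flow-masked a Bs k u hs))(mask-scale a -1ℤ(gram Bs v)== cong(-1ℤ ⋆_)(go Bs hs))) where
   v = iter(heatStep Bs)k(mask a u)
   go : ∀ Bs -> All (λ B -> mask a B ≡ B)Bs -> mask a(gram Bs v)≡ gram Bs v
   go [] [] = mask-zeros a
   go(B ∷ Bs)(h ∷ hs) = mask-add a _ _ ==(cong₂ _⊹_ (mask-scale a(B · v)B == cong(B · v ⋆_)h)(go Bs hs))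

  constraints-masked : ∀ st -> All (λ B -> mask(active(x st))B ≡ B)(constrs st)
  constraints-masked st = go(heavy(q st)(rows st)) where
   go : ∀ Bs -> All (λ B -> mask(active(x st))B ≡ B)(List.map(mask(active(x st)))Bs)
   go [] = []
   go(B ∷ Bs) = mask-mask(active(x st))B ∷ go Bs

  Small : ∀ {k} -> Vec ℤ k -> Set
  Small [] = ⊤
  Small(z ∷ v) = + ∣ z ∣ ≤ N × Small v

  small-norm : ∀ {k}(v : Vec ℤ k) -> v · v ≤ N * N -> Small v
  small-norm [] h = tt
  small-norm(z ∷ v)h = abs-≤ {z}(<⇒≤ 0<N)(≤-diff(v · v)(·-self≥0 v)refl << h), small-norm v(≤-diff(z * z)(sq≥0 z)(+-comm(v · v)(z * z))<< h)

  coordinate-step : ∀ z w -> + ∣ z ∣ ≤ X -> + ∣ w ∣ ≤ N -> ∀ a -> isActive z ≡ a ->(if a then w else 0ℤ)≡ w -> + ∣ z + w ∣ ≤ X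
  coordinate-step z w h g true act _ =(+≤+ (∣i+j∣≤∣i∣+∣j∣ z w))<<(pos-+ ∣ z ∣ ∣ w ∣)=< +-monoʳ-≤(+ ∣ z ∣)g << ≤?b-true(+ ∣ z ∣ + N)X act
  coordinate-step z w h g false _ e = cong (λ y -> + ∣ y ∣)(cong (λ y -> z + y)(sym e)== +-identityʳ z)=< h

  box-step : ∀ {k}(v u : Vec ℤ k) -> Box v -> Small u -> mask(Vec.map isActive v)u ≡ u -> Box(v ⊹ u)
  box-step [] [] _ _ _ = tt
  box-step(z ∷ v)(w ∷ u)(h , b)(g , s)eq =
   coordinate-step z w h g(isActive z)refl(mask-head(isActive z)(Vec.map isActive v)w u eq),
   box-step v u b s(mask-tail(isActive z)(Vec.map isActive v)w u eq) where
   mask-head : ∀ {k}a (as : Vec Bool k)w u -> mask(a ∷ as)(w ∷ u)≡ w ∷ u ->(if a then w else 0ℤ)≡ w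
   mask-head a as w u eq = cong Vec.head eq
   mask-tail : ∀ {k}a (as : Vec Bool k)w u -> mask(a ∷ as)(w ∷ u)≡ w ∷ u -> mask as u ≡ u
   mask-tail a as w u eq = cong Vec.tail eq

  heavy-member : ∀ a q u -> mask a u ≡ u -> ∀ rs -> All (λ r -> isHeavy q r ≡ true ->(A r · u)*(A r · u)≤ qform(List.map(mask a)(heavy q rs))u)rs
  heavy-member a q u mu [] = []
  heavy-member a q u mu(r ∷ rs) = head(isHeavy q r)refl ∷ All.map (λ f h -> f h << tail(isHeavy q r))(heavy-member a q u mu rs) where
   Bs = List.map(mask a)(heavy q rs)
   tail : ∀ b -> qform Bs u ≤ qform(List.map(mask a)(if b then A r ∷ heavy q rs else heavy q rs))u
   tail false = ≤-refl
   tail true = ≤-diff((mask a(A r)· u)*(mask a(A r)· u))(sq≥0(mask a(A r)· u))(+-comm(qform Bs u)_)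
   head : ∀ b -> isHeavy q r ≡ b -> isHeavy q r ≡ true ->(A r · u)*(A r · u)≤ qform(List.map(mask a)(if b then A r ∷ heavy q rs else heavy q rs))u
   head false p p' with sym p == p'
   ... | ()
   head true _ _ = ≤-diff(qform Bs u)(quadratic≥0 Bs u)(cong (λ z -> z * z + qform Bs u)(sym(mask-sym a(A r)u == cong(A r ·_)mu)))

  private
   0≤H = <⇒≤ 0<H
   0≤p : 0ℤ ≤ p
   0≤p = 0≤^ 9 0≤m
   1≤m12 : 1ℤ ≤ m ^ 12
   1≤m12 = 1≤^ 12 1≤m
   NE : ℤ
   NE = N * N *(E * E)
   0≤NE : 0ℤ ≤ NE
   0≤NE = 0≤*(sq≥0 N)(sq≥0 E)

  -- s² K ≤ n² K bounds the square of a scaled inner product.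
  scaled-square : ∀ {s a K} -> 0ℤ ≤ s -> s ≤ m -> 0ℤ ≤ K -> a * a ≤ K ->(s * a)*(s * a)≤ m * m * K
  scaled-square {s}{a}{K}0≤s s≤m 0≤K h = eq s a =< *-mono(0≤* 0≤m 0≤m)(sq≥0 a)(*-mono 0≤m 0≤s s≤m s≤m)h where
   eq : ∀ s a -> s * a *(s * a)≡ s * s *(a * a)
   eq = ring

  module RowStep {t xs q q0 r0 r}(u : Vec ℤ n)(inv : RowInv t xs q q0 r0 r)
   (0<q : 0ℤ < q)(0≤q0 : 0ℤ ≤ q0)(t≤ : + t ≤ + 40 * m ^ 9)(uu : u · u ≤ N * N)
   (hv : isHeavy q r ≡ true -> m ^ 24 *((A r · u)*(A r · u))≤ N * N * D) where

   open RowInv inv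

   a Z e : ℤ
   a = A r · u
   Z = s r * a
   e = drift(s r)

   a≤ : a * a ≤ NE
   a≤ = cauchy-schwarz(A r)u << *-mono(sq≥0 E)(·-self≥0 u)A≤E uu <= *-comm(E * E)(N * N)

   Z64 : + 64 *(Z * Z)≤ H * H
   Z64 = *-monoʳ(sq≥0 Z)(64≤m << sym(*-identityʳ m)=< ^-mono-exp {m}{1}{6}1≤m(N.s≤s N.z≤n))<<
    *-monoˡ(0≤^ 6 0≤m)(scaled-square {s r}{a}{NE}0≤s s≤m 0≤NE a≤)<= eq m(m ^ 6)NE == sym HH≡ where
    eq : ∀ m p k -> p *(m * m * k)≡ m *(m * p)* k
    eq = ring

   a-heavy : isHeavy q r ≡ true -> m ^ 24 *(a * a)≤ m * NE
   a-heavy h = hv h <= eq N m E where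
    eq : ∀ N m E -> N * N *(m *(E * E))≡ m *(N * N *(E * E))
    eq = ring

   m24 : m ^ 12 * m ^ 12 ≡ m ^ 24
   m24 = sym(^-distribˡ-+-* m 12 12)

   Z-heavy : isHeavy q r ≡ true -> m ^ 12 * m ^ 12 *(Z * Z)≤ H * H
   Z-heavy h = cong(_* (Z * Z))m24 == eq(m ^ 24)(s r)a =<
    *-mono(sq≥0 m)(0≤*(0≤^ 24 0≤m)(sq≥0 a))(*-mono 0≤m 0≤s s≤m s≤m)(a-heavy h)<<
    eq' m NE =< *-monoʳ 0≤NE(^-mono-exp {m}{3}{8}1≤m(N.s≤s(N.s≤s(N.s≤s N.z≤n))))<= sym HH≡ where
    eq : ∀ c s a -> c *(s * a *(s * a))≡ s * s *(c *(a * a))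
    eq = ring
    eq' : ∀ m k -> m * m *(m * k)≡ m *(m *(m * 1ℤ))* k
    eq' = ring

   8e≤H : + 8 * e ≤ H
   8e≤H = eq1(s r)H' =< *-monoʳ(<⇒≤ 0<H')(*-monoˡ(0≤pos 16)(*-mono 0≤m 0≤s s≤m s≤m))<<
    (eq2 m H' =< *-monoˡ(0≤*(sq≥0 m)(<⇒≤ 0<H'))((+≤+ (N.m≤m+n 16 48))<< 64≤m << sym(*-identityʳ m)=< ^-mono-exp {m}{1}{7}1≤m(N.s≤s N.z≤n)))<=
    eq3 m(m ^ 7)H' == sym H≡ where
    eq1 : ∀ s h -> + 8 *(+ 2 *(s * s)* h)≡ + 16 *(s * s)* h
    eq1 = ring
    eq2 : ∀ m h -> + 16 *(m * m)* h ≡ m * m * h * + 16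
    eq2 = ring
    eq3 : ∀ m p h -> m * m * h * p ≡ m *(m * p)* h
    eq3 = ring

   conditions : 0ℤ ≤ H + + 4 * Z - + 2 * e × Z ≤ H × - Z + e ≤ H
   conditions = let (up , lo) = square-bound {+ 8}{Z}0≤H Z64 in step-conditions {H}{Z}{e}0≤H up lo 8e≤H

   0≤weight : 0ℤ ≤ weight(s r)Z
   0≤weight = 0≤* 0≤p(0≤+(0≤* 0≤H(0≤-sub(proj₂(proj₂ conditions))))(sq≥0(Z - e))<= eq H Z e)<<
    factor-lower {H}{H'}{p}{s r}0<H 0≤p H≡ 0≤s(<⇒≤ 0<H')Z(proj₁ conditions) where
    eq : ∀ H Z e -> H *(H -(- Z + e))+(Z - e)*(Z - e)≡ H * H + H *(Z - e)+(Z - e)*(Z - e)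
    eq = ring

   W = weight(s r)Z

   8t+ : + 8 * + suc t ≡ + 8 * + t + + 8
   8t+ = cong(+ 8 *_)(pos-+ 1 t)== eq(+ t) where
    eq : ∀ t -> + 8 *(1ℤ + t)≡ + 8 * t + + 8
    eq = ring

   small-light : + 4 * V r ≤ q -> + 2 * m ^ 12 *(V r * W)≤(m ^ 12 + + 8 * + suc t)*(q * Q)
   small-light h = *-monoˡ(0≤*(0≤pos 2)(0≤pos 1 << 1≤m12))(*-monoˡ 0≤V(weight-light {H}{Z}{p}{s r}0≤H 0≤p Z64))<<
    eq(m ^ 12)(V r)Q =< *-monoˡ(0≤*(0≤pos 1 << 1≤m12)(<⇒≤ 0<Q))h <<
    ≤-diff(+ 8 * + suc t *(q * Q))(0≤*(0≤*(0≤pos 8)(0≤pos(suc t)))(<⇒≤ (0<* 0<q 0<Q)))(eq'(m ^ 12)(+ 8 * + suc t)q Q) where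
    eq : ∀ c v Q -> + 2 * c *(v *(+ 2 * Q))≡ c * Q *(+ 4 * v)
    eq = ring
    eq' : ∀ c k q Q -> c * Q * q + k *(q * Q)≡(c + k)*(q * Q)
    eq' = ring

   320t≤ : + 16 * + t ≤ + 6 * m ^ 12
   320t≤ = *-monoˡ(0≤pos 16)t≤ << eq(m ^ 9)=< *-monoʳ(0≤^ 9 0≤m)((+≤+ (N.m≤m+n 640(6 N.* 64 N.* 64 N.∸ 640)))<< c≤)<= *-assoc(+ 6)(m ^ 3)(m ^ 9)== cong(+ 6 *_)(sym(^-distribˡ-+-* m 3 9)) where
    eq : ∀ p -> + 16 *(+ 40 * p)≡ + 640 * p
    eq = ring
    eq' : ∀ m -> m * m ≡ m *(m * 1ℤ)
    eq' = ring
    c≤ = *-monoˡ {+ 6}{+ 4096}(0≤pos 6)(*-mono {+ 64}{m}{+ 64}{m}0≤m(0≤pos 64)64≤m 64≤m << eq' m =< ^-mono-exp {m}{2}{3}1≤m(N.s≤s(N.s≤s N.z≤n)))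

   small-heavy : isHeavy q r ≡ true -> + 2 * m ^ 12 *(V r * W)≤(m ^ 12 + + 8 * + suc t)*(q * Q)
   small-heavy h = *-cancel {m ^ 12}(0<^ 12 0<m)(eq(m ^ 12)(V r)W =<
    *-mono(0≤*(0≤+(0≤^ 12 0≤m)(0≤*(0≤pos 8)(0≤pos t)))(<⇒≤ 0<q))(0≤*(0≤^ 12 0≤m)0≤weight)small(weight-heavy {H}{Z}{m ^ 12}{p}{s r}0≤H 0≤p 1≤m12(Z-heavy h))<<
    ≤-diff((+ 6 * m ^ 12 - + 16 * + t)*(q * Q))(0≤*(0≤-sub 320t≤)(<⇒≤ (0<* 0<q 0<Q)))(eq'(m ^ 12)(+ t)q Q)<= cong (λ z -> m ^ 12 *((m ^ 12 + z)*(q * Q)))(sym 8t+)) where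
    eq : ∀ c v w -> c *(+ 2 * c *(v * w))≡ + 2 * c * v *(c * w)
    eq = ring
    eq' : ∀ c t q Q ->(c + + 8 * t)* q *((c + + 2)* Q)+(+ 6 * c - + 16 * t)*(q * Q)≡ c *((c +(+ 8 * t + + 8))*(q * Q))
    eq' = ring

   small' : + 2 * m ^ 12 *(V r * W)≤(m ^ 12 + + 8 * + suc t)*(q * Q)
   small' = by(isHeavy q r)refl where
    by : ∀ b -> isHeavy q r ≡ b -> + 2 * m ^ 12 *(V r * W)≤(m ^ 12 + + 8 * + suc t)*(q * Q)
    by true h = small-heavy h
    by false h = small-light(<⇒≤ (≤?b-false q(+ 4 * V r)h))

   expo' : Σ[ y ∈ Exponent H ] value y ≡ s r *(A r ·(xs ⊹ u)) - e * + suc t × V r0 *(q * Q)* numerator y ≤ V r * W * q0 * denominator y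
   expo' =
    let
     (y , val , le) = expo
     (y' , val' , le') = exponent-step {H}{H'}{p}{s r}0<H 0≤p H≡ 0≤s(<⇒≤ 0<H')Z(proj₁ conditions)(proj₁(proj₂ conditions))(proj₂(proj₂ conditions))
      {V r0}{q0}{V r}{q}0≤V0 0≤q0 0≤V(<⇒≤ 0<q)y le
    in y' , val' == cong(_+ (Z - e))val == eq(s r)(A r · xs)a e(+ t)== cong₂ (λ x k -> s r * x - e * k)(sym(·-addʳ(A r)xs u))(sym(pos-+ 1 t)), le' where
    eq : ∀ s x a e t -> s * x - e * t +(s * a - e)≡ s *(x + a) - e *(1ℤ + t)
    eq = ring

   zero-weight : s r ≡ 0ℤ -> W ≡ Q
   zero-weight h = cong (λ z -> p *(H * H + H *(z * a)+ z * a *(z * a)) - z * z *(H * H))h == eq p H a where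
    eq : ∀ p H a -> p *(H * H + H *(0ℤ * a)+ 0ℤ * a *(0ℤ * a)) - 0ℤ * 0ℤ *(H * H)≡ p *(H * H)
    eq = ring

   zero-a : s r ≡ 0ℤ -> m ^ 11 * + ∣ a ∣ ≤ E * N
   zero-a h = *-cancel {m}0<m(sym(*-assoc m(m ^ 11)(+ ∣ a ∣))== sym abs-mul =< abs-≤ {m ^ 12 * a}{m *(N * E)}(0≤* 0≤m(0≤*(<⇒≤ 0<N)(<⇒≤ 0<E)))sq <= cong(m *_)(*-comm N E)) where
    abs-mul =(cong +_ (abs-*(m ^ 12)a))==(pos-* ∣ m ^ 12 ∣ ∣ a ∣)== cong(_* + ∣ a ∣)(0≤i⇒+∣i∣≡i(0≤^ 12 0≤m))
    e1 : ∀ c a -> c * a *(c * a)≡ c * c *(a * a)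
    e1 = ring
    e2 : ∀ m N E -> m * m *(N * N *(E * E))≡ m *(N * E)*(m *(N * E))
    e2 = ring
    sq = e1(m ^ 12)a == cong(_* (a * a))m24 =< a-heavy(≤?b-complete(≤-reflexive(sym(proj₁(zero-row h)))))<<
     *-monoʳ 0≤NE(sym(*-identityʳ m)=< *-monoˡ 0≤m 1≤m)<= e2 m N E

   zero' : s r ≡ 0ℤ -> + 4 *(V r * W)≡ q * Q × m ^ 11 * + ∣ A r ·(xs ⊹ u) ∣ ≤ + suc t *(E * N)
   zero' h = sym(*-assoc(+ 4)(V r)W)==(cong₂ _*_ (proj₁(zero-row h))(zero-weight h)),
    *-monoˡ(0≤^ 11 0≤m)(cong (λ z -> + ∣ z ∣)(·-addʳ(A r)xs u)=<(+≤+ (∣i+j∣≤∣i∣+∣j∣(A r · xs)a))<=(pos-+ ∣ A r · xs ∣ ∣ a ∣))<<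
    *-distribˡ-+(m ^ 11)(+ ∣ A r · xs ∣)(+ ∣ a ∣)=< +-mono-≤(proj₂(zero-row h))(zero-a h)<=
    eq(+ t)(E * N)== cong(_* (E * N))(sym(pos-+ 1 t)) where
    eq : ∀ t x -> t * x + x ≡(1ℤ + t)* x
    eq = ring

   row-step : RowInv(suc t)(xs ⊹ u)(q * Q)q0 r0(update u r)
   row-step = record
    { s≡ = s≡ ; A≡ = A≡ ; 0≤s = 0≤s ; s≤m = s≤m ; A≤E = A≤E ; 0≤V0 = 0≤V0 ; 0≤V = 0≤* 0≤V 0≤weight
    ; small = small' ; expo = expo' ; zero-row = zero' }

  module _ {rows0 q0 t st}(inv : Inv rows0 q0 t st){σ : ℤ}{e : Vec ℤ n}(σσ : σ * σ ≡ 1ℤ)(ee : e · e ≡ 1ℤ) where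

   open Inv inv
   open Facts inv

   private
    act = active(x st)
    Bs = constrs st
    w = flowFrom st e
    u = σ ⋆ w
    me≤ : mask act e · mask act e ≤ 1ℤ
    me≤ = mask-norm act e <= ee
    ww : w · w ≤ N * N
    ww = Heat.flow-norm Bs D total-constraints R(mask act e)<< *-monoˡ(sq≥0 N)me≤ <= *-identityʳ(N * N)
    σ-square : ∀ y ->(σ * y)*(σ * y)≡ y * y
    σ-square y = eq σ y == cong(_* (y * y))σσ == *-identityˡ(y * y) where
     eq : ∀ a b -> a * b *(a * b)≡ a * a *(b * b)
     eq = ring
    uu : u · u ≤ N * N
    uu = ·-scaleˡ σ w u == cong(σ *_)(·-scaleʳ σ w w)== sym(*-assoc σ σ(w · w))== cong(_* (w · w))σσ == *-identityˡ(w · w)=< ww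
    mask-w : mask act w ≡ w
    mask-w = flow-masked act Bs R e(constraints-masked st)
    mask-u : mask act u ≡ u
    mask-u = mask-scale act σ w == cong(σ ⋆_)mask-w
    heavy-u : All (λ r -> isHeavy(q st)r ≡ true -> m ^ 24 *((A r · u)*(A r · u))≤ N * N * D)(rows st)
    heavy-u = All.map (λ {r}f h -> cong (λ z -> m ^ 24 *(z * z))(·-scaleʳ σ(A r)w)=<
     cong(m ^ 24 *_)(σ-square(A r · w))=<
     *-mono(0≤pos R)(sq≥0(A r · w))R≥(f h)<<
     Heat.flow-quadratic Bs D total-constraints R(mask act e)<<
     *-monoˡ(sq≥0 N)(*-monoˡ(<⇒≤ 0<D)me≤ <= *-identityʳ D))(heavy-member act(q st)w mask-w(rows st))

   move-inv : improves st(move st u)≡ true -> Inv rows0 q0(suc t)(move st u)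
   move-inv imp = record
    { 0≤q0 = 0≤q0 ; 0<q = 0<* 0<q 0<Q
    ; pot = cong (λ z -> + 4 * m ^ 8 * potential(move st u)+ z *(q st * Q * XX))(pos-+ 1 t)== eq1(+ 4 * m ^ 8 * potential(move st u))(+ t)(q st)Q XX =<
     +-monoˡ-≤(Q *(+ t *(q st * XX)))(≤?b-true(+ 4 * m ^ 8 * potential(move st u)+ q st * Q * XX)(+ 4 * m ^ 8 * Q * potential st)imp)<<
     eq2(+ 4 * m ^ 8)Q(potential st)(+ t *(q st * XX))=< *-monoˡ(<⇒≤ 0<Q)pot <= eq3(+ 4 * m ^ 8)Q(+ 9 * m * XX)(q st)
    ; box = box-step(x st)u box(small-norm u uu)mask-u
    ; rowInvs = pointwise-map(update u)(λ inv hv -> RowStep.row-step u inv 0<q 0≤q0 t≤ uu hv)rowInvs heavy-u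
    ; q≡ = cong(_* Q)q≡ == eq4 q0(Q ^ t)Q } where
    eq1 : ∀ P t q Q X -> P +(1ℤ + t)*(q * Q * X)≡ P + q * Q * X + Q *(t *(q * X))
    eq1 = ring
    eq2 : ∀ c Q P k -> c * Q * P + Q * k ≡ Q *(c * P + k)
    eq2 = ring
    eq3 : ∀ c Q k q -> Q *(c *(k * q))≡ c *(k *(q * Q))
    eq3 = ring
    eq4 : ∀ a b c -> a * b * c ≡ a *(c * b)
    eq4 = ring

  Candidate : ℤ × Vec ℤ n -> Set
  Candidate(σ , e) = σ * σ ≡ 1ℤ × e · e ≡ 1ℤ

  candidates-ok : All Candidate cands
  candidates-ok = All.++⁺ (All.map⁺(All.map(refl ,_)(units-norm n)))(All.map⁺(All.map(refl ,_)(units-norm n)))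

  Rejects : State n -> ℤ × Vec ℤ n -> Set
  Rejects st c = improves st(move st(direction st c))≡ false

  module _ {rows0 : List (Row n)}{q0 : ℤ} where

   Outcome : ℕ -> State n -> List(ℤ × Vec ℤ n) -> State n -> Set
   Outcome t st cs st' = Σ[ t' ∈ ℕ ] Inv rows0 q0 t' st' × (suc t N.≤ t' ⊎ (t' ≡ t × st' ≡ st × All(Rejects st)cs))

   attempt-inv : ∀ {t st}c -> Candidate c -> Inv rows0 q0 t st ->
    Σ[ t' ∈ ℕ ] Inv rows0 q0 t'(attempt c st)× (t' ≡ suc t ⊎ (t' ≡ t × attempt c st ≡ st × Rejects st c))
   attempt-inv {t}{st}c@(σ , e)(σσ , ee)inv = go(improves st(move st(direction st c)))refl where
    st' = move st(direction st c)
    go : ∀ b -> improves st st' ≡ b -> Σ[ t' ∈ ℕ ] Inv rows0 q0 t'(if b then st' else st)× (t' ≡ suc t ⊎ (t' ≡ t × (if b then st' else st)≡ st × improves st st' ≡ false))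
    go true h = suc t , move-inv inv {σ}{e}σσ ee h , inj₁ refl
    go false h = t , inv , inj₂(refl , refl , h)

   attempts-inv : ∀ {t st}cs -> All Candidate cs -> Inv rows0 q0 t st -> Outcome t st cs(List.foldr attempt st cs)
   attempts-inv {t}[] [] inv = t , inv , inj₂(refl , refl , [])
   attempts-inv {t}{st}(c ∷ cs)(h ∷ hs)inv =
    let
     (t1 , inv1 , prog) = attempts-inv cs hs inv
     (t2 , inv2 , step) = attempt-inv c h inv1
    in t2 , inv2 , combine t1 t2 prog step where
    st1 = List.foldr attempt st cs
    combine : ∀ t1 t2 -> suc t N.≤ t1 ⊎ (t1 ≡ t × st1 ≡ st × All(Rejects st)cs) -> t2 ≡ suc t1 ⊎ (t2 ≡ t1 × attempt c st1 ≡ st1 × Rejects st1 c) ->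
     suc t N.≤ t2 ⊎ (t2 ≡ t × attempt c st1 ≡ st × All(Rejects st)(c ∷ cs))
    combine t1 t2(inj₁ p)(inj₁ refl) = inj₁(p ℕ<< N.n≤1+n t1)
    combine t1 t2(inj₂(refl , _))(inj₁ refl) = inj₁ N.≤-refl
    combine t1 t2(inj₁ p)(inj₂(refl , _)) = inj₁ p
    combine t1 t2(inj₂(p , eq , rejs))(inj₂(refl , same , rej)) = inj₂(p , same == eq , subst (λ s -> Rejects s c)eq rej ∷ rejs)

   sweep-inv : ∀ {t st} -> Inv rows0 q0 t st -> Outcome t st cands(sweep st)
   sweep-inv inv = attempts-inv cands candidates-ok inv

   sweeps-inv : ∀ {st}T -> Inv rows0 q0 0 st -> Σ[ t ∈ ℕ ] Inv rows0 q0 t(iter sweep T st)× (T N.≤ t ⊎ All(Rejects(iter sweep T st))cands)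
   sweeps-inv zero inv = 0 , inv , inj₁ N.z≤n
   sweeps-inv {st}(suc T)inv =
    let
     (t , inv1 , prog) = sweeps-inv T inv
     (t' , inv2 , prog') = sweep-inv inv1
    in t' , inv2 , combine t t' prog prog' where
    sₜ = iter sweep T st
    combine : ∀ t t' -> T N.≤ t ⊎ All(Rejects sₜ)cands -> suc t N.≤ t' ⊎ (t' ≡ t × sweep sₜ ≡ sₜ × All(Rejects sₜ)cands) ->
     suc T N.≤ t' ⊎ All(Rejects(sweep sₜ))cands
    combine t t'(inj₁ p)(inj₁ p') = inj₁(N.s≤s p ℕ<< p')
    combine t t' _ (inj₂(_ , eq , rejs)) = inj₂(subst (λ z -> All(Rejects z)cands)(sym eq)rejs)
    combine t t'(inj₂ rejs)(inj₁ p') = inj₂(subst (λ z -> All(Rejects z)cands)(sym(stable cands rejs))rejs) where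
     stable : ∀ cs -> All(Rejects sₜ)cs -> List.foldr attempt sₜ cs ≡ sₜ
     stable [] [] = refl
     stable(c ∷ cs)(h ∷ hs) = cong(attempt c)(stable cs hs)== cong (λ b -> if b then move sₜ(direction sₜ c) else sₜ)h

   few-active : ∀ {t st} -> Inv rows0 q0 t st -> All(Rejects st)cands -> + 16 * + count(active(x st)) < + 15 * m
   few-active {t}{st}inv rejs = ≰⇒> λ h ->
    let (e , e∈ , σ , σ= , imp) = improvable st(Facts.good inv)(N.s≤s N.z≤n ℕ<< 64≤n)(enough h) in clash e e∈ σ σ= imp where
    enough : + 15 * m ≤ + 16 * + count(active(x st)) -> + 4 * + length(constrs st)+ m ≤ + 4 * + count(active(x st))
    enough h = *-cancel {+ 4}(0<pos 3)(e1(+ length(constrs st))m =< +-monoˡ-≤(+ 4 * m)(Facts.length-constraints inv)<<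
     ≤-diff m 0≤m(e2 m)<< h <= e3(+ count(active(x st)))) where
     e1 : ∀ l m -> + 4 *(+ 4 * l + m)≡ + 16 * l + + 4 * m
     e1 = ring
     e2 : ∀ m -> + 10 * m + + 4 * m + m ≡ + 15 * m
     e2 = ring
     e3 : ∀ c -> + 16 * c ≡ + 4 *(+ 4 * c)
     e3 = ring
    clash : ∀ e -> e ∈ units n -> ∀ σ -> σ ≡ 1ℤ ⊎ σ ≡ -1ℤ -> improves st(move st(direction st(σ , e)))≡ true -> ⊥
    clash e e∈ σ(inj₁ refl)imp = true≢false imp(All.lookup {P = Rejects st}rejs(∈-++⁺ˡ(∈-map⁺(1ℤ ,_)e∈)))
    clash e e∈ σ(inj₂ refl)imp = true≢false imp(All.lookup {P = Rejects st}rejs(∈-++⁺ʳ(List.map(1ℤ ,_)(units n))(∈-map⁺(-1ℤ ,_)e∈)))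

  V≤q : ∀ {t xs q q0 r0 r} -> 0ℤ < q -> + t ≤ + 40 * m ^ 9 -> RowInv t xs q q0 r0 r -> V r ≤ q
  V≤q {t}{xs}{q}{q0}{r0}{r}0<q t≤ inv = *-cancel {+ 2 * m ^ 12}(0<*(0<pos 1)(0<^ 12 0<m))(RowInv.small inv << *-monoʳ(<⇒≤ 0<q)(+-monoʳ-≤(m ^ 12)8t≤ <= e(m ^ 12))<< ≤-refl) where
   e : ∀ c -> c + c ≡ + 2 * c
   e = ring
   8t≤ = *-monoˡ(0≤pos 8)t≤ << e'(m ^ 9)=< *-monoʳ {m ^ 9}{+ 320}{m ^ 3}(0≤^ 9 0≤m)(≤-trans {+ 320}{+ 4096}(+≤+ (N.m≤m+n 320(64 N.* 64 N.∸ 320)))(*-mono {+ 64}{m}{+ 64}{m}0≤m(0≤pos 64)64≤m 64≤m << e'' m =< ^-mono-exp {m}{2}{3}1≤m(N.s≤s(N.s≤s N.z≤n))))<= sym(^-distribˡ-+-* m 3 9) where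
    e' : ∀ p -> + 8 *(+ 40 * p)≡ + 320 * p
    e' = ring
    e'' : ∀ m -> m * m ≡ m *(m * 1ℤ)
    e'' = ring

  origin : List(Row n) -> ℤ -> State n
  origin rows0 q0 = state zeros rows0 q0

  module _ {rows0 : List (Row n)}{q0 : ℤ}(0<q0 : 0ℤ < q0)(start : All (StartRow E q0) rows0)(light : + 64 * ∑l rows0 V ≤ + 9 * m * q0) where

   private
    box-zeros : ∀ k -> Box(zeros {k})
    box-zeros zero = tt
    box-zeros(suc k) = <⇒≤ 0<X , box-zeros k

    start-row : ∀ {r} -> StartRow E q0 r -> RowInv 0 zeros q0 q0 r r
    start-row {r}h = record
     { s≡ = refl ; A≡ = refl ; 0≤s = 0≤pos k <= sym s≡k ; s≤m = s≡k =<(+≤+ k≤n)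
     ; A≤E = A≤E ; 0≤V0 = <⇒≤ 0<V ; 0≤V = <⇒≤ 0<V
     ; small = e1(m ^ 12)(V r)=< *-monoˡ(0≤^ 12 0≤m)2V≤ <= e2(m ^ 12)q0
     ; expo =(0 ⟋ 0), e3(s r)(drift(s r))== cong (λ z -> s r * z - drift(s r)* 0ℤ)(sym(·-zeroʳ(A r))),
      ≤-refl
     ; zero-row = λ h0 ->(*-comm(+ 4)(V r)== cong (λ k -> V r *(+ 2) ^ levels k)(zero-k h0))== V≡ ,
      ≤-reflexive(cong (λ z -> m ^ 11 * + ∣ z ∣)(·-zeroʳ(A r))== *-zeroʳ(m ^ 11)== sym(*-zeroˡ(E * N))) } where
     open StartRow h
     zero-k : s r ≡ 0ℤ -> 0 ≡ k
     zero-k h0 = +-injective(sym h0 == s≡k)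
     2V≤ = *-comm(+ 2)(V r)=< *-monoˡ(<⇒≤ 0<V)(sym(*-identityʳ(+ 2))=< ^-mono-exp {+ 2}{1}{levels k}(+≤+ (N.s≤s N.z≤n))(N.s≤s N.z≤n))<= V≡
     e1 : ∀ c v -> + 2 * c * v ≡ c *(+ 2 * v)
     e1 = ring
     e2 : ∀ c q -> c * q ≡(c + + 8 * 0ℤ)* q
     e2 = ring
     e3 : ∀ s d -> 0ℤ - 0ℤ ≡ s * 0ℤ - d * 0ℤ
     e3 = ring

   origin-inv : Inv rows0 q0 0(origin rows0 q0)
   origin-inv = record
    { 0≤q0 = <⇒≤ 0<q0 ; 0<q = 0<q0
    ; pot = cong (λ z -> + 4 * m ^ 8 *(+ 64 * XX * ∑l rows0 V - q0 * z)+ 0ℤ *(q0 * XX))(·-zeroʳ(zeros {n}))== e1(m ^ 8)XX(∑l rows0 V)q0 =<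
     *-monoˡ(0≤*(0≤*(0≤pos 4)(0≤^ 8 0≤m))(<⇒≤ 0<XX))light <= e2(m ^ 8)XX m q0
    ; box = box-zeros n ; rowInvs = go start ; q≡ = sym(*-identityʳ q0) } where
    go : ∀ {rs} -> All(StartRow E q0)rs -> Pointwise(RowInv 0 zeros q0 q0)rs rs
    go [] = []
    go(h ∷ hs) = start-row h ∷ go hs
    e1 : ∀ m8 X S q -> + 4 * m8 *(+ 64 * X * S - q * 0ℤ)+ 0ℤ *(q * X)≡ + 4 * m8 * X *(+ 64 * S)
    e1 = ring
    e2 : ∀ m8 X m q -> + 4 * m8 * X *(+ 9 * m * q)≡ + 4 * m8 *(+ 9 * m * X * q)
    e2 = ring

   RowBound : Vec ℤ n -> Row n -> Set
   RowBound xs r =(s r ≡ 0ℤ -> m ^ 5 * + ∣ A r · xs ∣ ≤ H)× (1ℤ ≤ s r -> A r · xs ≤ + 89 * s r * H)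

   row-bound : ∀ {t xs q r0 r} -> 0ℤ < q -> + t ≤ + 40 * m ^ 9 -> StartRow E q0 r0 -> RowInv t xs q q0 r0 r -> RowBound xs r0
   row-bound {t}{xs}{q}{r0}{r}0<q t≤ h inv = subst (λ z -> z ≡ 0ℤ -> m ^ 5 * + ∣ A r0 · xs ∣ ≤ H)s≡(subst (λ z -> s r ≡ 0ℤ -> m ^ 5 * + ∣ z · xs ∣ ≤ H)A≡ tight),
    subst (λ z -> 1ℤ ≤ z -> A r0 · xs ≤ + 89 * z * H)s≡(subst (λ z -> 1ℤ ≤ s r -> z · xs ≤ + 89 * s r * H)A≡ loose) where
    open RowInv inv
    open StartRow h using (k; s≡k; 0<V; V≡)
    tight : s r ≡ 0ℤ -> m ^ 5 * + ∣ A r · xs ∣ ≤ H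
    tight h0 = *-cancel {m ^ 10}(0<^ 10 0<m)(e1 m(m ^ 4)(m ^ 10)(+ ∣ A r · xs ∣)=<
     *-monoˡ(0≤^ 4 0≤m)(proj₂(zero-row h0))<< *-monoˡ(0≤^ 4 0≤m)(*-monoʳ(<⇒≤ (0<* 0<E 0<N))t≤)<<
     e2(m ^ 4)(m ^ 9)E N =< *-monoʳ {m ^ 9 * H}{+ 40}{m}(0≤*(0≤^ 9 0≤m)(<⇒≤ 0<H))((+≤+ (N.m≤m+n 40 24))<< 64≤m)<= sym(*-assoc m(m ^ 9)H)) where
     e1 : ∀ m m4 m10 a -> m10 *(m * m4 * a)≡ m4 *(m * m10 * a)
     e1 = ring
     e2 : ∀ m4 m9 E N -> m4 *(+ 40 * m9 *(E * N))≡ + 40 *(m9 *(m4 * N * E))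
     e2 = ring
    loose : 1ℤ ≤ s r -> A r · xs ≤ + 89 * s r * H
    loose 1≤s = *-cancel {s r}(<-≤-trans(0<pos 0)1≤s)(bound <= e3(s r)H) where
     y = proj₁ expo
     num≤ = *-cancel {V r0 * q}(0<* 0<V 0<q)(proj₂(proj₂ expo)<< *-monoʳ(0≤*(0≤^(down y)(0≤+(<⇒≤ 0<H)(0≤pos 1)))(0≤^(up y)(<⇒≤ 0<H)))(*-monoʳ((<⇒≤ 0<q0)<< ≤-refl)(V≤q 0<q t≤ inv))<=
      cong (λ z -> q * z * denominator y)(sym V≡)== e(V r0)q((+ 2) ^ levels k)(denominator y)) where
      e : ∀ v q g d -> q *(v * g)* d ≡ v * q *(g * d)
      e = ring
     levels≡ = pos-+ 1(levels k)== cong (λ z -> 1ℤ + z)(pos-* 2(suc k N.* suc k)== cong(+ 2 *_)(pos-*(suc k)(suc k)== cong (λ z -> z * z)(pos-+ 1 k == cong (λ z -> 1ℤ + z)(sym(s≡ == s≡k)))))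
     e3 : ∀ s H -> + 89 *(s * s)* H ≡ s *(+ 89 * s * H)
     e3 = ring
     bound : s r *(A r · xs)≤ + 89 *(s r * s r)* H
     bound =(e4(s r *(A r · xs))(drift(s r)* + t)=< +-mono-≤(sym(proj₁(proj₂ expo))=< exponent-bound' 0<H y(levels k)num≤)
      (*-monoˡ(0≤*(0≤*(0≤pos 2)(sq≥0(s r)))(<⇒≤ 0<H'))t≤ <= e5(s r)H'(m ^ 9)== cong(+ 80 *(s r * s r) *_)(sym H≡)))<<
      +-monoˡ-≤(+ 80 *(s r * s r)* H)(cong(_* H)levels≡ =< *-monoʳ(<⇒≤ 0<H)nine)<= e6(s r)H where
      e4 : ∀ a b -> a ≡ a - b + b
      e4 = ring
      e5 : ∀ s h p -> + 2 *(s * s)* h *(+ 40 * p)≡ + 80 *(s * s)*(p * h)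
      e5 = ring
      e6 : ∀ s H -> + 9 *(s * s)* H + + 80 *(s * s)* H ≡ + 89 *(s * s)* H
      e6 = ring
      e7 : ∀ s -> 1ℤ + + 2 *((1ℤ + s)*(1ℤ + s))+((s - 1ℤ)*(+ 7 * s + + 3))≡ + 9 *(s * s)
      e7 = ring
      nine : 1ℤ + + 2 *((1ℤ + s r)*(1ℤ + s r))≤ + 9 *(s r * s r)
      nine = ≤-diff((s r - 1ℤ)*(+ 7 * s r + + 3))(0≤*(0≤-sub 1≤s)(0≤+(0≤*(0≤pos 7)(0≤pos 1 << 1≤s))(0≤pos 3)))(e7(s r))

   final : ∀ T -> + 40 * m ^ 9 < + T -> let st = iter sweep T(origin rows0 q0) in
    Box(x st)× + 16 * + count(active(x st)) < + 15 * m × All(RowBound(x st))rows0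
   final T T> = let (t , inv , prog) = sweeps-inv T origin-inv in
    Inv.box inv , few t inv prog , go start(Inv.rowInvs inv)(Inv.0<q inv)(Facts.t≤ inv) where
    st = iter sweep T(origin rows0 q0)
    few : ∀ t -> Inv rows0 q0 t st -> T N.≤ t ⊎ All(Rejects st)cands -> + 16 * + count(active(x st)) < + 15 * m
    few t inv(inj₁ T≤t) = ⊥-elim(<⇒≱ T>((+≤+ T≤t)<< Facts.t≤ inv))
    few t inv(inj₂ rej) = few-active inv rej
    go : ∀ {t xs q rs0 rs} -> All(StartRow E q0)rs0 -> Pointwise(RowInv t xs q q0)rs0 rs -> 0ℤ < q -> + t ≤ + 40 * m ^ 9 -> All(RowBound xs)rs0
    go [] [] _ _ = []
    go(h ∷ hs)(i ∷ is)0<q t≤ = row-bound 0<q t≤ h i ∷ go hs is 0<q t≤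

module WalkProgram where

 open import Data.Integer.Base using (∣_∣)
 open import Data.List.Base using (zipWith)
 open import Data.Nat.Base hiding (_^_)
 open import Data.Nat.Properties
 open Typed
 open Arithmetic
 open Chainℕ

 private variable
  Γ : Ctx

 rowt statet paramst candt : Ty
 rowt = ℤt ⊠ ℤt ⊠ 𝕃 ℤt
 statet = 𝕃 ℤt ⊠ 𝕃 rowt ⊠ ℤt
 -- D, N, X, H, n⁹, n⁸, the number R of heat steps, and the bound on all sizes.
 paramst = ℤt ⊠ ℤt ⊠ ℤt ⊠ ℤt ⊠ ℤt ⊠ ℤt ⊠ 𝕌 ⊠ 𝕌
 candt = ℤt ⊠ 𝕃 ℤt

 module Params (P : Car paramst) where
  D N X H p m8 : ℤ
  D = proj₁ P
  N = proj₁(proj₂ P)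
  X = proj₁(proj₂(proj₂ P))
  H = proj₁(proj₂(proj₂(proj₂ P)))
  p = proj₁(proj₂(proj₂(proj₂(proj₂ P))))
  m8 = proj₁(proj₂(proj₂(proj₂(proj₂(proj₂ P)))))
  R budget : ℕ
  R = proj₁(proj₂(proj₂(proj₂(proj₂(proj₂(proj₂ P))))))
  budget = proj₂(proj₂(proj₂(proj₂(proj₂(proj₂(proj₂ P))))))

 dT nT xT hT pT m8T : Γ ⊢ paramst -> Γ ⊢ ℤt
 dT P = fstT P
 nT P = fstT(sndT P)
 xT P = fstT(sndT(sndT P))
 hT P = fstT(sndT(sndT(sndT P)))
 pT P = fstT(sndT(sndT(sndT(sndT P))))
 m8T P = fstT(sndT(sndT(sndT(sndT(sndT P)))))

 rT budgetT : Γ ⊢ paramst -> Γ ⊢ 𝕌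
 rT P = fstT(sndT(sndT(sndT(sndT(sndT(sndT P))))))
 budgetT P = sndT(sndT(sndT(sndT(sndT(sndT(sndT P))))))

 lit : ℕ -> Γ ⊢ ℤt
 lit k = constT(Z.+ k)

 _-t_ : Γ ⊢ ℤt -> Γ ⊢ ℤt -> Γ ⊢ ℤt
 a -t b = a +t negℤ b

 infixl 6 _-t_

 activeL : Car paramst -> List ℤ -> List Bool
 activeL P = List.map (λ z ->(Z.+ ∣ z ∣ Z.+ N)≤?b X)
  where open Params P

 activeT : paramst ∷ 𝕃 ℤt ∷ [] ⊢ 𝕃 𝔹
 activeT = recast(mapT v1(natℤ(absT v0)+t nT v1 ≤t xT v1))(λ (P , x , _) -> activeL P x)(λ _ -> refl)

 maskL : List Bool -> List ℤ -> List ℤ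
 maskL = zipWith (λ b v -> if b then v else 0ℤ)

 maskT : 𝕃 𝔹 ∷ 𝕃 ℤt ∷ [] ⊢ 𝕃 ℤt
 maskT = recast(zipWithT(ifT v0 v1(lit 0))v0 v1)(λ (a , u , _) -> maskL a u)(λ _ -> refl)

 heavyL : ℤ -> List(Car rowt) -> List(List ℤ)
 heavyL q = List.foldr(λ (_ , V , A)Bs -> if q ≤?b(Z.+ 4 Z.* V) then A ∷ Bs else Bs)[]

 heavyT : ℤt ∷ 𝕃 rowt ∷ [] ⊢ 𝕃(𝕃 ℤt)
 heavyT = foldrT-exact v1 nilT v1(ifT(v2 ≤t lit 4 *t fstT(sndT v0))(consT(sndT(sndT v0))v1)v1)(λ (q , rs , _) -> heavyL q rs)(λ _ -> sz(𝕃 rowt))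
  (λ _ r rs -> m≤n+m(sz(𝕃 rowt)rs)(sz rowt r)<< n≤1+n _)
  (λ (q , _)r rs -> size≤ q(r ∷ rs))(λ _ -> ≤-refl)(λ _ -> refl) where
  size≤ : ∀ q rs -> sz(𝕃(𝕃 ℤt))(heavyL q rs)≤ sz(𝕃 rowt)rs
  size≤ q [] = ≤-refl
  size≤ q((s , V , A)∷ rs) with q ≤?b(Z.+ 4 Z.* V)
  ... | true = s≤s(+-mono-≤((m≤n+m(sz(𝕃 ℤt)A)(sz ℤt V)<< n≤1+n _)<< m≤n+m _ (sz ℤt s)<< n≤1+n _)(size≤ q rs))
  ... | false = size≤ q rs << m≤n+m _ (sz rowt(s , V , A))<< n≤1+n _

 gramL : List(List ℤ) -> List ℤ -> List ℤ
 gramL Bs u = List.foldr _⊞_ (List.map (λ _ -> 0ℤ)u)(List.map (λ B ->(B ∙ u) ⊡ B)Bs)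

 gramT : 𝕃(𝕃 ℤt)∷ 𝕃 ℤt ∷ [] ⊢ 𝕃 ℤt
 gramT = recast(call2 sumsT(mapT v0((v0 ∙t v2)⊡t v0))(mapT v1(lit 0)))(λ (Bs , u , _) -> gramL Bs u)(λ _ -> refl)

 heatL : ℤ -> List(List ℤ) -> List ℤ -> List ℤ
 heatL D Bs u =(D ⊡ u) ⊞ (-1ℤ ⊡ gramL Bs u)

 heatT : ℤt ∷ 𝕃(𝕃 ℤt)∷ 𝕃 ℤt ∷ [] ⊢ 𝕃 ℤt
 heatT = recast((v0 ⊡t v2)⊞t(constT -1ℤ ⊡t call2 gramT v1 v2))(λ (D , Bs , u , _) -> heatL D Bs u)(λ _ -> refl)

 constraintsL : Car paramst -> Car statet -> List(List ℤ)
 constraintsL P(x , rs , q) = List.map(maskL(activeL P x))(heavyL q rs)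

 constraintsT : paramst ∷ statet ∷ [] ⊢ 𝕃(𝕃 ℤt)
 constraintsT = recast(letT(call2 activeT v0(fstT v1))(mapT(call2 heavyT(sndT(sndT v2))(fstT(sndT v2)))(call2 maskT v1 v0)))
  (λ (P , st , _) -> constraintsL P st)(λ _ -> refl)

 flowL : Car paramst -> Car statet -> List ℤ -> List ℤ
 flowL P st e = iterC(𝕃 ℤt)(sz 𝕌 budget)(heatL D(constraintsL P st))R(maskL(activeL P(proj₁ st))e)
  where open Params P

 flowT : paramst ∷ statet ∷ 𝕃 ℤt ∷ [] ⊢ 𝕃 ℤt
 flowT = recast(letT(call2 constraintsT v0 v1)(iterT(rT v1)(call2 maskT(call2 activeT v1(fstT v2))v3)(budgetT v1)(call3 heatT(dT v2)v1 v0)))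
  (λ (P , st , e , _) -> flowL P st e)(λ _ -> refl)

 weightL : Car paramst -> ℤ -> ℤ -> ℤ
 weightL P s Z = p Z.* (H Z.* H Z.+ H Z.* Z Z.+ Z Z.* Z) Z.- s Z.* s Z.* (H Z.* H)
  where open Params P

 weightT : paramst ∷ ℤt ∷ ℤt ∷ [] ⊢ ℤt
 weightT = recast(pT v0 *t(hT v0 *t hT v0 +t hT v0 *t v2 +t v2 *t v2)-t v1 *t v1 *t(hT v0 *t hT v0))
  (λ (P , s , Z , _) -> weightL P s Z)(λ _ -> refl)

 updateL : Car paramst -> List ℤ -> Car rowt -> Car rowt
 updateL P u(s , V , A) = s , V Z.* weightL P s(s Z.* (A ∙ u)), A

 updateT : paramst ∷ 𝕃 ℤt ∷ rowt ∷ [] ⊢ rowt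
 updateT = recast(pairT(fstT v2)(pairT(fstT(sndT v2)*t call3 weightT v0(fstT v2)(fstT v2 *t(sndT(sndT v2)∙t v1)))(sndT(sndT v2))))
  (λ (P , u , r , _) -> updateL P u r)(λ _ -> refl)

 qL : Car paramst -> ℤ
 qL P = p Z.* (H Z.* H)
  where open Params P

 moveL : Car paramst -> Car statet -> List ℤ -> Car statet
 moveL P(x , rs , q)u = x ⊞ u , List.map(updateL P u)rs , q Z.* qL P

 moveT : paramst ∷ statet ∷ 𝕃 ℤt ∷ [] ⊢ statet
 moveT = recast(pairT(fstT v1 ⊞t v2)(pairT(mapT(fstT(sndT v1))(call3 updateT v1 v3 v0))(sndT(sndT v1)*t(pT v0 *t(hT v0 *t hT v0)))))
  (λ (P , st , u , _) -> moveL P st u)(λ _ -> refl)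

 potentialL : Car paramst -> Car statet -> ℤ
 potentialL P(x , rs , q) = Z.+ 64 Z.* (X Z.* X) Z.* sumℤ(List.map (λ r -> proj₁(proj₂ r))rs) Z.- q Z.* (x ∙ x)
  where open Params P

 potentialT : paramst ∷ statet ∷ [] ⊢ ℤt
 potentialT = recast(lit 64 *t(xT v0 *t xT v0)*t call1 sumT(mapT(fstT(sndT v1))(fstT(sndT v0)))-t sndT(sndT v1)*t(fstT v1 ∙t fstT v1))
  (λ (P , st , _) -> potentialL P st)(λ _ -> refl)

 improvesL : Car paramst -> Car statet -> Car statet -> Bool
 improvesL P st st' =(Z.+ 4 Z.* m8 Z.* potentialL P st' Z.+ proj₂(proj₂ st') Z.* (X Z.* X))≤?b(Z.+ 4 Z.* m8 Z.* qL P Z.* potentialL P st)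
  where open Params P

 improvesT : paramst ∷ statet ∷ statet ∷ [] ⊢ 𝔹
 improvesT = recast(lit 4 *t m8T v0 *t call2 potentialT v0 v2 +t sndT(sndT v2)*t(xT v0 *t xT v0)≤t lit 4 *t m8T v0 *t(pT v0 *t(hT v0 *t hT v0))*t call2 potentialT v0 v1)
  (λ (P , st , st' , _) -> improvesL P st st')(λ _ -> refl)

 attemptL : Car paramst -> Car candt -> Car statet -> Car statet
 attemptL P(σ , e)st = let st' = moveL P st(σ ⊡ flowL P st e) in if improvesL P st st' then st' else st

 attemptT : candt ∷ statet ∷ paramst ∷ [] ⊢ statet
 attemptT = recast(letT(call3 moveT v2 v1(fstT v0 ⊡t call3 flowT v2 v1(sndT v0)))(ifT(call3 improvesT v3 v2 v0)v0 v2))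
  (λ (c , st , P , _) -> attemptL P c st)(λ _ -> refl)

 sweepL : Car paramst -> List(Car candt) -> Car statet -> Car statet
 sweepL P cs st = foldrC statet(sz 𝕌(Params.budget P))(attemptL P)st cs

 sweepT : statet ∷ paramst ∷ 𝕃 candt ∷ [] ⊢ statet
 sweepT = recast(foldrT v2 v0(budgetT v1)(call3 attemptT v0 v1 v3))(λ (st , P , cs , _) -> sweepL P cs st)(λ _ -> refl)

 walkL : Car paramst -> List(Car candt) -> ℕ -> Car statet -> Car statet
 walkL P cs T st = iterC statet(sz 𝕌(Params.budget P))(sweepL P cs)T st

 walkT : paramst ∷ 𝕃 candt ∷ 𝕌 ∷ statet ∷ [] ⊢ statet
 walkT = recast(iterT v2 v3(budgetT v0)(call3 sweepT v0 v1 v2))(λ (P , cs , T , st , _) -> walkL P cs T st)(λ _ -> refl)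

module WalkSimulation where

 open import Data.Integer.Base using (∣_∣)
 open import Data.List.Relation.Binary.Pointwise.Base using (Pointwise; []; _∷_)
 open import Data.List.Relation.Unary.All as All using (All; []; _∷_)
 open import Data.Nat.Base hiding (_^_)
 open import Data.Nat.Properties
 open Machines using (leb-complete)
 open Typed
 open Arithmetic
 open Walks using (_·_; _⊹_; zeros; gram; Rows; 0≤pos; ·-self≥0; sq≥0; *-monoʳ; *-mono; ≤-diff; *-monoˡ)
 open Walks using (mask; ∑l; mask-norm; module Heat)
 open Walks
 open WalkProgram
 open Chainℕ
 open Chainℤ using () renaming (_<<_ to _ℤ<<_; _=<_ to _ℤ=<_; _<=_ to _ℤ<=_)

 tl : ∀ {A : Set}{n} -> Vec A n -> List A
 tl = Vec.toList

 tl-dot : ∀ {n}(u v : Vec ℤ n) -> tl u ∙ tl v ≡ u · v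
 tl-dot [] [] = refl
 tl-dot(a ∷ u)(b ∷ v) = cong (λ z -> a Z.* b Z.+ z)(tl-dot u v)

 tl-add : ∀ {n}(u v : Vec ℤ n) -> tl u ⊞ tl v ≡ tl(u ⊹ v)
 tl-add [] [] = refl
 tl-add(a ∷ u)(b ∷ v) = cong(a Z.+ b ∷_)(tl-add u v)

 tl-map : ∀ {A B : Set}(f : A -> B){n}(u : Vec A n) -> List.map f(tl u)≡ tl(Vec.map f u)
 tl-map f [] = refl
 tl-map f(a ∷ u) = cong(f a ∷_)(tl-map f u)

 tl-mask : ∀ {n}a (u : Vec ℤ n) -> maskL(tl a)(tl u)≡ tl(mask a u)
 tl-mask [] [] = refl
 tl-mask(b ∷ a)(x ∷ u) = cong(_ ∷_)(tl-mask a u)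

 tl-zeros : ∀ {n}(u : Vec ℤ n) -> List.map (λ _ -> 0ℤ)(tl u)≡ tl(zeros {n})
 tl-zeros [] = refl
 tl-zeros(a ∷ u) = cong(0ℤ ∷_)(tl-zeros u)

 tl-gram : ∀ {n}(Bs : Rows n)u -> gramL(List.map tl Bs)(tl u)≡ tl(gram Bs u)
 tl-gram [] u = tl-zeros u
 tl-gram(B ∷ Bs)u =(cong₂ _⊞_ (cong(_⊡ tl B)(tl-dot B u)== tl-map _ B)(tl-gram Bs u))== tl-add _ _

 iterC-sim : ∀ S {b}{Y : Set}(f : Car S -> Car S)(φ : Y -> Car S)(F : Y -> Y)(P : Y -> Set) ->
  (∀ y -> P y -> f(φ y)≡ φ(F y)× P(F y)) ->(∀ y -> P y -> sz S(φ y)≤ b) ->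
  ∀ y k -> P y -> iterC S b f k(φ y)≡ φ(iter F k y)× P(iter F k y)
 iterC-sim S {b}f φ F P step size≤ y zero h = refl , h
 iterC-sim S {b}f φ F P step size≤ y(suc k)h with iterC-sim S {b}f φ F P step size≤ y k h
 ... | eq , hk = cong (λ s -> clipped S b s(f s))eq == cong(clipped S b(φ(iter F k y)))(proj₁(step(iter F k y)hk))==
  cong (λ c -> if c then φ(F(iter F k y)) else φ(iter F k y))(leb-complete(size≤(F(iter F k y))(proj₂(step(iter F k y)hk)))),
  proj₂(step(iter F k y)hk)

 foldrC-sim : ∀ S {b}{A B Y : Set}(f : A -> Car S -> Car S)(φ : Y -> Car S)(ψ : B -> A)(F : B -> Y -> Y)(P : Y -> Set)(C : B -> Set) ->
  (∀ c y -> C c -> P y -> f(ψ c)(φ y)≡ φ(F c y)× P(F c y)) ->(∀ y -> P y -> sz S(φ y)≤ b) ->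
  ∀ cs -> All C cs -> ∀ y -> P y -> foldrC S b f(φ y)(List.map ψ cs)≡ φ(List.foldr F y cs)× P(List.foldr F y cs)
 foldrC-sim S {b}f φ ψ F P C step size≤ [] [] y h = refl , h
 foldrC-sim S {b}f φ ψ F P C step size≤(c ∷ cs)(g ∷ gs)y h with foldrC-sim S {b}f φ ψ F P C step size≤ cs gs y h
 ... | eq , hk = cong (λ s -> clipped S b s(f(ψ c)s))eq == cong(clipped S b(φ z))(proj₁(step c z g hk))==
  cong (λ x -> if x then φ(F c z) else φ z)(leb-complete(size≤(F c z)(proj₂(step c z g hk)))),
  proj₂(step c z g hk)
  where z = List.foldr F y cs

 Fits : ℕ -> ℤ -> Set
 Fits K z = ∣ z ∣ < 2 Data.Nat.Base.^ K

 size-fits : ∀ {K}z -> Fits K z -> sz ℤt z ≤ 5 + 4 * K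
 size-fits {K}z h = size-ℤ≤ z << +-monoʳ-≤ 5(*-monoʳ-≤ 4(bits-length K ∣ z ∣ h))

 fits-abs : ∀ {K y}z -> Z.+ ∣ z ∣ Z.≤ y -> Fits K y -> Fits K z
 fits-abs {K}{y}z h f = ≤-<-trans(Z.drop‿+≤+(h ℤ<< ≤-abs y))f

 fits-nonneg : ∀ {K y}z -> 0ℤ Z.≤ z -> z Z.≤ y -> Fits K y -> Fits K z
 fits-nonneg {K}{y}z 0≤z z≤y = fits-abs {K}{y}z(Z.0≤i⇒+∣i∣≡i 0≤z ℤ=< z≤y)

 vecSize : ℕ -> ℕ -> ℕ
 vecSize K n = suc(n *(6 + 4 * K))

 size-vec : ∀ {K B n}(v : Vec ℤ n) -> 0ℤ Z.≤ B -> Fits K B -> v · v Z.≤ B Z.* B -> sz(𝕃 ℤt)(tl v)≤ vecSize K n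
 size-vec [] _ _ _ = ≤-refl
 size-vec {K}{B}(z ∷ v)0≤B f h = s≤s(+-mono-≤(size-fits {K}z(fits-abs {K}{B}z(abs-≤ {z}0≤B(≤-diff(v · v)(·-self≥0 v)refl ℤ<< h))f))
  (size-vec {K}{B}v 0≤B f(≤-diff(z Z.* z)(sq≥0 z)(Z.+-comm(v · v)(z Z.* z))ℤ<< h))<= +-suc(5 + 4 * K)_)

 rowL : ∀ {n} -> Row n -> Car rowt
 rowL r = s r , V r , tl(A r)

 stL : ∀ {n} -> State n -> Car statet
 stL st = tl(x st), List.map rowL(rows st), q st

 candL : ∀ {n} -> ℤ × Vec ℤ n -> Car candt
 candL(σ , e) = σ , tl e

 stateSize : ℕ -> ℕ -> ℕ -> ℕ
 stateSize K n M = suc(vecSize K n + suc(suc(M * suc(suc((5 + 4 * K)+ suc((5 + 4 * K)+ vecSize K n))))+(5 + 4 * K)))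

 module Simulation (n R : ℕ)(E : ℤ)(64≤n : 64 ≤ n)(R≥ : (Z.+ n) Z.^ 24 Z.≤ Z.+ R)(1≤E : 1ℤ Z.≤ E)(budget : ℕ) where

  open Walk n R E 64≤n R≥ 1≤E public

  params : Car paramst
  params = D , N , X , H , p , m Z.^ 8 , R , budget

  active-tl : ∀ (v : Vec ℤ n) -> activeL params(tl v)≡ tl(active v)
  active-tl v = tl-map isActive v

  heavy-tl : ∀ q rs -> heavyL q(List.map rowL rs)≡ List.map tl(heavy q rs)
  heavy-tl q [] = refl
  heavy-tl q(r ∷ rs) = cong (λ Bs -> if isHeavy q r then tl(A r)∷ Bs else Bs)(heavy-tl q rs)== push(isHeavy q r) where
   push : ∀ b ->(if b then tl(A r)∷ List.map tl(heavy q rs) else List.map tl(heavy q rs))≡ List.map tl(if b then A r ∷ heavy q rs else heavy q rs)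
   push true = refl
   push false = refl

  constraints-tl : ∀ st -> constraintsL params(stL st)≡ List.map tl(constrs st)
  constraints-tl st = cong₂ (λ a Bs -> List.map(maskL a)Bs)(active-tl(x st))(heavy-tl(q st)(rows st))== go(heavy(q st)(rows st)) where
   go : ∀ Bs -> List.map(maskL(tl(active(x st))))(List.map tl Bs)≡ List.map tl(List.map(mask(active(x st)))Bs)
   go [] = refl
   go(B ∷ Bs) = cong₂ _∷_ (tl-mask(active(x st))B)(go Bs)

  heat-tl : ∀ (Bs : Rows n)u -> heatL D(List.map tl Bs)(tl u)≡ tl(heatStep Bs u)
  heat-tl Bs u =(cong₂ _⊞_ (tl-map _ u)(cong(-1ℤ ⊡_)(tl-gram Bs u)== tl-map _ (gram Bs u)))== tl-add _ _

  update-tl : ∀ u r -> updateL params(tl u)(rowL r)≡ rowL(update u r)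
  update-tl u r = cong (λ a -> s r , V r Z.* weight(s r)(s r Z.* a), tl(A r))(tl-dot(A r)u)

  move-tl : ∀ st u -> moveL params(stL st)(tl u)≡ stL(move st u)
  move-tl st u = cong₂ (λ v rs -> v , rs , q st Z.* Q)(tl-add(x st)u)(go(rows st)) where
   go : ∀ rs -> List.map(updateL params(tl u))(List.map rowL rs)≡ List.map rowL(List.map(update u)rs)
   go [] = refl
   go(r ∷ rs) = cong₂ _∷_ (update-tl u r)(go rs)

  potential-tl : ∀ st -> potentialL params(stL st)≡ potential st
  potential-tl st = cong₂ (λ a b -> Z.+ 64 Z.* XX Z.* a Z.- q st Z.* b)(go(rows st))(tl-dot(x st)(x st)) where
   go : ∀ rs -> sumℤ(List.map (λ r -> proj₁(proj₂ r))(List.map rowL rs))≡ ∑l rs V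
   go [] = refl
   go(r ∷ rs) = cong (λ z -> V r Z.+ z)(go rs)

  improves-tl : ∀ st st' -> improvesL params(stL st)(stL st')≡ improves st st'
  improves-tl st st' = cong₂ (λ a b ->(Z.+ 4 Z.* m Z.^ 8 Z.* a Z.+ q st' Z.* XX)≤?b(Z.+ 4 Z.* m Z.^ 8 Z.* Q Z.* b))(potential-tl st')(potential-tl st)

  module Sized (K : ℕ){rows0 : List (Row n)}{q0 : ℤ}
   (X-fits : Fits K X)(E-fits : Fits K E)(m-fits : Fits K m)(q-fits : ∀ t -> Z.+ t Z.≤ Z.+ 40 Z.* m Z.^ 9 -> Fits K(q0 Z.* Q Z.^ t))
   (enough : stateSize K n(length rows0)≤ sz 𝕌 budget) where

   Reachable : State n -> Set
   Reachable st = Σ[ t ∈ ℕ ] Inv rows0 q0 t st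

   vec≤ : vecSize K n ≤ sz 𝕌 budget
   vec≤ =(m≤m+n _ _ << n≤1+n _)<< enough

   N≤X : N Z.≤ X
   N≤X = sym(Z.*-identityˡ N)ℤ=< *-monoʳ {N}{1ℤ}{m Z.^ 4}(Z.<⇒≤ 0<N)(1≤^ 4 1≤m)

   N-fits : Fits K N
   N-fits = fits-nonneg {K}{X}N(Z.<⇒≤ 0<N)N≤X X-fits

   state-size : ∀ st -> Reachable st -> sz statet(stL st)≤ sz 𝕌 budget
   state-size st(t , inv) = s≤s(+-mono-≤(x-size(x st)box)(s≤s(+-mono-≤(rows-size rowInvs)(size-fits {K}(q st)q-fit))))<< enough where
    open Inv inv
    t≤ = Facts.t≤ inv
    q-fit = subst(Fits K)(sym q≡)(q-fits t t≤)
    x-size : ∀ {k}(v : Vec ℤ k) -> Box v -> sz(𝕃 ℤt)(tl v)≤ vecSize K k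
    x-size [] _ = ≤-refl
    x-size(z ∷ v)(h , b) = s≤s(+-mono-≤(size-fits {K}z(fits-abs {K}{X}z h X-fits))(x-size v b)<= +-suc(5 + 4 * K)_)
    row-size : ∀ {r0 r} -> RowInv t(x st)(q st)q0 r0 r -> sz rowt(rowL r)≤ suc((5 + 4 * K)+ suc((5 + 4 * K)+ vecSize K n))
    row-size {r0}{r}h = s≤s(+-mono-≤(size-fits {K}(s r)(fits-nonneg {K}{m}(s r)0≤s s≤m m-fits))
     (s≤s(+-mono-≤(size-fits {K}(V r)(fits-nonneg {K}{q st}(V r)0≤V(V≤q 0<q t≤ h)q-fit))(size-vec {K}{E}(A r)(Z.<⇒≤ 0<E)E-fits A≤E))))
     where open RowInv h
    rows-size : ∀ {rs0 rs} -> Pointwise(RowInv t(x st)(q st)q0)rs0 rs -> sz(𝕃 rowt)(List.map rowL rs)≤ suc(length rs0 * suc(suc((5 + 4 * K)+ suc((5 + 4 * K)+ vecSize K n))))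
    rows-size [] = ≤-refl
    rows-size(h ∷ hs) = s≤s(+-mono-≤(row-size h)(rows-size hs)<= +-suc(suc((5 + 4 * K)+ suc((5 + 4 * K)+ vecSize K n)))_)

   flow-tl : ∀ {t}st e -> Inv rows0 q0 t st -> e · e ≡ 1ℤ -> flowL params(stL st)(tl e)≡ tl(flowFrom st e)
   flow-tl {t}st e inv ee = cong₂ (λ Bs v -> iterC(𝕃 ℤt)(sz 𝕌 budget)(heatL D Bs)R v)(constraints-tl st)(cong (λ a -> maskL a(tl e))(active-tl(x st))== tl-mask(active(x st))e)== sim R ≤-refl where
    Bs = constrs st
    me = mask(active(x st))e
    total≤ = Facts.total-constraints inv
    bounded : ∀ k -> k ≤ R -> sz(𝕃 ℤt)(tl(iter(heatStep Bs)k me))≤ sz 𝕌 budget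
    bounded k k≤R = size-vec {K}{N}(iter(heatStep Bs)k me)(Z.<⇒≤ 0<N)N-fits
     (Heat.flow-norm Bs D total≤ k me ℤ<< *-monoˡ(sq≥0(D Z.^ k))(mask-norm(active(x st))e ℤ<= ee)ℤ<<
      Z.*-identityʳ _ ℤ=< *-mono(Z.<⇒≤ 0<N)(0≤Dk k)(Dk≤N k k≤R)(Dk≤N k k≤R))<< vec≤ where
     1≤D = *-mono {1ℤ}{m}{1ℤ}{E Z.* E}0≤m(0≤pos 1)1≤m(*-mono {1ℤ}{E}{1ℤ}{E}(Z.<⇒≤ 0<E)(0≤pos 1)1≤E 1≤E)
     0≤Dk : ∀ k -> 0ℤ Z.≤ D Z.^ k
     0≤Dk k = 0≤pos 1 ℤ<< 1≤^ k 1≤D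
     Dk≤N : ∀ k -> k ≤ R -> D Z.^ k Z.≤ N
     Dk≤N k k≤R = ^-mono-exp {D}1≤D k≤R
    sim : ∀ k -> k ≤ R -> iterC(𝕃 ℤt)(sz 𝕌 budget)(heatL D(List.map tl Bs))k(tl me)≡ tl(iter(heatStep Bs)k me)
    sim zero _ = refl
    sim(suc k)k<R = cong (λ v -> clipped(𝕃 ℤt)(sz 𝕌 budget)v(heatL D(List.map tl Bs)v))(sim k(<⇒≤ k<R))==
     cong(clipped(𝕃 ℤt)(sz 𝕌 budget)(tl(iter(heatStep Bs)k me)))(heat-tl Bs(iter(heatStep Bs)k me))==
      cong (λ c -> if c then tl(iter(heatStep Bs)(suc k)me) else tl(iter(heatStep Bs)k me))(leb-complete(bounded(suc k)k<R))

   attempt-tl : ∀ c st -> Candidate c -> Reachable st -> attemptL params(candL c)(stL st)≡ stL(attempt c st)× Reachable(attempt c st)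
   attempt-tl c@(σ , e)st(σσ , ee)(t , inv) = cong (λ st' -> if improvesL params(stL st)st' then st' else stL st)moved == cong (λ b -> if b then stL st' else stL st)(improves-tl st st')== push(improves st st'),
    (let (t' , inv' , _) = attempt-inv c(σσ , ee)inv in t' , inv') where
    st' = move st(direction st c)
    moved = cong (λ v -> moveL params(stL st)(σ ⊡ v))(flow-tl st e inv ee)== cong(moveL params(stL st))(tl-map(σ Z.*_)(flowFrom st e))== move-tl st(direction st c)
    push : ∀ b ->(if b then stL st' else stL st)≡ stL(if b then st' else st)
    push true = refl
    push false = refl

   sweep-tl : ∀ st -> Reachable st -> sweepL params(List.map candL cands)(stL st)≡ stL(sweep st)× Reachable(sweep st)
   sweep-tl st h = foldrC-sim statet {sz 𝕌 budget}(attemptL params)stL candL attempt Reachable Candidate (λ c st g h -> attempt-tl c st g h)state-size cands candidates-ok st h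

   walk-tl : ∀ st T -> Reachable st -> walkL params(List.map candL cands)T(stL st)≡ stL(iter sweep T st)
   walk-tl st T h = proj₁(iterC-sim statet {sz 𝕌 budget}(sweepL params(List.map candL cands))stL sweep Reachable sweep-tl state-size st T h)

module Program where

 open import Data.Integer.Base using (∣_∣)
 open import Data.List.Base using (_ʳ++_; zip; zipWith; take; drop)
 open import Data.Nat.Base hiding (_^_)
 open import Data.Nat.Properties
 open import Defs using (Letter; sep; encodeℚ)
 open Typed
 open Arithmetic
 open WalkProgram
 open Chainℕ

 private variable
  Γ : Ctx
  A B C S : Ty

 valT : 𝕃 𝔹 ∷ [] ⊢ ℕt
 valT = recast(call2 normT(reverseT v0)(constT 0))(λ (bs , _) -> val bs)(λ (bs , _) -> go bs []) where
  go : ∀ xs ys -> above(xs ʳ++ ys)0 ≡ above ys(val xs)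
  go [] ys = refl
  go(x ∷ xs)ys = go xs(x ∷ ys)

 -- Opaque, as comparing powers by evaluation is hopeless.
 opaque
  power : ℕ -> ℕ -> ℕ
  power k n = n N.^ k

  power≡ : ∀ k n -> power k n ≡ n N.^ k
  power≡ k n = refl

 powU : ℕ -> 𝕌 ∷ [] ⊢ 𝕌
 powU k = recast(go k)(λ (n , _) -> power k n)(λ (n , _) -> eq n k == sym(power≡ k n)) where
  go : ℕ -> 𝕌 ∷ [] ⊢ 𝕌
  go zero = constT 1
  go(suc k) = call2 mulT v0(go k)
  eq : ∀ n k -> fun(go k)(n , tt)≡ n N.^ k
  eq n zero = refl
  eq n(suc k) = cong(n *_)(eq n k)

 monusT : 𝕌 ∷ 𝕌 ∷ [] ⊢ 𝕌
 monusT = recast(lengthT(sndT(call2 splitT' v1(unaryList v0))))(λ (m , n , _) -> m ∸ n)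
  (λ (m , n , _) -> List.length-drop n(List.replicate m 0)== cong(_∸ n)(List.length-replicate m))

 ratt instt : Ty
 ratt = ℤt ⊠ ℤt
 instt = 𝕌 ⊠ 𝕃 ratt ⊠ 𝕃(𝕃 ratt) ⊠ 𝕃 ratt

 token1 : List(List Bool) -> List Bool
 token1 ts = listCase ts [] (λ t _ -> t)

 rest : List(List Bool) -> List(List Bool)
 rest ts = listCase ts [] (λ _ ts' -> ts')

 token1T : Γ ⊢ 𝕃(𝕃 𝔹) -> Γ ⊢ 𝕃 𝔹
 token1T l = caseT l nilT v0

 restT : Γ ⊢ 𝕃(𝕃 𝔹) -> Γ ⊢ 𝕃(𝕃 𝔹)
 restT l = caseT l nilT v1

 decodeL : List(List Bool) -> ℤ × ℤ
 decodeL ts = signed(hd0(token1 ts))(val(tl0(token1 ts))), Z.+ val(token1(rest ts))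

 decodeT : 𝕃(𝕃 𝔹)∷ [] ⊢ ratt
 decodeT = recast(pairT(call2 signedT(hdT(token1T v0))(call1 valT(tlT(token1T v0))))(natℤ(call1 valT(token1T(restT v0)))))
  (λ (ts , _) -> decodeL ts)(λ _ -> refl)

 unaryL : List Letter -> List Bool -> ℕ
 unaryL xs bs = fun unaryT(bs , xs , tt)

 ratsL : ℕ -> ℕ -> List(List Bool) -> List(ℤ × ℤ)
 ratsL n m ts = List.map decodeL(proj₁(chunks {A = 𝕃 𝔹}2(n + m * n + m)ts))

 ratsT : 𝕌 ∷ 𝕌 ∷ 𝕃(𝕃 𝔹)∷ [] ⊢ 𝕃 ratt
 ratsT = recast(mapT(fstT(call3 chunksT(constT 2)(call2 addT(call2 addT v0(call2 mulT v1 v0))v1)v2))(call1 decodeT v0))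
  (λ (n , m , ts , _) -> ratsL n m ts)(λ _ -> refl)

 instanceL : ℕ -> ℕ -> List(ℤ × ℤ) -> Car instt
 instanceL n m rs = n , take n rs , chunks {A = ratt}n m(drop n rs)

 instanceT : 𝕌 ∷ 𝕌 ∷ 𝕃 ratt ∷ [] ⊢ instt
 instanceT = recast(letT(call2 splitT' v0 v2)(pairT v1(pairT(fstT v0)(call3 chunksT v1 v2(sndT v0)))))
  (λ (n , m , rs , _) -> instanceL n m rs)(λ _ -> refl)

 parseTokensL : List Letter -> List(List Bool) -> Car instt
 parseTokensL xs ts = let n = unaryL xs(token1 ts); m = unaryL xs(token1(rest ts)) in instanceL n m(ratsL n m(rest(rest ts)))

 parseTokensT : 𝕃 𝕋 ∷ 𝕃(𝕃 𝔹)∷ [] ⊢ instt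
 parseTokensT = recast
  (letT(call2 unaryT(token1T v1)v0)(letT(call2 unaryT(token1T(restT v2))v1)(call3 instanceT v1 v0(call3 ratsT v1 v0(restT(restT v3))))))
  (λ (xs , ts , _) -> parseTokensL xs ts)(λ _ -> refl)

 opaque
  parseL : List Letter -> Car instt
  parseL xs = parseTokensL xs(tokens xs)

  parseL-def : ∀ xs -> parseTokensL xs(tokens xs)≡ parseL xs
  parseL-def xs = refl

 parseT : 𝕃 𝕋 ∷ [] ⊢ instt
 parseT = recast(call2 parseTokensT v0(call1 tokensT v0))(λ (xs , _) -> parseL xs)(λ (xs , _) -> parseL-def xs)

 isLow : ℤ × ℤ -> Bool
 isLow(p , q) = p ≤?b(q Z.- p)

 isLowT : Γ ⊢ ratt -> Γ ⊢ 𝔹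
 isLowT e = recast(fstT e ≤t sndT e -t fstT e)(λ γ -> isLow(fun e γ))(λ γ -> refl)

 -- min(y, 1 - y) for y = p/q.
 marginL : ℤ × ℤ -> ℤ × ℤ
 marginL(p , q) =(if isLow(p , q) then p else q Z.- p), q

 marginT : ratt ∷ [] ⊢ ratt
 marginT = recast(pairT(ifT(isLowT v0)(fstT v0)(sndT v0 -t fstT v0))(sndT v0))(λ (r , _) -> marginL r)(λ _ -> refl)

 mulL : ℤ × ℤ -> ℤ × ℤ -> ℤ × ℤ
 mulL(a , b)(c , d) = a Z.* c , b Z.* d

 mulRatT : ratt ∷ ratt ∷ [] ⊢ ratt
 mulRatT = recast(pairT(fstT v0 *t fstT v1)(sndT v0 *t sndT v1))(λ (r , s , _) -> mulL r s)(λ _ -> refl)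

 pickL : Bool -> ℤ × ℤ -> ℤ
 pickL b(c , d) = if b then c else d

 pickT : 𝔹 ∷ ratt ∷ [] ⊢ ℤt
 pickT = recast(ifT v0(fstT v1)(sndT v1))(λ (b , r , _) -> pickL b r)(λ _ -> refl)

 clearL : ℕ -> List(ℤ × ℤ) -> List ℤ
 clearL n fs = List.map (λ us -> prodℤ(zipWith pickL us fs))(unitRows n)

 clearT : 𝕌 ∷ 𝕃 ratt ∷ [] ⊢ 𝕃 ℤt
 clearT = recast(mapT(call1 unitRowsT v0)(call1 prodT(zipWithT pickT v0 v2)))(λ (n , fs , _) -> clearL n fs)(λ _ -> refl)

 doubleL : ℤ -> List ℤ -> List ℤ
 doubleL E A = if (Z.+ 4 Z.* (A ∙ A))≤?b(E Z.* E) then Z.+ 2 ⊡ A else A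

 doubleT : ℤt ∷ 𝕃 ℤt ∷ [] ⊢ 𝕃 ℤt
 doubleT = recast(ifT(lit 4 *t(v1 ∙t v1)≤t v0 *t v0)(lit 2 ⊡t v1)v1)(λ (E , A , _) -> doubleL E A)(λ _ -> refl)

 raiseL : ℤ × ℤ -> ℕ -> ℕ
 raiseL(p , q)s = if (Z.+ 256 Z.* Z.+ suc s Z.* q)≤?b p then suc s else s

 raiseT : 𝕌 ∷ ratt ∷ [] ⊢ 𝕌
 raiseT = recast(ifT(lit 256 *t call1 countT(sucT v0)*t sndT v1 ≤t fstT v1)(sucT v0)v0)
  (λ (s , r , _) -> raiseL r s)(λ _ -> refl)

 levelL : ℕ -> ℤ × ℤ -> ℕ
 levelL n r = iter(raiseL r)n 0

 level≤ : ∀ n r -> levelL n r ≤ n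
 level≤ zero r = z≤n
 level≤(suc n)r = raise≤ r(levelL n r)(level≤ n r) where
  raise≤ : ∀ r s -> s ≤ n -> raiseL r s ≤ suc n
  raise≤(p , q)s h with (Z.+ 256 Z.* Z.+ suc s Z.* q)≤?b p
  ... | true = s≤s h
  ... | false = h << n≤1+n n

 levelT : 𝕌 ∷ ratt ∷ [] ⊢ 𝕌
 levelT = iterT-exact v0 zeroT v0(call2 raiseT v0 v2)(λ (n , r , _) -> levelL n r)
  (λ (n , r , _)k k<n -> size-unary(levelL(suc k)r)=< s≤s(*-monoʳ-≤ 2(level≤(suc k)r << k<n))<= sym(size-unary n))
  (λ _ -> refl)

 weightOf : ℕ -> ℕ -> ℤ
 weightOf n s =(Z.+ 2) Z.^ (2 *((n ∸ s)* suc(suc(n + s))))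

 weightOfT : 𝕌 ∷ 𝕌 ∷ [] ⊢ ℤt
 weightOfT = recast(call2 powT(lit 2)(call2 mulT(constT 2)(call2 mulT(call2 monusT v0 v1)(sucT(sucT(call2 addT v0 v1))))))
  (λ (n , s , _) -> weightOf n s)(λ _ -> refl)

 unitWeight : ℕ -> ℤ
 unitWeight n =(Z.+ 2) Z.^ (2 *(suc n * suc n))

 unitWeightT : 𝕌 ∷ [] ⊢ ℤt
 unitWeightT = recast(call2 powT(lit 2)(call2 mulT(constT 2)(call2 mulT(sucT v0)(sucT v0))))(λ (n , _) -> unitWeight n)(λ _ -> refl)

 setupt : Ty
 setupt = 𝕌 ⊠ 𝕌 ⊠ 𝕌

 normalL : Car setupt -> List(ℤ × ℤ) -> List ℤ
 normalL(n , e , budget)fs = iterC(𝕃 ℤt)(sz 𝕌 budget)(doubleL((Z.+ 2) Z.^ e))e(clearL n fs)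

 normalT : setupt ∷ 𝕃 ratt ∷ [] ⊢ 𝕃 ℤt
 normalT = recast(letT(call2 powT(lit 2)(fstT(sndT v0)))(iterT(fstT(sndT v1))(call2 clearT(fstT v1)v2)(sndT(sndT v1))(call2 doubleT v1 v0)))
  (λ (u , fs , _) -> normalL u fs)(λ _ -> refl)

 rowOf : Car setupt -> List(ℤ × ℤ) -> List(ℤ × ℤ)× (ℤ × ℤ) -> Car rowt
 rowOf u margins(a , l) = Z.+ levelL(proj₁ u)l , weightOf(proj₁ u)(levelL(proj₁ u)l), normalL u(zipWith mulL a margins)

 rowOfT : setupt ∷ 𝕃 ratt ∷(𝕃 ratt ⊠ ratt)∷ [] ⊢ rowt
 rowOfT = recast(letT(call2 levelT(fstT v0)(sndT v2))(pairT(call1 countT v0)(pairT(call2 weightOfT(fstT v1)v0)(call2 normalT v1(zipWithT mulRatT(fstT v3)v2)))))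
  (λ (u , ms , c , _) -> rowOf u ms c)(λ _ -> refl)

 oppositeL : Car rowt -> Car rowt
 oppositeL(s , V , A) = s , V , -1ℤ ⊡ A

 oppositeT : rowt ∷ [] ⊢ rowt
 oppositeT = recast(pairT(fstT v0)(pairT(fstT(sndT v0))(constT -1ℤ ⊡t sndT(sndT v0))))(λ (r , _) -> oppositeL r)(λ _ -> refl)

 signedRowsL : List(Car rowt) -> List(Car rowt)
 signedRowsL rs = rs ++ List.map oppositeL rs

 rowsL : Car setupt -> List(ℤ × ℤ) -> List(List(ℤ × ℤ)) -> List(ℤ × ℤ) -> List(Car rowt)
 rowsL u ys as ls = signedRowsL(List.map(rowOf u(List.map marginL ys))(zip as ls))

 rowsT : setupt ∷ 𝕃 ratt ∷ 𝕃(𝕃 ratt)∷ 𝕃 ratt ∷ [] ⊢ 𝕃 rowt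
 rowsT = recast(letT(letT(mapT v1(call1 marginT v0))(mapT(call2 zipT v3 v4)(call3 rowOfT v2 v1 v0)))(call2 appendT v0(mapT v0(call1 oppositeT v0))))
  (λ (u , ys , as , ls , _) -> rowsL u ys as ls)(λ _ -> refl)

 startL : Car setupt -> Car instt -> Car statet
 startL u(n , ys , as , ls) = List.map (λ _ -> 0ℤ)ys , rowsL u ys as ls , unitWeight n

 startT : setupt ∷ instt ∷ [] ⊢ statet
 startT = recast(pairT(mapT(fstT(sndT v1))(lit 0))(pairT(call4 rowsT v0(fstT(sndT v1))(fstT(sndT(sndT v1)))(sndT(sndT(sndT v1))))(call1 unitWeightT(fstT v1))))
  (λ (u , i , _) -> startL u i)(λ _ -> refl)

 candidatesL : ℕ -> List(Car candt)
 candidatesL n = List.map(1ℤ ,_)es ++ List.map(-1ℤ ,_)es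
  where es = List.map(List.map (λ b -> if b then 1ℤ else 0ℤ))(unitRows n)

 candidatesT : 𝕌 ∷ [] ⊢ 𝕃 candt
 candidatesT = recast(letT(mapT(call1 unitRowsT v0)(mapT v0(ifT v0(lit 1)(lit 0))))(call2 appendT(mapT v0(pairT(lit 1)v0))(mapT v0(pairT(constT -1ℤ)v0))))
  (λ (n , _) -> candidatesL n)(λ _ -> refl)

 opaque
  assemble : ℤ -> ℤ -> ℕ -> ℕ -> Car paramst
  assemble m E R budget = D , N , X , X Z.* E , m Z.^ 9 , m Z.^ 8 , R , budget where
   D N X : ℤ
   D = m Z.* (E Z.* E)
   N = D Z.^ R
   X = m Z.^ 4 Z.* N

  assembling : ℤt ∷ ℤt ∷ 𝕌 ∷ 𝕌 ∷ [] ⊢ paramst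
  assembling =
   letT(v0 *t(v1 *t v1))(letT(call2 powT v0 v3)(letT(call2 powT v2(constT 4)*t v0)
    (pairT v2(pairT v1(pairT v0(pairT(v0 *t v4)(pairT(call2 powT v3(constT 9))(pairT(call2 powT v3(constT 8))(pairT v5 v6)))))))))

  assembling≡ : ∀ m E R budget -> fun assembling(m , E , R , budget , tt)≡ assemble m E R budget
  assembling≡ m E R budget = refl

  assemble-def : ∀ m E R budget -> let D = m Z.* (E Z.* E); N = D Z.^ R; X = m Z.^ 4 Z.* N in
   assemble m E R budget ≡(D , N , X , X Z.* E , m Z.^ 9 , m Z.^ 8 , R , budget)
  assemble-def m E R budget = refl

 assembleT : ℤt ∷ ℤt ∷ 𝕌 ∷ 𝕌 ∷ [] ⊢ paramst
 assembleT = recast assembling(λ (m , E , R , budget , _) -> assemble m E R budget)(λ (m , E , R , budget , _) -> assembling≡ m E R budget)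

 paramsL : Car setupt -> Car paramst
 paramsL(n , e , budget) = assemble(Z.+ n)((Z.+ 2) Z.^ e)(power 24 n)budget

 paramsT : setupt ∷ [] ⊢ paramst
 paramsT = recast(call4 assembleT(call1 countT(fstT v0))(call2 powT(lit 2)(fstT(sndT v0)))(call1(powU 24)(fstT v0))(sndT(sndT v0)))
  (λ (u , _) -> paramsL u)(λ _ -> refl)

 setupL : ℕ -> ℕ -> Car setupt
 setupL n ℓ = n , power 3 ℓ , power 70 ℓ

 setupT : 𝕌 ∷ 𝕌 ∷ [] ⊢ setupt
 setupT = recast(pairT v0(pairT(call1(powU 3)v1)(call1(powU 70)v1)))(λ (n , ℓ , _) -> setupL n ℓ)(λ _ -> refl)

 opaque
  walkedL : Car setupt -> Car instt -> List ℤ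
  walkedL u i = proj₁(walkL(paramsL u)(candidatesL(proj₁ u))(power 10(proj₁ u))(startL u i))

  walkedL-def : ∀ u i -> proj₁(walkL(paramsL u)(candidatesL(proj₁ u))(power 10(proj₁ u))(startL u i))≡ walkedL u i
  walkedL-def u i = refl

 walkedT : setupt ∷ instt ∷ [] ⊢ 𝕃 ℤt
 walkedT = recast(fstT(call4 walkT(call1 paramsT v0)(call1 candidatesT(fstT v0))(call1(powU 10)(fstT v0))(call2 startT v0 v1)))
  (λ (u , i , _) -> walkedL u i)(λ (u , i , _) -> walkedL-def u i)

 isGood : Car paramst -> ℤ × ℤ -> ℤ -> Bool
 isGood P r x = if (Z.+ ∣ x ∣ Z.+ N)≤?b X then false else (if isLow r then isNeg x else not(isNeg x))
  where open Params P

 isGoodT : paramst ∷ ratt ∷ ℤt ∷ [] ⊢ 𝔹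
 isGoodT = recast(ifT(natℤ(absT v2)+t nT v0 ≤t xT v0)(constT false)(ifT(isLowT v1)(negativeT v2)(notT(negativeT v2))))
  (λ (P , r , x , _) -> isGood P r x)(λ _ -> refl)

 countGood : Car paramst -> List(ℤ × ℤ) -> List ℤ -> ℕ
 countGood P ys x = trues(List.map(λ (r , z) -> isGood P r z)(zip ys x))

 countGoodT : paramst ∷ 𝕃 ratt ∷ 𝕃 ℤt ∷ [] ⊢ 𝕌
 countGoodT = recast(call1 countTrueT(mapT(call2 zipT v1 v2)(call3 isGoodT v1(fstT v0)(sndT v0))))(λ (P , ys , x , _) -> countGood P ys x)(λ _ -> refl)

 opaque
  orientL : Car paramst -> List(ℤ × ℤ) -> List ℤ -> List ℤ
  orientL P ys x = if (Z.+ countGood P ys(-1ℤ ⊡ x))≤?b(Z.+ countGood P ys x) then x else -1ℤ ⊡ x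

  orientL-def : ∀ P ys x ->(if (Z.+ countGood P ys(-1ℤ ⊡ x))≤?b(Z.+ countGood P ys x) then x else -1ℤ ⊡ x)≡ orientL P ys x
  orientL-def P ys x = refl

 orientT : paramst ∷ 𝕃 ratt ∷ 𝕃 ℤt ∷ [] ⊢ 𝕃 ℤt
 orientT = recast(letT(constT -1ℤ ⊡t v2)(ifT(call1 countT(call3 countGoodT v1 v2 v0)≤t call1 countT(call3 countGoodT v1 v2 v3))v3 v0))
  (λ (P , ys , x , _) -> orientL P ys x)(λ (P , ys , x , _) -> orientL-def P ys x)

 -- One digit of the long division by d, for a remainder r.
 divideL : ℤ -> ℤ × ℕ -> ℤ × ℕ
 divideL d(r , k) = if d ≤?b(r Z.+ r) then ((r Z.+ r) Z.- d , 1 +(k + k)) else (r Z.+ r , k + k)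

 divideT : ℤt ∷(ℤt ⊠ ℕt)∷ [] ⊢ ℤt ⊠ ℕt
 divideT = recast(letT(fstT v1 +t fstT v1)(letT(call2 addℕ(sndT v2)(sndT v2))(ifT(v2 ≤t v1)(pairT(v1 -t v2)(call2 addℕ(constT 1)v0))(pairT v1 v0))))
  (λ (d , s , _) -> divideL d s)(λ _ -> refl)

 quotientL : ℕ -> ℕ -> ℤ -> ℤ -> ℕ
 quotientL budget n d r = proj₂(iterC(ℤt ⊠ ℕt)(sz 𝕌 budget)(divideL d)n(r , 0))

 quotientT : 𝕌 ∷ 𝕌 ∷ ℤt ∷ ℤt ∷ [] ⊢ ℕt
 quotientT = recast(sndT(iterT v1(pairT v3(constT 0))v0(call2 divideT v3 v0)))(λ (b , n , d , r , _) -> quotientL b n d r)(λ _ -> refl)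

 natLetters : ℕ -> List Letter
 natLetters k = List.map bitLetter(bits k) ++ sep ∷ []

 natLettersT : ℕt ∷ [] ⊢ 𝕃 𝕋
 natLettersT = recast(call2 appendT(mapT(asBits v0)(call1 bitLetterT v0))(constT(sep ∷ [])))(λ (k , _) -> natLetters k)(λ _ -> refl)

 -- The code of (2k + 1) / 2ⁿ⁺¹.
 dyadicLetters : ℕ -> ℕ -> List Letter
 dyadicLetters n k = bitLetter false ∷(natLetters(1 +(k + k)) ++ natLetters ∣ (Z.+ 2) Z.^ suc n ∣)

 dyadicLettersT : 𝕌 ∷ ℕt ∷ [] ⊢ 𝕃 𝕋
 dyadicLettersT = recast(consT(constT(bitLetter false))(call2 appendT(call1 natLettersT(call2 addℕ(constT 1)(call2 addℕ v1 v1)))(call1 natLettersT(absT(call2 powT(lit 2)(sucT v0))))))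
  (λ (n , k , _) -> dyadicLetters n k)(λ _ -> refl)

 roundL : Car paramst -> ℕ -> ℤ × ℤ -> ℤ -> List Letter
 roundL P n(p , q)x = if isGood P(p , q)x then (if isLow(p , q) then encodeℚ 0ℚ else encodeℚ 1ℚ)
  else dyadicLetters n(quotientL budget n(q Z.* X)(p Z.* X Z.+ proj₁(marginL(p , q)) Z.* x))
  where open Params P using (budget; X)

 roundT : paramst ∷ 𝕌 ∷ ratt ∷ ℤt ∷ [] ⊢ 𝕃 𝕋
 roundT = recast(ifT(call3 isGoodT v0 v2 v3)(ifT(isLowT v2)(constT(encodeℚ 0ℚ))(constT(encodeℚ 1ℚ)))
  (call2 dyadicLettersT v1(call4 quotientT(budgetT v0)v1(sndT v2 *t xT v0)(fstT v2 *t xT v0 +t fstT(call1 marginT v2)*t v3))))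
  (λ (P , n , r , x , _) -> roundL P n r x)(λ _ -> refl)

 opaque
  outputL : Car paramst -> ℕ -> List(ℤ × ℤ) -> List ℤ -> List Letter
  outputL P n ys x = List.concat(List.map(λ (r , z) -> roundL P n r z)(zip ys x))

  outputL-def : ∀ P n ys x -> List.concat(List.map(λ (r , z) -> roundL P n r z)(zip ys x))≡ outputL P n ys x
  outputL-def P n ys x = refl

 outputT : paramst ∷ 𝕌 ∷ 𝕃 ratt ∷ 𝕃 ℤt ∷ [] ⊢ 𝕃 𝕋
 outputT = recast(call1 concatT(mapT(call2 zipT v2 v3)(call4 roundT v1 v2(fstT v0)(sndT v0))))(λ (P , n , ys , x , _) -> outputL P n ys x)(λ (P , n , ys , x , _) -> outputL-def P n ys x)

 solveInstanceL : Car setupt -> Car instt -> List Letter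
 solveInstanceL u i = outputL(paramsL u)(proj₁ u)(proj₁(proj₂ i))(orientL(paramsL u)(proj₁(proj₂ i))(walkedL u i))

 solveInstanceT : setupt ∷ instt ∷ [] ⊢ 𝕃 𝕋
 solveInstanceT = recast(letT(call1 paramsT v0)(call4 outputT v0(fstT v1)(fstT(sndT v2))(call3 orientT v0(fstT(sndT v2))(call2 walkedT v1 v2))))
  (λ (u , i , _) -> solveInstanceL u i)(λ _ -> refl)

 solveL : List Letter -> List Letter
 solveL xs = solveInstanceL(setupL(proj₁(parseL xs))(length xs))(parseL xs)

 solveT : 𝕃 𝕋 ∷ [] ⊢ 𝕃 𝕋
 solveT = recast(letT(call1 parseT v0)(call2 solveInstanceT(call2 setupT(fstT v0)(lengthT v1))v0))(λ (xs , _) -> solveL xs)(λ _ -> refl)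

module Digits where

 open import Data.Digit using (Bit; Expansion; fromDigits; toDigits)
 open import Data.Fin.Base using (toℕ)
 open import Data.Nat.Base
 open import Data.Nat.DivMod using (_divMod_; result)
 open import Data.Nat.Induction using (Acc; acc; <′-Rec; <′-wellFounded′)
 open import Data.Nat.Properties
 import Induction.WellFounded as WF
 open import Defs using (bit)
 open Arithmetic

 Value : ℕ -> Set
 Value n = Σ[ ds ∈ Expansion 2 ] fromDigits ds ≡ n

 record Canonical (n : ℕ)(ds : Expansion 2) : Set where
  constructor canonical
  field
   letters≡ : 0 < n -> List.map bit ds ≡ List.map bitLetter(bits n)

 open Canonical public

 bits-suc : ∀ b x -> bits(b2n b + suc x * 2)≡ b ∷ bits(suc x)
 bits-suc b x = cong (λ z -> bits(b2n b + z))(*-comm(suc x)2 == 2*-dbl(suc x))== bits-cons b(suc x)== go b where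
  go : ∀ b -> cons0 b(bits(suc x))≡ b ∷ bits(suc x)
  go true = refl
  go false = cons0-inc(bits x)

 canonical-cons : ∀ r x ds -> Canonical(suc x)ds -> Canonical(toℕ r + suc x * 2)(r ∷ ds)
 canonical-cons Fin.zero x ds h = canonical λ _ -> cong(bit Fin.zero ∷_)(letters≡ h(s≤s z≤n))== sym(cong(List.map bitLetter)(bits-suc false x))
 canonical-cons(Fin.suc Fin.zero)x ds h = canonical λ _ -> cong(bit(Fin.suc Fin.zero) ∷_)(letters≡ h(s≤s z≤n))== sym(cong(List.map bitLetter)(bits-suc true x))

 canonical-one : ∀ r n -> n ≡ toℕ r + 0 -> Canonical n(r ∷ [])
 canonical-one Fin.zero .0 refl = canonical λ ()
 canonical-one(Fin.suc Fin.zero).1 refl = canonical λ _ -> refl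

 canonical-rec :(f : ∀ n -> <′-Rec Value n -> Value n) ->
  (∀ n (rec : <′-Rec Value n) ->(∀ {m}(p : m <′ n) -> Canonical m(proj₁(rec p))) -> Canonical n(proj₁(f n rec))) ->
  ∀ n (q : Acc _<′_ n){m}(p : m <′ n) -> Canonical m(proj₁(WF.Some.wfRecBuilder Value f n q p))
 canonical-rec f step n(acc rs)p = step _ _ (λ p' -> canonical-rec f step _ (rs p)p')

 -- The local functions that toDigits iterates are the placeholders _ in the first two types.
 mutual
  canonical-step0 : ∀ (r : Bit)(x : ℕ)n (rec : <′-Rec Value n) ->(∀ {m}(p : m <′ n) -> Canonical m(proj₁(rec p))) ->
   Canonical n _
  canonical-step1 : ∀ (r : Bit)(x : ℕ)n (rec : <′-Rec Value n) ->(∀ {m}(p : m <′ n) -> Canonical m(proj₁(rec p))) ->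
   Canonical n _

  canonical-digits : ∀ n -> Canonical n(proj₁(toDigits 2 n))
  canonical-digits n with n divMod 2
  ... | result zero r eq = canonical-one r n eq
  ... | result(suc x)r refl with suc x divMod 2
  ... | result zero r' eq = canonical-cons r x _ (canonical-one r'(suc x)eq)
  ... | result(suc x')Fin.zero refl with <′-wellFounded′
  ... | w = canonical-cons r x _ (canonical-cons Fin.zero x' _ (canonical-rec _ (canonical-step0 r x')(suc x)(w(toℕ r + suc x * 2)_)_))
  canonical-digits n | result(suc x)r refl | result(suc x')(Fin.suc Fin.zero)refl with <′-wellFounded′
  ... | w = canonical-cons r x _ (canonical-cons(Fin.suc Fin.zero)x' _ (canonical-rec _ (canonical-step1 r x')(suc x)(w(toℕ r + suc x * 2)_)_))

  canonical-step0 _ _ n rec h with n divMod 2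
  ... | result zero r eq = canonical-one r n eq
  ... | result(suc x)r refl = canonical-cons r x _ (h _)

  canonical-step1 _ _ n rec h with n divMod 2
  ... | result zero r eq = canonical-one r n eq
  ... | result(suc x)r refl = canonical-cons r x _ (h _)

module Decoding where

 open import Data.Digit using (Bit; Expansion; fromDigits; toDigits)
 open import Data.Fin.Base using (toℕ)
 open import Data.Integer.Base using (+_; -[1+_]; ∣_∣)
 open import Data.List.Base using (concat; concatMap; take; drop)
 open import Data.List.Relation.Unary.All as All using (All; []; _∷_)
 import Data.List.Relation.Unary.All.Properties as All
 open import Data.Nat.Base
 open import Data.Nat.Properties
 open import Defs
 open Typed
 open Arithmetic
 open Program
 open Digits
 open Chainℕ

 digitBool : Bit -> Bool
 digitBool Fin.zero = false
 digitBool(Fin.suc _) = true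

 natBits : ℕ -> List Bool
 natBits n = List.map digitBool(proj₁(toDigits 2 n))

 bitLetter-digit : ∀ d -> bit d ≡ bitLetter(digitBool d)
 bitLetter-digit Fin.zero = refl
 bitLetter-digit(Fin.suc Fin.zero) = refl

 encodeℕ-bits : ∀ n -> encodeℕ n ≡ List.map bitLetter(natBits n) ++ sep ∷ []
 encodeℕ-bits n = cong(_++ sep ∷ [])(List.map-cong bitLetter-digit _ == List.map-∘ _)

 val-natBits : ∀ n -> val(natBits n)≡ n
 val-natBits n = go(proj₁(toDigits 2 n))== proj₂(toDigits 2 n) where
  go : ∀ (ds : Expansion 2) -> val(List.map digitBool ds)≡ fromDigits ds
  go [] = refl
  go(d ∷ ds) = cong₂ _+_ (digit d)(cong dbl(go ds)== sym(2*-dbl _)== *-comm 2(fromDigits ds)) where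
   digit : ∀ d -> b2n(digitBool d)≡ toℕ d
   digit Fin.zero = refl
   digit(Fin.suc Fin.zero) = refl

 ℕ-letters : ∀ n -> 0 < n -> encodeℕ n ≡ natLetters n
 ℕ-letters n 0<n = cong(_++ sep ∷ [])(letters≡(canonical-digits n)0<n)

 letterBits-bit : ∀ b -> letterBits(bitLetter b)≡ b ∷ []
 letterBits-bit false = refl
 letterBits-bit true = refl

 tokens-block : ∀ bs r -> tokens(List.map bitLetter bs ++ sep ∷ r)≡ bs ∷ tokens r
 tokens-block [] r = refl
 tokens-block(b ∷ bs)r rewrite letterBits-bit b | tokens-block bs r = refl

 tokens-ℕ : ∀ n r -> tokens(encodeℕ n ++ r)≡ natBits n ∷ tokens r
 tokens-ℕ n r = cong (λ l -> tokens(l ++ r))(encodeℕ-bits n)== cong tokens(List.++-assoc(List.map bitLetter(natBits n))(sep ∷ [])r)== tokens-block(natBits n)r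

 intBits : ℤ -> List Bool
 intBits z = isNeg z ∷ natBits ∣ z ∣

 ratTokens : ℚ -> List(List Bool)
 ratTokens q = intBits(↥ q)∷ natBits(↧ₙ q)∷ []

 tokens-bit : ∀ b x r -> tokens(bitLetter b ∷(encodeℕ x ++ r))≡(b ∷ natBits x)∷ tokens r
 tokens-bit b x r rewrite letterBits-bit b | tokens-ℕ x r = refl

 tokens-ℤ : ∀ z r -> tokens(encodeℤ z ++ r)≡ intBits z ∷ tokens r
 tokens-ℤ(+ n)r = tokens-bit false n r
 tokens-ℤ -[1+ n ] r = tokens-bit true(suc n)r

 tokens-ℚ : ∀ q r -> tokens(encodeℚ q ++ r)≡ ratTokens q ++ tokens r
 tokens-ℚ q r = cong tokens(List.++-assoc(encodeℤ(↥ q))(encodeℕ(↧ₙ q))r)== tokens-ℤ(↥ q)_ == cong(intBits(↥ q) ∷_)(tokens-ℕ(↧ₙ q)r)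

 tokens-ℚs : ∀ qs -> tokens(concatMap encodeℚ qs)≡ concatMap ratTokens qs
 tokens-ℚs [] = refl
 tokens-ℚs(q ∷ qs) = tokens-ℚ q(concatMap encodeℚ qs)== cong(ratTokens q ++_)(tokens-ℚs qs)

 ratOf : ℚ -> ℤ × ℤ
 ratOf q = ↥ q , ↧ q

 decode-ratTokens : ∀ q -> decodeL(ratTokens q)≡ ratOf q
 decode-ratTokens q = cong₂ _,_ (cong(signed(isNeg(↥ q)))(val-natBits ∣ ↥ q ∣)== go(↥ q))(cong +_ (val-natBits(↧ₙ q))) where
  go : ∀ z -> signed(isNeg z) ∣ z ∣ ≡ z
  go(+ n) = refl
  go -[1+ n ] = refl

 chunks-pairs : ∀ qs -> proj₁(chunks {A = 𝕃 𝔹}2(length qs)(concatMap ratTokens qs))≡ List.map ratTokens qs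
 chunks-pairs [] = refl
 chunks-pairs(q ∷ qs) = cong(ratTokens q ∷_)(chunks-pairs qs)

 take-length : ∀ {X : Set}{n}(xs ys : List X) -> length xs ≡ n -> take n(xs ++ ys)≡ xs
 take-length [] ys refl = refl
 take-length(x ∷ xs)ys refl = cong(x ∷_)(take-length xs ys refl)

 drop-length : ∀ {X : Set}{n}(xs ys : List X) -> length xs ≡ n -> drop n(xs ++ ys)≡ ys
 drop-length [] ys refl = refl
 drop-length(x ∷ xs)ys refl = drop-length xs ys refl

 chunks-concat : ∀ n (xss : List(List(ℤ × ℤ)))r -> All (λ xs -> length xs ≡ n)xss -> chunks {A = ratt}n(length xss)(concat xss ++ r)≡(xss , r)
 chunks-concat n [] r [] = refl
 chunks-concat n(xs ∷ xss)r(h ∷ hs)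
  rewrite List.++-assoc xs(concat xss)r | take-length xs(concat xss ++ r)h | drop-length xs(concat xss ++ r)h | chunks-concat n xss r hs = refl

 length-concat : ∀ {X : Set}n (xss : List(List X)) -> All (λ xs -> length xs ≡ n)xss -> length(concat xss)≡ length xss * n
 length-concat n [] [] = refl
 length-concat n(xs ∷ xss)(h ∷ hs) = List.length-++ xs ==(cong₂ _+_ h(length-concat n xss hs))

 module Input (n m : ℕ)(y : Vector ℚ n)(a : Vector (Vector ℚ n) m)(Λ : Vector ℚ m) where

  input : List Letter
  input = encodeInput n m y a Λ

  opaque
   L : ℕ
   L = length input

   L≡ : length input ≡ L
   L≡ = refl

  ys ls numbers : List ℚ
  ys = Vector.toList y
  ls = Vector.toList Λ
  as : List(List ℚ)
  as = List.map Vector.toList(Vector.toList a)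
  numbers = ys ++ concat as ++ ls

  body : List Letter
  body = concatMap encodeℚ numbers

  input≡ : input ≡ encodeℕ n ++ encodeℕ m ++ body
  input≡ = cong (λ b -> encodeℕ n ++ encodeℕ m ++ b)
   (sym(List.concatMap-++ encodeℚ ys(concat as ++ ls)== cong(concatMap encodeℚ ys ++_)(List.concatMap-++ encodeℚ(concat as)ls == cong(_++ concatMap encodeℚ ls)(rows(Vector.toList a))))) where
   rows : ∀ (vs : List(Vector ℚ n)) -> concatMap encodeℚ(concat(List.map Vector.toList vs))≡ concatMap (λ v -> concatMap encodeℚ(Vector.toList v))vs
   rows [] = refl
   rows(v ∷ vs) = List.concatMap-++ encodeℚ(Vector.toList v)_ == cong(concatMap encodeℚ(Vector.toList v) ++_)(rows vs)

  tokens≡ : tokens input ≡ natBits n ∷ natBits m ∷ concatMap ratTokens numbers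
  tokens≡ = cong tokens input≡ == tokens-ℕ n _ == cong(natBits n ∷_)(tokens-ℕ m _ == cong(natBits m ∷_)(tokens-ℚs numbers))

  body≤ : length body ≤ L
  body≤ =(m≤n+m(length body)(length(encodeℕ m))<= sym(List.length-++(encodeℕ m)))<<
   m≤n+m _ (length(encodeℕ n))<= sym(List.length-++(encodeℕ n))== cong length(sym input≡)== L≡

  1≤encodeℕ : ∀ k -> 1 ≤ length(encodeℕ k)
  1≤encodeℕ k = m≤n+m 1 _ <= sym(List.length-++(List.map bit(proj₁(toDigits 2 k))))

  1≤encodeℚ : ∀ q -> 1 ≤ length(encodeℚ q)
  1≤encodeℚ q = 1≤encodeℕ(↧ₙ q)<< m≤n+m _ (length(encodeℤ(↥ q)))<= sym(List.length-++(encodeℤ(↥ q)))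

  length≤ : ∀ qs -> length qs ≤ length(concatMap encodeℚ qs)
  length≤ [] = z≤n
  length≤(q ∷ qs) = +-mono-≤(1≤encodeℚ q)(length≤ qs)<= sym(List.length-++(encodeℚ q))

  length-ys : length ys ≡ n
  length-ys = List.length-tabulate y

  length-ls : length ls ≡ m
  length-ls = List.length-tabulate Λ

  length-as : length as ≡ m
  length-as = List.length-map Vector.toList(Vector.toList a)== List.length-tabulate a

  as-lengths : All (λ xs -> length xs ≡ n)as
  as-lengths = All.map⁺(All.universal (λ v -> List.length-tabulate v)(Vector.toList a))

  length-numbers : length numbers ≡ n + m * n + m
  length-numbers = List.length-++ ys ==(cong₂ _+_ length-ys(List.length-++(concat as)==(cong₂ _+_ (length-concat n as as-lengths == cong(_* n)length-as)length-ls)))== sym(+-assoc n(m * n)m)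

  n+m≤L : n + m ≤ L
  n+m≤L =((+-monoˡ-≤ m(m≤m+n n(m * n))<= sym length-numbers)<< length≤ numbers)<< body≤

  n≤L : n ≤ L
  n≤L = m≤m+n n m << n+m≤L

  m≤L : m ≤ L
  m≤L = m≤n+m m n << n+m≤L

  rats : List ℚ -> List(ℤ × ℤ)
  rats = List.map ratOf

  parsed : parseL input ≡(n , rats ys , List.map rats as , rats ls)
  parsed = sym(parseL-def input)== cong(parseTokensL input)tokens≡ == cong₂ (λ n' m' -> instanceL n' m'(ratsL n' m' ts))(unary≡ n n≤L)(unary≡ m m≤L)==
   cong(instanceL n m)rats≡ == instance≡ where
   ts = concatMap ratTokens numbers
   unary≡ : ∀ k -> k ≤ L -> unaryL input(natBits k)≡ k
   unary≡ k k≤ = unaryT≡(natBits k)input(val-natBits k =< k≤ <= sym L≡)== val-natBits k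
   rats≡ = cong (λ k -> List.map decodeL(proj₁(chunks {A = 𝕃 𝔹}2 k ts)))(sym length-numbers)== cong(List.map decodeL)(chunks-pairs numbers)==
    sym(List.map-∘ numbers)== List.map-cong decode-ratTokens numbers
   split≡ = List.map-++ ratOf ys(concat as ++ ls)== cong(rats ys ++_)(List.map-++ ratOf(concat as)ls == cong(_++ rats ls)(sym(List.concat-map as)))
   length-rats = List.length-map ratOf ys == length-ys
   instance≡ : instanceL n m(rats numbers)≡(n , rats ys , List.map rats as , rats ls)
   instance≡ rewrite split≡ = cong₂ (λ a b -> n , a , b)(take-length(rats ys)_ length-rats)
    (cong(chunks {A = ratt}n m)(drop-length(rats ys)_ length-rats)== cong (λ k -> chunks {A = ratt}n k(concat(List.map rats as) ++ rats ls))(sym(List.length-map rats as == length-as))==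
     chunks-concat n(List.map rats as)(rats ls)(All.map⁺(All.map (λ {xs}h -> List.length-map ratOf xs == h)as-lengths)))

  Short : ℚ -> Set
  Short q = ∣ ↥ q ∣ < 2 ^ L × ↧ₙ q < 2 ^ L

  short : All Short numbers
  short = go numbers ≤-refl where
   nat-short : ∀ k L -> length(encodeℕ k)≤ L -> k < 2 ^ L
   nat-short k L h =(cong suc(sym(val-natBits k))=< val<2^(natBits k))<< ^-monoʳ-≤ 2((sym(List.length-map bitLetter(natBits k))=<
    m≤m+n _ 1 <= sym(List.length-++(List.map bitLetter(natBits k)))== cong length(sym(encodeℕ-bits k)))<< h)
   int-length : ∀ z -> length(encodeℕ ∣ z ∣)≤ length(encodeℤ z)
   int-length(+ n) = n≤1+n _
   int-length -[1+ n ] = n≤1+n _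
   one : ∀ q L -> length(encodeℚ q)≤ L -> ∣ ↥ q ∣ < 2 ^ L × ↧ₙ q < 2 ^ L
   one q L h = nat-short _ L((int-length(↥ q)<< m≤m+n _ _ <= sym(List.length-++(encodeℤ(↥ q))))<< h),
    nat-short _ L((m≤n+m _ (length(encodeℤ(↥ q)))<= sym(List.length-++(encodeℤ(↥ q))))<< h)
   go : ∀ qs -> length(concatMap encodeℚ qs)≤ length body -> All Short qs
   go [] _ = []
   go(q ∷ qs)h = one q _ ((m≤m+n(length(encodeℚ q))_ << sym(List.length-++(encodeℚ q))=< h)<< body≤)∷
    go qs((m≤n+m _ (length(encodeℚ q))<= sym(List.length-++(encodeℚ q)))<< h)

module Rows where

 open import Data.Integer.Base hiding (suc)
 open import Data.Integer.Properties
 open import Data.Integer.Tactic.RingSolver using () renaming (solve-∀ to ring)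
 open import Data.List.Base using (zipWith)
 import Data.Nat.Tactic.RingSolver as N
 open Typed
 open Arithmetic
 open Walks
 open WalkProgram
 open WalkSimulation
 open Program
 open Chainℕ using () renaming (_<<_ to _ℕ<<_)
 open Chainℤ

 Frac : Set
 Frac = ℤ × ℤ

 denoms : ∀ {n} -> Vec Frac n -> ℤ
 denoms [] = 1ℤ
 denoms((c , d)∷ fs) = d * denoms fs

 clear : ∀ {n} -> Vec Frac n -> Vec ℤ n
 clear [] = []
 clear((c , d)∷ fs) = c * denoms fs ∷ d ⋆ clear fs

 clear-tl : ∀ {n}(fs : Vec Frac n) -> clearL n(tl fs)≡ tl(clear fs)
 clear-tl [] = refl
 clear-tl {suc n}((c , d)∷ fs) = cong₂ _∷_ (cong(c *_)(dens fs))(go(unitRows n)== cong(List.map(d *_))(clear-tl fs)== tl-map(d *_)(clear fs)) where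
  dens : ∀ {n}(fs : Vec Frac n) -> prodℤ(zipWith pickL(falses n)(tl fs))≡ denoms fs
  dens [] = refl
  dens((c , d)∷ fs) = cong(d *_)(dens fs)
  go : ∀ rs -> List.map (λ us -> prodℤ(zipWith pickL us((c , d)∷ tl fs)))(List.map(false ∷_)rs)≡ List.map(d *_)(List.map (λ us -> prodℤ(zipWith pickL us(tl fs)))rs)
  go [] = refl
  go(r ∷ rs) = cong(_ ∷_)(go rs)

 tl-zipWith : ∀ {A B C : Set}(f : A -> B -> C){n}(u : Vec A n)(v : Vec B n) -> zipWith f(tl u)(tl v)≡ tl(Vec.zipWith f u v)
 tl-zipWith f [] [] = refl
 tl-zipWith f(a ∷ u)(b ∷ v) = cong(f a b ∷_)(tl-zipWith f u v)

 double : ∀ {n} -> ℤ -> Vec ℤ n -> Vec ℤ n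
 double E A = if (+ 4 *(A · A))≤?b(E * E) then + 2 ⋆ A else A

 double-tl : ∀ {n}E (A : Vec ℤ n) -> doubleL E(tl A)≡ tl(double E A)
 double-tl E A = cong₂ (λ a A2 -> if (+ 4 * a)≤?b(E * E) then A2 else tl A)(tl-dot A A)(tl-map(+ 2 *_)A)== push((+ 4 *(A · A))≤?b(E * E)) where
  push : ∀ b ->(if b then tl(+ 2 ⋆ A) else tl A)≡ tl(if b then + 2 ⋆ A else A)
  push true = refl
  push false = refl

 ⋆-⋆ : ∀ {n}c d (u : Vec ℤ n) -> c ⋆ d ⋆ u ≡(c * d) ⋆ u
 ⋆-⋆ c d [] = refl
 ⋆-⋆ c d(a ∷ u) = cong₂ _∷_ (sym(*-assoc c d a))(⋆-⋆ c d u)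

 ⋆-one : ∀ {n}(u : Vec ℤ n) -> 1ℤ ⋆ u ≡ u
 ⋆-one [] = refl
 ⋆-one(a ∷ u) = cong₂ _∷_ (*-identityˡ a)(⋆-one u)

 ·-square : ∀ {n}c (u : Vec ℤ n) ->(c ⋆ u)·(c ⋆ u)≡ c * c *(u · u)
 ·-square c u = ·-scaleˡ c u(c ⋆ u)== cong(c *_)(·-scaleʳ c u u)== sym(*-assoc c c(u · u))

 module Doubling {n}(E : ℤ)(A : Vec ℤ n)(A≤E : A · A ≤ E * E) where

  record Doubled (k : ℕ)(B : Vec ℤ n) : Set where
   field
    f : ℕ
    B≡ : B ≡((+ 2) ^ f) ⋆ A
    B≤E : B · B ≤ E * E
    large : E * E < + 4 *(B · B) ⊎ ((+ 4) ^ k)*(A · A)≤ B · B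

  open Doubled

  double-step : ∀ {k B}b ->((+ 4 *(B · B))≤?b(E * E))≡ b -> Doubled k B -> Doubled(suc k)(if b then + 2 ⋆ B else B)
  double-step {k}{B}true h d = record
   { f = suc(f d) ; B≡ = cong(+ 2 ⋆_)(B≡ d)==(⋆-⋆ (+ 2)((+ 2) ^ f d)A)
   ; B≤E = ·-square(+ 2)B =< ≤?b-true(+ 4 *(B · B))(E * E)h
   ; large = go(large d) } where
   go : E * E < + 4 *(B · B) ⊎ ((+ 4) ^ k)*(A · A)≤ B · B -> E * E < + 4 *((+ 2 ⋆ B)·(+ 2 ⋆ B)) ⊎ ((+ 4) ^ suc k)*(A · A)≤(+ 2 ⋆ B)·(+ 2 ⋆ B)
   go(inj₁ lt) = inj₁(<-≤-trans lt(≤-diff(+ 12 *(B · B))(0≤*(0≤pos 12)(·-self≥0 B))(e(B · B))<= cong(+ 4 *_)(sym(·-square(+ 2)B)))) where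
    e : ∀ b -> + 4 * b + + 12 * b ≡ + 4 *(+ 4 * b)
    e = ring
   go(inj₂ le) = inj₂(*-assoc(+ 4)((+ 4) ^ k)(A · A)=< *-monoˡ(0≤pos 4)le <= sym(·-square(+ 2)B))
  double-step {k}{B}false h d = record
   { f = f d ; B≡ = B≡ d ; B≤E = B≤E d ; large = inj₁(≤?b-false(+ 4 *(B · B))(E * E)h) }

  doubled : ∀ k -> Doubled k(iter(double E)k A)
  doubled zero = record { f = 0 ; B≡ = sym(⋆-one A) ; B≤E = A≤E ; large = inj₂(≤-reflexive(*-identityˡ(A · A))) }
  doubled(suc k) = double-step _ refl(doubled k)

 4^≡2^*2^ : ∀ k ->(+ 4) ^ k ≡(+ 2) ^ k *(+ 2) ^ k
 4^≡2^*2^ zero = refl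
 4^≡2^*2^(suc k) = cong(+ 4 *_)(4^≡2^*2^ k)== e((+ 2) ^ k) where
  e : ∀ a -> + 4 *(a * a)≡ + 2 * a *(+ 2 * a)
  e = ring

 record Normalised {n}(E : ℤ)(A B : Vec ℤ n) : Set where
  field
   f : ℕ
   B≡ : B ≡((+ 2) ^ f) ⋆ A
   B≤E : B · B ≤ E * E
   large : 1ℤ ≤ A · A -> E * E < + 4 *(B · B)

 normal-ok : ∀ {n}e (A : Vec ℤ n) -> A · A ≤(+ 2) ^ e *(+ 2) ^ e -> Normalised((+ 2) ^ e)A(iter(double((+ 2) ^ e))e A)
 normal-ok e A A≤E = record { f = f ; B≡ = B≡ ; B≤E = B≤E ; large = λ 1≤A -> go 1≤A large } where
  E =(+ 2) ^ e
  B = iter(double E)e A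
  open Doubling E A A≤E
  open Doubled (doubled e)
  go : 1ℤ ≤ A · A -> E * E < + 4 *(B · B) ⊎ ((+ 4) ^ e)*(A · A)≤ B · B -> E * E < + 4 *(B · B)
  go 1≤A(inj₁ lt) = lt
  go 1≤A(inj₂ le) = <-≤-trans(≤-<-trans EE≤B(≤-<-trans(≤-reflexive(sym(+-identityʳ(B · B))))(+-monoʳ-<(B · B)(0<*(0<pos 2)0<B))))(≤-reflexive(e1(B · B))) where
   EE≤B =(sym(4^≡2^*2^ e)== sym(*-identityʳ _)=< *-monoˡ(0≤^ e(0≤pos 4))1≤A)<< le
   0<B = <-≤-trans(+<+ (N.s≤s N.z≤n))(*-mono {1ℤ}{E}{1ℤ}{E}(0≤^ e(0≤pos 2))(0≤pos 1)(1≤^ e(+≤+ (N.s≤s N.z≤n)))(1≤^ e(+≤+ (N.s≤s N.z≤n)))<< EE≤B)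
   e1 : ∀ b -> b + + 3 * b ≡ + 4 * b
   e1 = ring

 normal-tl : ∀ {K n e budget}(fs : Vec Frac n) -> clear fs · clear fs ≤(+ 2) ^ e *(+ 2) ^ e -> Fits K((+ 2) ^ e) -> vecSize K n N.≤ sz 𝕌 budget ->
  normalL(n , e , budget)(tl fs)≡ tl(iter(double((+ 2) ^ e))e(clear fs))
 normal-tl {K}{n}{e}{budget}fs A≤E fits enough = cong(iterC(𝕃 ℤt)(sz 𝕌 budget)(doubleL E)e)(clear-tl fs)==
  proj₁(iterC-sim(𝕃 ℤt){sz 𝕌 budget}(doubleL E)tl(double E)(λ B -> Σ[ k ∈ ℕ ] Doubled k B)
   (λ B(k , d) -> double-tl E B , suc k , double-step _ refl d)(λ B(k , d) -> size-vec {K}{E}B(0≤^ e(0≤pos 2))fits(Doubled.B≤E d)ℕ<< enough)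
   (clear fs)e(0 , doubled 0)) where
  E =(+ 2) ^ e
  open Doubling E (clear fs) A≤E

 level-lower : ∀ n p q -> 0ℤ ≤ p -> + 256 * + levelL n(p , q)* q ≤ p
 level-lower zero p q 0≤p = *-zeroˡ q =< 0≤p
 level-lower(suc n)p q 0≤p = go(levelL n(p , q))_ refl(level-lower n p q 0≤p) where
  go : ∀ s b ->((+ 256 * + suc s * q)≤?b p)≡ b -> + 256 * + s * q ≤ p -> + 256 * +(if b then suc s else s)* q ≤ p
  go s true h _ = ≤?b-true(+ 256 * + suc s * q)p h
  go s false h le = le

 level-upper : ∀ n p q -> 0ℤ ≤ q -> levelL n(p , q) N.< n -> p < + 256 * + suc(levelL n(p , q))* q
 level-upper zero p q 0≤q()
 level-upper(suc n)p q 0≤q = go(levelL n(p , q))_ refl(level-upper n p q 0≤q)(level≤ n(p , q)) where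
  go : ∀ s b ->((+ 256 * + suc s * q)≤?b p)≡ b ->(s N.< n -> p < + 256 * + suc s * q) -> s N.≤ n ->
   (if b then suc s else s) N.< suc n -> p < + 256 * + suc(if b then suc s else s)* q
  go s true h up s≤n(N.s≤s lt) = <-≤-trans(up lt)(*-monoʳ {q}{+ 256 * + suc s}{+ 256 * + suc(suc s)}0≤q(*-monoˡ(0≤pos 256)(+≤+ (N.n≤1+n(suc s)))))
  go s false h up s≤n _ = ≤?b-false(+ 256 * + suc s * q)p h

 weight-levels : ∀ n k -> k N.≤ n -> weightOf n k *(+ 2) ^ levels k ≡ unitWeight n
 weight-levels n k k≤n = sym(^-distribˡ-+-*(+ 2)(2 N.* ((n N.∸ k) N.* suc(suc(n N.+ k))))(levels k))== cong((+ 2) ^_)(subst (λ z -> 2 N.* ((n N.∸ k) N.* suc(suc(z N.+ k))) N.+ levels k ≡ 2 N.* (suc z N.* suc z))(N.m∸n+n≡m k≤n)(eq(n N.∸ k)k)) where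
  eq : ∀ f k -> 2 N.* (f N.* suc(suc(f N.+ k N.+ k))) N.+ 2 N.* (suc k N.* suc k)≡ 2 N.* (suc(f N.+ k) N.* suc(f N.+ k))
  eq = N.solve-∀

 rowV : ∀ n e (margins as : Vec Frac n) -> Frac -> Row n
 rowV n e ms as l = row(+ levelL n l)(weightOf n(levelL n l))(iter(double((+ 2) ^ e))e(clear(Vec.zipWith mulL as ms)))

 opposite : ∀ {n} -> Row n -> Row n
 opposite r = row(s r)(V r)(-1ℤ ⋆ A r)

 start-row : ∀ n e ms as l -> clear(Vec.zipWith mulL as ms)· clear(Vec.zipWith mulL as ms)≤(+ 2) ^ e *(+ 2) ^ e ->
  StartRow((+ 2) ^ e)(unitWeight n)(rowV n e ms as l)
 start-row n e ms as l A≤E = record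
  { k = levelL n l ; k≤n = level≤ n l ; s≡k = refl ; A≤E = Normalised.B≤E(normal-ok e(clear(Vec.zipWith mulL as ms))A≤E)
  ; 0<V = 0<^(2 N.* ((n N.∸ levelL n l) N.* suc(suc(n N.+ levelL n l))))(0<pos 1) ; V≡ = weight-levels n(levelL n l)(level≤ n l) }

 start-opposite : ∀ {n E q0}{r : Row n} -> StartRow E q0 r -> StartRow E q0(opposite r)
 start-opposite {r = r}h = record { k = k ; k≤n = k≤n ; s≡k = s≡k ; A≤E = ·-square -1ℤ(A r)== *-identityˡ _ =< A≤E ; 0<V = 0<V ; V≡ = V≡ }
  where open StartRow h

 opposite-tl : ∀ {n}(r : Row n) -> oppositeL(rowL r)≡ rowL(opposite r)
 opposite-tl r = cong (λ A -> s r , V r , A)(tl-map(-1ℤ *_)(A r))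

 candidates-tl : ∀ n -> candidatesL n ≡ List.map candL(List.map(1ℤ ,_)(units n)List.++ List.map(-1ℤ ,_)(units n))
 candidates-tl n = cong (λ es -> List.map(1ℤ ,_)es ++ List.map(-1ℤ ,_)es)(unitRows-tl n)== sym(List.map-++ candL(List.map(1ℤ ,_)(units n))_ ==(cong₂ _++_ (push 1ℤ(units n))(push -1ℤ(units n)))) where
  num : Bool -> ℤ
  num b = if b then 1ℤ else 0ℤ
  push : ∀ σ (es : List(Vec ℤ n)) -> List.map candL(List.map(σ ,_)es)≡ List.map(σ ,_)(List.map tl es)
  push σ [] = refl
  push σ(e ∷ es) = cong(_ ∷_)(push σ es)
  zeros≡ : ∀ n -> List.map num(falses n)≡ tl(zeros {n})
  zeros≡ zero = refl
  zeros≡(suc n) = cong(0ℤ ∷_)(zeros≡ n)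
  shift : ∀ {n}(rs : List(List Bool))(es : List(Vec ℤ n)) -> List.map(List.map num)rs ≡ List.map tl es ->
   List.map(List.map num)(List.map(false ∷_)rs)≡ List.map tl(List.map(0ℤ ∷_)es)
  shift [] [] _ = refl
  shift(r ∷ rs)(e ∷ es)h = cong₂ _∷_ (cong(0ℤ ∷_)(List.∷-injectiveˡ h))(shift rs es(List.∷-injectiveʳ h))
  unitRows-tl : ∀ n -> List.map(List.map num)(unitRows n)≡ List.map tl(units n)
  unitRows-tl zero = refl
  unitRows-tl(suc n) = cong₂ _∷_ (cong(1ℤ ∷_)(zeros≡ n))(shift(unitRows n)(units n)(unitRows-tl n))

module Bits where

 open import Data.Integer.Base using (+_; ∣_∣)
 import Data.Integer.Tactic.RingSolver as Z
 open import Data.List.Base using (zip)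
 open import Data.List.Relation.Unary.All as All using ([]; _∷_)
 import Data.List.Relation.Unary.All.Properties as All
 open import Data.Nat.Base hiding (_^_)
 open import Data.Nat.Properties
 open import Data.Nat.Tactic.RingSolver using () renaming (solve-∀ to ring)
 open Typed
 open Arithmetic
 open Walks using (_·_; *-mono; ≤-diff; sq≥0; 0≤-sub; ·-self≥0)
 open Walks using (abs-square)
 open WalkProgram
 open WalkSimulation
 open Program
 open Decoding
 open Rows
 open Chainℕ
 open Chainℤ using () renaming (_=<_ to _ℤ=<_; _<=_ to _ℤ<=_)

 Bits : ℕ -> ℤ -> Set
 Bits k z = ∣ z ∣ ≤ 2 N.^ k

 bits-mono : ∀ {j k}z -> j ≤ k -> Bits j z -> Bits k z
 bits-mono z h b = b << ^-monoʳ-≤ 2 h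

 bits-* : ∀ {j k}x z -> Bits j x -> Bits k z -> Bits(j + k)(x Z.* z)
 bits-* {j}{k}x z hx hz = Z.abs-* x z =< *-mono-≤ hx hz <= sym(^-distribˡ-+-* 2 j k)

 bits-^ : ∀ {j}x k -> Bits j x -> Bits(k * j)(x Z.^ k)
 bits-^ x zero h = ≤-refl
 bits-^ {j}x(suc k)h = bits-* {j}{k * j}x(x Z.^ k)h(bits-^ x k h)

 bits-2^ : ∀ k -> Bits k((+ 2) Z.^ k)
 bits-2^ k = bits-^ {1}(+ 2)k ≤-refl <= cong(2 N.^_)(*-identityʳ k)

 n≤2^n : ∀ n -> n ≤ 2 N.^ n
 n≤2^n n = <⇒≤ (n<2^n n)

 bits-ℕ : ∀ n -> Bits n(+ n)
 bits-ℕ = n≤2^n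

 fits : ∀ {j k}z -> j < k -> Bits j z -> Fits k z
 fits {j}z h b = ≤-<-trans b(^-monoʳ-< 2(s≤s(s≤s z≤n))h)

 pos-^ : ∀ a k -> +(a N.^ k)≡(+ a) Z.^ k
 pos-^ a zero = refl
 pos-^ a(suc k) = Z.pos-* a(a N.^ k)== cong(+ a Z.*_)(pos-^ a k)

 module Powers (L : ℕ)(64≤L : 64 ≤ L) where

  P : ℕ -> ℕ
  P k = power k L

  P≡ : ∀ k -> P k ≡ L N.^ k
  P≡ k = power≡ k L

  1≤L : 1 ≤ L
  1≤L = s≤s z≤n << 64≤L

  *-P : ∀ {x y}i j -> x ≤ P i -> y ≤ P j -> x * y ≤ P(i + j)
  *-P i j hx hy = *-mono-≤ hx hy <=(cong₂ _*_ (P≡ i)(P≡ j))== sym(^-distribˡ-+-* L i j)== sym(P≡(i + j))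

  P-mono : ∀ {x i}j -> i ≤ j -> x ≤ P i -> x ≤ P j
  P-mono {x}{i}j h hx = hx << P≡ i =< ^-monoʳ-≤ L {{>-nonZero 1≤L}}h <= sym(P≡ j)

  P-L : ∀ {x} -> x ≤ L -> x ≤ P 1
  P-L h = h <= sym(*-identityʳ L)== sym(P≡ 1)

  P-const : ∀ {x} -> x ≤ 64 -> x ≤ P 1
  P-const h = P-L(h << 64≤L)

  +-P : ∀ {x y}k -> x ≤ P k -> y ≤ P k -> x + y ≤ P(suc k)
  +-P {x}{y}k hx hy = +-mono-≤ hx hy << cong (λ z -> P k + z)(sym(+-identityʳ(P k)))=< *-P {2}{P k}1 k(P-const(s≤s(s≤s z≤n)))≤-refl

  P-^ : ∀ {x}k -> x ≤ L -> x N.^ k ≤ P k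
  P-^ k h = ^-monoˡ-≤ k h <= sym(P≡ k)

  P-suc : ∀ {x}k -> 0 < k -> x ≤ P k -> suc x ≤ P(suc k)
  P-suc {x}k 0<k h = +-P {1}{x}k(P-mono k 0<k(P-const(s≤s z≤n)))h

  P-< : ∀ k -> P k < P(suc k)
  P-< k = <-≤-trans(m<n+m(P k){P k}(m^n>0 L {{>-nonZero 1≤L}}k <= sym(P≡ k)))(+-P k ≤-refl ≤-refl)

 clear-norm : ∀ {n F} -> 0ℤ Z.≤ F ->(fs : Vec Frac n) ->(∀ i -> let (c , d) = Vec.lookup fs i in c Z.* c Z.≤ F × d Z.* d Z.≤ F) ->
  denoms fs Z.* denoms fs Z.≤ F Z.^ n × clear fs · clear fs Z.≤ + n Z.* F Z.^ n
 clear-norm 0≤F [] h = Z.≤-refl , Z.≤-refl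
 clear-norm {suc n}{F}0≤F((c , d)∷ fs)h =(sq-* d D ℤ=< *-mono 0≤F(sq≥0 D)(proj₂(h Fin.zero))(proj₁ IH)), Z.+-mono-≤(sq-* c D ℤ=< *-mono 0≤F(sq≥0 D)(proj₁(h Fin.zero))(proj₁ IH))(·-square d(clear fs)ℤ=<(*-mono 0≤F(·-self≥0(clear fs))(proj₂(h Fin.zero))(proj₂ IH)))ℤ<=
  e3(+ n)F(F Z.^ n)== cong(Z._* (F Z.* F Z.^ n))(sym(Z.pos-+ 1 n)) where
  IH = clear-norm 0≤F fs(h ∘ Fin.suc)
  D = denoms fs
  sq-* : ∀ a b ->(a Z.* b) Z.* (a Z.* b)≡(a Z.* a) Z.* (b Z.* b)
  sq-* = Z.solve-∀
  e3 : ∀ n F G -> F Z.* G Z.+ F Z.* (n Z.* G)≡(1ℤ Z.+ n) Z.* (F Z.* G)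
  e3 = Z.solve-∀

 tl-tabulate : ∀ {A : Set}{n}(f : Fin n -> A) -> List.tabulate f ≡ tl(Vec.tabulate f)
 tl-tabulate {n = zero}f = refl
 tl-tabulate {n = suc n}f = cong(f Fin.zero ∷_)(tl-tabulate(f ∘ Fin.suc))

 zip-tabulate : ∀ {A B : Set}{n}(f : Fin n -> A)(g : Fin n -> B) -> zip(List.tabulate f)(List.tabulate g)≡ List.tabulate (λ j -> f j , g j)
 zip-tabulate {n = zero}f g = refl
 zip-tabulate {n = suc n}f g = cong(_ ∷_)(zip-tabulate(f ∘ Fin.suc)(g ∘ Fin.suc))

 unit-interval : ∀ y -> 0ℚ Q.≤ y -> y Q.≤ 1ℚ -> 0ℤ Z.≤ ↥ y × ↥ y Z.≤ ↧ y
 unit-interval y 0≤y y≤1 = Q.drop-*≤* 0≤y ℤ<= Z.*-identityʳ(↥ y),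
  sym(Z.*-identityʳ(↥ y))ℤ=< Q.drop-*≤* y≤1 ℤ<= Z.*-identityˡ(↧ y)

 margin-bounds : ∀ p q -> 0ℤ Z.≤ p -> p Z.≤ q -> 0ℤ Z.≤ proj₁(marginL(p , q))× proj₁(marginL(p , q)) Z.≤ q
 margin-bounds p q 0≤p p≤q = go(isLow(p , q)) where
  e : ∀ p q -> q Z.- p Z.+ p ≡ q
  e = Z.solve-∀
  go : ∀ b -> 0ℤ Z.≤ (if b then p else q Z.- p)× (if b then p else q Z.- p) Z.≤ q
  go true = 0≤p , p≤q
  go false = 0≤-sub p≤q , ≤-diff p 0≤p(e p q)

 square-bits : ∀ {k}z -> Bits k z -> z Z.* z Z.≤ (+ 2) Z.^ (k + k)
 square-bits {k}z h = sym(abs-square z)ℤ=< sym(Z.pos-* ∣ z ∣ ∣ z ∣)ℤ=<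
  (Z.+≤+ (*-mono-≤ h h))ℤ<=(cong +_ (sym(^-distribˡ-+-* 2 k k)))== pos-^ 2(k + k)

module Rounding where

 open import Data.Integer.Base hiding (suc)
 open import Data.Integer.Properties
 open import Data.Integer.Tactic.RingSolver using () renaming (solve-∀ to ring)
 open import Data.Nat.Coprimality using (Coprime; coprime-divisor)
 open import Data.Nat.Divisibility using (_∣_; ∣-trans; ∣m+n∣m⇒∣n; ∣1⇒≡1; n∣m*n)
 import Data.Nat.Tactic.RingSolver as N
 open import Data.Rational.Base using (mkℚ)
 open import Defs using (encodeℚ)
 open Typed
 open Arithmetic using (1≤2^; bits-length; size-ℕ≤; ℕt)
 open Arithmetic
 open Walks
 open WalkProgram
 open WalkSimulation using (Fits; size-fits; fits-nonneg)
 open Program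
 open Decoding using (ℕ-letters)
 open Bits using (pos-^; margin-bounds)
 open Chainℕ using () renaming (_<<_ to _ℕ<<_; _=<_ to _ℕ=<_; _<=_ to _ℕ<=_)
 open Chainℤ

 coprime-2 : ∀ k -> Coprime(suc(k N.+ k))2
 coprime-2 k {d}(d∣o , d∣2) = ∣1⇒≡1(∣m+n∣m⇒∣n(subst(d ∣_)(cong suc(e k)== N.+-comm 1(k N.* 2))d∣o)(∣-trans d∣2(n∣m*n k))) where
  e : ∀ k -> k N.+ k ≡ k N.* 2
  e = N.solve-∀

 coprime-2^ : ∀ k j -> Coprime(suc(k N.+ k))(2 N.^ j)
 coprime-2^ k zero(_ , d∣1) = ∣1⇒≡1 d∣1
 coprime-2^ k(suc j)(d∣o , d∣2^) = coprime-2^ k j(d∣o , coprime-divisor(λ (e∣d , e∣2) -> coprime-2 k(∣-trans e∣d d∣o , e∣2))d∣2^)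

 suc-pred-2^ : ∀ j -> suc(N.pred(2 N.^ j))≡ 2 N.^ j
 suc-pred-2^ j = N.suc-pred(2 N.^ j){{N.>-nonZero(1≤2^ j)}}

 -- (2k + 1) / 2ⁿ⁺¹
 dyadic : ℕ -> ℕ -> ℚ
 dyadic n k = mkℚ(+ suc(k N.+ k))(N.pred(2 N.^ suc n))(subst(Coprime(suc(k N.+ k)))(sym(suc-pred-2^(suc n)))(coprime-2^ k(suc n)))

 ↧-dyadic : ∀ n k -> ↧ₙ(dyadic n k)≡ 2 N.^ suc n
 ↧-dyadic n k = suc-pred-2^(suc n)

 dyadic-letters : ∀ n k -> encodeℚ(dyadic n k)≡ dyadicLetters n k
 dyadic-letters n k = cong₂ (λ u v -> _ ∷(u ++ v))(ℕ-letters(suc(k N.+ k))(N.s≤s N.z≤n))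
  (ℕ-letters(↧ₙ(dyadic n k))(N.s≤s N.z≤n)== cong natLetters(↧-dyadic n k ==(cong ∣_∣ (pos-^ 2(suc n)))))

 record Division (d r0 : ℤ)(j : ℕ)(s : ℤ × ℕ) : Set where
  field
   0≤r : 0ℤ ≤ proj₁ s
   r≤d : proj₁ s ≤ d
   k<2^j : proj₂ s N.< 2 N.^ j
   exact :(+ 2) ^ j * r0 ≡ + proj₂ s * d + proj₁ s

 divide-step : ∀ {d r0 j s} -> Division d r0 j s -> Division d r0(suc j)(divideL d s)
 divide-step {d}{r0}{j}{r , k}h = go _ refl where
  open Division h
  e1 : ∀ r d k -> + 2 *(k * d + r)≡(1ℤ +(k + k))* d +(r + r - d)
  e1 = ring
  e2 : ∀ r d k -> + 2 *(k * d + r)≡(k + k)* d +(r + r)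
  e2 = ring
  e3 : ∀ r d -> r + r - d +(d - r)≡ r
  e3 = ring
  double< = N.<-trans(N.n<1+n _)lt , lt where
   lt = cong suc(sym(N.+-suc k k))ℕ=< N.+-mono-≤ k<2^j k<2^j ℕ<= cong(2 N.^ j N.+_)(sym(N.+-identityʳ _))
  go : ∀ b ->(d ≤?b(r + r))≡ b -> Division d r0(suc j)(if b then ((r + r) - d , 1 N.+ (k N.+ k)) else (r + r , k N.+ k))
  go true eq = record
   { 0≤r = 0≤-sub(≤?b-true d(r + r)eq) ; r≤d = ≤-diff(d - r)(0≤-sub r≤d)(e3 r d)<< r≤d ; k<2^j = proj₂ double<
   ; exact = *-assoc(+ 2)((+ 2) ^ j)r0 == cong(+ 2 *_)exact == e1 r d(+ k)== cong (λ z -> z * d +(r + r - d))(cong (λ z -> 1ℤ + z)(sym(pos-+ k k))== sym(pos-+ 1(k N.+ k))) }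
  go false eq = record
   { 0≤r = 0≤+ 0≤r 0≤r ; r≤d = <⇒≤ (≤?b-false d(r + r)eq) ; k<2^j = proj₁ double<
   ; exact = *-assoc(+ 2)((+ 2) ^ j)r0 == cong(+ 2 *_)exact == e2 r d(+ k)== cong (λ z -> z * d +(r + r))(sym(pos-+ k k)) }

 division : ∀ {d r0} -> 0ℤ ≤ r0 -> r0 ≤ d -> ∀ j -> Division d r0 j(iter(divideL d)j(r0 , 0))
 division {d}{r0}0≤r r≤d zero = record { 0≤r = 0≤r ; r≤d = r≤d ; k<2^j = N.s≤s N.z≤n ; exact = e r0 d } where
  e : ∀ r d -> 1ℤ * r ≡ 0ℤ * d + r
  e = ring
 division 0≤r r≤d(suc j) = divide-step(division 0≤r r≤d j)

 quotient-spec : ∀ {K budget n d r0} -> 0ℤ ≤ r0 -> r0 ≤ d -> Fits K d -> suc((5 N.+ 4 N.* K) N.+ suc(4 N.* n)) N.≤ sz 𝕌 budget ->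
  quotientL budget n d r0 ≡ proj₂(iter(divideL d)n(r0 , 0))
 quotient-spec {K}{budget}{n}{d}{r0}0≤r r≤d fits enough = cong proj₂(iterC-unclip(ℤt ⊠ ℕt)(r0 , 0)n (λ j j<n -> size j j<n(division 0≤r r≤d(suc j))ℕ<< enough)) where
  size : ∀ j -> j N.< n -> ∀ {s} -> Division d r0(suc j)s -> sz(ℤt ⊠ ℕt)s N.≤ suc((5 N.+ 4 N.* K) N.+ suc(4 N.* n))
  size j j<n {r , k}h = N.s≤s(N.+-mono-≤(size-fits {K}r(fits-nonneg {K}{d}r(Division.0≤r h)(Division.r≤d h)fits))
   (size-ℕ≤ k ℕ<< N.s≤s(N.*-monoʳ-≤ 4(bits-length(suc j)k(Division.k<2^j h)ℕ<< j<n))))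

 n⁴≤2^ : ∀ n -> 16 N.≤ n -> n N.^ 4 N.≤ 2 N.^ n
 n⁴≤2^ n 16≤n = subst (λ z -> z N.^ 4 N.≤ 2 N.^ z)(N.m+[n∸m]≡n 16≤n)(go(n N.∸ 16)) where
  e : ∀ m n -> m N.* n N.* (m N.* n N.* (m N.* n N.* (m N.* n N.* 1)))≡ m N.* (m N.* (m N.* (m N.* 1))) N.* (n N.* (n N.* (n N.* (n N.* 1))))
  e = N.solve-∀
  fourth : ∀ m n ->(m N.* n) N.^ 4 ≡ m N.^ 4 N.* n N.^ 4
  fourth m n = e m n
  cancel : ∀ c d {x y} .{{_ : N.NonZero c}} -> d N.≤ c N.* 2 -> c N.* y N.≤ d N.* x -> y N.≤ 2 N.* x
  cancel c d {x}h le = N.*-cancelˡ-≤ c(le ℕ<< N.*-monoˡ-≤ x h ℕ<= N.*-assoc c 2 x)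
  -- (1 + 1/n)⁴ ≤ (17/16)⁴ ≤ 2
  step : ∀ n -> 16 N.≤ n ->(suc n) N.^ 4 N.≤ 2 N.* n N.^ 4
  step n h = cancel(16 N.^ 4)(17 N.^ 4){n N.^ 4}{suc n N.^ 4}(N.≤ᵇ⇒≤(17 N.^ 4)(16 N.^ 4 N.* 2)_)
   (sym(fourth 16(suc n))ℕ=< N.^-monoˡ-≤ 4(N.*-suc 16 n ℕ=< N.+-monoˡ-≤(16 N.* n)h)ℕ<= fourth 17 n)
  go : ∀ o ->(16 N.+ o) N.^ 4 N.≤ 2 N.^ (16 N.+ o)
  go zero = N.≤ᵇ⇒≤(16 N.^ 4)(2 N.^ 16)_
  go(suc o) = subst (λ z -> z N.^ 4 N.≤ 2 N.^ z)(sym(N.+-suc 16 o))(step(16 N.+ o)(N.m≤m+n 16 o)ℕ<< N.*-monoʳ-≤ 2(go o))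

 module Coordinate (P : Car paramst)(n : ℕ)(16≤n : 16 N.≤ n)(0<N : 0ℤ < Params.N P)(X≡ : Params.X P ≡ (+ n) ^ 4 * Params.N P) where

  open Params P using (N; X; budget)

  0<X : 0ℤ < X
  0<X = <-≤-trans(0<*(0<^ 4(+<+ (N.s≤s N.z≤n ℕ<< 16≤n)))0<N)(≤-reflexive(sym X≡))

  N≤X : N ≤ X
  N≤X = sym(*-identityˡ N)=< *-monoʳ {N}{1ℤ}{(+ n) ^ 4}(<⇒≤ 0<N)(1≤^ 4(+≤+ (N.s≤s N.z≤n ℕ<< 16≤n)))<= sym X≡

  numer : ℤ × ℤ -> ℤ -> ℤ
  numer(p , q)x = p * X + proj₁(marginL(p , q))* x

  roundℚ : ℤ × ℤ -> ℤ -> ℚ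
  roundℚ(p , q)x = if isGood P(p , q)x then (if isLow(p , q) then 0ℚ else 1ℚ) else dyadic n(quotientL budget n(q * X)(numer(p , q)x))

  round-letters : ∀ r x -> roundL P n r x ≡ encodeℚ(roundℚ r x)
  round-letters(p , q)x = go(isGood P(p , q)x)(isLow(p , q)) where
   k = quotientL budget n(q * X)(numer(p , q)x)
   go : ∀ g l ->(if g then (if l then encodeℚ 0ℚ else encodeℚ 1ℚ) else dyadicLetters n k)≡ encodeℚ(if g then (if l then 0ℚ else 1ℚ) else dyadic n k)
   go true true = refl
   go true false = refl
   go false l = sym(dyadic-letters n k)

  record Rounds (p q x : ℤ)(y' : ℚ) : Set where
   field
    0≤↥ : 0ℤ ≤ ↥ y'
    ↥≤↧ : ↥ y' ≤ ↧ y'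
    close : + ∣ ↥ y' *(q * X) - ↧ y' * numer(p , q)x ∣ *(+ n) ^ 4 ≤ ↧ y' *(q * X)

  -- A frozen coordinate is rounded to the integer towards which it moved, whose distance is at most N / X = 1 / n⁴.
  frozen-close : ∀ {q z} -> 0ℤ ≤ q -> 0ℤ ≤ z -> z ≤ q * N -> z *(+ n) ^ 4 ≤ q * X
  frozen-close {q}{z}0≤q 0≤z h = *-monoʳ(0≤^ 4(0≤pos n))h <= e q N((+ n) ^ 4)== cong(q *_)(sym X≡) where
   e : ∀ q N m -> q * N * m ≡ q *(m * N)
   e = ring

  module _ {p q x : ℤ}(0≤p : 0ℤ ≤ p)(p≤q : p ≤ q)(x≤X : + ∣ x ∣ ≤ X) where

   c = proj₁(marginL(p , q))
   0≤c = proj₁(margin-bounds p q 0≤p p≤q)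
   0≤q = 0≤p << p≤q

   -X≤x : 0ℤ ≤ X + x
   -X≤x = ≤-diff(X - + ∣ x ∣ +(+ ∣ x ∣ - - x))(0≤+(0≤-sub x≤X)(0≤-sub(neg≤-abs x)))(e X x(+ ∣ x ∣)) where
    e : ∀ X x a -> 0ℤ +(X - a +(a - - x))≡ X + x
    e = ring

   x≤X' : 0ℤ ≤ X - x
   x≤X' = 0≤-sub(≤-abs x << x≤X)

   low-good : isLow(p , q)≡ true -> isNeg x ≡ true -> X < + ∣ x ∣ + N -> Rounds p q x 0ℚ
   low-good lo neg fr = record { 0≤↥ = ≤-refl ; ↥≤↧ = 0≤pos 1 ; close = *-monoʳ(0≤^ 4(0≤pos n))(≤-reflexive abs≡)<< frozen-close {q}{p *(X + x)}0≤q(0≤* 0≤p -X≤x)small <= sym(*-identityˡ(q * X)) } where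
    ∣x∣≡ = neg-abs x neg where
     neg-abs : ∀ x -> isNeg x ≡ true -> + ∣ x ∣ ≡ - x
     neg-abs -[1+ x ] _ = refl
    e : ∀ p X x q -> 0ℤ *(q * X) - 1ℤ *(p * X + p * x)≡ -(p *(X + x))
    e = ring
    abs≡ = cong (λ z -> + ∣ z ∣)(cong (λ c -> 0ℤ *(q * X) - 1ℤ *(p * X + c * x))(cong (λ b -> if b then p else q - p)lo)== e p X x q)==(cong +_ (∣-i∣≡∣i∣(p *(X + x))))== 0≤i⇒+∣i∣≡i(0≤* 0≤p -X≤x)
    e' : ∀ X x N -> X + x +(- x + N - X)≡ N
    e' = ring
    small = *-mono 0≤q -X≤x p≤q(≤-diff(- x + N - X)(0≤-sub(<⇒≤ (<-≤-trans fr(≤-reflexive(cong(_+ N)∣x∣≡)))))(e' X x N))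

   high-good : isLow(p , q)≡ false -> isNeg x ≡ false -> X < + ∣ x ∣ + N -> Rounds p q x 1ℚ
   high-good hi pos fr = record { 0≤↥ = 0≤pos 1 ; ↥≤↧ = ≤-refl ; close = *-monoʳ(0≤^ 4(0≤pos n))(≤-reflexive abs≡)<< frozen-close {q}{(q - p)*(X - x)}0≤q(0≤*(0≤-sub p≤q)x≤X')small <= sym(*-identityˡ(q * X)) } where
    ∣x∣≡ = pos-abs x pos where
     pos-abs : ∀ x -> isNeg x ≡ false -> + ∣ x ∣ ≡ x
     pos-abs(+ x)_ = refl
    e : ∀ p q X x -> 1ℤ *(q * X) - 1ℤ *(p * X +(q - p)* x)≡(q - p)*(X - x)
    e = ring
    abs≡ = cong (λ z -> + ∣ z ∣)(cong (λ c -> 1ℤ *(q * X) - 1ℤ *(p * X + c * x))(cong (λ b -> if b then p else q - p)hi)== e p q X x)== 0≤i⇒+∣i∣≡i(0≤*(0≤-sub p≤q)x≤X')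
    e' : ∀ X x N -> X - x +(x + N - X)≡ N
    e' = ring
    e'' : ∀ q p -> q - p + p ≡ q
    e'' = ring
    small = *-mono {q - p}{q}{X - x}{N}0≤q x≤X'(≤-diff p 0≤p(e'' q p))(≤-diff(x + N - X)(0≤-sub(<⇒≤ (<-≤-trans fr(≤-reflexive(cong(_+ N)∣x∣≡)))))(e' X x N))

   numer-bounds : 0ℤ ≤ numer(p , q)x × numer(p , q)x ≤ q * X
   numer-bounds = go(isLow(p , q))refl where
    e1 : ∀ p X x -> p *(X + x)≡ p * X + p * x
    e1 = ring
    e2 : ∀ p q X x -> p * X + p * x +(p *(X - x)+(q - p - p)* X)≡ q * X
    e2 = ring
    e3 : ∀ p q X x ->(q - p)*(X + x)+(p -(q - p))* X ≡ p * X +(q - p)* x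
    e3 = ring
    e4 : ∀ p q X x -> p * X +(q - p)* x +(q - p)*(X - x)≡ q * X
    e4 = ring
    go : ∀ b -> isLow(p , q)≡ b -> 0ℤ ≤ p * X +(if b then p else q - p)* x × p * X +(if b then p else q - p)* x ≤ q * X
    go true lo = 0≤* 0≤p -X≤x <= e1 p X x ,
     ≤-diff(p *(X - x)+(q - p - p)* X)(0≤+(0≤* 0≤p x≤X')(0≤*(0≤-sub(≤?b-true p(q - p)lo))(<⇒≤ 0<X)))(e2 p q X x)
    go false hi = 0≤+(0≤*(0≤-sub p≤q)-X≤x)(0≤*(0≤-sub(<⇒≤ (≤?b-false p(q - p)hi)))(<⇒≤ 0<X))<= e3 p q X x ,
     ≤-diff((q - p)*(X - x))(0≤*(0≤-sub p≤q)x≤X')(e4 p q X x)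

   dyadic-rounds : ∀ {K} -> Fits K(q * X) -> suc((5 N.+ 4 N.* K) N.+ suc(4 N.* n)) N.≤ sz 𝕌 budget ->
    Rounds p q x(dyadic n(quotientL budget n(q * X)(numer(p , q)x)))
   dyadic-rounds {K}fits enough = subst (λ k -> Rounds p q x(dyadic n k))(sym(quotient-spec {K}{budget}{n}{d}(proj₁ numer-bounds)(proj₂ numer-bounds)fits enough))(go(division(proj₁ numer-bounds)(proj₂ numer-bounds)n)) where
    d = q * X
    r0 = numer(p , q)x
    0≤d = 0≤* 0≤q(<⇒≤ 0<X)
    go : ∀ {s} -> Division d r0 n s -> Rounds p q x(dyadic n(proj₂ s))
    go {r , k}h = record { 0≤↥ = 0≤pos _ ; ↥≤↧ = +≤+ (lt ℕ<= sym(↧-dyadic n k)) ; close = close } where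
     open Division h
     lt = N.s≤s(N.n≤1+n _)ℕ<< cong suc(sym(N.+-suc k k))ℕ=< N.+-mono-≤ k<2^j k<2^j ℕ<= cong(2 N.^ n N.+_)(sym(N.+-identityʳ _))
     e1 : ∀ k d r ->(1ℤ +(k + k))* d - + 2 *(k * d + r)≡ d - r - r
     e1 = ring
     diff≡ = cong₂ (λ u v -> u * d - v)(pos-+ 1(k N.+ k)== cong (λ z -> 1ℤ + z)(pos-+ k k))(cong(_* r0)((cong +_ (↧-dyadic n k))== pos-^ 2(suc n))== *-assoc(+ 2)((+ 2) ^ n)r0 == cong(+ 2 *_)exact)== e1(+ k)d r
     abs≤ = abs-≤ {d - r - r}{d}0≤d(≤-diff(+ 4 *(r *(d - r)))(0≤*(0≤pos 4)(0≤* 0≤r(0≤-sub r≤d)))(e2 d r)) where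
      e2 : ∀ d r ->(d - r - r)*(d - r - r)+ + 4 *(r *(d - r))≡ d * d
      e2 = ring
     close = cong (λ z -> + ∣ z ∣ *(+ n) ^ 4)diff≡ =< *-mono 0≤d(0≤^ 4(0≤pos n))abs≤(sym(pos-^ n 4)=<(+≤+ (n⁴≤2^ n 16≤n ℕ<< N.m≤m+n _ _ ℕ<= sym(↧-dyadic n k))))<= *-comm d _

   rounds : ∀ {K} -> Fits K(q * X) -> suc((5 N.+ 4 N.* K) N.+ suc(4 N.* n)) N.≤ sz 𝕌 budget -> Rounds p q x(roundℚ(p , q)x)
   rounds {K}fits enough = go _ _ refl refl where
    go : ∀ a l ->((+ ∣ x ∣ + N)≤?b X)≡ a -> isLow(p , q)≡ l ->
     Rounds p q x(if (if a then false else (if l then isNeg x else not(isNeg x))) then (if l then 0ℚ else 1ℚ) else dyadic n(quotientL budget n(q * X)(numer(p , q)x)))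
    go true l _ _ = dyadic-rounds {K}fits enough
    go false true a l with isNeg x in eq
    ... | true = low-good l eq(≤?b-false(+ ∣ x ∣ + N)X a)
    ... | false = dyadic-rounds {K}fits enough
    go false false a l with isNeg x in eq
    ... | true = dyadic-rounds {K}fits enough
    ... | false = high-good l eq(≤?b-false(+ ∣ x ∣ + N)X a)

  good-integral : ∀ r x -> isGood P r x ≡ true -> roundℚ r x ≡ 0ℚ ⊎ roundℚ r x ≡ 1ℚ
  good-integral r x h = subst (λ g ->(if g then (if isLow r then 0ℚ else 1ℚ) else dy)≡ 0ℚ ⊎ (if g then (if isLow r then 0ℚ else 1ℚ) else dy)≡ 1ℚ)(sym h)(go(isLow r)) where
   dy = dyadic n(quotientL budget n(proj₂ r * X)(numer r x))
   go : ∀ l ->(if l then 0ℚ else 1ℚ)≡ 0ℚ ⊎ (if l then 0ℚ else 1ℚ)≡ 1ℚ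
   go true = inj₁ refl
   go false = inj₂ refl

module Solving where

 open import Data.Fin.Subset using (Subset; _∈_) renaming (∣_∣ to card)
 open import Data.Integer.Base using (+_; -[1+_]; ∣_∣)
 import Data.Integer.Tactic.RingSolver as Z
 open import Data.List.Base using (zip)
 open import Data.Nat.Base hiding (_^_)
 open import Data.Nat.Properties
 open import Data.Nat.Tactic.RingSolver using () renaming (solve-∀ to ring)
 open import Defs using (InUnitCube; encodeℚ; encodeInput; encodeOutput)
 open Typed
 open Arithmetic using (b2n)
 open Arithmetic
 open Walks using (_⋆_)
 open Walks using (∑l; count)
 open Walks using (Row; ≤?b-true; ≤?b-false)
 open WalkProgram
 open WalkSimulation
 open Program
 open Decoding
 open Rows
 open Bits
 open Rounding
 open import Data.List.Relation.Unary.All as All using (All; []; _∷_)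
 import Data.List.Relation.Unary.All.Properties as All
 open Walks using (_·_; zeros; 0≤pos)
 open Walks using (0≤^)
 open Walks using (State)
 open Walks using (0<pos; 0<^)
 open Walks using (StartRow)
 open Chainℕ
 open Chainℤ using () renaming (_<<_ to _ℤ<<_; _=<_ to _ℤ=<_; _<=_ to _ℤ<=_)

 card≡ : ∀ {n}(v : Subset n) -> card v ≡ trues(tl v)
 card≡ [] = refl
 card≡(true ∷ v) = cong suc(card≡ v)
 card≡(false ∷ v) = card≡ v

 countTrue-cons : ∀ b bs -> trues(b ∷ bs)≡ b2n b + trues bs
 countTrue-cons true bs = refl
 countTrue-cons false bs = refl

 count-cons : ∀ {n}b (v : Vec Bool n) -> count(b ∷ v)≡ b2n b + count v
 count-cons true v = refl
 count-cons false v = refl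

 isNeg-opposite : ∀ z -> z ≢ 0ℤ -> isNeg(-1ℤ Z.* z)≡ not(isNeg z)
 isNeg-opposite(+ zero)h = contradiction refl h
 isNeg-opposite(+ suc z)h = refl
 isNeg-opposite -[1+ z ] h = refl

 ∣opposite∣ : ∀ z -> ∣ -1ℤ Z.* z ∣ ≡ ∣ z ∣
 ∣opposite∣ z =(cong ∣_∣ (Z.-1*i≡-i z))== Z.∣-i∣≡∣i∣ z

 one-good : ∀ (P : Car paramst) -> Params.N P Z.≤ Params.X P -> ∀ r z ->
  b2n(isGood P r z)+ b2n(isGood P r(-1ℤ Z.* z))+ b2n((+ ∣ z ∣ Z.+ Params.N P)≤?b Params.X P)≡ 1
 one-good P N≤X r z = cong (λ a -> b2n(isGood P r z)+ b2n(if (+ a Z.+ N)≤?b X then false else (if isLow r then isNeg(-1ℤ Z.* z) else not(isNeg(-1ℤ Z.* z))))+ b2n((+ ∣ z ∣ Z.+ N)≤?b X))(∣opposite∣ z)==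
  go _ (isLow r)refl where
  open Params P using (N; X)
  flip : ∀ b -> b2n b + b2n(not b)+ 0 ≡ 1
  flip true = refl
  flip false = refl
  go : ∀ a l ->((+ ∣ z ∣ Z.+ N)≤?b X)≡ a ->
   b2n(if a then false else (if l then isNeg z else not(isNeg z)))+ b2n(if a then false else (if l then isNeg(-1ℤ Z.* z) else not(isNeg(-1ℤ Z.* z))))+ b2n a ≡ 1
  go true l eq = refl
  go false l eq = go' l where
   nonzero : z ≢ 0ℤ
   nonzero refl = contradiction(≤?b-false(0ℤ Z.+ N)X eq)(Z.≤⇒≯ (Z.+-identityˡ N ℤ=< N≤X))
   go' : ∀ l -> b2n(if l then isNeg z else not(isNeg z))+ b2n(if l then isNeg(-1ℤ Z.* z) else not(isNeg(-1ℤ Z.* z)))+ 0 ≡ 1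
   go' true rewrite isNeg-opposite z nonzero = flip(isNeg z)
   go' false rewrite isNeg-opposite z nonzero = flip(not(isNeg z))

 goods : ∀ {n} -> Car paramst -> Vec Frac n -> Vec ℤ n -> Vec Bool n
 goods P = Vec.zipWith(isGood P)

 countGood-tl : ∀ {n}P (rs : Vec Frac n)v -> countGood P(tl rs)(tl v)≡ trues(tl(goods P rs v))
 countGood-tl P rs v = cong trues(go rs v) where
  go : ∀ {n}(rs : Vec Frac n)v -> List.map(λ (r , z) -> isGood P r z)(zip(tl rs)(tl v))≡ tl(goods P rs v)
  go [] [] = refl
  go(r ∷ rs)(z ∷ v) = cong(_ ∷_)(go rs v)

 goods-total : ∀ {n}P -> Params.N P Z.≤ Params.X P ->(rs : Vec Frac n)(v : Vec ℤ n) ->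
  trues(tl(goods P rs v))+ trues(tl(goods P rs(-1ℤ ⋆ v)))+ count(Vec.map (λ z ->(+ ∣ z ∣ Z.+ Params.N P)≤?b Params.X P)v)≡ n
 goods-total P h [] [] = refl
 goods-total P h(r ∷ rs)(z ∷ v)
  rewrite countTrue-cons(isGood P r z)(tl(goods P rs v)) | countTrue-cons(isGood P r(-1ℤ Z.* z))(tl(goods P rs(-1ℤ ⋆ v)))
   | count-cons((+ ∣ z ∣ Z.+ Params.N P)≤?b Params.X P)(Vec.map (λ z ->(+ ∣ z ∣ Z.+ Params.N P)≤?b Params.X P)v) =
  shuffle(b2n(isGood P r z))_ (b2n(isGood P r(-1ℤ Z.* z)))_ (b2n((+ ∣ z ∣ Z.+ Params.N P)≤?b Params.X P))_ ==(cong₂ _+_ (one-good P h r z)(goods-total P h rs v)) where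
  shuffle : ∀ a b c d e f ->(a + b)+(c + d)+(e + f)≡(a + c + e)+(b + d + f)
  shuffle = ring

 record Oriented {n}(P : Car paramst)(fs : Vec Frac n)(x : Vec ℤ n) : Set where
  field
   σ : ℤ
   σ≡ : σ ≡ 1ℤ ⊎ σ ≡ -1ℤ
   orient≡ : orientL P(tl fs)(tl x)≡ tl(σ ⋆ x)
   many : n ≤ 32 * trues(tl(goods P fs(σ ⋆ x)))

 half-many : ∀ {n a c d} -> 16 * a < 15 * n -> c + d + a ≡ n -> d ≤ c -> n ≤ 32 * c
 half-many {n}{a}{c}{d}few eq d≤c = +-cancelʳ-≤(16 * a)n(32 * c)(<⇒≤ (<-≤-trans(+-monoʳ-< n few)(e1 n == cong(16 *_)(sym eq)=<
  *-monoʳ-≤ 16(+-monoˡ-≤ a(+-monoʳ-≤ c d≤c))<= e2 c a))) where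
  e1 : ∀ n -> n + 15 * n ≡ 16 * n
  e1 = ring
  e2 : ∀ c a -> 16 *(c + c + a)≡ 32 * c + 16 * a
  e2 = ring

 oriented : ∀ {n}P -> Params.N P Z.≤ Params.X P ->(fs : Vec Frac n)(x : Vec ℤ n) ->
  16 * count(Vec.map (λ z ->(+ ∣ z ∣ Z.+ Params.N P)≤?b Params.X P)x) < 15 * n -> Oriented P fs x
 oriented {n}P N≤X fs x few = go _ refl where
  c⁺ = countGood P(tl fs)(tl x)
  c⁻ = countGood P(tl fs)(-1ℤ ⊡ tl x)
  active# = count(Vec.map (λ z ->(+ ∣ z ∣ Z.+ Params.N P)≤?b Params.X P)x)
  c⁺≡ = countGood-tl P fs x
  c⁻≡ = cong(countGood P(tl fs))(tl-map(-1ℤ Z.*_)x)== countGood-tl P fs(-1ℤ ⋆ x)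
  total = cong₂ (λ u v -> u + v + active#)c⁺≡ c⁻≡ == goods-total P N≤X fs x
  go : ∀ b ->((+ c⁻)≤?b(+ c⁺))≡ b -> Oriented P fs x
  go true eq = record { σ = 1ℤ ; σ≡ = inj₁ refl ; orient≡ = sym(orientL-def P(tl fs)(tl x))== cong (λ b -> if b then tl x else -1ℤ ⊡ tl x)eq == cong tl(sym(⋆-one x))
   ; many = half-many few total(Z.drop‿+≤+(≤?b-true(+ c⁻)(+ c⁺)eq))<= cong(32 *_)(c⁺≡ == cong (λ v -> trues(tl(goods P fs v)))(sym(⋆-one x))) }
  go false eq = record { σ = -1ℤ ; σ≡ = inj₂ refl ; orient≡ = sym(orientL-def P(tl fs)(tl x))== cong (λ b -> if b then tl x else -1ℤ ⊡ tl x)eq == tl-map(-1ℤ Z.*_)x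
   ; many = half-many few(cong(_+ active#)(+-comm c⁻ c⁺)== total)(<⇒≤ (Z.drop‿+<+(≤?b-false(+ c⁻)(+ c⁺)eq)))<= cong(32 *_)c⁻≡ }

 record Rounded (n k : ℕ)(y : Vector ℚ n)(a : Vector (Vector ℚ n) k)(Λ : Vector ℚ k) : Set where
  field
   E X : ℤ
   0≤E : 0ℤ Z.≤ E
   0<X : 0ℤ Z.< X
   x : Vec ℤ n
   A : Fin k -> Vec ℤ n
   normal : ∀ j -> Normalised E(clear(Vec.zipWith mulL(Vec.tabulate(ratOf ∘ a j))(Vec.map marginL(Vec.tabulate(ratOf ∘ y)))))(A j)
   tight : ∀ j -> + levelL n(ratOf(Λ j))≡ 0ℤ ->(+ n) Z.^ 5 Z.* + ∣ A j · x ∣ Z.≤ X Z.* E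
   loose : ∀ j -> 1ℤ Z.≤ + levelL n(ratOf(Λ j)) -> A j · x Z.≤ + 89 Z.* + levelL n(ratOf(Λ j)) Z.* (X Z.* E)
   loose⁻ : ∀ j -> 1ℤ Z.≤ + levelL n(ratOf(Λ j)) ->(-1ℤ ⋆ A j)· x Z.≤ + 89 Z.* + levelL n(ratOf(Λ j)) Z.* (X Z.* E)
   σ : ℤ
   σ≡ : σ ≡ 1ℤ ⊎ σ ≡ -1ℤ
   y' : Vector ℚ n
   0≤↥ : ∀ i -> 0ℤ Z.≤ ↥ y' i
   ↥≤↧ : ∀ i -> ↥ y' i Z.≤ ↧ y' i
   close : ∀ i -> + ∣ ↥ y' i Z.* (↧ y i Z.* X) Z.- ↧ y' i Z.* (↥ y i Z.* X Z.+ proj₁(marginL(ratOf(y i))) Z.* (σ Z.* Vec.lookup x i)) ∣ Z.* (+ n) Z.^ 4 Z.≤ ↧ y' i Z.* (↧ y i Z.* X)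
   frozen : Subset n
   many : n ≤ 32 * card frozen
   integral : ∀ {i} -> i ∈ frozen -> y' i ≡ 0ℚ ⊎ y' i ≡ 1ℚ
   solve≡ : solveL(encodeInput n k y a Λ)≡ encodeOutput y'

 module Solution (n k : ℕ)(y : Vector ℚ n)(a : Vector (Vector ℚ n) k)(Λ : Vector ℚ k)
  (64≤n : 64 ≤ n)(cube : InUnitCube y) where

  open Input n k y a Λ public

  open Powers L (64≤n << n≤L) public

  setup : Car setupt
  setup = setupL n L

  e R budget T K : ℕ
  e = P 3
  R = power 24 n
  budget = P 70
  T = power 10 n
  K = P 50

  E q0 : ℤ
  E =(+ 2) Z.^ e
  q0 = unitWeight n

  1≤E : 1ℤ Z.≤ E
  1≤E =(Z.+≤+ (1≤2^ e))ℤ<= pos-^ 2 e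

  R≥ :(+ n) Z.^ 24 Z.≤ + R
  R≥ = Z.≤-reflexive(sym(pos-^ n 24)==(cong +_ (sym(power≡ 24 n))))

  open Simulation n R E 64≤n R≥ 1≤E budget public

  n≤P : n ≤ P 1
  n≤P = P-L n≤L

  L≤P : L ≤ P 1
  L≤P = P-L ≤-refl

  fs : Vec Frac n
  fs = Vec.tabulate(ratOf ∘ y)

  margins : Vec Frac n
  margins = Vec.map marginL fs

  coefs : Fin k -> Vec Frac n
  coefs j = Vec.tabulate(ratOf ∘ a j)

  cleared : Fin k -> Vec ℤ n
  cleared j = clear(Vec.zipWith mulL(coefs j)margins)

  rowj : Fin k -> Row n
  rowj j = rowV n e margins(coefs j)(ratOf(Λ j))

  rows0 : List(Row n)
  rows0 = List.tabulate rowj ++ List.map opposite(List.tabulate rowj)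

  num-bits : ∀ {q} -> Short q -> Bits L(↥ q)
  num-bits(h , _) = <⇒≤ h

  den-bits : ∀ {q} -> Short q -> Bits L(↧ q)
  den-bits(_ , h) = <⇒≤ h

  short-y : ∀ i -> Short(y i)
  short-y i = All.tabulate⁻(All.++⁻ˡ ys short)i

  short-rest : All Short(List.concat as ++ ls)
  short-rest = All.++⁻ʳ ys short

  short-a : ∀ j i -> Short(a j i)
  short-a j i = All.tabulate⁻(All.tabulate⁻(All.map⁻(All.concat⁻(All.++⁻ˡ(List.concat as)short-rest)))j)i

  nonneg-num : ∀ i -> 0ℤ Z.≤ ↥ y i
  nonneg-num i = proj₁(unit-interval(y i)(proj₁(cube i))(proj₂(cube i)))

  num≤den : ∀ i -> ↥ y i Z.≤ ↧ y i
  num≤den i = proj₂(unit-interval(y i)(proj₁(cube i))(proj₂(cube i)))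

  margin-bits : ∀ i -> Bits L(proj₁(marginL(ratOf(y i))))
  margin-bits i = let (0≤c , c≤q) = margin-bounds(↥ y i)(↧ y i)(nonneg-num i)(num≤den i) in
   Z.drop‿+≤+(Z.0≤i⇒+∣i∣≡i 0≤c ℤ=< c≤q)<< den-bits {y i}(short-y i)

  entry-bits : ∀ j i -> let (c , d) = Vec.lookup(Vec.zipWith mulL(coefs j)margins)i in
   c Z.* c Z.≤ (+ 2) Z.^ ((L + L)+(L + L))× d Z.* d Z.≤ (+ 2) Z.^ ((L + L)+(L + L))
  entry-bits j i = subst (λ f -> proj₁ f Z.* proj₁ f Z.≤ (+ 2) Z.^ ((L + L)+(L + L))× proj₂ f Z.* proj₂ f Z.≤ (+ 2) Z.^ ((L + L)+(L + L)))(sym entry)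
   (product(↥ a j i)(proj₁(marginL(ratOf(y i))))(num-bits {a j i}(short-a j i))(margin-bits i),
    product(↧ a j i)(↧ y i)(den-bits {a j i}(short-a j i))(den-bits {y i}(short-y i))) where
   product : ∀ x z -> Bits L x -> Bits L z ->(x Z.* z) Z.* (x Z.* z) Z.≤ (+ 2) Z.^ ((L + L)+(L + L))
   product x z hx hz = square-bits {L + L}(x Z.* z)(bits-* {L}{L}x z hx hz)
   entry = Vec.lookup-zipWith mulL i(coefs j)margins == cong₂ mulL(Vec.lookup∘tabulate(ratOf ∘ a j)i)
    (Vec.lookup-map i marginL fs == cong marginL(Vec.lookup∘tabulate(ratOf ∘ y)i))

  cleared-norm : ∀ j -> cleared j · cleared j Z.≤ E Z.* E
  cleared-norm j = proj₂(clear-norm {n}{(+ 2) Z.^ ((L + L)+(L + L))}(0≤^((L + L)+(L + L))(0≤pos 2))(Vec.zipWith mulL(coefs j)margins)(entry-bits j))ℤ<<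
   cong (λ z -> + n Z.* (z Z.^ n))(sym(pos-^ 2((L + L)+(L + L))))== cong(+ n Z.*_)(sym(pos-^(2 N.^ ((L + L)+(L + L)))n))== sym(Z.pos-* n _)ℤ=<
   (Z.+≤+ (*-monoˡ-≤((2 N.^ ((L + L)+(L + L))) N.^ n)(n≤2^n n)<< cong(2 N.^ n *_)(^-*-assoc 2((L + L)+(L + L))n)== sym(^-distribˡ-+-* 2 n _)=< ^-monoʳ-≤ 2 exps))ℤ<=
    (cong +_ (^-distribˡ-+-* 2 e e))== Z.pos-*(2 N.^ e)(2 N.^ e)== cong (λ z -> z Z.* z)(pos-^ 2 e) where
   exps = +-mono-≤ n≤L(*-monoʳ-≤((L + L)+(L + L))n≤L)<< eq1 L =< *-monoˡ-≤ L(+-monoˡ-≤(4 * L)1≤L <<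
    *-monoˡ-≤ L {5}{L}(m≤m+n 5 59 << 64≤n << n≤L))<< eq2 L == sym(P≡ 3)=< m≤m+n e e where
    eq1 : ∀ L -> L +((L + L)+(L + L))* L ≡(1 + 4 * L)* L
    eq1 = ring
    eq2 : ∀ L -> L * L * L ≡ L *(L *(L * 1))
    eq2 = ring

  start : All(StartRow E q0)rows0
  start = All.++⁺ rows-start(All.map⁺(All.map start-opposite rows-start)) where
   rows-start = All.tabulate⁺ (λ j -> start-row n e margins(coefs j)(ratOf(Λ j))(cleared-norm j))

  0<q0 : 0ℤ Z.< q0
  0<q0 = 0<^(2 *(suc n * suc n))(0<pos 1)

  T> : + 40 Z.* m Z.^ 9 Z.< + T
  T> = Z.<-≤-trans(Z.*-monoʳ-<-pos(m Z.^ 9){{Z.positive(0<^ 9 0<m)}}{+ 40}{m}(Z.+<+ (m≤m+n 41 23 << 64≤n)))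
   (Z.≤-reflexive(sym(pos-^ n 10)==(cong +_ (sym(power≡ 10 n)))))

  E-bits : Bits(P 3)E
  E-bits = bits-2^(P 3)

  n-bits : Bits(P 1)m
  n-bits = bits-mono m n≤P(bits-ℕ n)

  X-bits : Bits(P 32)X
  X-bits = bits-mono X(+-P 31(P-mono 31(m≤m+n 2 29)(*-P 1 1(P-const(m≤m+n 4 60))≤-refl))(P-mono 31(m≤m+n 30 1)exponent))
   (bits-* {4 * P 1}{R *(P 1 +(P 3 + P 3))}(m Z.^ 4)N(bits-^ {P 1}m 4 n-bits)(bits-^ {P 1 +(P 3 + P 3)}D R(bits-* {P 1}{P 3 + P 3}m(E Z.* E)n-bits(bits-* {P 3}{P 3}E E E-bits E-bits)))) where
   exponent = P-mono 30(m≤m+n 29 1)(*-P 24 5(power≡ 24 n =< P-^ 24 n≤L)(+-P 4(P-mono 4(s≤s z≤n)≤-refl)(+-P 3 ≤-refl ≤-refl)))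

  H-bits : Bits(P 33)H
  H-bits = bits-mono H(+-P 32 ≤-refl(P-mono 32(m≤m+n 3 29)≤-refl))(bits-* {P 32}{P 3}X E X-bits E-bits)

  Q-bits : Bits(P 35)Q
  Q-bits = bits-mono Q(+-P 34(P-mono 34(m≤m+n 2 32)(*-P 1 1(P-const(m≤m+n 9 55))≤-refl))(+-P 33 ≤-refl ≤-refl))
   (bits-* {9 * P 1}{P 33 + P 33}p(H Z.* H)(bits-^ {P 1}m 9 n-bits)(bits-* {P 33}{P 33}H H H-bits H-bits))

  steps-≤ : ∀ t -> + t Z.≤ + 40 Z.* m Z.^ 9 -> t ≤ P 10
  steps-≤ t h = Z.drop‿+≤+(h ℤ<= cong(+ 40 Z.*_)(sym(pos-^ n 9))== sym(Z.pos-* 40(n N.^ 9)))<< *-P 1 9(P-const(m≤m+n 40 24))(P-^ 9 n≤L)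

  q0-bits : Bits(P 6)q0
  q0-bits = bits-mono q0(*-P 1 5(P-const(s≤s(s≤s z≤n)))(P-mono 5(m≤m+n 4 1)(*-P 2 2(P-suc 1(s≤s z≤n)n≤P)(P-suc 1(s≤s z≤n)n≤P))))(bits-2^(2 *(suc n * suc n)))

  X-fits : Fits K X
  X-fits = fits X(<-≤-trans(P-< 32)(P-mono 50(m≤m+n 33 17)≤-refl))X-bits

  E-fits : Fits K E
  E-fits = fits E(<-≤-trans(P-< 3)(P-mono 50(m≤m+n 4 46)≤-refl))E-bits

  m-fits : Fits K m
  m-fits = fits m(<-≤-trans(P-< 1)(P-mono 50(m≤m+n 2 48)≤-refl))n-bits

  q-fits : ∀ t -> + t Z.≤ + 40 Z.* m Z.^ 9 -> Fits K(q0 Z.* Q Z.^ t)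
  q-fits t h = fits(q0 Z.* Q Z.^ t)(≤-<-trans(+-P 45(P-mono 45(m≤m+n 6 39)≤-refl)(*-P 10 35(steps-≤ t h)≤-refl))(<-≤-trans(P-< 46)(P-mono 50(m≤m+n 47 3)≤-refl)))
   (bits-* {P 6}{t * P 35}q0(Q Z.^ t)q0-bits(bits-^ {P 35}Q t Q-bits))

  vecSize≤ : vecSize K n ≤ P 55
  vecSize≤ = P-suc 54(s≤s z≤n)(P-mono 54(m≤m+n 53 1)(*-P 1 52 n≤P(+-P 51(P-mono 51(s≤s z≤n)(P-const(m≤m+n 6 58)))(*-P 1 50(P-const(m≤m+n 4 60))≤-refl))))

  number≤ : 5 + 4 * K ≤ P 52
  number≤ = +-P 51(P-mono 51(s≤s z≤n)(P-const(m≤m+n 5 59)))(*-P 1 50(P-const(m≤m+n 4 60))≤-refl)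

  length-rows0 : length rows0 ≡ k + k
  length-rows0 = List.length-++(List.tabulate rowj)==(cong₂ _+_ (List.length-tabulate rowj)(List.length-map opposite(List.tabulate rowj)== List.length-tabulate rowj))

  P≤budget : ∀ {x} -> x ≤ P 70 -> x ≤ sz 𝕌 budget
  P≤budget h = h <<(m≤m+n(P 70)_ << n≤1+n _)<= sym(size-unary(P 70))

  enough : stateSize K n(length rows0)≤ sz 𝕌 budget
  enough = P≤budget(P-mono 70(m≤m+n 67 3)(P-suc 66(s≤s z≤n)(+-P 65(P-mono 65(m≤m+n 55 10)vecSize≤)(P-suc 64(s≤s z≤n)(+-P 63(P-suc 62(s≤s z≤n)
   (*-P 2 60(length-rows0 =< +-P 1(P-L m≤L)(P-L m≤L))(P-suc 59(s≤s z≤n)(P-suc 58(s≤s z≤n)(+-P 57(P-mono 57(m≤m+n 52 5)number≤)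
    (P-suc 56(s≤s z≤n)(+-P 55(P-mono 55(m≤m+n 52 3)number≤)vecSize≤)))))))(P-mono 63(m≤m+n 52 11)number≤))))))

  open Sized K {rows0}{q0} X-fits E-fits m-fits q-fits enough public

  inst : Car instt
  inst = n , rats ys , List.map rats as , rats ls

  rows-tl : rowsL setup(rats ys)(List.map rats as)(rats ls)≡ List.map rowL rows0
  rows-tl = cong signedRowsL(cong(List.map(rowOf setup(List.map marginL(rats ys))))pairs == List.map-tabulate _ (rowOf setup(List.map marginL(rats ys)))== List.tabulate-cong one == sym(List.map-tabulate rowj rowL))==
   cong(List.map rowL(List.tabulate rowj) ++_)(sym(List.map-∘(List.tabulate rowj))== List.map-cong opposite-tl(List.tabulate rowj)== List.map-∘(List.tabulate rowj))==
    sym(List.map-++ rowL(List.tabulate rowj)(List.map opposite(List.tabulate rowj))) where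
   coeffs : ∀ j -> rats(Vector.toList(a j))≡ tl(coefs j)
   coeffs j = List.map-tabulate(a j)ratOf == tl-tabulate(ratOf ∘ a j)
   pairs = cong₂ zip(cong(List.map rats)(List.map-tabulate a Vector.toList)== List.map-tabulate (λ j -> Vector.toList(a j))rats == List.tabulate-cong coeffs)(List.map-tabulate Λ ratOf)==
    zip-tabulate (λ j -> tl(coefs j))(λ j -> ratOf(Λ j))
   margins≡ = cong(List.map marginL)(List.map-tabulate y ratOf == tl-tabulate(ratOf ∘ y))== tl-map marginL fs
   one : ∀ j -> rowOf setup(List.map marginL(rats ys))(tl(coefs j), ratOf(Λ j))≡ rowL(rowj j)
   one j = cong (λ A -> + levelL n(ratOf(Λ j)), weightOf n(levelL n(ratOf(Λ j))), A)
    (cong(normalL setup)(cong(List.zipWith mulL(tl(coefs j)))margins≡ == tl-zipWith mulL(coefs j)margins)==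
     normal-tl {K}{n}{e}{budget}(Vec.zipWith mulL(coefs j)margins)(cleared-norm j)E-fits vec≤)

  start-tl : startL setup inst ≡ stL(origin rows0 q0)
  start-tl = cong₂ (λ v rs -> v , rs , q0)(cong(List.map (λ _ -> 0ℤ))(List.map-tabulate y ratOf == tl-tabulate(ratOf ∘ y))== zeros≡ fs)rows-tl where
   zeros≡ : ∀ {n}(v : Vec Frac n) -> List.map (λ _ -> 0ℤ)(tl v)≡ tl(zeros {n})
   zeros≡ [] = refl
   zeros≡(_ ∷ v) = cong(0ℤ ∷_)(zeros≡ v)

  params≡ : paramsL setup ≡ params
  params≡ = assemble-def m E R budget

  module Light (light : + 64 Z.* ∑l rows0 Row.V Z.≤ + 9 Z.* m Z.* q0) where

   opaque
    x : Vec ℤ n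
    x = State.x(iter sweep T(origin rows0 q0))

    walked : walkedL setup inst ≡ tl x
    walked = sym(walkedL-def setup inst)== cong (λ st -> proj₁(walkL(paramsL setup)(candidatesL n)T st))start-tl ==
     cong₂ (λ P cs -> proj₁(walkL P cs T(stL(origin rows0 q0))))params≡(candidates-tl n)==
      cong proj₁(walk-tl(origin rows0 q0)T(0 , origin-inv 0<q0 start light))

    outcome : Box x × + 16 Z.* + count(active x) Z.< + 15 Z.* m × All(RowBound 0<q0 start light x)rows0
    outcome = final 0<q0 start light T T>

   box : Box x
   box = proj₁ outcome

   few : + 16 Z.* + count(active x) Z.< + 15 Z.* m
   few = proj₁(proj₂ outcome)

   bound⁺ : ∀ j -> RowBound 0<q0 start light x(rowj j)
   bound⁺ j = All.tabulate⁻(All.++⁻ˡ(List.tabulate rowj)(proj₂(proj₂ outcome)))j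

   bound⁻ : ∀ j -> RowBound 0<q0 start light x(opposite(rowj j))
   bound⁻ j = All.tabulate⁻(All.map⁻(All.++⁻ʳ(List.tabulate rowj)(proj₂(proj₂ outcome))))j

   open Coordinate params n (m≤m+n 16 48 << 64≤n) 0<N refl hiding (0<X; N≤X)

   open Oriented (oriented params N≤X fs x (Z.drop‿+<+ (Z.≤-<-trans (Z.≤-reflexive (Z.pos-* 16 (count (active x))))(Z.<-≤-trans few (Z.≤-reflexive (sym (Z.pos-* 15 n))))))) public

   o : Vec ℤ n
   o = σ ⋆ x

   y' : Vector ℚ n
   y' i = roundℚ(ratOf(y i))(Vec.lookup o i)

   rats≡ : rats ys ≡ tl fs
   rats≡ = List.map-tabulate y ratOf == tl-tabulate(ratOf ∘ y)

   output≡ : outputL params n(tl fs)(tl o)≡ encodeOutput y'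
   output≡ = sym(outputL-def params n(tl fs)(tl o))== cong List.concat(go y o == sym(List.map-tabulate y' encodeℚ)) where
    go : ∀ {j}(y : Vector ℚ j)(v : Vec ℤ j) -> List.map(λ (r , z) -> roundL params n r z)(zip(tl(Vec.tabulate(ratOf ∘ y)))(tl v))≡ List.tabulate (λ i -> encodeℚ(roundℚ(ratOf(y i))(Vec.lookup v i)))
    go y [] = refl
    go y(z ∷ v) = cong₂ _∷_ (round-letters(ratOf(y Fin.zero))z)(go(y ∘ Fin.suc)v)

   solve≡ : solveL input ≡ encodeOutput y'
   solve≡ = cong₂ (λ i ℓ -> solveInstanceL(setupL(proj₁ i)ℓ)i)parsed L≡ ==
    cong(outputL(paramsL setup)n(rats ys))(cong(orientL(paramsL setup)(rats ys))walked)==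
    cong₂ (λ P r -> outputL P n r(orientL P r(tl x)))params≡ rats≡ == cong(outputL params n(tl fs))orient≡ == output≡

   o≡ : ∀ i -> Vec.lookup o i ≡ σ Z.* Vec.lookup x i
   o≡ i = Vec.lookup-map i(σ Z.*_)x

   box-lookup : ∀ {j}(v : Vec ℤ j) -> Box v -> ∀ i -> + ∣ Vec.lookup v i ∣ Z.≤ X
   box-lookup(z ∷ v)(h , b)Fin.zero = h
   box-lookup(z ∷ v)(h , b)(Fin.suc i) = box-lookup v b i

   o-box : ∀ i -> + ∣ Vec.lookup o i ∣ Z.≤ X
   o-box i =(cong +_ ((cong ∣_∣ (o≡ i))== ∣σ∣ σ≡))ℤ=< box-lookup x box i where
    ∣σ∣ : ∀ {σ z} -> σ ≡ 1ℤ ⊎ σ ≡ -1ℤ -> ∣ σ Z.* z ∣ ≡ ∣ z ∣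
    ∣σ∣ {z = z}(inj₁ refl) = cong ∣_∣ (Z.*-identityˡ z)
    ∣σ∣ {z = z}(inj₂ refl) = ∣opposite∣ z

   rounded : ∀ i -> Rounds(↥ y i)(↧ y i)(Vec.lookup o i)(y' i)
   rounded i = rounds(nonneg-num i)(num≤den i)(o-box i){K}
    (fits(↧ y i Z.* X)(≤-<-trans(+-P 32(P-mono 32(s≤s z≤n)L≤P)≤-refl)(<-≤-trans(P-< 33)(P-mono 50(m≤m+n 34 16)≤-refl)))(bits-* {L}{P 32}(↧ y i)X(den-bits {y i}(short-y i))X-bits))
    (P≤budget(P-mono 70(m≤m+n 54 16)(P-suc 53(s≤s z≤n)(+-P 52 number≤(P-mono 52(m≤m+n 3 49)(P-suc 2(s≤s z≤n)(*-P 1 1(P-const(m≤m+n 4 60))n≤P)))))))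

   frozen : Subset n
   frozen = goods params fs o

   frozen-many : n ≤ 32 * card frozen
   frozen-many = many <= cong(32 *_)(sym(card≡ frozen))

   frozen-integral : ∀ {i} -> i ∈ frozen -> y' i ≡ 0ℚ ⊎ y' i ≡ 1ℚ
   frozen-integral {i}i∈ = good-integral(ratOf(y i))(Vec.lookup o i)
    (sym(Vec.lookup-zipWith(isGood params)i fs o == cong (λ r -> isGood params r(Vec.lookup o i))(Vec.lookup∘tabulate(ratOf ∘ y)i))== Vec.[]=⇒lookup i∈)

   all-rounded : Rounded n k y a Λ
   all-rounded = record
    { E = E ; X = X ; 0≤E = 0≤pos 1 ℤ<< 1≤E ; 0<X = 0<X ; x = x ; A = λ j -> Row.A(rowj j) ; normal = λ j -> normal-ok e(cleared j)(cleared-norm j)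
    ; tight = λ j -> proj₁(bound⁺ j) ; loose = λ j -> proj₂(bound⁺ j) ; loose⁻ = λ j -> proj₂(bound⁻ j)
    ; σ = σ ; σ≡ = σ≡ ; y' = y' ; 0≤↥ = λ i -> Rounds.0≤↥(rounded i) ; ↥≤↧ = λ i -> Rounds.↥≤↧ (rounded i)
    ; close = λ i -> subst (λ z -> + ∣ ↥ y' i Z.* (↧ y i Z.* X) Z.- ↧ y' i Z.* (↥ y i Z.* X Z.+ proj₁(marginL(ratOf(y i))) Z.* z) ∣ Z.* (+ n) Z.^ 4 Z.≤ ↧ y' i Z.* (↧ y i Z.* X))(o≡ i)(Rounds.close(rounded i))
    ; frozen = frozen ; many = frozen-many ; integral = frozen-integral ; solve≡ = solve≡ }

module Rationals where

 open import Data.Integer.Base using (+_; -[1+_])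
 open import Data.Rational.Base
 open import Data.Rational.Properties
 import Data.Rational.Unnormalised.Base as ℚᵘ
 import Data.Rational.Unnormalised.Properties as ℚᵘ
 open import Level using (0ℓ)
 open import Tactic.RingSolver using () renaming (solve-∀ to ring)
 open import Tactic.RingSolver.Core.AlmostCommutativeRing using (AlmostCommutativeRing; fromCommutativeRing)
 open import Defs hiding (_·_)
 open Walks using (_·_)
 open Chainℚ

 ℚ-ring : AlmostCommutativeRing 0ℓ 0ℓ
 ℚ-ring = fromCommutativeRing +-*-commutativeRing isZero where
  isZero : ∀ q -> Maybe(0ℚ ≡ q)
  isZero q with 0ℚ ≟ q
  ... | yes eq = just eq
  ... | no _ = nothing

 ≤-diff : ∀ {x y}d -> 0ℚ ≤ d -> x + d ≡ y -> x ≤ y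
 ≤-diff {x}d 0≤d eq =(sym(+-identityʳ x)=< +-monoʳ-≤ x 0≤d)<= eq

 0≤-sub : ∀ {x y} -> x ≤ y -> 0ℚ ≤ y - x
 0≤-sub {x}{y}h = sym(+-inverseʳ x)=< +-monoˡ-≤(- x)h

 0≤+ : ∀ {x y} -> 0ℚ ≤ x -> 0ℚ ≤ y -> 0ℚ ≤ x + y
 0≤+ = +-mono-≤

 *-monoˡ : ∀ {c x y} -> 0ℚ ≤ c -> x ≤ y -> c * x ≤ c * y
 *-monoˡ {c}0≤c h = *-monoˡ-≤-nonNeg c {{nonNegative 0≤c}}h

 *-monoʳ : ∀ {c x y} -> 0ℚ ≤ c -> x ≤ y -> x * c ≤ y * c
 *-monoʳ {c}0≤c h = *-monoʳ-≤-nonNeg c {{nonNegative 0≤c}}h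

 *-mono : ∀ {a b c d} -> 0ℚ ≤ b -> 0ℚ ≤ c -> a ≤ b -> c ≤ d -> a * c ≤ b * d
 *-mono 0≤b 0≤c a≤b c≤d = *-monoʳ 0≤c a≤b << *-monoˡ 0≤b c≤d

 0≤* : ∀ {x y} -> 0ℚ ≤ x -> 0ℚ ≤ y -> 0ℚ ≤ x * y
 0≤* {x}0≤x 0≤y = sym(*-zeroʳ x)=< *-monoˡ 0≤x 0≤y

 0<* : ∀ {x y} -> 0ℚ < x -> 0ℚ < y -> 0ℚ < x * y
 0<* {x}{y}0<x 0<y = positive⁻¹(x * y){{pos*pos⇒pos x {{positive 0<x}}y {{positive 0<y}}}}

 *-cancel : ∀ {c x y} -> 0ℚ < c -> c * x ≤ c * y -> x ≤ y
 *-cancel {c}0<c h = *-cancelˡ-≤-pos c {{positive 0<c}}h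

 sq≥0 : ∀ x -> 0ℚ ≤ x * x
 sq≥0 x with ≤-total 0ℚ x
 ... | inj₁ 0≤x = 0≤* 0≤x 0≤x
 ... | inj₂ x≤0 = 0≤*(0≤neg x≤0)(0≤neg x≤0)<= eq x where
  0≤neg : ∀ {x} -> x ≤ 0ℚ -> 0ℚ ≤ - x
  0≤neg {x}h = 0≤-sub h <= +-identityˡ(- x)
  eq : ∀ x -> - x * - x ≡ x * x
  eq = ring ℚ-ring

 square-≤ : ∀ {a b} -> 0ℚ ≤ b -> a * a ≤ b * b -> a ≤ b
 square-≤ {a}{b}0≤b h with <-cmp a b
 ... | tri< a<b _ _ = <⇒≤ a<b
 ... | tri≈ _ refl _ = ≤-refl
 ... | tri> _ _ b<a = contradiction(<-≤-trans(0<* 0<a-b 0<a-b)product≤0)(<-irrefl refl) where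
  0<a-b = ≤-<-trans(≤-reflexive(sym(+-inverseʳ b)))(+-monoˡ-<(- b)b<a)
  product≤0 = ≤-diff((a - b)*(b + b))(0≤*(<⇒≤ 0<a-b)(0≤+ 0≤b 0≤b))(e a b)<< +-monoˡ-≤(- (b * b))h <= +-inverseʳ(b * b) where
   e : ∀ a b ->(a - b)*(a - b)+(a - b)*(b + b)≡ a * a - b * b
   e = ring ℚ-ring

 ∣∣-square : ∀ x -> ∣ x ∣ * ∣ x ∣ ≡ x * x
 ∣∣-square x with ∣p∣≡p∨∣p∣≡-p x
 ... | inj₁ eq rewrite eq = refl
 ... | inj₂ eq rewrite eq = e x where
  e : ∀ x -> - x * - x ≡ x * x
  e = ring ℚ-ring

 ι : ℤ -> ℚ
 ι z = z / 1

 toℚᵘ-ι : ∀ z -> toℚᵘ(ι z)ℚᵘ.≃ ℚᵘ.mkℚᵘ z 0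
 toℚᵘ-ι z = toℚᵘ-fromℚᵘ(ℚᵘ.mkℚᵘ z 0)

 ι-+ : ∀ x y -> ι(x Z.+ y)≡ ι x + ι y
 ι-+ x y = toℚᵘ-injective(ℚᵘ.≃-trans(toℚᵘ-ι(x Z.+ y))(ℚᵘ.≃-trans(ℚᵘ.*≡* (cong(Z._* + 1)(sym(cong₂ Z._+_ (Z.*-identityʳ x)(Z.*-identityʳ y)))))
  (ℚᵘ.≃-sym(ℚᵘ.≃-trans(toℚᵘ-homo-+(ι x)(ι y))(ℚᵘ.+-cong(toℚᵘ-ι x)(toℚᵘ-ι y))))))

 ι-* : ∀ x y -> ι(x Z.* y)≡ ι x * ι y
 ι-* x y = toℚᵘ-injective(ℚᵘ.≃-trans(toℚᵘ-ι(x Z.* y))(ℚᵘ.≃-sym(ℚᵘ.≃-trans(toℚᵘ-homo-*(ι x)(ι y))(ℚᵘ.*-cong(toℚᵘ-ι x)(toℚᵘ-ι y)))))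

 ι-≤ : ∀ {x y} -> x Z.≤ y -> ι x ≤ ι y
 ι-≤ {x}{y}h = toℚᵘ-cancel-≤(ℚᵘ.≤-trans(ℚᵘ.≤-reflexive(toℚᵘ-ι x))(ℚᵘ.≤-trans(ℚᵘ.*≤* (Z.*-monoʳ-≤-nonNeg(+ 1)h))(ℚᵘ.≤-reflexive(ℚᵘ.≃-sym(toℚᵘ-ι y)))))

 ι-< : ∀ {x y} -> x Z.< y -> ι x < ι y
 ι-< {x}{y}h = toℚᵘ-cancel-<(ℚᵘ.≤-<-trans(ℚᵘ.≤-reflexive(toℚᵘ-ι x))(ℚᵘ.<-≤-trans(ℚᵘ.*<* (Z.*-monoʳ-<-pos(+ 1)h))(ℚᵘ.≤-reflexive(ℚᵘ.≃-sym(toℚᵘ-ι y)))))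

 ι-neg : ∀ x -> ι(Z.- x)≡ - ι x
 ι-neg x = +-cancelʳ(ι x)(sym(ι-+(Z.- x)x)== cong ι(Z.+-inverseˡ x)== sym(+-inverseˡ(ι x))) where
  +-cancelʳ : ∀ z {a b} -> a + z ≡ b + z -> a ≡ b
  +-cancelʳ z {a}{b}h = e a z == cong(_- z)h == sym(e b z) where
   e : ∀ a z -> a ≡ a + z - z
   e = ring ℚ-ring

 ι-sub : ∀ x y -> ι(x Z.- y)≡ ι x - ι y
 ι-sub x y = ι-+ x(Z.- y)== cong (λ z -> ι x + z)(ι-neg y)

 ι-abs : ∀ z -> ι(+ Z.∣ z ∣)≡ ∣ ι z ∣
 ι-abs(+ n) = sym(0≤p⇒∣p∣≡p(ι-≤ {0ℤ}{+ n}(Z.+≤+ N.z≤n)))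
 ι-abs -[1+ n ] = sym(0≤p⇒∣p∣≡p(ι-≤ {0ℤ}{+ suc n}(Z.+≤+ N.z≤n)))==(cong ∣_∣ (cong ι(sym(Z.neg-involutive(+ suc n)))==(ι-neg -[1+ n ])))== ∣-p∣≡∣p∣(ι -[1+ n ])

 ι-↧ : ∀ q -> q * ι(↧ q)≡ ι(↥ q)
 ι-↧ q@(mkℚ n d _) = toℚᵘ-injective(ℚᵘ.≃-trans(toℚᵘ-homo-* q(ι(↧ q)))(ℚᵘ.≃-trans(ℚᵘ.*-cong(ℚᵘ.≃-refl {toℚᵘ q})(toℚᵘ-ι(↧ q)))(ℚᵘ.≃-trans(ℚᵘ.*≡* (Z.*-identityʳ _ == cong (λ k -> n Z.* + k)(sym(N.*-identityʳ(suc d)))))(ℚᵘ.≃-sym(toℚᵘ-ι(↥ q))))))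

 0<ι↧ : ∀ q -> 0ℚ < ι(↧ q)
 0<ι↧ q@(mkℚ n d _) = ι-< {0ℤ}{+ suc d}(Z.+<+ (N.s≤s N.z≤n))

 ∑-cong : ∀ {n}{f g : Vector ℚ n} ->(∀ i -> f i ≡ g i) -> ∑ f ≡ ∑ g
 ∑-cong {zero}h = refl
 ∑-cong {suc n}h = cong₂ _+_ (h Fin.zero)(∑-cong(h ∘ Fin.suc))

 ∑-mono : ∀ {n}{f g : Vector ℚ n} ->(∀ i -> f i ≤ g i) -> ∑ f ≤ ∑ g
 ∑-mono {zero}h = ≤-refl
 ∑-mono {suc n}h = +-mono-≤(h Fin.zero)(∑-mono(h ∘ Fin.suc))

 ∑≥0 : ∀ {n}{f : Vector ℚ n} ->(∀ i -> 0ℚ ≤ f i) -> 0ℚ ≤ ∑ f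
 ∑≥0 {zero}h = ≤-refl
 ∑≥0 {suc n}h = 0≤+(h Fin.zero)(∑≥0(h ∘ Fin.suc))

 ∑-+ : ∀ {n}(f g : Vector ℚ n) -> ∑ (λ i -> f i + g i)≡ ∑ f + ∑ g
 ∑-+ {zero}f g = refl
 ∑-+ {suc n}f g = cong (λ z -> f Fin.zero + g Fin.zero + z)(∑-+ (f ∘ Fin.suc)(g ∘ Fin.suc))== e(f Fin.zero)(g Fin.zero)(∑ (f ∘ Fin.suc))(∑ (g ∘ Fin.suc)) where
  e : ∀ a b c d -> a + b +(c + d)≡ a + c +(b + d)
  e = ring ℚ-ring

 ∑-* : ∀ {n}c (f : Vector ℚ n) -> ∑ (λ i -> c * f i)≡ c * ∑ f
 ∑-* {zero}c f = sym(*-zeroʳ c)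
 ∑-* {suc n}c f = cong (λ z -> c * f Fin.zero + z)(∑-* c(f ∘ Fin.suc))== sym(*-distribˡ-+ c(f Fin.zero)_)

 ∑-const : ∀ n c -> ∑ {n}(λ _ -> c)≡ fromℕ n * c
 ∑-const zero c = sym(*-zeroˡ c)
 ∑-const(suc n)c = cong (λ z -> c + z)(∑-const n c)== e c(fromℕ n)== cong(_* c)(sym(fromℕ-suc n)) where
  e : ∀ c n -> c + n * c ≡(1ℚ + n)* c
  e = ring ℚ-ring

 cauchy-schwarz : ∀ {n}(u v : Vector ℚ n) -> ⟨ u , v ⟩ * ⟨ u , v ⟩ ≤ ⟨ u , u ⟩ * ⟨ v , v ⟩
 cauchy-schwarz {zero}u v = ≤-refl
 cauchy-schwarz {suc n}u v = ≤-diff((uu * vv - uv * uv)+ rest)(0≤+(0≤-sub(cauchy-schwarz u' v'))(∑≥0 (λ i -> sq≥0(a * v' i - b * u' i))<= rest≡))(e a b uu vv uv) where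
  a = u Fin.zero
  b = v Fin.zero
  u' v' : Vector ℚ n
  u' = u ∘ Fin.suc
  v' = v ∘ Fin.suc
  uu = ⟨ u' , u' ⟩
  vv = ⟨ v' , v' ⟩
  uv = ⟨ u' , v' ⟩
  rest = a * a * vv +(b * b * uu + -(a * b + a * b)* uv)
  rest≡ = ∑-cong (λ i -> e1 a b(u' i)(v' i))==(∑-+ (λ i -> a * a *(v' i * v' i))_)==(cong₂ _+_ (∑-* (a * a)(λ i -> v' i * v' i))
   ((∑-+ (λ i -> b * b *(u' i * u' i))_)==(cong₂ _+_ (∑-* (b * b)(λ i -> u' i * u' i))(∑-* (- (a * b + a * b))(λ i -> u' i * v' i))))) where
   e1 : ∀ a b u v ->(a * v - b * u)*(a * v - b * u)≡ a * a *(v * v)+(b * b *(u * u)+ -(a * b + a * b)*(u * v))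
   e1 = ring ℚ-ring
  e : ∀ a b uu vv uv ->(a * b + uv)*(a * b + uv)+((uu * vv - uv * uv)+(a * a * vv +(b * b * uu + -(a * b + a * b)* uv)))≡(a * a + uu)*(b * b + vv)
  e = ring ℚ-ring

 ι-dot : ∀ {n}(u v : Vec ℤ n) -> ι(u · v)≡ ∑ (λ i -> ι(Vec.lookup u i)* ι(Vec.lookup v i))
 ι-dot [] [] = refl
 ι-dot(a ∷ u)(b ∷ v) = ι-+(a Z.* b)(u · v)==(cong₂ _+_ (ι-* a b)(ι-dot u v))

module ErrorTerms where

 open import Data.Integer.Base using (+_)
 open import Data.Rational.Base
 open import Data.Rational.Properties
 open import Tactic.RingSolver using () renaming (solve-∀ to ring)
 open import Defs
 open Rationals
 open Chainℚ

 -- p is at most the sum of two numbers whose squares are at most b and c.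
 record Split (p b c : ℚ) : Set where
  field
   t1 t2 : ℚ
   0≤t1 : 0ℚ ≤ t1
   0≤t2 : 0ℚ ≤ t2
   t1²≤ : t1 * t1 ≤ b
   t2²≤ : t2 * t2 ≤ c
   p≤ : p ≤ t1 + t2

 num : ℕ -> ℚ
 num k = ι(+ k)

 0≤num : ∀ k -> 0ℚ ≤ num k
 0≤num k = ι-≤ {0ℤ}{+ k}(Z.+≤+ N.z≤n)

 num-mono : ∀ {j k} -> j N.≤ k -> num j ≤ num k
 num-mono h = ι-≤(Z.+≤+ h)

 module Errors {n : ℕ}(α μ ξ ε y y' : Vector ℚ n)(σ : ℚ)(σσ : σ * σ ≡ 1ℚ)(0≤μ : ∀ i -> 0ℚ ≤ μ i)(μ≤1 : ∀ i -> μ i ≤ 1ℚ)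
  (y'≡ : ∀ i -> y' i - y i ≡ σ *(μ i * ξ i)+ ε i)
  (64≤n : 64 N.≤ n)(small : ∀ i ->(ε i * ε i)*(num n * num n * num n * num n *(num n * num n * num n * num n))≤ 1ℚ) where

  ν ν² ν⁴ u v S V : ℚ
  ν = num n
  ν² = ν * ν
  ν⁴ = ν * ν * ν * ν
  u = ∑ (λ i -> α i * μ i * ξ i)
  v = ⟨ ε , α ⟩
  S = ⟨ α , α ⟩
  V = ∑ (λ i -> α i ² * μ i ²)

  0≤ν = 0≤num n

  64≤ν = num-mono 64≤n

  0≤S = ∑≥0 (λ i -> sq≥0(α i))

  0≤V = ∑≥0 (λ i -> 0≤*(sq≥0(α i))(sq≥0(μ i)))

  V≤S = ∑-mono (λ i -> *-monoˡ(sq≥0(α i))(*-mono(nonNegative⁻¹ 1ℚ)(0≤μ i)(μ≤1 i)(μ≤1 i))<= *-identityʳ(α i * α i))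

  difference = ∑-cong (λ i -> cong(_* α i)(y'≡ i)== e σ(μ i)(ξ i)(ε i)(α i))==(∑-+ (λ i -> σ *(α i * μ i * ξ i))(λ i -> ε i * α i))== cong (λ z -> z + v)(∑-* σ (λ i -> α i * μ i * ξ i)) where
   e : ∀ s m x ε a ->(s *(m * x)+ ε)* a ≡ s *(a * m * x)+ ε * a
   e = ring ℚ-ring

  ∣σu∣ = ≤-antisym(square-≤(0≤∣p∣ u)(≤-reflexive eq))(square-≤(0≤∣p∣(σ * u))(≤-reflexive(sym eq))) where
   e : ∀ s u -> s * u *(s * u)≡ s * s *(u * u)
   e = ring ℚ-ring
   eq = ∣∣-square(σ * u)== e σ u == cong(_* (u * u))σσ == *-identityˡ(u * u)== sym(∣∣-square u)

  error≤ =(cong ∣_∣ difference)=< ∣p+q∣≤∣p∣+∣q∣(σ * u)v <= cong (λ z -> z + ∣ v ∣)∣σu∣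

  v²-small = *-monoʳ(0≤* 0≤ν⁴ 0≤ν⁴)(cauchy-schwarz ε α)<<(e ⟨ ε , ε ⟩ S(ν⁴ * ν⁴))=< *-monoˡ 0≤S ε-total where
   0≤ν⁴ = 0≤*(0≤*(0≤* 0≤ν 0≤ν)0≤ν)0≤ν
   e : ∀ a s n -> a * s * n ≡ s *(n * a)
   e = ring ℚ-ring
   ε-total = sym(∑-* (ν⁴ * ν⁴)(λ i -> ε i * ε i))=< ∑-mono (λ i -> *-comm(ν⁴ * ν⁴)(ε i * ε i)=< small i)<=
    ∑-const n 1ℚ == *-identityʳ ν

  module _ (κ : ℚ)(κν² : κ * ν² ≡ 1ℚ) where

   private
    unscale : ∀ {x} -> x * ν⁴ ≤ S -> x ≤ κ * κ * S
    unscale {x}h = sym(*-identityʳ x)== cong (λ z -> x *(z * z))(sym κν²)== e x κ ν =< *-monoˡ(sq≥0 κ)h << ≤-refl where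
     e : ∀ x k n -> x *(k *(n * n)*(k *(n * n)))≡ k * k *(x *(n * n * n * n))
     e = ring ℚ-ring

    1≤ν : 1ℚ ≤ ν
    1≤ν = num-mono {1}{64}(N.s≤s N.z≤n)<< 64≤ν

    0<ν : 0ℚ < ν
    0<ν = <-≤-trans(positive⁻¹ 1ℚ)1≤ν

    0<ν³ : 0ℚ < ν * ν * ν
    0<ν³ = 0<*(0<* 0<ν 0<ν)0<ν

    64≤ν³ : num 64 ≤ ν * ν * ν
    64≤ν³ = 64≤ν << sym(*-identityˡ ν)== sym(cong(_* ν)(*-identityˡ 1ℚ))=< *-monoʳ 0≤ν(*-mono 0≤ν(nonNegative⁻¹ 1ℚ)1≤ν 1≤ν)

    -- v² n⁸ ≤ n S, hence 2 v² n⁴ · n³ ≤ 2 S ≤ n³ S / 32.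
    v²-bound : num 32 *(v * v * ν⁴)≤ S
    v²-bound = *-cancel {ν * ν * ν}0<ν³(*-cancel {ν}0<ν(e1(num 32)(v * v)ν =< *-monoˡ(0≤num 32)v²-small <= e2(num 32)S ν)<<
     *-monoʳ 0≤S(num-mono {32}{64}(N.m≤m+n 32 32)<< 64≤ν³)) where
     e1 : ∀ c w n -> n *(n * n * n *(c *(w *(n * n * n * n))))≡ c *(w *(n * n * n * n *(n * n * n * n)))
     e1 = ring ℚ-ring
     e2 : ∀ c s n -> c *(s * n)≡ n *(c * s)
     e2 = ring ℚ-ring

    v²-fine : v * v * ν⁴ ≤ S
    v²-fine =(sym(*-identityˡ _)=< *-monoʳ(0≤*(sq≥0 v)(0≤*(0≤*(0≤* 0≤ν 0≤ν)0≤ν)0≤ν))(num-mono {1}{32}(N.s≤s N.z≤n)))<< v²-bound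

   coarse : ∀ {b} -> u * u ≤ b -> Split ∣ ⟨ y' ⊖ y , α ⟩ ∣ b(κ * κ * S)
   coarse u²≤ = record
    { t1 = ∣ u ∣ ; t2 = ∣ v ∣ ; 0≤t1 = 0≤∣p∣ u ; 0≤t2 = 0≤∣p∣ v ; t1²≤ = ∣∣-square u =< u²≤
    ; t2²≤ = ∣∣-square v =< unscale v²-fine ; p≤ = error≤ }

   fine : ∀ {b} -> 0ℚ ≤ b -> ν⁴ *(ν⁴ *(ν * ν))*(u * u)≤ num 4 * V -> Split ∣ ⟨ y' ⊖ y , α ⟩ ∣ b(κ * κ * S)
   fine 0≤b u²≤ = record
    { t1 = 0ℚ ; t2 = ∣ u ∣ + ∣ v ∣ ; 0≤t1 = ≤-refl ; 0≤t2 = 0≤+(0≤∣p∣ u)(0≤∣p∣ v) ; t1²≤ = 0≤b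
    ; t2²≤ = square≤ << unscale total ; p≤ = error≤ <= sym(+-identityˡ(∣ u ∣ + ∣ v ∣)) } where
    e0 : ∀ a b ->(a + b)*(a + b)+(a - b)*(a - b)≡(1ℚ + 1ℚ)*(a * a + b * b)
    e0 = ring ℚ-ring
    square≤ = ≤-diff((∣ u ∣ - ∣ v ∣)*(∣ u ∣ - ∣ v ∣))(sq≥0(∣ u ∣ - ∣ v ∣))(e0 ∣ u ∣ ∣ v ∣)<= cong₂ (λ a b ->(1ℚ + 1ℚ)*(a + b))(∣∣-square u)(∣∣-square v)
    -- n¹⁰ u² ≤ 4 S gives 16 n⁴ u² ≤ S since n⁶ ≥ 64.
    u²-bound : num 16 *(u * u * ν⁴)≤ S
    u²-bound = *-cancel {num 4}(ι-< {0ℤ}{+ 4}(Z.+<+ (N.s≤s N.z≤n)))(sym(*-assoc(num 4)(num 16)(u * u * ν⁴))== cong(_* (u * u * ν⁴))(sym(ι-*(+ 4)(+ 16)))=<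
     *-monoʳ(0≤*(sq≥0 u)0≤ν⁴)(64≤ν³ << ν³≤ν⁶)<< e1(u * u)ν =< u²≤ << *-monoˡ(0≤num 4)V≤S) where
     0≤ν⁴ = 0≤*(0≤*(0≤* 0≤ν 0≤ν)0≤ν)0≤ν
     ν³≤ν⁶ = sym(*-identityʳ _)=< *-monoˡ(<⇒≤ 0<ν³)(num-mono {1}{64}(N.s≤s N.z≤n)<< 64≤ν³)
     e1 : ∀ w n -> n * n * n *(n * n * n)*(w *(n * n * n * n))≡ n * n * n * n *(n * n * n * n *(n * n))* w
     e1 = ring ℚ-ring
    total :(1ℚ + 1ℚ)*(u * u + v * v)* ν⁴ ≤ S
    total = *-cancel {num 16}(ι-< {0ℤ}{+ 16}(Z.+<+ (N.s≤s N.z≤n)))(e2(num 16)(u * u)(v * v)ν⁴ == cong (λ z -> num 16 *(u * u * ν⁴)+ num 16 *(u * u * ν⁴)+ z *(v * v * ν⁴))(sym(ι-+(+ 16)(+ 16)))=<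
     +-mono-≤(+-mono-≤ u²-bound u²-bound)v²-bound << ≤-diff(num 13 * S)(0≤*(0≤num 13)0≤S)(e3 S(num 13)== cong(_* S)(cong (λ z -> z + num 13)(cong (λ z -> z + 1ℚ)(sym(ι-+(+ 1)(+ 1)))== sym(ι-+(+ 2)(+ 1)))== sym(ι-+(+ 3)(+ 13))))) where
     e2 : ∀ c x y n -> c *((1ℚ + 1ℚ)*(x + y)* n)≡ c *(x * n)+ c *(x * n)+(c + c)*(y * n)
     e2 = ring ℚ-ring
     e3 : ∀ s c -> s + s + s + c * s ≡(1ℚ + 1ℚ + 1ℚ + c)* s
     e3 = ring ℚ-ring

module RowBounds where

 open import Data.Integer.Base using (+_)
 import Data.Integer.Tactic.RingSolver as Z
 open import Data.Rational.Base
 open import Data.Rational.Properties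
 open import Tactic.RingSolver using () renaming (solve-∀ to ring)
 open import Defs hiding (_·_)
 open Walks using (_·_)
 open Walks using (≤?b-true; ≤?b-false)
 open Walks using (0<pos; 0<^)
 open Program using (isLow; marginL; mulL)
 open Decoding using (ratOf)
 open Rows
 open Rationals
 open ErrorTerms
 open Chainℤ using () renaming (_<<_ to _ℤ<<_; _=<_ to _ℤ=<_; _<=_ to _ℤ<=_)
 open Chainℚ

 clear-lookup : ∀ {n}(fs : Vec Frac n)i -> Vec.lookup(clear fs)i Z.* proj₂(Vec.lookup fs i)≡ denoms fs Z.* proj₁(Vec.lookup fs i)
 clear-lookup((c , d)∷ fs)Fin.zero = e c(denoms fs)d where
  e : ∀ c D d -> c Z.* D Z.* d ≡ d Z.* D Z.* c
  e = Z.solve-∀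
 clear-lookup((c , d)∷ fs)(Fin.suc i) = cong(Z._* proj₂(Vec.lookup fs i))(Vec.lookup-map i(d Z.*_)(clear fs))== Z.*-assoc d _ _ == cong(d Z.*_)(clear-lookup fs i)== sym(Z.*-assoc d _ _)

 denominators-pos : ∀ {n}(fs : Vec Frac n) ->(∀ i -> 0ℤ Z.< proj₂(Vec.lookup fs i)) -> 0ℤ Z.< denoms fs
 denominators-pos [] h = Z.+<+ (N.s≤s N.z≤n)
 denominators-pos((c , d)∷ fs)h = Walks.0<*(h Fin.zero)(denominators-pos fs(h ∘ Fin.suc))

 *-cancel-≡ : ∀ {c x y} -> 0ℚ < c -> x * c ≡ y * c -> x ≡ y
 *-cancel-≡ {c}{x}{y}0<c h = ≤-antisym(*-cancel 0<c(≤-reflexive(*-comm c x == h == *-comm y c)))(*-cancel 0<c(≤-reflexive(*-comm c y == sym h == *-comm x c)))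

 margin : ℚ -> ℚ
 margin q = q ⊓ (1ℚ - q)

 margin-ι : ∀ q -> margin q * ι(↧ q)≡ ι(proj₁(marginL(ratOf q)))
 margin-ι q = go(isLow(ratOf q))refl where
  B = ι(↧ q)
  e : ∀ q b ->(1ℚ - q)* b ≡ b - q * b
  e = ring ℚ-ring
  upper = e q B == cong (λ z -> B - z)(ι-↧ q)== sym(ι-sub(↧ q)(↥ q))
  cancel : ∀ x y -> x * B ≤ y * B -> x ≤ y
  cancel x y h = *-cancel(0<ι↧ q)(*-comm B x =< h <= *-comm y B)
  go : ∀ b -> isLow(ratOf q)≡ b -> margin q * B ≡ ι(if b then ↥ q else ↧ q Z.- ↥ q)
  go true lo = cong(_* B)(p≤q⇒p⊓q≡p(cancel q(1ℚ - q)(ι-↧ q =< ι-≤(≤?b-true(↥ q)(↧ q Z.- ↥ q)lo)<= sym upper)))== ι-↧ q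
  go false hi = cong(_* B)(p≥q⇒p⊓q≡q(cancel(1ℚ - q)q(upper =< ι-≤(Z.<⇒≤ (≤?b-false(↥ q)(↧ q Z.- ↥ q)hi))<= sym(ι-↧ q))))== upper

 margin-bounds' : ∀ q -> 0ℚ ≤ q -> q ≤ 1ℚ -> 0ℚ ≤ margin q × margin q ≤ 1ℚ
 margin-bounds' q 0≤q q≤1 = ⊓-glb 0≤q(0≤-sub q≤1), p⊓q≤p q(1ℚ - q)<< q≤1

 ι-power⁴ : ∀ z -> ι(z Z.^ 4)≡ ι z * ι z * ι z * ι z
 ι-power⁴ z = cong ι(e z)== ι-*(z Z.* z Z.* z)z == cong(_* ι z)(ι-*(z Z.* z)z == cong(_* ι z)(ι-* z z)) where
  e : ∀ z -> z Z.* (z Z.* (z Z.* (z Z.* 1ℤ)))≡ z Z.* z Z.* z Z.* z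
  e = Z.solve-∀

 ι-power⁵ : ∀ z -> ι(z Z.^ 5)≡ ι z * ι z * ι z * ι z * ι z
 ι-power⁵ z = cong ι(Z.*-comm z(z Z.^ 4))== ι-*(z Z.^ 4)z == cong(_* ι z)(ι-power⁴ z)

 sq-unit : ∀ {σ} -> σ ≡ 1ℤ ⊎ σ ≡ -1ℤ -> ι σ * ι σ ≡ 1ℚ
 sq-unit(inj₁ refl) = refl
 sq-unit(inj₂ refl) = refl

 add-back : ∀ a b -> a ≡ b +(a - b)
 add-back = ring ℚ-ring

 module RowErrors {n : ℕ}(64≤n : 64 N.≤ n)(X E : ℤ)(0<X : 0ℤ Z.< X)(0≤E : 0ℤ Z.≤ E)(y y' : Vector ℚ n)(cube : InUnitCube y)(x : Vec ℤ n)
  (σ : ℤ)(σ≡ : σ ≡ 1ℤ ⊎ σ ≡ -1ℤ)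
  (close : ∀ i -> + Z.∣ ↥ y' i Z.* (↧ y i Z.* X) Z.- ↧ y' i Z.* (↥ y i Z.* X Z.+ proj₁(marginL(ratOf(y i))) Z.* (σ Z.* Vec.lookup x i)) ∣ Z.* (+ n) Z.^ 4 Z.≤ ↧ y' i Z.* (↧ y i Z.* X)) where

  0<ιX : 0ℚ < ι X
  0<ιX = ι-< 0<X

  r : ℚ
  r =(1/ ι X){{pos⇒nonZero(ι X){{positive 0<ιX}}}}

  rX≡1 : r * ι X ≡ 1ℚ
  rX≡1 = *-inverseˡ(ι X){{pos⇒nonZero(ι X){{positive 0<ιX}}}}

  μ ξ ε : Vector ℚ n
  μ i = margin(y i)
  ξ i = ι(Vec.lookup x i)* r
  ε i =(y' i - y i) - ι σ *(μ i * ξ i)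

  ξX : ∀ i -> ξ i * ι X ≡ ι(Vec.lookup x i)
  ξX i = *-assoc(ι(Vec.lookup x i))r(ι X)== cong (λ z -> ι(Vec.lookup x i)* z)rX≡1 == *-identityʳ _

  small : ∀ i ->(ε i * ε i)*(num n * num n * num n * num n *(num n * num n * num n * num n))≤ 1ℚ
  small i = e(ε i)ν⁴ == sym(∣∣-square(ε i * ν⁴))== cong (λ z -> z * z)(∣p*q∣≡∣p∣*∣q∣(ε i)ν⁴ == cong (λ z -> ∣ ε i ∣ * z)(0≤p⇒∣p∣≡p 0≤ν⁴))=<
   *-mono(nonNegative⁻¹ 1ℚ)(0≤*(0≤∣p∣(ε i))0≤ν⁴)∣ε∣ ∣ε∣ where
   ν⁴ = num n * num n * num n * num n
   0≤ν⁴ = 0≤*(0≤*(0≤*(0≤num n)(0≤num n))(0≤num n))(0≤num n)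
   e : ∀ a b -> a * a *(b * b)≡ a * b *(a * b)
   e = ring ℚ-ring
   p = ↥ y i
   q = ↧ y i
   c = proj₁(marginL(ratOf(y i)))
   xi = Vec.lookup x i
   Z = ↥ y' i Z.* (q Z.* X) Z.- ↧ y' i Z.* (p Z.* X Z.+ c Z.* (σ Z.* xi))
   B = ι(↧ y' i)*(ι q * ι X)
   0<B = 0<*(0<ι↧(y' i))(0<*(0<ι↧(y i))0<ιX)
   εB = e1(y' i)(y i)(ι σ)(μ i)(ξ i)(ι(↧ y' i))(ι q)(ι X)== cong₂ (λ f g -> f *(ι q * ι X) - g)(ι-↧(y' i))
    (cong₂ (λ f g -> ι(↧ y' i)*(f * ι X + g))(ι-↧(y i))(cong₂ (λ f g -> f *(ι σ * g))(margin-ι(y i))(ξX i)))== sym image where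
    e1 : ∀ y' y s m x d q X ->(y' - y - s *(m * x))*(d *(q * X))≡ y' * d *(q * X) - d *(y * q * X + m * q *(s *(x * X)))
    e1 = ring ℚ-ring
    image = ι-sub(↥ y' i Z.* (q Z.* X))(↧ y' i Z.* (p Z.* X Z.+ c Z.* (σ Z.* xi)))== cong₂ (λ f g -> f - g)(ι-*(↥ y' i)(q Z.* X)== cong (λ z -> ι(↥ y' i)* z)(ι-* q X))
     (ι-*(↧ y' i)(p Z.* X Z.+ c Z.* (σ Z.* xi))== cong (λ z -> ι(↧ y' i)* z)(ι-+(p Z.* X)(c Z.* (σ Z.* xi))== cong₂ (λ f g -> f + g)(ι-* p X)(ι-* c(σ Z.* xi)== cong (λ z -> ι c * z)(ι-* σ xi))))
   ∣ε∣B = cong (λ z -> ∣ ε i ∣ * z)(sym(0≤p⇒∣p∣≡p(<⇒≤ 0<B)))== sym(∣p*q∣≡∣p∣*∣q∣(ε i)B)==(cong ∣_∣ εB)== sym(ι-abs Z)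
   ∣ε∣ = *-cancel 0<B((e2 B ∣ ε i ∣ ν⁴)==(cong₂ _*_ ∣ε∣B(sym(ι-power⁴(+ n))))== sym(ι-*(+ Z.∣ Z ∣)((+ n) Z.^ 4))=< ι-≤(close i)<=
    ι-*(↧ y' i)(q Z.* X)== cong (λ z -> ι(↧ y' i)* z)(ι-* q X)== sym(*-identityʳ B)) where
    e2 : ∀ b a n -> b *(a * n)≡ a * b * n
    e2 = ring ℚ-ring

  module Row (α : Vector ℚ n)(A : Vec ℤ n)(normal : Normalised E (clear (Vec.zipWith mulL (Vec.tabulate (ratOf ∘ α))(Vec.map marginL (Vec.tabulate (ratOf ∘ y))))) A) where

   open Normalised normal

   fracs : Vec Frac n
   fracs = Vec.zipWith mulL(Vec.tabulate(ratOf ∘ α))(Vec.map marginL(Vec.tabulate(ratOf ∘ y)))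

   open Errors α μ ξ ε y y' (ι σ)(sq-unit σ≡)(λ i -> proj₁ (margin-bounds' (y i)(proj₁ (cube i))(proj₂ (cube i))))(λ i -> proj₂ (margin-bounds' (y i)(proj₁ (cube i))(proj₂ (cube i))))
    (λ i -> add-back(y' i - y i)(ι σ *(μ i * ξ i)))64≤n small public

   w : ℚ
   w = ι((+ 2) Z.^ f)* ι(denoms fracs)

   frac : ∀ i -> Vec.lookup fracs i ≡ mulL(ratOf(α i))(marginL(ratOf(y i)))
   frac i = Vec.lookup-zipWith mulL i(Vec.tabulate(ratOf ∘ α))(Vec.map marginL(Vec.tabulate(ratOf ∘ y)))== cong₂ mulL(Vec.lookup∘tabulate(ratOf ∘ α)i)
    (Vec.lookup-map i marginL(Vec.tabulate(ratOf ∘ y))== cong marginL(Vec.lookup∘tabulate(ratOf ∘ y)i))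

   0<w : 0ℚ < w
   0<w = 0<*(ι-<(0<^ f(0<pos 1)))(ι-<(denominators-pos fracs (λ i -> subst (λ fr -> 0ℤ Z.< proj₂ fr)(sym(frac i))(Walks.0<*(den-pos(α i))(den-pos(y i)))))) where
    den-pos : ∀ q -> 0ℤ Z.< ↧ q
    den-pos(mkℚ _ _ _) = Z.+<+ (N.s≤s N.z≤n)

   A-lookup : ∀ i -> ι(Vec.lookup A i)≡ w *(α i * μ i)
   A-lookup i = cong ι(cong (λ v -> Vec.lookup v i)B≡ == Vec.lookup-map i(((+ 2) Z.^ f)Z.*_)(clear fracs))== ι-*((+ 2) Z.^ f)(Vec.lookup(clear fracs)i)== cong (λ z -> ι((+ 2) Z.^ f)* z)cleared == sym(*-assoc(ι((+ 2) Z.^ f))(ι(denoms fracs))(α i * μ i)) where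
    d = ι(↧ α i)* ι(↧ y i)
    eq = cong (λ z -> ι(Vec.lookup(clear fracs)i)* z)(sym(ι-*(↧ α i)(↧ y i)))== sym(ι-*(Vec.lookup(clear fracs)i)(↧ α i Z.* ↧ y i))==
     cong ι(subst (λ fr -> Vec.lookup(clear fracs)i Z.* proj₂ fr ≡ denoms fracs Z.* proj₁ fr)(frac i)(clear-lookup fracs i))==
     ι-*(denoms fracs)(↥ α i Z.* proj₁(marginL(ratOf(y i))))== cong (λ z -> ι(denoms fracs)* z)(ι-*(↥ α i)(proj₁(marginL(ratOf(y i)))))
    e : ∀ D a m x y -> D *(a * x *(m * y))≡ D *(a * m)*(x * y)
    e = ring ℚ-ring
    cleared = *-cancel-≡(0<*(0<ι↧(α i))(0<ι↧(y i)))(eq == cong₂ (λ a b -> ι(denoms fracs)*(a * b))(sym(ι-↧(α i)))(sym(margin-ι(y i)))== e(ι(denoms fracs))(α i)(μ i)(ι(↧ α i))(ι(↧ y i)))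

   A·x≡ : ι(A · x)≡ ι X *(w * u)
   A·x≡ = ι-dot A x == ∑-cong (λ i ->(cong₂ _*_ (A-lookup i)(sym(ξX i)))== e w(α i)(μ i)(ξ i)(ι X))==(∑-* (ι X * w)(λ i -> α i * μ i * ξ i))== *-assoc(ι X)w u where
    e : ∀ w a m x X -> w *(a * m)*(x * X)≡ X * w *(a * m * x)
    e = ring ℚ-ring

   A·A≡ : ι(A · A)≡ w * w * V
   A·A≡ = ι-dot A A == ∑-cong (λ i ->(cong₂ _*_ (A-lookup i)(A-lookup i))== e w(α i)(μ i))==(∑-* (w * w)(λ i -> α i ² * μ i ²)) where
    e : ∀ w a m -> w *(a * m)*(w *(a * m))≡ w * w *(a * a *(m * m))
    e = ring ℚ-ring

   ∣A·x∣≡ : ι(+ Z.∣ A · x ∣)≡ ι X *(w * ∣ u ∣)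
   ∣A·x∣≡ = ι-abs(A · x)==(cong ∣_∣ A·x≡)== ∣p*q∣≡∣p∣*∣q∣(ι X)(w * u)==(cong₂ _*_ (0≤p⇒∣p∣≡p(<⇒≤ 0<ιX))(∣p*q∣≡∣p∣*∣q∣ w u == cong(_* ∣ u ∣)(0≤p⇒∣p∣≡p(<⇒≤ 0<w))))

   -- Either E² < 4 |A|², or A = 0 and then u = 0.
   scaled :(c : ℚ) -> 0ℚ ≤ c -> c *(w * ∣ u ∣)≤ ι E -> c * c *(u * u)≤ num 4 * V
   scaled c 0≤c h = go(1ℤ Z.≤? (clear fracs · clear fracs)) where
    e1 : ∀ c w u -> w * w *(c * c *(u * u))≡ c *(w * u)*(c *(w * u))
    e1 = ring ℚ-ring
    go : Dec(1ℤ Z.≤ clear fracs · clear fracs) -> c * c *(u * u)≤ num 4 * V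
    go(yes 1≤) = *-cancel(0<* 0<w 0<w)((cong (λ z -> w * w *(c * c * z))(sym(∣∣-square u))==(e1 c w ∣ u ∣))=< *-mono(ι-≤ 0≤E)(0≤* 0≤c(0≤*(<⇒≤ 0<w)(0≤∣p∣ u)))h h <<
     sym(ι-* E E)=< ι-≤(Z.<⇒≤ (large 1≤))<= ι-*(+ 4)(A · A)== cong (λ z -> num 4 * z)A·A≡ == e2(num 4)w V) where
     e2 : ∀ c w v -> c *(w * w * v)≡ w * w *(c * v)
     e2 = ring ℚ-ring
    go(no ¬1≤) = *-cancel(0<* 0<ιX(0<* 0<ιX(0<* 0<w 0<w)))(e3(ι X)w c u =< cong (λ z -> c * c *(z * z))(sym A·x≡)== cong (λ z -> c * c * z)(sym(ι-*(A · x)(A · x)))=<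
     *-monoˡ(0≤* 0≤c 0≤c)(ι-≤ Ax²≤0)<= *-zeroʳ(c * c)== sym(*-zeroʳ(ι X *(ι X *(w * w)))))<<
     0≤*(0≤num 4)0≤V where
     e3 : ∀ X w c u -> X *(X *(w * w))*(c * c *(u * u))≡ c * c *(X *(w * u)*(X *(w * u)))
     e3 = ring ℚ-ring
     A·A≤0 = cong (λ v -> v · v)B≡ == ·-square((+ 2) Z.^ f)(clear fracs)ℤ=< Walks.*-monoˡ(Walks.sq≥0((+ 2) Z.^ f))(Z.≮⇒≥ (λ lt -> ¬1≤(Z.i<j⇒suc[i]≤j lt)))ℤ<= Z.*-zeroʳ((+ 2) Z.^ f Z.* (+ 2) Z.^ f)
     Ax²≤0 = Walks.cauchy-schwarz A x ℤ<< Walks.*-monoʳ(Walks.·-self≥0 x)A·A≤0 ℤ<= Z.*-zeroˡ(x · x)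

   row-split : ∀ {k Λ}κ -> κ *(num n * num n)≡ 1ℚ -> 0ℚ ≤ Λ -> num 256 * num k ≤ Λ ->
    (+ k ≡ 0ℤ ->(+ n) Z.^ 5 Z.* + Z.∣ A · x ∣ Z.≤ X Z.* E) ->(1ℤ Z.≤ + k -> + Z.∣ A · x ∣ Z.≤ + 89 Z.* + k Z.* (X Z.* E)) ->
    Split ∣ ⟨ y' ⊖ y , α ⟩ ∣ (Λ ² * W α y)(κ * κ * ⟨ α , α ⟩)
   row-split {zero}{Λ}κ κν² 0≤Λ lev tight loose = fine κ κν²(0≤*(sq≥0 Λ)0≤V)(e1(num n)(u * u)=< scaled(ν * ν * ν * ν * ν)(0≤*(0≤*(0≤*(0≤* 0≤ν 0≤ν)0≤ν)0≤ν)0≤ν)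
    (*-cancel 0<ιX(e2(ι X)(ν * ν * ν * ν * ν)(w * ∣ u ∣)==(cong₂ _*_ (sym(ι-power⁵(+ n)))(sym ∣A·x∣≡))== sym(ι-*((+ n) Z.^ 5)(+ Z.∣ A · x ∣))=<
     ι-≤(tight refl)<= ι-* X E))) where
    e1 : ∀ n x -> n * n * n * n *(n * n * n * n *(n * n))* x ≡ n * n * n * n * n *(n * n * n * n * n)* x
    e1 = ring ℚ-ring
    e2 : ∀ X c z -> X *(c * z)≡ c *(X * z)
    e2 = ring ℚ-ring
   row-split {suc k}{Λ}κ κν² 0≤Λ lev tight loose = coarse κ κν²(*-cancel(positive⁻¹ 1ℚ)(*-identityˡ(u * u)=< u²≤ << *-monoʳ 0≤V(*-mono 0≤Λ(0≤*(0≤num 178)(0≤num(suc k)))lev1 lev1)<= sym(*-identityˡ _))) where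
    s = num(suc k)
    c = num 178 * s
    lev1 = *-monoʳ(0≤num(suc k))(num-mono(N.m≤m+n 178 78))<< lev
    0<s = 0<*(ι-< {0ℤ}{+ 89}(Z.+<+ (N.s≤s N.z≤n)))(ι-< {0ℤ}{+ suc k}(Z.+<+ (N.s≤s N.z≤n)))
    wu≤ = *-cancel 0<ιX(sym ∣A·x∣≡ =< ι-≤(loose(Z.+≤+ (N.s≤s N.z≤n)))<= ι-*(+ 89 Z.* + suc k)(X Z.* E)==(cong₂ _*_ (ι-*(+ 89)(+ suc k))(ι-* X E))== e3(num 89 * s)(ι X)(ι E)) where
     e3 : ∀ c X E -> c *(X * E)≡ X *(c * E)
     e3 = ring ℚ-ring
    t =(1/(num 89 * s)){{pos⇒nonZero(num 89 * s){{positive 0<s}}}}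
    ts≡1 = *-inverseˡ(num 89 * s){{pos⇒nonZero(num 89 * s){{positive 0<s}}}}
    0≤t = <⇒≤ (positive⁻¹ t {{1/pos⇒pos(num 89 * s){{positive 0<s}}}})
    u²≤ = sym(*-identityˡ(u * u))== cong (λ z -> z * z *(u * u))(sym ts≡1)== e4 t(num 89 * s)(u * u)=<
     *-monoˡ(0≤*(<⇒≤ 0<s)(<⇒≤ 0<s))(scaled t 0≤t(*-monoˡ 0≤t wu≤ <= sym(*-assoc t(num 89 * s)(ι E))== cong(_* ι E)ts≡1 == *-identityˡ(ι E)))<=
     e5(num 89)s(num 4)V == cong (λ z -> z *(s * s)* V)(cong(_* num 4)(sym(ι-*(+ 89)(+ 89)))== sym(ι-*(+ 7921)(+ 4))== ι-*(+ 178)(+ 178))== e6(num 178)s V where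
     e4 : ∀ t s x -> t * s *(t * s)* x ≡ s * s *(t * t * x)
     e4 = ring ℚ-ring
     e5 : ∀ a s b v -> a * s *(a * s)*(b * v)≡ a * a * b *(s * s)* v
     e5 = ring ℚ-ring
     e6 : ∀ a s v -> a * a *(s * s)* v ≡ a * s *(a * s)* v
     e6 = ring ℚ-ring

module Reals where

 open import Data.Integer.Base using (+_)
 open import Data.Rational.Base
 open import Data.Rational.Properties
 open import Relation.Nullary using (does)
 open import Tactic.RingSolver using () renaming (solve-∀ to ring)
 open import Defs
 open Rationals
 open ErrorTerms
 open Chainℚ

 0≤½^ : ∀ k -> 0ℚ ≤ ½^ k
 0≤½^ k = nonNegative⁻¹(½^ k){{½^-nonNeg k}}

 module SquareRoot (q : ℚ)(0≤q : 0ℚ ≤ q) where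

  gap : ℕ -> ℚ
  gap k =(1ℚ + ∣ q ∣)*(½^ k)

  0≤gap : ∀ k -> 0ℚ ≤ gap k
  0≤gap k = 0≤*(0≤+(nonNegative⁻¹ 1ℚ)(0≤∣p∣ q))(0≤½^ k)

  sqrt-bounds : ∀ k -> 0ℚ ≤ sqrtSeq q k × q ≤(sqrtSeq q k + gap k)*(sqrtSeq q k + gap k)
  sqrt-bounds zero = ≤-refl , ≤-diff(1ℚ + q + q * q)(0≤+(0≤+(nonNegative⁻¹ 1ℚ)0≤q)(sq≥0 q))(e q == cong (λ z ->(0ℚ +(1ℚ + z)* 1ℚ)*(0ℚ +(1ℚ + z)* 1ℚ))(sym(0≤p⇒∣p∣≡p 0≤q))) where
   e : ∀ q -> q +(1ℚ + q + q * q)≡(0ℚ +(1ℚ + q)* 1ℚ)*(0ℚ +(1ℚ + q)* 1ℚ)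
   e = ring ℚ-ring
  sqrt-bounds(suc k) = go((s + g)² ≤? q) where
   s = sqrtSeq q k
   g = gap(suc k)
   0≤s = proj₁(sqrt-bounds k)
   two-gaps = cong (λ z -> s + z)(e(1ℚ + ∣ q ∣)(½^ k))== sym(+-assoc s g g) where
    e : ∀ a h -> a * h ≡ a *(h * ½)+ a *(h * ½)
    e a h = cong(a *_)(sym(halves h))== *-distribˡ-+ a(h * ½)(h * ½)
   go :(d : Dec((s + g)² ≤ q)) -> 0ℚ ≤(if does d then s + g else s)× q ≤((if does d then s + g else s)+ g)*((if does d then s + g else s)+ g)
   go(yes _) = 0≤+ 0≤s(0≤gap(suc k)), proj₂(sqrt-bounds k)<= cong (λ z -> z * z)two-gaps
   go(no gt) = 0≤s , <⇒≤ (≰⇒> gt)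

  sqrt-lower : ∀ {t c} -> 0ℚ ≤ t -> 0ℚ ≤ c -> t * t ≤ c * c * q -> ∀ ε -> 0ℚ < ε -> ∃[ N ] ∀ k -> N N.≤ k -> t ≤ c * sqrtSeq q k + ε
  sqrt-lower {t}{c}0≤t 0≤c h ε 0<ε = proj₁ small , λ k N≤k -> square-≤(0≤* 0≤c(0≤+(proj₁(sqrt-bounds k))(0≤gap k)))
   (h << *-monoˡ(0≤* 0≤c 0≤c)(proj₂(sqrt-bounds k))<= e c(sqrtSeq q k + gap k))<<
   *-distribˡ-+ c(sqrtSeq q k)(gap k)=< +-monoʳ-≤(c * sqrtSeq q k)(sym(*-assoc c(1ℚ + ∣ q ∣)(½^ k))=< *-monoˡ(0≤* 0≤c(0≤+(nonNegative⁻¹ 1ℚ)(0≤∣p∣ q)))(½^-mono N≤k)<< proj₂ small) where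
   small = ½^-small(c *(1ℚ + ∣ q ∣))ε 0<ε
   e : ∀ c s -> c * c *(s * s)≡ c * s *(c * s)
   e = ring ℚ-ring
   ½^-mono : ∀ {j k} -> j N.≤ k -> ½^ k ≤ ½^ j
   ½^-mono {j}{k}j≤k = subst (λ z -> ½^ z ≤ ½^ j)(N.m∸n+n≡m j≤k)(go(k N.∸ j)) where
    go : ∀ o -> ½^(o N.+ j)≤ ½^ j
    go zero = ≤-refl
    go(suc o) =(*-monoˡ(0≤½^(o N.+ j))(toWitness {a? = ½ ≤? 1ℚ}_)<= *-identityʳ _)<< go o

 split-≤ : ∀ {p c d a b} -> 0ℚ ≤ c -> 0ℚ ≤ d -> 0ℚ ≤ a -> 0ℚ ≤ b -> Split p(c ² * a)(d * d * b) -> fromℚ p ≤ᴿ c · √ a +ᴿ d · √ b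
 split-≤ {p}{c}{d}{a}{b}0≤c 0≤d 0≤a 0≤b h ε 0<ε = proj₁ h1 N.⊔ proj₁ h2 , λ k N≤k -> p≤ <<
  +-mono-≤(proj₂ h1 k(N.m⊔n≤o⇒m≤o(proj₁ h1)(proj₁ h2)N≤k))(proj₂ h2 k(N.m⊔n≤o⇒n≤o(proj₁ h1)(proj₁ h2)N≤k))<=
   e(c * sqrtSeq a k)(d * sqrtSeq b k)(ε * ½)== cong (λ z -> c * sqrtSeq a k + d * sqrtSeq b k + z)(halves ε) where
  open Split h
  h1 = SquareRoot.sqrt-lower a 0≤a 0≤t1 0≤c t1²≤(ε * ½)(half-pos 0<ε)
  h2 = SquareRoot.sqrt-lower b 0≤b 0≤t2 0≤d t2²≤(ε * ½)(half-pos 0<ε)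
  e : ∀ x y h -> x + h +(y + h)≡ x + y +(h + h)
  e = ring ℚ-ring

 -- ∑ f i · g j over i + j = k
 conv :(ℕ -> ℚ) ->(ℕ -> ℚ) -> ℕ -> ℚ
 conv f g zero = f 0 * g 0
 conv f g(suc k) = f 0 * g(suc k)+ conv(f ∘ suc)g k

 partial :(ℕ -> ℚ) -> ℕ -> ℚ
 partial f zero = f 0
 partial f(suc k) = f 0 + partial(f ∘ suc)k

 derive :(ℕ -> ℚ) -> ℕ -> ℚ
 derive f i = fromℕ(suc i)* f(suc i)

 conv-congˡ : ∀ {f f'}g k ->(∀ i -> f i ≡ f' i) -> conv f g k ≡ conv f' g k
 conv-congˡ g zero h = cong(_* g 0)(h 0)
 conv-congˡ g(suc k)h = cong₂ _+_ (cong(_* g(suc k))(h 0))(conv-congˡ g k(h ∘ suc))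

 conv-congʳ : ∀ f {g g'}k ->(∀ i -> g i ≡ g' i) -> conv f g k ≡ conv f g' k
 conv-congʳ f zero h = cong(f 0 *_)(h 0)
 conv-congʳ f(suc k)h = cong₂ _+_ (cong(f 0 *_)(h(suc k)))(conv-congʳ(f ∘ suc)k h)

 conv-+ˡ : ∀ f f' g k -> conv (λ i -> f i + f' i)g k ≡ conv f g k + conv f' g k
 conv-+ˡ f f' g zero = *-distribʳ-+(g 0)(f 0)(f' 0)
 conv-+ˡ f f' g(suc k) =(cong₂ _+_ (*-distribʳ-+(g(suc k))(f 0)(f' 0))(conv-+ˡ(f ∘ suc)(f' ∘ suc)g k))== e(f 0 * g(suc k))(f' 0 * g(suc k))_ _ where
  e : ∀ a b c d -> a + b +(c + d)≡ a + c +(b + d)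
  e = ring ℚ-ring

 conv-*ˡ : ∀ c f g k -> conv (λ i -> c * f i)g k ≡ c * conv f g k
 conv-*ˡ c f g zero = *-assoc c(f 0)(g 0)
 conv-*ˡ c f g(suc k) =(cong₂ _+_ (*-assoc c(f 0)(g(suc k)))(conv-*ˡ c(f ∘ suc)g k))== sym(*-distribˡ-+ c _ _)

 conv-*ʳ : ∀ c f g k -> conv f (λ i -> c * g i)k ≡ c * conv f g k
 conv-*ʳ c f g zero = e c(f 0)(g 0) where
  e : ∀ c f g -> f *(c * g)≡ c *(f * g)
  e = ring ℚ-ring
 conv-*ʳ c f g(suc k) =(cong₂ _+_ (e c(f 0)(g(suc k)))(conv-*ʳ c(f ∘ suc)g k))== sym(*-distribˡ-+ c _ _) where
  e : ∀ c f g -> f *(c * g)≡ c *(f * g)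
  e = ring ℚ-ring

 leibniz : ∀ f g k -> conv(derive f)g k + conv f(derive g)k ≡ fromℕ(suc k)* conv f g(suc k)
 leibniz f g zero = e(f 0)(f 1)(g 0)(g 1) where
  e : ∀ f0 f1 g0 g1 -> 1ℚ * f1 * g0 + f0 *(1ℚ * g1)≡ 1ℚ *(f0 * g1 + f1 * g0)
  e = ring ℚ-ring
 leibniz f g(suc k) = cong₂ (λ a b -> 1ℚ * f 1 * g(suc k)+ a +(f 0 *(κ * g(suc(suc k)))+ b))shifted refl ==
  e1(f 1)(g(suc k))(conv(derive f')g k)(conv f'' g k)(f 0 *(κ * g(suc(suc k))))(conv f'(derive g)k)==
  cong (λ z -> z +(f 1 * g(suc k)+ conv f'' g k)+ f 0 *(κ * g(suc(suc k))))(leibniz f' g k)==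
  e2(fromℕ(suc k))(conv f' g(suc k))(f 0)κ(g(suc(suc k)))== cong (λ z -> z * conv f' g(suc k)+ κ *(f 0 * g(suc(suc k))))(sym(fromℕ-suc(suc k)))== e3 κ(conv f' g(suc k))(f 0 * g(suc(suc k))) where
  κ = fromℕ(suc(suc k))
  f' = f ∘ suc
  f'' = f ∘ suc ∘ suc
  e0 : ∀ n a ->(1ℚ + n)* a ≡ n * a + a
  e0 = ring ℚ-ring
  shifted = conv-congˡ g k (λ i -> cong(_* f(suc(suc i)))(fromℕ-suc(suc i))== e0(fromℕ(suc i))(f(suc(suc i))))== conv-+ˡ(derive f')f'' g k
  e1 : ∀ a a' b c d e -> 1ℚ * a * a' +(b + c)+(d + e)≡ b + e +(a * a' + c)+ d
  e1 = ring ℚ-ring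
  e2 : ∀ n c f k g -> n * c + c + f *(k * g)≡(1ℚ + n)* c + k *(f * g)
  e2 = ring ℚ-ring
  e3 : ∀ k c d -> k * c + k * d ≡ k *(d + c)
  e3 = ring ℚ-ring

 expTerm-derive : ∀ q i -> derive(expTerm q)i ≡ q * expTerm q i
 expTerm-derive q i = e(fromℕ(suc i))(expTerm q i)q(+ 1 / suc i)== cong(q * expTerm q i *_)(fromℕ-*-1/ i)== *-identityʳ _ where
  e : ∀ n t q r -> n *(t *(q * r))≡ q * t *(n * r)
  e = ring ℚ-ring

 0<fromℕ : ∀ k -> 0ℚ < fromℕ(suc k)
 0<fromℕ k = ι-< {0ℤ}{+ suc k}(Z.+<+ (N.s≤s N.z≤n))

 conv-exp : ∀ x y k -> fromℕ(suc k)* conv(expTerm x)(expTerm y)(suc k)≡(x + y)* conv(expTerm x)(expTerm y)k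
 conv-exp x y k = sym(leibniz(expTerm x)(expTerm y)k)==(cong₂ _+_ (conv-congˡ(expTerm y)k(expTerm-derive x)== conv-*ˡ x(expTerm x)(expTerm y)k)
  (conv-congʳ(expTerm x)k(expTerm-derive y)== conv-*ʳ y(expTerm x)(expTerm y)k))== sym(*-distribʳ-+(conv(expTerm x)(expTerm y)k)x y)

 conv-inverse : ∀ q k -> conv(expTerm q)(expTerm(- q))(suc k)≡ 0ℚ
 conv-inverse q k = *-cancel-0(conv-exp q(- q)k == cong(_* conv(expTerm q)(expTerm(- q))k)(+-inverseʳ q)== *-zeroˡ(conv(expTerm q)(expTerm(- q))k)) where
  *-cancel-0 : ∀ {x} -> fromℕ(suc k)* x ≡ 0ℚ -> x ≡ 0ℚ
  *-cancel-0 {x}h = ≤-antisym(*-cancel(0<fromℕ k)(≤-reflexive(h == sym(*-zeroʳ(fromℕ(suc k))))))(*-cancel(0<fromℕ k)(≤-reflexive(*-zeroʳ(fromℕ(suc k))== sym h)))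

 conv-add : ∀ x y k -> conv(expTerm x)(expTerm y)k ≡ expTerm(x + y)k
 conv-add x y zero = refl
 conv-add x y(suc k) = ≤-antisym(*-cancel(0<fromℕ k)(≤-reflexive eq))(*-cancel(0<fromℕ k)(≤-reflexive(sym eq))) where
  eq = conv-exp x y k == cong((x + y) *_)(conv-add x y k)== sym(expTerm-derive(x + y)k)

 conv-sums : ∀ f g G -> G 0 ≡ g 0 ->(∀ i -> G(suc i)≡ G i + g(suc i)) -> ∀ k -> conv f G(suc k)≡ conv f G k + conv f g(suc k)
 conv-sums f g G G0 Gs zero = cong₂ (λ a b -> f 0 * a + f 1 * b)(Gs 0)G0 == e(f 0)(f 1)(G 0)(g 1)(g 0) where
  e : ∀ f0 f1 G g1 g0 -> f0 *(G + g1)+ f1 * g0 ≡ f0 * G +(f0 * g1 + f1 * g0)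
  e = ring ℚ-ring
 conv-sums f g G G0 Gs(suc k) = cong₂ (λ a b -> f 0 * a + b)(Gs(suc k))(conv-sums(f ∘ suc)g G G0 Gs k)== e(f 0)(G(suc k))(g(suc(suc k)))(conv(f ∘ suc)G k)(conv(f ∘ suc)g(suc k)) where
  e : ∀ f0 G g c d -> f0 *(G + g)+(c + d)≡ f0 * G + c +(f0 * g + d)
  e = ring ℚ-ring

 expSums : ℚ -> ℕ -> ℚ
 expSums q k = expSeq q(suc k)

 conv-expSums : ∀ f y k -> conv f(expSums y)(suc k)≡ conv f(expSums y)k + conv f(expTerm y)(suc k)
 conv-expSums f y = conv-sums f(expTerm y)(expSums y)(+-identityˡ 1ℚ)(λ _ -> refl)

 conv-unit : ∀ q k -> conv(expTerm q)(expSums(- q))k ≡ 1ℚ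
 conv-unit q zero = refl
 conv-unit q(suc k) = conv-expSums(expTerm q)(- q)k ==(cong₂ _+_ (conv-unit q k)(conv-inverse q k))== +-identityʳ 1ℚ

 conv-expSums-add : ∀ x y k -> conv(expTerm x)(expSums y)k ≡ expSums(x + y)k
 conv-expSums-add x y zero = refl
 conv-expSums-add x y(suc k) = conv-expSums(expTerm x)y k ==(cong₂ _+_ (conv-expSums-add x y k)(conv-add x y(suc k)))

 partial-snoc : ∀ f k -> partial f(suc k)≡ partial f k + f(suc k)
 partial-snoc f zero = refl
 partial-snoc f(suc k) = cong (λ z -> f 0 + z)(partial-snoc(f ∘ suc)k)== sym(+-assoc(f 0)_ _)

 partial-exp : ∀ q k -> partial(expTerm q)k ≡ expSums q k
 partial-exp q zero = sym(+-identityˡ 1ℚ)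
 partial-exp q(suc k) = partial-snoc(expTerm q)k == cong(_+ expTerm q(suc k))(partial-exp q k)

 conv-bound : ∀ f G B ->(∀ i -> 0ℚ ≤ f i) ->(∀ i -> G i ≤ B) -> ∀ k -> conv f G k ≤ B * partial f k
 conv-bound f G B 0≤f G≤B zero = *-monoˡ(0≤f 0)(G≤B 0)<= *-comm(f 0)B
 conv-bound f G B 0≤f G≤B(suc k) = +-mono-≤(*-monoˡ(0≤f 0)(G≤B(suc k)))(conv-bound(f ∘ suc)G B(0≤f ∘ suc)G≤B k)<= e(f 0)B(partial(f ∘ suc)k) where
  e : ∀ f B p -> f * B + B * p ≡ B *(f + p)
  e = ring ℚ-ring

 conv-tail-bound : ∀ f G B c N ->(∀ i -> 0ℚ ≤ f i) ->(∀ i -> G i ≤ B) ->(∀ i -> N N.≤ i -> G i ≤ c) ->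
  ∀ m -> conv f G(m N.+ N)≤ c * partial f m + B *(partial f(m N.+ N) - partial f m)
 conv-tail-bound f G B c zero 0≤f G≤B G≤c zero = *-monoˡ(0≤f 0)(G≤c 0 N.z≤n)<= e(f 0)c B where
  e : ∀ f c B -> f * c ≡ c * f + B *(f - f)
  e = ring ℚ-ring
 conv-tail-bound f G B c(suc N)0≤f G≤B G≤c zero = +-mono-≤(*-monoˡ(0≤f 0)(G≤c(suc N)N.≤-refl))(conv-bound(f ∘ suc)G B(0≤f ∘ suc)G≤B N)<= e(f 0)c B(partial(f ∘ suc)N) where
  e : ∀ f c B p -> f * c + B * p ≡ c * f + B *(f + p - f)
  e = ring ℚ-ring
 conv-tail-bound f G B c N 0≤f G≤B G≤c(suc m) = +-mono-≤(*-monoˡ(0≤f 0)(G≤c(suc(m N.+ N))(N.m≤n+m N(suc m))))(conv-tail-bound(f ∘ suc)G B c N(0≤f ∘ suc)G≤B G≤c m)<=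
  e(f 0)c B(partial(f ∘ suc)m)(partial(f ∘ suc)(m N.+ N)) where
  e : ∀ f c B p q -> f * c +(c * p + B *(q - p))≡ c *(f + p)+ B *(f + q -(f + p))
  e = ring ℚ-ring

 0≤recip : ∀ k -> 0ℚ ≤ + 1 / suc k
 0≤recip k = nonNegative⁻¹(+ 1 / suc k){{normalize-nonNeg 1(suc k)}}

 expTerm≥0 : ∀ {q} -> 0ℚ ≤ q -> ∀ k -> 0ℚ ≤ expTerm q k
 expTerm≥0 0≤q zero = nonNegative⁻¹ 1ℚ
 expTerm≥0 0≤q(suc k) = 0≤*(expTerm≥0 0≤q k)(0≤* 0≤q(0≤recip k))

 expTerm-mono : ∀ {p q} -> 0ℚ ≤ p -> p ≤ q -> ∀ k -> expTerm p k ≤ expTerm q k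
 expTerm-mono 0≤p p≤q zero = ≤-refl
 expTerm-mono {p}{q}0≤p p≤q(suc k) = *-mono(expTerm≥0(0≤p << p≤q)k)(0≤* 0≤p(0≤recip k))(expTerm-mono 0≤p p≤q k)(*-monoʳ(0≤recip k)p≤q)

 expSeq-mono : ∀ {p q} -> 0ℚ ≤ p -> p ≤ q -> ∀ k -> expSeq p k ≤ expSeq q k
 expSeq-mono 0≤p p≤q zero = ≤-refl
 expSeq-mono 0≤p p≤q(suc k) = +-mono-≤(expSeq-mono 0≤p p≤q k)(expTerm-mono 0≤p p≤q k)

 expSeq≥0 : ∀ {q} -> 0ℚ ≤ q -> ∀ k -> 0ℚ ≤ expSeq q k
 expSeq≥0 0≤q zero = ≤-refl
 expSeq≥0 0≤q(suc k) = 0≤+(expSeq≥0 0≤q k)(expTerm≥0 0≤q k)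

 4^_ : ℕ -> ℚ
 4^ zero = 1ℚ
 4^ suc k =(4^ k)* num 4

 0≤4^ : ∀ k -> 0ℚ ≤ 4^ k
 0≤4^ zero = nonNegative⁻¹ 1ℚ
 0≤4^(suc k) = 0≤*(0≤4^ k)(0≤num 4)

 expSums-one : ∀ k -> expSums 1ℚ k ≤ num 4
 expSums-one k = ≤-diff((1ℚ + 1ℚ)* expTerm 1ℚ(suc k))(0≤*(toWitness {a? = 0ℚ ≤? 1ℚ + 1ℚ}_)(expTerm≥0(nonNegative⁻¹ 1ℚ)(suc k)))refl << go k where
  halving : ∀ k -> expTerm 1ℚ(suc(suc k))≤ expTerm 1ℚ(suc k)* ½
  halving k = *-monoˡ(expTerm≥0(nonNegative⁻¹ 1ℚ)(suc k))(*-identityˡ(+ 1 / suc(suc k))=< *-cancel(0<fromℕ(suc k))(fromℕ-*-1/(suc k)=<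
   sym(toWitness {a? = fromℕ 2 * ½ ≟ 1ℚ}_)=< *-monoʳ(toWitness {a? = 0ℚ ≤? ½}_)(fromℕ-mono {2}{suc(suc k)}(N.s≤s(N.s≤s N.z≤n)))))
  go : ∀ k -> expSums 1ℚ k +(1ℚ + 1ℚ)* expTerm 1ℚ(suc k)≤ num 4
  go zero = toWitness {a? = expSums 1ℚ 0 +(1ℚ + 1ℚ)* expTerm 1ℚ 1 ≤? num 4}_
  go(suc k) = +-monoʳ-≤(expSums 1ℚ(suc k))(*-monoˡ(toWitness {a? = 0ℚ ≤? 1ℚ + 1ℚ}_)(halving k)<= e1(expTerm 1ℚ(suc k)))<<
   e2(expSums 1ℚ k)(expTerm 1ℚ(suc k))=< go k where
   e1 : ∀ t ->(1ℚ + 1ℚ)*(t * ½)≡ t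
   e1 t = e3 t ½ == cong(t *_)(toWitness {a? = ½ + ½ ≟ 1ℚ}_)== *-identityʳ t where
    e3 : ∀ t h ->(1ℚ + 1ℚ)*(t * h)≡ t *(h + h)
    e3 = ring ℚ-ring
   e2 : ∀ s t -> s + t + t ≡ s +(1ℚ + 1ℚ)* t
   e2 = ring ℚ-ring

 expSums-nat : ∀ r k -> expSums(fromℕ r)k ≤ 4^ r
 expSums-nat zero zero = ≤-reflexive(+-identityˡ 1ℚ)
 expSums-nat zero(suc k) = cong (λ z -> expSums 0ℚ k + z)(cong(expTerm 0ℚ k *_)(*-zeroˡ(+ 1 / suc k))== *-zeroʳ(expTerm 0ℚ k))== +-identityʳ _ =< expSums-nat zero k
 expSums-nat(suc r)k = cong (λ z -> expSums z k)(fromℕ-suc r)== sym(conv-expSums-add 1ℚ(fromℕ r)k)=<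
  conv-bound(expTerm 1ℚ)(expSums(fromℕ r))(4^ r)(expTerm≥0(nonNegative⁻¹ 1ℚ))(expSums-nat r)k <<
   *-monoˡ(0≤4^ r)(partial-exp 1ℚ k =< expSums-one k)

 ∣expTerm∣ : ∀ {q} -> 0ℚ ≤ q -> ∀ k -> expTerm(- q)k ≤ expTerm q k × - expTerm q k ≤ expTerm(- q)k
 ∣expTerm∣ 0≤q zero = ≤-refl , toWitness {a? = - 1ℚ ≤? 1ℚ}_
 ∣expTerm∣ {q}0≤q(suc k) with ∣expTerm∣ 0≤q k
 ... | up , low = e(expTerm(- q)k)q(+ 1 / suc k)=< *-monoʳ(0≤* 0≤q(0≤recip k))(neg-antimono-≤ low <= neg-neg(expTerm q k))<< ≤-refl ,
  e2(expTerm q k)q(+ 1 / suc k)=< *-monoʳ(0≤* 0≤q(0≤recip k))(neg-antimono-≤ up)<= sym(e(expTerm(- q)k)q(+ 1 / suc k)) where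
  e : ∀ t q r -> t *(- q * r)≡ - t *(q * r)
  e = ring ℚ-ring
  e2 : ∀ t q r -> -(t *(q * r))≡ - t *(q * r)
  e2 = ring ℚ-ring
  neg-neg : ∀ t -> - - t ≡ t
  neg-neg = ring ℚ-ring

 expSeq-neg : ∀ {q} -> 0ℚ ≤ q -> ∀ k -> expSeq(- q)k ≤ expSeq q k
 expSeq-neg 0≤q zero = ≤-refl
 expSeq-neg 0≤q(suc k) = +-mono-≤(expSeq-neg 0≤q k)(proj₁(∣expTerm∣ 0≤q k))

module Weights where

 open import Data.Integer.Base using (+_)
 open import Data.Rational.Base
 open import Data.Rational.Properties
 open import Tactic.RingSolver using () renaming (solve-∀ to ring)
 open import Defs
 open Rationals
 open ErrorTerms
 open Reals
 open Chainℕ using () renaming (_<<_ to _ℕ<<_)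
 open Chainℚ

 quarter : ℕ -> ℚ
 quarter r = ½^(2 N.* r)

 ½^-* : ∀ j k -> ½^(j N.+ k)≡(½^ j)*(½^ k)
 ½^-* zero k = sym(*-identityˡ _)
 ½^-*(suc j)k = cong(_* ½)(½^-* j k)== e(½^ j)(½^ k)½ where
  e : ∀ a b h -> a * b * h ≡ a * h * b
  e = ring ℚ-ring

 4^*quarter : ∀ r ->(4^ r)* quarter r ≡ 1ℚ
 4^*quarter zero = refl
 4^*quarter(suc r) = cong((4^ suc r) *_)(cong ½^_(cong suc(N.+-suc r(r N.+ 0)))== refl)== e(4^ r)(num 4)(quarter r)½ ==(cong₂ _*_ (4^*quarter r)(toWitness {a? = num 4 *(½ * ½) ≟ 1ℚ}_))== refl where
  e : ∀ a b q h -> a * b *(q * h * h)≡ a * q *(b *(h * h))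
  e = ring ℚ-ring

 ½^≤1 : ∀ k -> ½^ k ≤ 1ℚ
 ½^≤1 zero = ≤-refl
 ½^≤1(suc k) = *-mono(nonNegative⁻¹ 1ℚ)(toWitness {a? = 0ℚ ≤? ½}_)(½^≤1 k)(toWitness {a? = ½ ≤? 1ℚ}_)<= *-identityˡ 1ℚ

 0<½^ : ∀ k -> 0ℚ < ½^ k
 0<½^ zero = positive⁻¹ 1ℚ
 0<½^(suc k) = 0<*(0<½^ k)(toWitness {a? = 0ℚ <? ½}_)

 abs-bound : ∀ {x y δ} -> ∣ x - y ∣ ≤ δ -> x ≤ y + δ
 abs-bound {x}{y}{δ}h = e x y =< +-monoʳ-≤ y(p≤∣p∣(x - y)<< h) where
  e : ∀ x y -> x ≡ y +(x - y)
  e = ring ℚ-ring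
  p≤∣p∣ : ∀ p -> p ≤ ∣ p ∣
  p≤∣p∣ p with ≤-total 0ℚ p
  ... | inj₁ 0≤p = ≤-reflexive(sym(0≤p⇒∣p∣≡p 0≤p))
  ... | inj₂ p≤0 = p≤0 << 0≤∣p∣ p

 module ExpLower {q : ℚ}(r : ℕ)(0≤q : 0ℚ ≤ q)(q≤r : q ≤ fromℕ r){δ : ℚ}(0<δ : 0ℚ < δ) where

  M w η : ℚ
  M = 4^ r
  w = quarter r
  η = δ ⊓ ½

  0<w : 0ℚ < w
  0<w = 0<½^(2 N.* r)

  0<η : 0ℚ < η
  0<η = ⊓-pres-<m 0<δ(toWitness {a? = 0ℚ <? ½}_) where
   ⊓-pres-<m : ∀ {a b} -> 0ℚ < a -> 0ℚ < b -> 0ℚ < a ⊓ b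
   ⊓-pres-<m {a}{b}ha hb with ⊓-sel a b
   ... | inj₁ eq = subst(0ℚ <_)(sym eq)ha
   ... | inj₂ eq = subst(0ℚ <_)(sym eq)hb

  near : ∃[ N ] ∀ k l -> N N.≤ k -> N N.≤ l -> ∣ expSeq(- q)k - expSeq(- q)l ∣ ≤ δ
  near = expSeq-cauchy(- q)δ 0<δ

  tail : ∃[ m ] ∀ k l -> m N.≤ k -> m N.≤ l -> ∣ expSeq q k - expSeq q l ∣ ≤ w * η
  tail = expSeq-cauchy q(w * η)(0<* 0<w 0<η)

  N m : ℕ
  N = proj₁ near
  m = proj₁ tail

  P R : ℚ
  P = partial(expTerm q)m
  R = partial(expTerm q)(m N.+ N) - P

  sums≤M : ∀ i -> expSums q i ≤ M
  sums≤M i = expSeq-mono 0≤q q≤r(suc i)<< expSums-nat r i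

  MR≤η : M * R ≤ η
  MR≤η = *-monoˡ(0≤4^ r)R≤ <= sym(*-assoc M w η)== cong(_* η)(4^*quarter r)== *-identityˡ η where
   e : ∀ x y z -> x ≤ y + z -> x - y ≤ z
   e x y z h = +-monoˡ-≤(- y)h <= e' y z where
    e' : ∀ y z -> y + z - y ≡ z
    e' = ring ℚ-ring
   R≤ = e _ _ _ (partial-exp q(m N.+ N)=< abs-bound(proj₂ tail(suc(m N.+ N))(suc m)(N.m≤m+n m N ℕ<< N.n≤1+n _)(N.n≤1+n m))<=
    cong (λ z -> z + w * η)(sym(partial-exp q m)))

  c : ℕ -> ℚ
  c k = expSeq(- q)k + δ

  total : ∀ k -> N N.≤ k -> 1ℚ ≤ c k * P + η
  total k N≤k = sym(conv-unit q(m N.+ N))=< conv-tail-bound(expTerm q)(expSums(- q))M(c k)N(expTerm≥0 0≤q)(λ i -> expSeq-neg 0≤q(suc i)<< sums≤M i)sums≤c m << +-monoʳ-≤(c k * P)MR≤η where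
   sums≤c : ∀ i -> N N.≤ i -> expSums(- q)i ≤ c k
   sums≤c i N≤i = abs-bound(proj₂ near(suc i)k(N≤i ℕ<< N.n≤1+n i)N≤k)

  exp-lower' : ∀ k -> N N.≤ k -> w ≤ c k + δ
  exp-lower' k N≤k with ≤-total(c k)0ℚ
  ... | inj₁ c≤0 = contradiction((≤-diff _ (0≤-sub(total k N≤k << +-monoʳ-≤(c k * P)(p⊓q≤q δ ½)))(e(c k * P)½))<< *-monoʳ(expSeq≥0 0≤q(suc m)<= sym(partial-exp q m))c≤0 <= *-zeroˡ P)(λ h -> <-irrefl refl(<-≤-trans(toWitness {a? = 0ℚ <? ½}_)h)) where
   e : ∀ x h -> h +(x + h -(h + h))≡ x
   e = ring ℚ-ring
  ... | inj₂ 0≤c = sym(*-identityʳ w)=< *-monoˡ(<⇒≤ 0<w)(total k N≤k)<< *-distribˡ-+ w(c k * P)η =< +-mono-≤ part1(*-monoʳ(<⇒≤ 0<η)(½^≤1(2 N.* r))<< *-identityˡ η =< p⊓q≤p δ ½) where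
   e : ∀ w c m -> w *(c * m)≡ c *(m * w)
   e = ring ℚ-ring
   part1 = *-monoˡ(<⇒≤ 0<w)(*-monoˡ 0≤c(partial-exp q m =< sums≤M m))<= e w(c k)M == cong(c k *_)(4^*quarter r)== *-identityʳ(c k)

 exp-lower : ∀ {q}r -> 0ℚ ≤ q -> q ≤ fromℕ r -> ∀ δ -> 0ℚ < δ -> ∃[ N ] ∀ k -> N N.≤ k -> quarter r ≤ expSeq(- q)k + δ
 exp-lower {q}r 0≤q q≤r δ 0<δ = N , λ k N≤k -> exp-lower' k N≤k <= +-assoc(expSeq(- q)k)(δ * ½)(δ * ½)== cong (λ z -> expSeq(- q)k + z)(halves δ)
  where open ExpLower r 0≤q q≤r(half-pos 0<δ)

 ≤-+ : ∀ x {y} -> 0ℚ ≤ y -> x ≤ x + y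
 ≤-+ x {y}0≤y = ≤-diff y 0≤y refl

 uniform : ∀ {m}{B : Fin m -> ℕ -> Set} ->(∀ j -> ∃[ N ] ∀ k -> N N.≤ k -> B j k) -> ∃[ N ] ∀ j k -> N N.≤ k -> B j k
 uniform {zero}h = 0 , λ ()
 uniform {suc m}h = proj₁(h Fin.zero) N.⊔ proj₁ rest , λ
  { Fin.zero k le -> proj₂(h Fin.zero)k(N.m⊔n≤o⇒m≤o(proj₁(h Fin.zero))(proj₁ rest)le)
  ; (Fin.suc j)k le -> proj₂ rest j k(N.m⊔n≤o⇒n≤o(proj₁(h Fin.zero))(proj₁ rest)le) }
  where rest = uniform(h ∘ Fin.suc)

 ∑ᴿ-seq : ∀ {m}(v : Vector ℝ m)k -> seq(∑ᴿ v)k ≡ ∑ (λ j -> seq(v j)k)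
 ∑ᴿ-seq {zero}v k = refl
 ∑ᴿ-seq {suc m}v k = cong (λ z -> seq(v Fin.zero)k + z)(∑ᴿ-seq(v ∘ Fin.suc)k)

 -- A weight is at most the exponential unless the level is capped, and then it is tiny.
 total-weight : ∀ {m}n (q : Vector ℚ m)(r : Fin m -> ℕ) ->(∀ j -> 0ℚ ≤ q j) ->(∀ j -> q j ≤ fromℕ(r j) ⊎ quarter(r j)≤ ½^ n) ->
  m N.≤ 2 N.^ n -> ∑ᴿ (λ j -> exp(- q j))<ᴿ fromℚ(+ n / 16) -> ∑ (λ j -> quarter(r j))≤ + n / 16 +(1ℚ + 1ℚ)
 total-weight {m}n q r 0≤q small m≤(ε , 0<ε , N , lt) = ∑-mono (λ j -> proj₂ estimates j K(N.m≤n⊔m N(proj₁ estimates)))<<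
  (∑-+ (λ j -> expSeq(- q j)K)(λ _ -> h + h))==(cong₂ _+_ (sym(∑ᴿ-seq (λ j -> exp(- q j))K))(∑-const m(h + h)))=< +-mono-≤((≤-+ (seq(∑ᴿ (λ j -> exp(- q j)))K)(<⇒≤ 0<ε))<< lt K(N.m≤m⊔n N(proj₁ estimates)))(*-distribˡ-+(fromℕ m)h h =< +-mono-≤ mh≤1 mh≤1) where
  h = ½^ n
  0<h = 0<½^ n
  estimates = uniform (λ j -> go j(small j)) where
   e : ∀ x h -> x + h + h ≡ x +(h + h)
   e = ring ℚ-ring
   go : ∀ j -> q j ≤ fromℕ(r j) ⊎ quarter(r j)≤ h -> ∃[ N ] ∀ k -> N N.≤ k -> quarter(r j)≤ expSeq(- q j)k +(h + h)
   go j(inj₁ q≤r) = let (N , f) = exp-lower(r j)(0≤q j)q≤r h 0<h in N , λ k le -> f k le <<(≤-+ (expSeq(- q j)k + h)(<⇒≤ 0<h))<= e(expSeq(- q j)k)h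
   go j(inj₂ tiny) = let (N , f) = exp-lower(bound(q j))(0≤q j)(≤-bound(q j))h 0<h in N , λ k le ->
    tiny << sym(+-identityˡ h)=< +-monoˡ-≤ h(0≤½^(2 N.* bound(q j))<< f k le)<= e(expSeq(- q j)k)h
  K = N N.⊔ proj₁ estimates
  fromℕ-2^ : ∀ n -> fromℕ(2 N.^ n)*(½^ n)≡ 1ℚ
  fromℕ-2^ zero = refl
  fromℕ-2^(suc n) = cong(_* (½^ suc n))(cong ι(Z.pos-* 2(2 N.^ n))== ι-*(+ 2)(+ (2 N.^ n)))== e(num 2)(fromℕ(2 N.^ n))(½^ n)½ ==(cong₂ _*_ (fromℕ-2^ n)(toWitness {a? = num 2 * ½ ≟ 1ℚ}_))== refl where
   e : ∀ a b c d -> a * b *(c * d)≡ b * c *(a * d)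
   e = ring ℚ-ring
  mh≤1 = *-monoʳ(<⇒≤ 0<h)(fromℕ-mono m≤)<= fromℕ-2^ n

module Conclusions where

 open import Data.Integer.Base using (+_; -[1+_])
 open import Data.Rational.Base
 open import Data.Rational.Properties
 import Data.Rational.Unnormalised.Base as ℚᵘ
 import Data.Rational.Unnormalised.Properties as ℚᵘ
 open import Tactic.RingSolver using () renaming (solve-∀ to ring)
 open import Data.Fin.Subset renaming (∣_∣ to card) using ()
 open import Defs
 open Walks using (_⋆_)
 open Walks using (∑l)
 open Walks using (Row)
 open Walks using (levels)
 open Program using (solveL; levelL; level≤; unitWeight; weightOf)
 open Decoding using (ratOf)
 open Rows
 open Solving using (module Solution; Rounded; module Rounded)
 open Rationals
 open ErrorTerms
 open RowBounds
 open Reals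
 open Weights
 open Chainℕ using () renaming (_<<_ to _ℕ<<_)
 open Chainℤ using () renaming (_=<_ to _ℤ=<_; _<=_ to _ℤ<=_)
 open Chainℚ

 ι-reflect-≤ : ∀ {x y} -> ι x ≤ ι y -> x Z.≤ y
 ι-reflect-≤ {x}{y}h with Z.≤-total x y
 ... | inj₁ x≤y = x≤y
 ... | inj₂ y≤x with Z.<-cmp y x
 ... | tri< y<x _ _ = contradiction(<-≤-trans(ι-< y<x)h)(<-irrefl refl)
 ... | tri≈ _ refl _ = Z.≤-refl
 ... | tri> _ _ x<y = Z.<⇒≤ x<y

 /-* : ∀ n d ->(+ n / suc d)* fromℕ(suc d)≡ fromℕ n
 /-* n d = toℚᵘ-injective(ℚᵘ.≃-trans(toℚᵘ-homo-*(+ n / suc d)(fromℕ(suc d)))(ℚᵘ.≃-trans(ℚᵘ.*-cong(toℚᵘ-fromℚᵘ(ℚᵘ.mkℚᵘ(+ n)d))(toℚᵘ-ι(+ suc d)))(ℚᵘ.≃-trans(ℚᵘ.*≡* (Z.*-identityʳ _ == cong (λ k -> + n Z.* + k)(sym(N.*-identityʳ(suc d)))))(ℚᵘ.≃-sym(toℚᵘ-ι(+ n))))))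

 recip-* : ∀ d .{{_ : N.NonZero d}} ->(+ 1 / d)* fromℕ d ≡ 1ℚ
 recip-*(suc d) = /-* 1 d

 num-* : ∀ j k -> num(j N.* k)≡ num j * num k
 num-* j k = cong ι(Z.pos-* j k)== ι-*(+ j)(+ k)

 2^*½ : ∀ k -> ι((+ 2) Z.^ k)*(½^ k)≡ 1ℚ
 2^*½ zero = refl
 2^*½(suc k) = cong(_* (½^ suc k))(ι-*(+ 2)((+ 2) Z.^ k))== e(num 2)(ι((+ 2) Z.^ k))(½^ k)½ ==(cong₂ _*_ (2^*½ k)(toWitness {a? = num 2 * ½ ≟ 1ℚ}_))== refl where
  e : ∀ a b c d -> a * b *(c * d)≡ b * c *(a * d)
  e = ring ℚ-ring

 ∑l-tabulate : ∀ {A : Set}{m}(f : Fin m -> A)(g : A -> ℤ) -> ι(∑l(List.tabulate f)g)≡ ∑ (λ j -> ι(g(f j)))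
 ∑l-tabulate {m = zero}f g = refl
 ∑l-tabulate {m = suc m}f g = ι-+(g(f Fin.zero))_ == cong (λ z -> ι(g(f Fin.zero))+ z)(∑l-tabulate(f ∘ Fin.suc)g)

 ∑l-++ : ∀ {A : Set}(xs ys : List A)g -> ∑l(xs ++ ys)g ≡ ∑l xs g Z.+ ∑l ys g
 ∑l-++ [] ys g = sym(Z.+-identityˡ _)
 ∑l-++(x ∷ xs)ys g = cong (λ z -> g x Z.+ z)(∑l-++ xs ys g)== sym(Z.+-assoc(g x)_ _)

 ∑l-opposite : ∀ {n}(rs : List(Row n)) -> ∑l(List.map opposite rs)Row.V ≡ ∑l rs Row.V
 ∑l-opposite [] = refl
 ∑l-opposite(r ∷ rs) = cong (λ z -> Row.V r Z.+ z)(∑l-opposite rs)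

 ½^-antimono : ∀ {j k} -> j N.≤ k -> ½^ k ≤ ½^ j
 ½^-antimono {j}{k}j≤k = cong ½^_(sym(N.m+[n∸m]≡n j≤k))== ½^-* j(k N.∸ j)=< *-monoˡ(0≤½^ j)(½^≤1(k N.∸ j))<= *-identityʳ(½^ j)

 abs-from-both : ∀ {z b} -> z Z.≤ b -> Z.- z Z.≤ b -> + Z.∣ z ∣ Z.≤ b
 abs-from-both {+ n}h _ = h
 abs-from-both { -[1+ n ]}_ h = h

 level-num : ∀ n q -> 0ℚ ≤ q -> num 256 * num(levelL n(ratOf q))≤ q
 level-num n q 0≤q = *-cancel(0<ι↧ q)(*-comm(ι(↧ q))_ == sym(ι-*(+ 256 Z.* + s)(↧ q)== cong(_* ι(↧ q))(ι-*(+ 256)(+ s)))=<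
  ι-≤(level-lower n(↥ q)(↧ q)(nonneg q 0≤q))<= sym(ι-↧ q)== *-comm q(ι(↧ q))) where
  s = levelL n(ratOf q)
  nonneg : ∀ q -> 0ℚ ≤ q -> 0ℤ Z.≤ ↥ q
  nonneg q h = drop-*≤* h ℤ<= Z.*-identityʳ(↥ q)

 exponent-small : ∀ {K₀}(K₀>0 : Positive K₀) -> num 256 * num 256 ≡ K₀ -> ∀ n q -> 0ℚ ≤ q -> let s = levelL n(ratOf q) in
  (q ² ÷ K₀){{pos⇒nonZero K₀ {{K₀>0}}}}≤ fromℕ(suc s N.* suc s) ⊎ quarter(suc s N.* suc s)≤ ½^ n
 exponent-small {K₀}K₀>0 K₀≡ n q 0≤q = go(s N.<? n) where
  s = levelL n(ratOf q)
  inv =(1/ K₀){{pos⇒nonZero K₀ {{K₀>0}}}}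
  e : ∀ a b i -> a * b *(a * b)* i ≡ a * a * i *(b * b)
  e = ring ℚ-ring
  den : ∀ q -> 0ℤ Z.≤ ↧ q
  den(mkℚ _ _ _) = Z.+≤+ N.z≤n
  below : s N.< n -> q ≤ num 256 * num(suc s)
  below s<n = *-cancel(0<ι↧ q)(*-comm(ι(↧ q))q == ι-↧ q =< ι-≤(Z.<⇒≤ (level-upper n(↥ q)(↧ q)(den q)s<n))<=
   ι-*(+ 256 Z.* + suc s)(↧ q)== cong(_* ι(↧ q))(ι-*(+ 256)(+ suc s))== *-comm(num 256 * num(suc s))(ι(↧ q)))
  cancelled = e(num 256)(num(suc s))inv ==(cong₂ _*_ (cong(_* inv)K₀≡ == *-inverseʳ K₀ {{pos⇒nonZero K₀ {{K₀>0}}}})(sym(num-*(suc s)(suc s))))== *-identityˡ _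
  go : Dec(s N.< n) ->(q ² ÷ K₀){{pos⇒nonZero K₀ {{K₀>0}}}}≤ fromℕ(suc s N.* suc s) ⊎ quarter(suc s N.* suc s)≤ ½^ n
  go(yes s<n) = inj₁(*-monoʳ(<⇒≤ (positive⁻¹ inv {{1/pos⇒pos K₀ {{K₀>0}}}}))(*-mono(0≤*(0≤num 256)(0≤num(suc s)))0≤q(below s<n)(below s<n))<= cancelled)
  go(no s≮n) = inj₂(½^-antimono((N.≮⇒≥ s≮n)ℕ<<(N.n≤1+n s ℕ<< N.m≤m*n(suc s)(suc s))ℕ<< N.m≤m+n(suc s N.* suc s)_))

 record Solved (n k : ℕ)(y : Vector ℚ n)(a : Vector (Vector ℚ n) k)(Λ : Vector ℚ k) : Set where
  field
   y' : Vector ℚ n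
   solve≡ : solveL(encodeInput n k y a Λ)≡ encodeOutput y'
   in-cube : InUnitCube y'
   close : ∀ κ -> 0ℚ ≤ κ -> κ *(num n * num n)≡ 1ℚ -> ∀ j -> fromℚ ∣ ⟨ y' ⊖ y , a j ⟩ ∣ ≤ᴿ Λ j · √ W(a j)y +ᴿ κ · ∥ a j ∥
   integral : AtLeast((+ 1 / 32)* fromℕ n)IntegralIn y'

 module Conclusion {K₀ : ℚ}(K₀>0 : Positive K₀)(K₀≡ : num 256 * num 256 ≡ K₀)(n : ℕ)(n≥ : 65536 N.≤ n)(y : Vector ℚ n)(cube : InUnitCube y)(k : ℕ)(k≤ : k N.≤ 2 N.^ n)
  (a : Vector(Vector ℚ n)k)(Λ : Vector ℚ k)(0≤Λ : ∀ j -> 0ℚ ≤ Λ j)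
  (light : ∑ᴿ (λ j -> exp(- ((Λ j ² ÷ K₀){{pos⇒nonZero K₀ {{K₀>0}}}})))<ᴿ fromℚ(+ n / 16)) where

  64≤n : 64 N.≤ n
  64≤n = N.m≤m+n 64 65472 ℕ<< n≥

  rowj : Fin k -> Row n
  rowj = Solution.rowj n k y a Λ 64≤n cube

  rows0 : List(Row n)
  rows0 = Solution.rows0 n k y a Λ 64≤n cube

  m q0 : ℤ
  m = + n
  q0 = unitWeight n

  0<q0 : 0ℤ Z.< q0
  0<q0 = Solution.0<q0 n k y a Λ 64≤n cube

  level : Fin k -> ℕ
  level j = levelL n(ratOf(Λ j))

  r : Fin k -> ℕ
  r j = suc(level j) N.* suc(level j)

  weights : ∑ (λ j -> quarter(r j))≤ + n / 16 +(1ℚ + 1ℚ)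
  weights = total-weight n (λ j ->(Λ j ² ÷ K₀){{pos⇒nonZero K₀ {{K₀>0}}}})r
   (λ j -> 0≤*(sq≥0(Λ j))(<⇒≤ (positive⁻¹((1/ K₀){{pos⇒nonZero K₀ {{K₀>0}}}}){{1/pos⇒pos K₀ {{K₀>0}}}})))(λ j -> exponent-small K₀>0 K₀≡ n(Λ j)(0≤Λ j))k≤ light

  V-quarter : ∀ j -> ι(Row.V(rowj j))≡ ι q0 * quarter(r j)
  V-quarter j = sym(*-identityʳ _)== cong (λ z -> ι(weightOf n(level j))* z)(sym(2^*½(levels(level j))))== sym(*-assoc(ι(weightOf n(level j)))(ι((+ 2) Z.^ levels(level j)))_)==
   cong(_* quarter(r j))(sym(ι-*(weightOf n(level j))((+ 2) Z.^ levels(level j)))== cong ι(weight-levels n(level j)(level≤ n(ratOf(Λ j)))))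

  light' : + 64 Z.* ∑l rows0 Row.V Z.≤ + 9 Z.* m Z.* q0
  light' = ι-reflect-≤(image =< *-monoˡ(<⇒≤ (ι-< 0<q0))bounded <= *-comm(ι q0)_ == sym(ι-*(+ 9 Z.* m)q0 == cong(_* ι q0)(ι-*(+ 9)m))) where
   w = ∑ (λ j -> quarter(r j))
   e1 : ∀ c q w -> c *(q * w + q * w)≡ q *(c *(w + w))
   e1 = ring ℚ-ring
   rows-sum = ∑l-tabulate rowj Row.V == ∑-cong V-quarter ==(∑-* (ι q0)(λ j -> quarter(r j)))
   image = ι-*(+ 64)(∑l rows0 Row.V)== cong (λ z -> num 64 * z)(cong ι(∑l-++(List.tabulate rowj)_ Row.V == cong (λ z -> ∑l(List.tabulate rowj)Row.V Z.+ z)(∑l-opposite(List.tabulate rowj)))==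
    ι-+(∑l(List.tabulate rowj)Row.V)_ ==(cong₂ _+_ rows-sum rows-sum))== e1(num 64)(ι q0)w
   x = + n / 16
   e2 : ∀ c x -> c *(x +(1ℚ + 1ℚ)+(x +(1ℚ + 1ℚ)))≡ x *(c + c)+(c + c +(c + c))
   e2 = ring ℚ-ring
   8n = cong(x *_)(toWitness {a? = num 64 + num 64 ≟ num 16 * num 8}_)== sym(*-assoc x(num 16)(num 8))== cong(_* num 8)(/-* n 15)== *-comm(num n)(num 8)
   256≤n = toWitness {a? = num 64 + num 64 +(num 64 + num 64) ≟ num 256}_ =< num-mono(N.m≤m+n 256 65280 ℕ<< n≥)
   e3 : ∀ c n -> c * n + n ≡(c + 1ℚ)* n
   e3 = ring ℚ-ring
   bounded = *-monoˡ(0≤num 64)(+-mono-≤ weights weights)<< e2(num 64)x =< +-mono-≤(≤-reflexive 8n)256≤n <= e3(num 8)(num n)== cong(_* num n)(toWitness {a? = num 8 + 1ℚ ≟ num 9}_)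

  open Rounded (Solution.Light.all-rounded n k y a Λ 64≤n cube light') renaming (close to near; integral to frozen-integral)

  in-cube : InUnitCube y'
  in-cube i = *-cancel(0<ι↧(y' i))(*-zeroʳ(ι(↧ y' i))=< ι-≤(0≤↥ i)<= num≡ i),
   *-cancel(0<ι↧(y' i))(sym(num≡ i)=< ι-≤(↥≤↧ i)<= sym(*-identityʳ(ι(↧ y' i)))) where
   num≡ : ∀ i -> ι(↥ y' i)≡ ι(↧ y' i)* y' i
   num≡ i = sym(ι-↧(y' i))== *-comm(y' i)(ι(↧ y' i))

  integral :((+ 1 / 32)* fromℕ n)≤ fromℕ(card frozen)
  integral = *-monoˡ(toWitness {a? = 0ℚ ≤? + 1 / 32}_)(num-mono many)<= cong((+ 1 / 32) *_)(num-* 32(card frozen))== sym(*-assoc(+ 1 / 32)(num 32)(num(card frozen)))==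
   cong(_* num(card frozen))(toWitness {a? =(+ 1 / 32)* num 32 ≟ 1ℚ}_)== *-identityˡ(num(card frozen))

  split : ∀ κ -> κ *(num n * num n)≡ 1ℚ -> ∀ j -> Split ∣ ⟨ y' ⊖ y , a j ⟩ ∣ (Λ j ² * W(a j)y)(κ * κ * ⟨ a j , a j ⟩)
  split κ κν² j = RowErrors.Row.row-split 64≤n X E 0<X 0≤E y y' cube x σ σ≡ near(a j)(A j)(normal j){level j}{Λ j}κ κν²(0≤Λ j)(level-num n(Λ j)(0≤Λ j))
   (tight j)(λ 1≤s -> abs-from-both(loose j 1≤s)((sym(Z.-1*i≡-i _)== sym(Walks.·-scaleˡ -1ℤ(A j)x))ℤ=< loose⁻ j 1≤s))

  0≤W : ∀ j -> 0ℚ ≤ W(a j)y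
  0≤W j = ∑≥0 (λ i -> 0≤*(sq≥0(a j i))(sq≥0(y i ⊓ (1ℚ - y i))))

  close-enough : ∀ κ -> 0ℚ ≤ κ -> κ *(num n * num n)≡ 1ℚ -> ∀ j -> fromℚ ∣ ⟨ y' ⊖ y , a j ⟩ ∣ ≤ᴿ Λ j · √ W(a j)y +ᴿ κ · ∥ a j ∥
  close-enough κ 0≤κ κν² j = split-≤(0≤Λ j)0≤κ(0≤W j)(∑≥0 (λ i -> sq≥0(a j i)))(split κ κν² j)

  solution : Solved n k y a Λ
  solution = record { y' = y' ; solve≡ = solve≡ ; in-cube = in-cube ; close = close-enough ; integral = frozen , integral , frozen-integral }

import Data.Nat.Base as ℕ
open import Data.Integer.Base using (+_)
open import Data.List.Membership.Propositional using (_∈_)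
open import Data.List.Membership.Propositional.Properties using (∈-map⁻)
open import Data.List.Relation.Unary.All as All using (All)
open import Data.List.Relation.Unary.AllPairs using ([]; _∷_)
open import Data.List.Relation.Unary.Unique.Propositional using (Unique)
import Data.List.Relation.Unary.Unique.Propositional.Properties as Unique
open import Data.Nat.Properties using (m*n≢0)
open import Data.Rational.Base using (_<_; _≤_; _*_; _÷_; -_; ∣_∣; _/_; Positive; positive)
open import Data.Rational.Properties using (pos⇒nonZero)
open import Defs
open Machines using (eval; ⟦_⟧)
open Machines
open Typed
open Arithmetic using (𝕋; inputTree-list)
open Program using (solveL; solveT)
open Rationals using (*-monoʳ; 0<*; ι-<; ι-*)
open ErrorTerms
open Conclusions
open Chainℚ using () renaming (_=<_ to _ℚ=<_; _<=_ to _ℚ<=_)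

allCoins : ∀ t -> List(Vec Bool t)
allCoins zero = [] ∷ []
allCoins(suc t) = List.map(true ∷_)(allCoins t)List.++ List.map(false ∷_)(allCoins t)

allCoins-unique : ∀ t -> Unique(allCoins t)
allCoins-unique zero = All.[] ∷ []
allCoins-unique(suc t) = Unique.++⁺ (Unique.map⁺ Vec.∷-injectiveʳ(allCoins-unique t))(Unique.map⁺ Vec.∷-injectiveʳ(allCoins-unique t))disjoint where
 disjoint : ∀ {v} -> v ∈ List.map(true ∷_)(allCoins t)× v ∈ List.map(false ∷_)(allCoins t) -> ⊥
 disjoint(p , q) with ∈-map⁻(true ∷_)p | ∈-map⁻(false ∷_)q
 ... | _ , _ , refl | _ , _ ,()

length-allCoins : ∀ t -> length(allCoins t)≡ 2 N.^ t
length-allCoins zero = refl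
length-allCoins(suc t) = List.length-++(List.map(true ∷_)(allCoins t))==(cong₂ N._+_ (List.length-map _ (allCoins t)== length-allCoins t)
 ((List.length-map _ (allCoins t)== length-allCoins t)== sym(N.+-identityʳ _)))

certain : ∀ {t}{E : Vec Bool t -> Set} ->(∀ coins -> E coins) -> Pr[ E ]≥ (+ 2 / 3)
certain {t}h = allCoins t , allCoins-unique t , All.universal h(allCoins t),
 *-monoʳ(0≤num(2 N.^ t))(toWitness {a? = + 2 / 3 Q.≤? + 1 / 1}_)ℚ<= Q.*-identityˡ _ == cong fromℕ(sym(length-allCoins t))

eval-code : ∀ (e : 𝕃 𝕋 ∷ [] ⊢ 𝕃 𝕋)x -> eval(code e)(λ _ -> inputTree x)≡ inputTree(fun e(x , tt))
eval-code e x = ok e(x , tt)(λ _ -> inputTree x)(λ { Fin.zero -> inputTree-list x })== sym(inputTree-list(fun e(x , tt)))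

opaque
 solver : 𝕃 𝕋 ∷ [] ⊢ 𝕃 𝕋
 solver = solveT

 solver≡ : ∀ x -> fun solver(x , tt)≡ solveL x
 solver≡ x = refl

opaque
 K₀ : ℚ
 K₀ = num 256 * num 256

 K₀≡ : num 256 * num 256 ≡ K₀
 K₀≡ = refl

K₀>0 : Positive K₀
K₀>0 = positive(Q.<-≤-trans(0<*(ι-< {Z.0ℤ}{+ 256}(Z.+<+ (N.s≤s N.z≤n)))(ι-< {Z.0ℤ}{+ 256}(Z.+<+ (N.s≤s N.z≤n))))(Q.≤-reflexive K₀≡))

open Realise (code solver)

solve-output : ∀ x (coins : Vec Bool(⟦ time ⟧ (length x))) -> output algorithm x coins ≡ solveL x
solve-output x coins = output≡ x coins == cong outLetters(eval-code solver x == cong inputTree(solver≡ x))== outLetters-inputTree(solveL x)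

many : ∀ {n} -> K₀ < fromℕ n -> 65536 N.≤ n
many {n}h = Z.drop‿+≤+(ι-reflect-≤ {+ 256 Z.* + 256}{+ n}(ι-*(+ 256)(+ 256)== K₀≡ ℚ=<(Q.<⇒≤ h)))

rounding : ∀ (M : Machine)(T : ℕ -> ℕ) ->(∀ x (coins : Vec Bool(T(length x))) -> output M x coins ≡ solveL x) ->
 (∀ (n : ℕ) .{{_ : N.NonZero n}} -> K₀ < fromℕ n ->
 ∀ (y : Vector ℚ n) -> InUnitCube y ->
 ∀ (m : ℕ) -> m N.≤ 2 N.^ n ->
 ∀ (a : Vector(Vector ℚ n)m)(Λ : Vector ℚ m) ->(∀ j -> 0ℚ ≤ Λ j) ->
 ∑ᴿ (λ j -> exp(- ((Λ j ² ÷ K₀){{pos⇒nonZero K₀ {{K₀>0}}}})))<ᴿ fromℚ(+ n / 16) ->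
 let input = encodeInput n m y a Λ in
 Pr[(λ (coins : Vec Bool(T(length input))) ->
 ∃[ y' ] (output M input coins ≡ encodeOutput y' ×
 InUnitCube y' ×
 (∀ j -> fromℚ ∣ ⟨ y' ⊖ y , a j ⟩ ∣
 ≤ᴿ Λ j · √ W(a j)y +ᴿ((+ 1 / (n N.* n)){{m*n≢0 n n}})· ∥ a j ∥)×
 AtLeast((+ 1 / 32)* fromℕ n)IntegralIn y')) ]≥ (+ 2 / 3))
rounding M T outputs n n> y cube m m≤ a Λ 0≤Λ light = certain(go(Conclusion.solution K₀>0 K₀≡ n(many n>)y cube m m≤ a Λ 0≤Λ light)) where
 κ =(+ 1 / (n N.* n)){{m*n≢0 n n}}
 go : Solved n m y a Λ -> ∀ (coins : Vec Bool(T(length(encodeInput n m y a Λ)))) ->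
  ∃[ y' ] (output M(encodeInput n m y a Λ)coins ≡ encodeOutput y' × InUnitCube y' ×
   (∀ j -> fromℚ ∣ ⟨ y' ⊖ y , a j ⟩ ∣ ≤ᴿ Λ j · √ W(a j)y +ᴿ κ · ∥ a j ∥)×
   AtLeast((+ 1 / 32)* fromℕ n)IntegralIn y')
 go s coins = y' , outputs(encodeInput n m y a Λ)coins == solve≡ , in-cube ,
  close κ(Q.nonNegative⁻¹ κ {{Q.normalize-nonNeg 1(n N.* n){{m*n≢0 n n}}}})(cong(κ *_)(sym(num-* n n))== recip-*(n N.* n){{m*n≢0 n n}}),
  integral
  where open Solved s

theorem4 : Σ[ K₀ ∈ ℚ ] Σ[ K₀>0 ∈ Positive K₀ ] Σ[ c ∈ ℚ ] (0ℚ < c ×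
 Σ[ M ∈ Machine ] Σ[ T ∈ (ℕ → ℕ) ] (PolynomiallyBounded T × HaltsWithin M T ×
 (∀ (n : ℕ) .{{_ : ℕ.NonZero n}} → K₀ < fromℕ n →
 ∀ (y : Vector ℚ n) → InUnitCube y →
 ∀ (m : ℕ) → m ℕ.≤ 2 ℕ.^ n →
 ∀ (a : Vector (Vector ℚ n) m) (Λ : Vector ℚ m) → (∀ j → 0ℚ ≤ Λ j) →
 ∑ᴿ (λ j → exp (- ((Λ j ² ÷ K₀) {{pos⇒nonZero K₀ {{K₀>0}}}}))) <ᴿ fromℚ (+ n / 16) →
 let input = encodeInput n m y a Λ in
 Pr[ (λ (coins : Vec Bool (T (length input))) →
 ∃[ y′ ] (output M input coins ≡ encodeOutput y′ ×
 InUnitCube y′ ×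
 (∀ j → fromℚ ∣ ⟨ y′ ⊖ y , a j ⟩ ∣
 ≤ᴿ Λ j · √ W (a j) y +ᴿ ((+ 1 / (n ℕ.* n)) {{m*n≢0 n n}}) · ∥ a j ∥) ×
 AtLeast (c * fromℕ n) IntegralIn y′)) ]≥ (+ 2 / 3))))
theorem4 = K₀ , K₀>0 , + 1 / 32 , toWitness {a? = 0ℚ Q.<? + 1 / 32}_ , algorithm , ⟦ time ⟧ , polynomiallyBounded time , halts , rounding algorithm ⟦ time ⟧ solve-output
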